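{- Every circulant scheme of prime power degree (that is, every circulant scheme on a cyclic group of order $p^n$, $p$ prime, $n\ge1$) is sesquiseparable.
   Context: A coherent configuration $\mathcal X=(\Omega,S)$ ($\Omega$ finite) is a partition $S$ of $\Omega^2$ with $1_\Omega$ a union of elements of $S$, closed under transposition $s\mapsto s^*$, with intersection numbers $c_{rs}^t=|\alpha r\cap\beta s^*|$ ($\alpha r=\{\beta:(\alpha,\beta)\in r\}$) independent of $(\alpha,\beta)\in t$; a scheme if $1_\Omega\in S$; its degree is $|\Omega|$. Relations: unions of elements of $S$; fibers: $\Delta$ with $1_\Delta\in S$. An isomorphism is a bijection $f$ with $s^f\in S'$ for all $s\in S$. A scheme on a finite cyclic group $G$ is circulant if every translation $x\mapsto xg$ preserves each element of $S$. An algebraic isomorphism $\varphi:\mathcal X\to\mathcal X'$ is a bijection $S\to S'$ preserving intersection numbers (extended by unions); $\mathrm{Iso}(\mathcal X,\mathcal X',\varphi)$ is the set of isomorphisms $f$ with $s^f=\varphi(s)$ for all $s$. The one-point extension $\mathcal X_\alpha$ is the smallest coherent configuration whose relations include those of $\mathcal X$ and with $\{(\alpha,\alpha)\}$ a basis relation. An $(\alpha,\alpha')$-extension of $\varphi$ is an algebraic isomorphism $\mathcal X_\alpha\to\mathcal X'_{\alpha'}$ agreeing with $\varphi$ on $S$ and mapping $1_{\{\alpha\}}$ to $1_{\{\alpha'\}}$; $\varphi$ is sesquiclosed if it has such an extension whenever $\alpha,\alpha'$ lie in fibers $\Delta,\Delta'$ with $\varphi(1_\Delta)=1_{\Delta'}$.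 $\mathcal X$ is sesquiseparable if $\mathrm{Iso}(\mathcal X,\mathcal X',\varphi)\ne\emptyset$ for every sesquiclosed algebraic isomorphism $\varphi$ from $\mathcal X$ to any coherent configuration $\mathcal X'$. -}

module Defs where

open import Data.Nat using (ℕ; suc)
open import Data.Nat.DivMod using (_mod_)
open import Data.Fin using (Fin; toℕ; _≟_)
open import Data.List using (length; filter; allFin)
open import Data.Product using (Σ; ∃; ∃₂; _×_; _,_)
open import Relation.Nullary.Decidable using (_×-dec_)
open import Relation.Binary.PropositionalEquality using (_≡_)

-- A partition S of Ω² (Ω = Fin m) into r classes, encoded as a colouring:
-- the basis relation with colour t is {(x,y) : c x y ≡ t}.
Coloring : ℕ → ℕ → Set
Coloring m r = Fin m → Fin m → Fin r

Bij : ∀ {a b} {A : Set a} {B : Set b} → (A → B) → Set _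
Bij {A = A} {B} f = (∀ x y → f x ≡ f y → x ≡ y) × (∀ z → ∃ λ x → f x ≡ z)

inum : ∀ {m r} → Coloring m r → Fin r → Fin r → Fin m → Fin m → ℕ
inum {m} c r s α β =
  length (filter (λ γ → (c α γ ≟ r) ×-dec (c γ β ≟ s)) (allFin m))

record IsCC {m r : ℕ} (c : Coloring m r) : Set where
  field
    -- every colour class is nonempty (classes form a partition)
    nonempty : ∀ t → ∃₂ λ x y → c x y ≡ t
    diagUnion : ∀ x y z → c x x ≡ c y z → y ≡ z
    transp : ∀ x y u v → c x y ≡ c u v → c y x ≡ c v u
    inter : ∀ s t α β α' β' → c α β ≡ c α' β' →
            inum c s t α β ≡ inum c s t α' β'

IsScheme : ∀ {m r} → Coloring m r → Set
IsScheme c = IsCC c × (∀ x y → c x x ≡ c y y)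

_⊕_ : ∀ {k} → Fin (suc k) → Fin (suc k) → Fin (suc k)
_⊕_ {k} x g = (toℕ x Data.Nat.+ toℕ g) mod (suc k)

IsCirculant : ∀ {k r} → Coloring (suc k) r → Set
IsCirculant c = ∀ x y g → c (x ⊕ g) (y ⊕ g) ≡ c x y

IsAlgIso : ∀ {m r m' r'} → Coloring m r → Coloring m' r' → (Fin r → Fin r') → Set
IsAlgIso c c' φ = Bij φ ×
  (∀ s t α β α' β' → c' α' β' ≡ φ (c α β) →
     inum c s t α β ≡ inum c' (φ s) (φ t) α' β')

Refines : ∀ {m r r₁} → Coloring m r₁ → Coloring m r → Set
Refines d c = ∀ x y u v → d x y ≡ d u v → c x y ≡ c u v

SingletonBasis : ∀ {m r} → Coloring m r → Fin m → Set
SingletonBasis d α = ∀ u v → d u v ≡ d α α → (u ≡ α) × (v ≡ α)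

IsOnePointExt : ∀ {m r r₁} → Coloring m r → Fin m → Coloring m r₁ → Set
IsOnePointExt {m} c α d =
  IsCC d × Refines d c × SingletonBasis d α ×
  (∀ {r₂} (e : Coloring m r₂) → IsCC e → Refines e c → SingletonBasis e α →
     Refines e d)

IsExtension : ∀ {m r m' r' r₁ r₁'} (c : Coloring m r) (c' : Coloring m' r')
  (φ : Fin r → Fin r') (α : Fin m) (α' : Fin m')
  (d : Coloring m r₁) (d' : Coloring m' r₁') (ψ : Fin r₁ → Fin r₁') → Set
IsExtension c c' φ α α' d d' ψ =
  IsAlgIso d d' ψ ×
  -- ψ agrees with φ on S: ψ(u) ⊆ φ(s) whenever u ⊆ s
  (∀ x y x' y' → d' x' y' ≡ ψ (d x y) → c' x' y' ≡ φ (c x y)) ×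
  ψ (d α α) ≡ d' α' α'

IsSesquiclosed : ∀ {m r m' r'} → Coloring m r → Coloring m' r' → (Fin r → Fin r') → Set
IsSesquiclosed {m} {r} {m'} {r'} c c' φ =
  IsAlgIso c c' φ ×
  (∀ α α' → φ (c α α) ≡ c' α' α' →
     ∀ r₁ (d : Coloring m r₁) → IsOnePointExt c α d →
     ∀ r₁' (d' : Coloring m' r₁') → IsOnePointExt c' α' d' →
     ∃ λ (ψ : Fin r₁ → Fin r₁') → IsExtension c c' φ α α' d d' ψ)

IsIsoOver : ∀ {m r m' r'} → Coloring m r → Coloring m' r' → (Fin r → Fin r') →
  (Fin m → Fin m') → Set
IsIsoOver c c' φ f = Bij f × (∀ x y → c' (f x) (f y) ≡ φ (c x y))

IsSesquiseparable : ∀ {m r} → Coloring m r → Set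
IsSesquiseparable {m} {r} c =
  ∀ m' r' (c' : Coloring m' r') → IsCC c' → (φ : Fin r → Fin r') →
  IsSesquiclosed c c' φ → ∃ λ (f : Fin m → Fin m') → IsIsoOver c c' φ f

{-# OPTIONS --safe #-}

-- A circulant scheme on ℤ/pⁿ is an S-ring, which is analysed through the chain of its closed
-- subgroups pˢ.  By Schur's multiplier theorem and the congruences for p-th powers of class
-- sums, an S-ring over ℤ/pᵐ in which the class of 1 has trivial radical is trivial, or has
-- m = 1, or is cyclotomic; in the last case its classes are orbits of a group of units and
-- it is rigid once two points are fixed.  Applied to pˢ/pᵗ, where pᵗ is the radical of the
-- class of pˢ, this gives an isomorphism modulo pᵗ between cosets: any bijection in the trivial
-- case, and otherwise the one obtained by individualising a point, which makes the section
-- discrete.  (For a section of order p this follows from a polynomial identity over 𝔽ₚ.)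
-- Outside the next closed subgroup the classes are unions of cosets of pᵗ, so isomorphisms on
-- the cosets of that subgroup that are compatible modulo pᵗ glue.  Compatibility is a lifting
-- problem, non-trivial only where two cyclotomic sections overlap; there the isomorphisms
-- from a one-point extension agree on the overlap up to a multiplier, which can be corrected.
module Submission where

-- The hypothesis relates the one-point extensions at α and α′ separately for each pair of points,
-- and correspondences obtained at different points have no relation to each other. What they
-- provide is local: once α is individualised, the colours seen from one further point α + p^s
-- separate the coset of p^s modulo p^t, so that a bijection can be read off from the colours seen
-- from the image of that point. Compatibility is why two statements are proved together, by
-- descending induction over the closed subgroups: `CosetIso` gives an isomorphism on each coset,
-- `SectionLift` gives one inside a graph already prescribed modulo p^t on a larger coset. In a
-- section with one nonzero class or of prime order, the subgroup along which cosets are glued is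
-- p^t itself, and every choice is compatible. In a cyclotomic section it is only p^(s+1), so the
-- pieces must still follow the graph down to p^t, and may meet there a cyclotomic section with a
-- smaller radical. The image carries no group structure, so isomorphisms are graphs, and positions
-- modulo p^t are recovered from colours by `Near` and `ColMod`.

module Congruence where
  open import Data.Nat as ℕ using (ℕ; zero; suc)
  import Data.Nat.Properties as ℕ
  import Data.Nat.Divisibility as ℕ
  open import Data.Nat.Primality using (Prime; euclidsLemma; prime⇒nonZero; prime⇒nonTrivial)
  open import Data.Nat.Coprimality using (prime⇒coprime; coprime-Bézout)
  import Data.Nat.GCD as GCD
  open import Data.Integer using (ℤ; +_; -_; _+_; _-_; _*_; 0ℤ; 1ℤ)
  open import Data.Integer.Properties using (abs-*; pos-*; pos-+; *-identityʳ; m-n≡m⊖n; ⊖-≥)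
  open import Data.Integer.Divisibility.Signed using (_∣_; divides; _∣?_; ∣⇒∣ᵤ; ∣ᵤ⇒∣; *-cancelˡ-∣)
  open import Data.Integer.DivMod using (_/ℕ_; n%ℕd<d; a≡a%ℕn+[a/ℕn]*n)
  open import Data.Integer.Tactic.RingSolver using (solve-∀)
  open import Data.Fin using (Fin; toℕ; fromℕ<)
  open import Data.Fin.Properties using (toℕ-fromℕ<; toℕ-injective; toℕ<n)
  open import Data.Product using (∃; ∃₂; _×_; _,_)
  open import Data.Sum using (_⊎_; inj₁; inj₂)
  open import Data.Empty using (⊥-elim)
  open import Relation.Nullary using (¬_; Dec; yes; no)
  open import Relation.Nullary.Decidable using (map′)
  open import Relation.Binary.Bundles using (Setoid)
  open import Relation.Binary.PropositionalEquality
  open import Level using (0ℓ)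

  -- Congruences of integers; units and valuations for powers of a prime.

  infix 4 _≈_mod_

  -- The quotient is kept explicit: matching the equation against `refl` turns the rules for
  -- congruences into ring identities for the solver.
  record _≈_mod_ (a b M : ℤ) : Set where
    constructor mod-by
    field
      quotient : ℤ
      equation : a ≡ b + quotient * M

  open _≈_mod_ public

  ≈-refl : ∀ {M a} → a ≈ a mod M
  ≈-refl {M} {a} = mod-by 0ℤ (lem a M)
    where
    lem : ∀ a M → a ≡ a + 0ℤ * M
    lem = solve-∀

  ≈-reflexive : ∀ {M a b} → a ≡ b → a ≈ b mod M
  ≈-reflexive refl = ≈-refl

  ≈-sym : ∀ {M a b} → a ≈ b mod M → b ≈ a mod M
  ≈-sym {M} {a} {b} (mod-by q refl) = mod-by (- q) (lem b q M)
    where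
    lem : ∀ b q M → b ≡ b + q * M + - q * M
    lem = solve-∀

  ≈-trans : ∀ {M a b c} → a ≈ b mod M → b ≈ c mod M → a ≈ c mod M
  ≈-trans {M} {c = c} (mod-by q refl) (mod-by r refl) = mod-by (r + q) (lem c r q M)
    where
    lem : ∀ c r q M → c + r * M + q * M ≡ c + (r + q) * M
    lem = solve-∀

  ≈-+ : ∀ {M a b c d} → a ≈ b mod M → c ≈ d mod M → a + c ≈ b + d mod M
  ≈-+ {M} {b = b} {d = d} (mod-by q refl) (mod-by r refl) = mod-by (q + r) (lem b d q r M)
    where
    lem : ∀ b d q r M → b + q * M + (d + r * M) ≡ b + d + (q + r) * M
    lem = solve-∀

  ≈-* : ∀ {M a b c d} → a ≈ b mod M → c ≈ d mod M → a * c ≈ b * d mod M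
  ≈-* {M} {b = b} {d = d} (mod-by q refl) (mod-by r refl) =
    mod-by (q * d + b * r + q * r * M) (lem b d q r M)
    where
    lem : ∀ b d q r M → (b + q * M) * (d + r * M) ≡ b * d + (q * d + b * r + q * r * M) * M
    lem = solve-∀

  ≈-neg : ∀ {M a b} → a ≈ b mod M → - a ≈ - b mod M
  ≈-neg {M} {b = b} (mod-by q refl) = mod-by (- q) (lem b q M)
    where
    lem : ∀ b q M → - (b + q * M) ≡ - b + - q * M
    lem = solve-∀

  ≈-- : ∀ {M a b c d} → a ≈ b mod M → c ≈ d mod M → a - c ≈ b - d mod M
  ≈-- a≈b c≈d = ≈-+ a≈b (≈-neg c≈d)

  ≈-*ˡ : ∀ {M b c} a → b ≈ c mod M → a * b ≈ a * c mod M
  ≈-*ˡ a = ≈-* (≈-refl {a = a})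

  ≈-*ʳ : ∀ {M b c} a → b ≈ c mod M → b * a ≈ c * a mod M
  ≈-*ʳ a b≈c = ≈-* b≈c (≈-refl {a = a})

  ≈-+ˡ : ∀ {M b c} a → b ≈ c mod M → a + b ≈ a + c mod M
  ≈-+ˡ a = ≈-+ (≈-refl {a = a})

  ≈-+ʳ : ∀ {M b c} a → b ≈ c mod M → b + a ≈ c + a mod M
  ≈-+ʳ a b≈c = ≈-+ b≈c (≈-refl {a = a})

  ≈--ˡ : ∀ {M b c} a → b ≈ c mod M → a - b ≈ a - c mod M
  ≈--ˡ a = ≈-- (≈-refl {a = a})

  ≈--ʳ : ∀ {M b c} a → b ≈ c mod M → b - a ≈ c - a mod M
  ≈--ʳ a b≈c = ≈-- b≈c (≈-refl {a = a})

  ≈-setoid : ℤ → Setoid 0ℓ 0ℓ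
  ≈-setoid M = record
    { Carrier = ℤ ; _≈_ = λ a b → a ≈ b mod M
    ; isEquivalence = record { refl = ≈-refl ; sym = ≈-sym ; trans = ≈-trans } }

  ∣⇒≈ : ∀ {M a b} → M ∣ a - b → a ≈ b mod M
  ∣⇒≈ {M} {a} {b} (divides q eq) = mod-by q (trans (lem a b) (cong (λ x → b + x) eq))
    where
    lem : ∀ a b → a ≡ b + (a - b)
    lem = solve-∀

  ≈⇒∣ : ∀ {M a b} → a ≈ b mod M → M ∣ a - b
  ≈⇒∣ {M} {a} {b} (mod-by q refl) = divides q (lem b (q * M))
    where
    lem : ∀ b x → b + x - b ≡ x
    lem = solve-∀

  ∣⇒≈0 : ∀ {M a} → M ∣ a → a ≈ 0ℤ mod M
  ∣⇒≈0 {M} (divides q eq) = mod-by q (trans eq (lem (q * M)))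
    where
    lem : ∀ x → x ≡ 0ℤ + x
    lem = solve-∀

  ≈0⇒∣ : ∀ {M a} → a ≈ 0ℤ mod M → M ∣ a
  ≈0⇒∣ {M} (mod-by q eq) = divides q (trans eq (lem (q * M)))
    where
    lem : ∀ x → 0ℤ + x ≡ x
    lem = solve-∀

  ∣-resp-≈ : ∀ {M a b} → a ≈ b mod M → M ∣ b → M ∣ a
  ∣-resp-≈ a≈b M∣b = ≈0⇒∣ (≈-trans a≈b (∣⇒≈0 M∣b))

  ≈-coarsen : ∀ {M M′ a b} → M′ ∣ M → a ≈ b mod M → a ≈ b mod M′
  ≈-coarsen {M} {M′} {b = b} (divides r refl) (mod-by q refl) = mod-by (q * r) (lem b q r M′)
    where
    lem : ∀ b q r M′ → b + q * (r * M′) ≡ b + q * r * M′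
    lem = solve-∀

  ≈-scale : ∀ {M a b} k → a ≈ b mod M → k * a ≈ k * b mod (k * M)
  ≈-scale {M} {b = b} k (mod-by q refl) = mod-by q (lem b q k M)
    where
    lem : ∀ b q k M → k * (b + q * M) ≡ k * b + q * (k * M)
    lem = solve-∀

  ≈-unscale : ∀ {M a b} k .{{_ : Data.Integer.NonZero k}} →
              k * a ≈ k * b mod (k * M) → a ≈ b mod M
  ≈-unscale {M} {a} {b} k h = ∣⇒≈ (*-cancelˡ-∣ k (subst (k * M ∣_) (lem a b k) (≈⇒∣ h)))
    where
    lem : ∀ a b k → k * a - k * b ≡ k * (a - b)
    lem = solve-∀

  infix 4 _≈?_mod_

  _≈?_mod_ : ∀ a b M → Dec (a ≈ b mod M)
  a ≈? b mod M = map′ ∣⇒≈ ≈⇒∣ (M ∣? (a - b))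

  residue : ∀ M .{{_ : ℕ.NonZero M}} → ℤ → Fin M
  residue M a = fromℕ< (n%ℕd<d a M)

  residue-≈ : ∀ M .{{_ : ℕ.NonZero M}} a → + toℕ (residue M a) ≈ a mod + M
  residue-≈ M a = ≈-sym (mod-by (a /ℕ M) (trans (a≡a%ℕn+[a/ℕn]*n a M)
    (cong (λ x → + x + (a /ℕ M) * + M) (sym (toℕ-fromℕ< (n%ℕd<d a M))))))

  private
    divides-small : ∀ {M d} → d ℕ.< M → M ℕ.∣ d → d ≡ 0
    divides-small {d = zero} _ _ = refl
    divides-small {d = suc d} d<M M∣d = ⊥-elim (ℕ.<⇒≱ d<M (ℕ.∣⇒≤ M∣d))

    small-≥ : ∀ {M i j} → j ℕ.≤ i → i ℕ.< M → + i ≈ + j mod + M → i ≡ j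
    small-≥ {M} {i} {j} j≤i i<M h = sym (ℕ.≤-antisym j≤i (ℕ.m∸n≡0⇒m≤n (divides-small
      (ℕ.≤-<-trans (ℕ.m∸n≤m i j) i<M)
      (∣⇒∣ᵤ (subst (+ M ∣_) (trans (m-n≡m⊖n i j) (⊖-≥ j≤i)) (≈⇒∣ h))))))

  small-≈ : ∀ {M i j} → i ℕ.< M → j ℕ.< M → + i ≈ + j mod + M → i ≡ j
  small-≈ {M} {i} {j} i<M j<M h with ℕ.≤-total j i
  ... | inj₁ j≤i = small-≥ j≤i i<M h
  ... | inj₂ i≤j = sym (small-≥ i≤j j<M (≈-sym h))

  residue-cong : ∀ M .{{_ : ℕ.NonZero M}} {a b} → a ≈ b mod + M → residue M a ≡ residue M b
  residue-cong M {a} {b} h = toℕ-injective (small-≈ (toℕ<n (residue M a)) (toℕ<n (residue M b))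
    (≈-trans (residue-≈ M a) (≈-trans h (≈-sym (residue-≈ M b)))))

  residue-toℕ : ∀ M .{{_ : ℕ.NonZero M}} (i : Fin M) → residue M (+ toℕ i) ≡ i
  residue-toℕ M i = toℕ-injective (small-≈ (toℕ<n (residue M (+ toℕ i))) (toℕ<n i) (residue-≈ M (+ toℕ i)))

  module PrimePower (p : ℕ) (pr : Prime p) where

    private instance
      p≢0 : ℕ.NonZero p
      p≢0 = prime⇒nonZero pr

    P : ℤ
    P = + p

    pow : ℕ → ℤ
    pow t = + (p ℕ.^ t)

    pow-nonZero : ∀ t → ℕ.NonZero (p ℕ.^ t)
    pow-nonZero t = ℕ.m^n≢0 p t

    pow-suc : ∀ t → pow (suc t) ≡ P * pow t
    pow-suc t = pos-* p (p ℕ.^ t)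

    pow-+ : ∀ s t → pow (s ℕ.+ t) ≡ pow s * pow t
    pow-+ s t = trans (cong +_ (ℕ.^-distribˡ-+-* p s t)) (pos-* (p ℕ.^ s) (p ℕ.^ t))

    pow-1 : pow 1 ≡ P
    pow-1 = cong +_ (ℕ.*-identityʳ p)

    pow-∣ : ∀ {s t} → s ℕ.≤ t → pow s ∣ pow t
    pow-∣ {s} {t} s≤t = divides (pow (t ℕ.∸ s))
      (trans (cong pow (sym (ℕ.m∸n+n≡m s≤t))) (pow-+ (t ℕ.∸ s) s))

    p-∣-pow : ∀ {t} → 1 ℕ.≤ t → P ∣ pow t
    p-∣-pow {t} 1≤t = subst (_∣ pow t) pow-1 (pow-∣ {1} {t} 1≤t)

    ∣-* : ∀ {a b} → P ∣ a * b → P ∣ a ⊎ P ∣ b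
    ∣-* {a} {b} h with euclidsLemma Data.Integer.∣ a ∣ Data.Integer.∣ b ∣ pr (subst (p ℕ.∣_) (abs-* a b) (∣⇒∣ᵤ h))
    ... | inj₁ x = inj₁ (∣ᵤ⇒∣ x)
    ... | inj₂ y = inj₂ (∣ᵤ⇒∣ y)

    ∤1 : ¬ P ∣ 1ℤ
    ∤1 h = ℕ.<⇒≱ (ℕ.nonTrivial⇒n>1 p {{prime⇒nonTrivial pr}}) (ℕ.∣⇒≤ (∣⇒∣ᵤ h))

    ∤-* : ∀ {a b} → ¬ P ∣ a → ¬ P ∣ b → ¬ P ∣ a * b
    ∤-* na nb h with ∣-* h
    ... | inj₁ x = na x
    ... | inj₂ y = nb y

    ∤-resp-≈ : ∀ {a b} → a ≈ b mod P → ¬ P ∣ a → ¬ P ∣ b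
    ∤-resp-≈ a≈b na pb = na (∣-resp-≈ a≈b pb)

    private
      bézout : ∀ r .{{_ : ℕ.NonZero r}} → r ℕ.< p → ∃ λ b → + r * b ≈ 1ℤ mod P
      bézout r r<p with coprime-Bézout (prime⇒coprime pr r<p)
      ... | GCD.Bézout.+- x y eq = - (+ y) , mod-by (- (+ x))
            (lem (+ r) (+ y) (+ x) P (trans (sym (trans (pos-+ 1 (y ℕ.* r)) (cong (λ z → 1ℤ + z) (pos-* y r)))) (trans (cong +_ eq) (pos-* x p))))
        where
        lem : ∀ r y x P → 1ℤ + y * r ≡ x * P → r * - y ≡ 1ℤ + - x * P
        lem r y x P e = trans (l₁ r y) (trans (cong (λ z → 1ℤ + - z) e) (l₂ x P))
          where
          l₁ : ∀ r y → r * - y ≡ 1ℤ + - (1ℤ + y * r)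
          l₁ = solve-∀
          l₂ : ∀ x P → 1ℤ + - (x * P) ≡ 1ℤ + - x * P
          l₂ = solve-∀
      ... | GCD.Bézout.-+ x y eq = + y , mod-by (+ x)
            (lem (+ r) (+ y) (+ x) P (trans (sym (trans (pos-+ 1 (x ℕ.* p)) (cong (λ z → 1ℤ + z) (pos-* x p)))) (trans (cong +_ eq) (pos-* y r))))
        where
        lem : ∀ r y x P → 1ℤ + x * P ≡ y * r → r * y ≡ 1ℤ + x * P
        lem r y x P e = trans (l₁ r y) (sym e)
          where
          l₁ : ∀ r y → r * y ≡ y * r
          l₁ = solve-∀

      inverse-p : ∀ a → ¬ P ∣ a → ∃ λ b → a * b ≈ 1ℤ mod P
      inverse-p a na with toℕ (residue p a) in eq
      ... | zero = ⊥-elim (na (≈0⇒∣ (≈-sym (subst (λ z → + z ≈ a mod P) eq (residue-≈ p a)))))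
      ... | suc r with bézout (suc r) (subst (ℕ._< p) eq (toℕ<n (residue p a)))
      ...   | b , h = b , ≈-trans (≈-*ʳ b (≈-sym (subst (λ z → + z ≈ a mod P) eq (residue-≈ p a)))) h

    abstract
      -- Hensel lifting: if b inverts a modulo p^n and b₁ inverts a modulo p, then
      -- (1 - a b)(1 - a b₁) is of the form 1 - a b′ and is divisible by p^(n+1).
      inverse : ∀ n a → ¬ P ∣ a → ∃ λ b → a * b ≈ 1ℤ mod pow n
      inverse zero a _ = 0ℤ , mod-by (a * 0ℤ - 1ℤ) (lem (a * 0ℤ))
        where
        lem : ∀ x → x ≡ 1ℤ + (x - 1ℤ) * 1ℤ
        lem = solve-∀
      inverse (suc n) a na with inverse n a na | inverse-p a na
      ... | b , mod-by q eq | b₁ , mod-by r eq₁ = b + b₁ - a * b * b₁ , mod-by (- (r * q)) (begin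
        a * (b + b₁ - a * b * b₁)          ≡⟨ l₁ a b b₁ ⟩
        a * b + a * b₁ - a * b * (a * b₁)  ≡⟨ cong₂ (λ x y → x + y - x * y) eq eq₁ ⟩
        _                                  ≡⟨ l₂ q (pow n) r P ⟩
        1ℤ + - (r * q) * (P * pow n)       ≡⟨ cong (λ x → 1ℤ + - (r * q) * x) (sym (pow-suc n)) ⟩
        1ℤ + - (r * q) * pow (suc n) ∎)
        where
        open ≡-Reasoning
        l₁ : ∀ a b c → a * (b + c - a * b * c) ≡ a * b + a * c - a * b * (a * c)
        l₁ = solve-∀
        l₂ : ∀ q M r P → (1ℤ + q * M) + (1ℤ + r * P) - (1ℤ + q * M) * (1ℤ + r * P) ≡ 1ℤ + - (r * q) * (P * M)
        l₂ = solve-∀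

    unit-∣ : ∀ {n a b} → 1 ℕ.≤ n → a * b ≈ 1ℤ mod pow n → ¬ P ∣ a × ¬ P ∣ b
    unit-∣ {n} {a} {b} 1≤n h =
      (λ { (divides q refl) → ∤1 (∣-resp-≈ (≈-sym h′) (divides (q * b) (l₁ q P b))) }) ,
      (λ { (divides q refl) → ∤1 (∣-resp-≈ (≈-sym h′) (divides (a * q) (l₂ a q P))) })
      where
      h′ : a * b ≈ 1ℤ mod P
      h′ = ≈-coarsen (p-∣-pow 1≤n) h
      l₁ : ∀ q P b → q * P * b ≡ q * b * P
      l₁ = solve-∀
      l₂ : ∀ a q P → a * (q * P) ≡ a * q * P
      l₂ = solve-∀

    abstract
      valuation : ∀ m a → ¬ pow m ∣ a → ∃₂ λ v u → v ℕ.< m × a ≡ pow v * u × ¬ P ∣ u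
      valuation zero a h = ⊥-elim (h (divides a (sym (*-identityʳ a))))
      valuation (suc m) a h with P ∣? a
      ... | no na = 0 , a , ℕ.s≤s ℕ.z≤n , lem a , na
        where
        lem : ∀ a → a ≡ 1ℤ * a
        lem = solve-∀
      ... | yes (divides q refl) with valuation m q (λ { (divides r refl) → h (divides r (trans (lem r (pow m) P) (cong (r *_) (sym (pow-suc m))))) })
        where
        lem : ∀ r M P → r * M * P ≡ r * (P * M)
        lem = solve-∀
      ...   | v , u , v<m , refl , nu = suc v , u , ℕ.s≤s v<m ,
                trans (lem (pow v) u P) (cong (_* u) (sym (pow-suc v))) , nu
        where
        lem : ∀ M u P → M * u * P ≡ P * M * u
        lem = solve-∀

-- Finite sums, and sums of periodic functions on the integers.

module FiniteSums where
  open import Defs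
  open Congruence
  open import Data.Nat using (ℕ; zero; suc; _+_; _*_; _≤_; z≤n; NonZero)
  open import Data.Nat.Properties hiding (_≟_)
  open import Data.Integer as ℤ using (ℤ; +_)
  import Data.Integer.Properties as ℤ
  open import Data.Fin using (Fin; zero; suc; toℕ; _≟_)
  import Data.Fin.Permutation as Perm
  open import Data.List using (length; filter; tabulate)
  open import Data.Product using (∃; _,_)
  open import Data.Empty using (⊥-elim)
  open import Relation.Nullary using (¬_; Dec; yes; no)
  open import Relation.Nullary.Decidable using (_×-dec_)
  open import Relation.Unary using (Pred; Decidable)
  open import Relation.Binary.PropositionalEquality
  open import Function using (_∘_; id)
  open import Algebra.Properties.CommutativeMonoid.Sum +-0-commutativeMonoid public
    using (sum; sum-cong-≗; ∑-distrib-+; ∑-comm; sum-permute)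
  open import Algebra.Properties.Semiring.Sum +-*-semiring public
    using (*-distribˡ-sum; *-distribʳ-sum)

  ⟦_⟧ : ∀ {a} {A : Set a} → Dec A → ℕ
  ⟦ yes _ ⟧ = 1
  ⟦ no _ ⟧ = 0

  module _ {a} {A : Set a} where

    ⟦⟧-yes : (d : Dec A) → A → ⟦ d ⟧ ≡ 1
    ⟦⟧-yes (yes _) _ = refl
    ⟦⟧-yes (no ¬x) x = ⊥-elim (¬x x)

    ⟦⟧-no : (d : Dec A) → ¬ A → ⟦ d ⟧ ≡ 0
    ⟦⟧-no (yes x) ¬x = ⊥-elim (¬x x)
    ⟦⟧-no (no _) _ = refl

    ⟦⟧-≢0 : (d : Dec A) → ⟦ d ⟧ ≢ 0 → A
    ⟦⟧-≢0 (yes x) _ = x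
    ⟦⟧-≢0 (no _) h = ⊥-elim (h refl)

    ⟦⟧-cong : ∀ {b} {B : Set b} (d : Dec A) (e : Dec B) → (A → B) → (B → A) → ⟦ d ⟧ ≡ ⟦ e ⟧
    ⟦⟧-cong (yes x) e f g = sym (helper e (f x))
      where
      helper : ∀ {b} {B : Set b} (d : Dec B) → B → ⟦ d ⟧ ≡ 1
      helper (yes _) _ = refl
      helper (no ¬x) x = ⊥-elim (¬x x)
    ⟦⟧-cong (no ¬x) (yes y) f g = ⊥-elim (¬x (g y))
    ⟦⟧-cong (no ¬x) (no _) f g = refl

  *-≢0ˡ : ∀ {a b} → a * b ≢ 0 → a ≢ 0
  *-≢0ˡ h refl = h refl

  *-≢0ʳ : ∀ {a b} → a * b ≢ 0 → b ≢ 0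
  *-≢0ʳ {a} h refl = h (*-zeroʳ a)

  sum-mono : ∀ {n} {f g : Fin n → ℕ} → (∀ i → f i ≤ g i) → sum f ≤ sum g
  sum-mono {zero} h = z≤n
  sum-mono {suc n} h = +-mono-≤ (h zero) (sum-mono (h ∘ suc))

  sum-const : ∀ n c → sum {n} (λ _ → c) ≡ n * c
  sum-const zero c = refl
  sum-const (suc n) c = cong (_+_ c) (sum-const n c)

  sum-zero : ∀ {n} {f : Fin n → ℕ} → (∀ i → f i ≡ 0) → sum f ≡ 0
  sum-zero {n} h = trans (sum-cong-≗ h) (trans (sum-const n 0) (*-zeroʳ n))

  term≤sum : ∀ {n} (f : Fin n → ℕ) i → f i ≤ sum f
  term≤sum f zero = m≤m+n _ _
  term≤sum f (suc i) = ≤-trans (term≤sum (f ∘ suc) i) (m≤n+m _ _)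

  sum≢0⇒∃ : ∀ {n} (f : Fin n → ℕ) → sum f ≢ 0 → ∃ λ i → f i ≢ 0
  sum≢0⇒∃ {zero} f h = ⊥-elim (h refl)
  sum≢0⇒∃ {suc n} f h with f zero in eq
  ... | suc _ = zero , λ e → 0≢1+n (trans (sym e) eq)
  ... | zero with sum≢0⇒∃ (f ∘ suc) h
  ...   | i , hi = suc i , hi

  ∃⇒sum≢0 : ∀ {n} (f : Fin n → ℕ) i → f i ≢ 0 → sum f ≢ 0
  ∃⇒sum≢0 f i h e = h (n≤0⇒n≡0 (≤-trans (term≤sum f i) (≤-reflexive e)))

  sum-δ : ∀ {n} (j : Fin n) (f : Fin n → ℕ) → sum (λ i → ⟦ i ≟ j ⟧ * f i) ≡ f j
  sum-δ {suc n} zero f = trans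
    (cong₂ _+_ (+-identityʳ (f zero)) (sum-zero {f = λ i → ⟦ suc i ≟ zero ⟧ * f (suc i)} λ i → refl)) (+-identityʳ _)
  sum-δ {suc n} (suc j) f = trans
    (sum-cong-≗ (λ i → cong (_* f (suc i)) (⟦⟧-cong (suc i ≟ suc j) (i ≟ j) (λ { refl → refl }) (cong suc))))
    (sum-δ j (f ∘ suc))

  sum-bijection : ∀ {m n} (f : Fin m → ℕ) (g : Fin n → ℕ) (to : Fin m → Fin n) (from : Fin n → Fin m) →
                  (∀ i → to (from i) ≡ i) → (∀ i → from (to i) ≡ i) → (∀ i → f i ≡ g (to i)) →
                  sum f ≡ sum g
  sum-bijection f g to from tf ft h =
    trans (sum-cong-≗ h) (sym (sum-permute g (Perm.permutation to from tf ft)))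

  length-filter-tabulate : ∀ {a ℓ n} {A : Set a} {Q : Pred A ℓ} (Q? : Decidable Q) (f : Fin n → A) →
    length (filter Q? (tabulate f)) ≡ sum (λ i → ⟦ Q? (f i) ⟧)
  length-filter-tabulate {n = zero} Q? f = refl
  length-filter-tabulate {n = suc n} Q? f with Q? (f zero)
  ... | yes _ = cong suc (length-filter-tabulate Q? (f ∘ suc))
  ... | no _ = length-filter-tabulate Q? (f ∘ suc)

  inum-sum : ∀ {m r} (c : Coloring m r) s t α β →
    inum c s t α β ≡ sum (λ γ → ⟦ c α γ ≟ s ⟧ * ⟦ c γ β ≟ t ⟧)
  inum-sum c s t α β = trans (length-filter-tabulate (λ γ → (c α γ ≟ s) ×-dec (c γ β ≟ t)) id)
    (sum-cong-≗ (λ γ → prod (c α γ ≟ s) (c γ β ≟ t)))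
    where
    prod : ∀ {A B : Set} (d : Dec A) (e : Dec B) → ⟦ d ×-dec e ⟧ ≡ ⟦ d ⟧ * ⟦ e ⟧
    prod (yes _) (yes _) = refl
    prod (yes _) (no _) = refl
    prod (no _) _ = refl

  module _ {m n k l : ℕ} (u₁ : Fin m → Fin k) (u₂ : Fin m → Fin l)
           (v₁ : Fin n → Fin k) (v₂ : Fin n → Fin l) where

    private
      partition : ∀ {m} (u₁ : Fin m → Fin k) (u₂ : Fin m → Fin l) (H : Fin m → ℕ) →
        sum H ≡ sum (λ s → sum (λ t → sum (λ i → ⟦ u₁ i ≟ s ⟧ * ⟦ u₂ i ≟ t ⟧ * H i)))
      partition {m} u₁ u₂ H = sym (trans
        (sum-cong-≗ λ s → ∑-comm (λ t i → ⟦ u₁ i ≟ s ⟧ * ⟦ u₂ i ≟ t ⟧ * H i)) (trans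
        (∑-comm (λ s i → sum (λ t → ⟦ u₁ i ≟ s ⟧ * ⟦ u₂ i ≟ t ⟧ * H i)))
        (sum-cong-≗ λ i → trans
          (sum-cong-≗ λ s → trans
            (sum-cong-≗ {l} λ t → trans (*-assoc ⟦ u₁ i ≟ s ⟧ _ _) (cong₂ (λ a b → a * (b * H i))
              (⟦⟧-cong (u₁ i ≟ s) (s ≟ u₁ i) sym sym) (⟦⟧-cong (u₂ i ≟ t) (t ≟ u₂ i) sym sym)))
            (trans (sym (*-distribˡ-sum ⟦ s ≟ u₁ i ⟧ (λ t → ⟦ t ≟ u₂ i ⟧ * H i)))
                   (cong (⟦ s ≟ u₁ i ⟧ *_) (sum-δ (u₂ i) (λ _ → H i)))))
          (sum-δ (u₁ i) (λ _ → H i)))))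

      block : ∀ {m} (u₁ : Fin m → Fin k) (u₂ : Fin m → Fin l) (H : Fin m → ℕ) s t h →
        (∀ i → u₁ i ≡ s → u₂ i ≡ t → H i ≡ h) →
        sum (λ i → ⟦ u₁ i ≟ s ⟧ * ⟦ u₂ i ≟ t ⟧ * H i) ≡ sum (λ i → ⟦ u₁ i ≟ s ⟧ * ⟦ u₂ i ≟ t ⟧) * h
      block u₁ u₂ H s t h e = trans (sum-cong-≗ λ i → term i (u₁ i ≟ s) (u₂ i ≟ t))
          (sym (*-distribʳ-sum h (λ i → ⟦ u₁ i ≟ s ⟧ * ⟦ u₂ i ≟ t ⟧)))
        where
        term : ∀ i (d : Dec (u₁ i ≡ s)) (f : Dec (u₂ i ≡ t)) → ⟦ d ⟧ * ⟦ f ⟧ * H i ≡ ⟦ d ⟧ * ⟦ f ⟧ * h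
        term i (yes x) (yes y) = cong (1 *_) (e i x y)
        term i (yes x) (no y) = refl
        term i (no x) _ = refl

    -- Intersection numbers enter the proof through this lemma. Both index sets are partitioned into
    -- blocks (s , t) of equal sizes. A block that is empty on one side is empty on the other; in a
    -- nonempty one both summands are constant, with a common value obtained by comparing with a
    -- fixed element of the other side.
    sum-transfer : (∀ s t → sum (λ i → ⟦ u₁ i ≟ s ⟧ * ⟦ u₂ i ≟ t ⟧) ≡ sum (λ j → ⟦ v₁ j ≟ s ⟧ * ⟦ v₂ j ≟ t ⟧)) →
      (H : Fin m → ℕ) (H′ : Fin n → ℕ) → (∀ i j → u₁ i ≡ v₁ j → u₂ i ≡ v₂ j → H i ≡ H′ j) →
      sum H ≡ sum H′
    sum-transfer count H H′ e = trans (partition u₁ u₂ H)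
      (trans (sum-cong-≗ λ s → sum-cong-≗ λ t → blocks s t) (sym (partition v₁ v₂ H′)))
      where
      blocks : ∀ s t → sum (λ i → ⟦ u₁ i ≟ s ⟧ * ⟦ u₂ i ≟ t ⟧ * H i) ≡
                       sum (λ j → ⟦ v₁ j ≟ s ⟧ * ⟦ v₂ j ≟ t ⟧ * H′ j)
      blocks s t with sum (λ j → ⟦ v₁ j ≟ s ⟧ * ⟦ v₂ j ≟ t ⟧) in eq
      ... | zero = trans (zeros u₁ u₂ H (trans (count s t) eq)) (sym (zeros v₁ v₂ H′ eq))
        where
        zeros : ∀ {m} (u₁ : Fin m → Fin k) (u₂ : Fin m → Fin l) (H : Fin m → ℕ) →
          sum (λ i → ⟦ u₁ i ≟ s ⟧ * ⟦ u₂ i ≟ t ⟧) ≡ 0 →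
          sum (λ i → ⟦ u₁ i ≟ s ⟧ * ⟦ u₂ i ≟ t ⟧ * H i) ≡ 0
        zeros u₁ u₂ H z = sum-zero λ i → cong (_* H i)
          (n≤0⇒n≡0 (≤-trans (term≤sum (λ i → ⟦ u₁ i ≟ s ⟧ * ⟦ u₂ i ≟ t ⟧) i) (≤-reflexive z)))
      ... | suc x with sum≢0⇒∃ (λ j → ⟦ v₁ j ≟ s ⟧ * ⟦ v₂ j ≟ t ⟧) (λ z → 0≢1+n (trans (sym z) eq))
                     | sum≢0⇒∃ (λ i → ⟦ u₁ i ≟ s ⟧ * ⟦ u₂ i ≟ t ⟧) (λ z → 0≢1+n (trans (sym z) (trans (count s t) eq)))
      ...   | j , hj | i , hi = trans (block u₁ u₂ H s t (H i) sameU) (trans (cong (_* H i) (count s t))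
                (sym (block v₁ v₂ H′ s t (H i) sameV)))
        where
        v₁≡ = ⟦⟧-≢0 (v₁ j ≟ s) (*-≢0ˡ hj)
        v₂≡ = ⟦⟧-≢0 (v₂ j ≟ t) (*-≢0ʳ {⟦ v₁ j ≟ s ⟧} hj)
        u₁≡ = ⟦⟧-≢0 (u₁ i ≟ s) (*-≢0ˡ hi)
        u₂≡ = ⟦⟧-≢0 (u₂ i ≟ t) (*-≢0ʳ {⟦ u₁ i ≟ s ⟧} hi)
        sameU : ∀ i′ → u₁ i′ ≡ s → u₂ i′ ≡ t → H i′ ≡ H i
        sameU i′ a b = trans (e i′ j (trans a (sym v₁≡)) (trans b (sym v₂≡)))
                       (sym (e i j (trans u₁≡ (sym v₁≡)) (trans u₂≡ (sym v₂≡))))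
        sameV : ∀ j′ → v₁ j′ ≡ s → v₂ j′ ≡ t → H′ j′ ≡ H i
        sameV j′ a b = sym (e i j′ (trans u₁≡ (sym a)) (trans u₂≡ (sym b)))

  sumℕ : ℕ → (ℕ → ℕ) → ℕ
  sumℕ n f = sum {n} (f ∘ toℕ)

  sumℕ-+ : ∀ a b f → sumℕ (a + b) f ≡ sumℕ a f + sumℕ b (λ j → f (a + j))
  sumℕ-+ zero b f = refl
  sumℕ-+ (suc a) b f = trans (cong (_+_ (f 0)) (sumℕ-+ a b (f ∘ suc))) (sym (+-assoc (f 0) _ _))

  sumℕ-* : ∀ a b f → sumℕ (a * b) f ≡ sumℕ a (λ i → sumℕ b (λ j → f (i * b + j)))
  sumℕ-* zero b f = refl
  sumℕ-* (suc a) b f = trans (sumℕ-+ b (a * b) f) (cong (_+_ (sumℕ b f))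
    (trans (sumℕ-* a b (λ x → f (b + x))) (sum-cong-≗ {a} λ i → sum-cong-≗ {b} λ j →
      cong f (sym (+-assoc b (toℕ i * b) (toℕ j))))))

  Periodic : ℕ → (ℤ → ℕ) → Set
  Periodic M f = ∀ {a b} → a ≈ b mod + M → f a ≡ f b

  ∑ : ℕ → (ℤ → ℕ) → ℕ
  ∑ M f = sumℕ M (λ i → f (+ i))

  ∑-cong : ∀ M {f g} → (∀ a → f a ≡ g a) → ∑ M f ≡ ∑ M g
  ∑-cong M h = sum-cong-≗ {M} (λ i → h (+ toℕ i))

  ∑-reindex : ∀ M .{{_ : NonZero M}} {f g} (π π⁻¹ : ℤ → ℤ) → Periodic M g →
    (∀ {a b} → a ≈ b mod + M → π a ≈ π b mod + M) →
    (∀ {a b} → a ≈ b mod + M → π⁻¹ a ≈ π⁻¹ b mod + M) →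
    (∀ a → π (π⁻¹ a) ≈ a mod + M) → (∀ a → π⁻¹ (π a) ≈ a mod + M) →
    (∀ a → f a ≡ g (π a)) → ∑ M f ≡ ∑ M g
  ∑-reindex M {f} {g} π π⁻¹ gper πc πc′ r l h = sum-bijection (λ i → f (+ toℕ i)) (λ i → g (+ toℕ i))
    (λ i → residue M (π (+ toℕ i))) (λ i → residue M (π⁻¹ (+ toℕ i)))
    (λ i → inv π π⁻¹ πc r i) (λ i → inv π⁻¹ π πc′ l i)
    (λ i → trans (h (+ toℕ i)) (gper (≈-sym (residue-≈ M (π (+ toℕ i))))))
    where
    inv : ∀ (π π⁻¹ : ℤ → ℤ) → (∀ {a b} → a ≈ b mod + M → π a ≈ π b mod + M) →
          (∀ a → π (π⁻¹ a) ≈ a mod + M) → ∀ i → residue M (π (+ toℕ (residue M (π⁻¹ (+ toℕ i))))) ≡ i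
    inv π π⁻¹ πc r i = trans (residue-cong M (≈-trans (πc (residue-≈ M (π⁻¹ (+ toℕ i)))) (r (+ toℕ i)))) (residue-toℕ M i)

  ∑-≢0⇒∃ : ∀ M f → ∑ M f ≢ 0 → ∃ λ a → f a ≢ 0
  ∑-≢0⇒∃ M f h with sum≢0⇒∃ {M} (λ i → f (+ toℕ i)) h
  ... | i , hi = + toℕ i , hi

  ∃⇒∑-≢0 : ∀ M .{{_ : NonZero M}} f → Periodic M f → ∀ a → f a ≢ 0 → ∑ M f ≢ 0
  ∃⇒∑-≢0 M f per a h = ∃⇒sum≢0 (λ i → f (+ toℕ i)) (residue M a) (λ e → h (trans (per (≈-sym (residue-≈ M a))) e))

  ∑-periodic : ∀ ρ K {f} → Periodic K f → ∑ (ρ * K) f ≡ ρ * ∑ K f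
  ∑-periodic ρ K {f} per = trans (sumℕ-* ρ K (λ i → f (+ i)))
    (trans (sum-cong-≗ {ρ} (λ i → sum-cong-≗ {K} (λ j → per (shift (toℕ i) (toℕ j))))) (sum-const ρ (∑ K f)))
    where
    shift : ∀ i j → + (i * K + j) ≈ + j mod + K
    shift i j = mod-by (+ i) (trans (ℤ.pos-+ (i * K) j) (trans (cong (ℤ._+ + j) (ℤ.pos-* i K)) (ℤ.+-comm (+ i ℤ.* + K) (+ j))))

-- The Frobenius map in characteristic q.

module Frobenius where
  open import Algebra.Bundles using (CommutativeSemiring)
  open import Data.Nat as ℕ using (ℕ; zero; suc; _!; _≤_; _<_; z≤n; s≤s; _∸_)
  import Data.Nat.Properties as ℕ
  import Data.Nat.Divisibility as ℕ
  open import Data.Nat.DivMod using (m/n*n≡m)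
  open import Data.Nat.Combinatorics using (_C_; nCk≡n!/k![n-k]!; k![n∸k]!∣n!; nCn≡1)
  open import Data.Nat.Primality using (Prime; euclidsLemma; prime⇒nonTrivial)
  open import Data.Fin using (Fin; zero; suc; fromℕ; inject₁)
  open import Data.Fin.Properties using (toℕ-fromℕ; toℕ-inject₁; toℕ<n)
  open import Data.Sum using (inj₁; inj₂)
  open import Data.Empty using (⊥-elim)
  open import Relation.Nullary using (¬_)
  open import Relation.Binary.PropositionalEquality as ≡ using (_≡_; refl; cong; subst)
  open import Function using (_∘_)

  factorial-∤ : ∀ {q} → Prime q → ∀ k → k < q → ¬ q ℕ.∣ k !
  factorial-∤ {q} pr zero _ h = ℕ.<⇒≱ (ℕ.nonTrivial⇒n>1 q {{prime⇒nonTrivial pr}}) (ℕ.∣⇒≤ h)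
  factorial-∤ {q} pr (suc k) k<q h with euclidsLemma (suc k) (k !) pr h
  ... | inj₁ x = ℕ.<⇒≱ k<q (ℕ.∣⇒≤ x)
  ... | inj₂ y = factorial-∤ pr k (ℕ.<-trans (ℕ.n<1+n k) k<q) y

  binomial-factorial : ∀ {n k} → k ≤ n → (n C k) ℕ.* (k ! ℕ.* (n ∸ k) !) ≡ n !
  binomial-factorial {n} {k} k≤n = ≡.trans (cong (ℕ._* (k ! ℕ.* (n ∸ k) !)) (nCk≡n!/k![n-k]! k≤n))
    (m/n*n≡m {{ℕ._!*_!≢0 k (n ∸ k)}} (k![n∸k]!∣n! k≤n))

  prime-∣-binomial : ∀ {q} → Prime q → ∀ k → 0 < k → k < q → q ℕ.∣ q C k
  prime-∣-binomial {zero} pr k _ ()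
  prime-∣-binomial {q@(suc q′)} pr k 0<k k<q with euclidsLemma (q C k) (k ! ℕ.* (q ∸ k) !) pr
      (subst (q ℕ.∣_) (≡.sym (binomial-factorial (ℕ.<⇒≤ k<q))) (ℕ.m∣m*n (q′ !)))
  ... | inj₁ x = x
  ... | inj₂ y with euclidsLemma (k !) ((q ∸ k) !) pr y
  ...   | inj₁ z = ⊥-elim (factorial-∤ pr k k<q z)
  ...   | inj₂ z = ⊥-elim (factorial-∤ pr (q ∸ k) (ℕ.∸-monoʳ-< 0<k (ℕ.<⇒≤ k<q)) z)

  module _ {a ℓ} (S : CommutativeSemiring a ℓ) where
    open CommutativeSemiring S renaming (Carrier to A) hiding (refl; zero)
    open import Algebra.Properties.Semiring.Exp semiring using (_^_)
    open import Algebra.Properties.Semiring.Mult semiring using (×-assocˡ) renaming (_×_ to _·_)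
    open import Algebra.Properties.Semiring.Sum semiring using (sum; sum-cong-≋; sum-init-last; sum-replicate-zero)
    open import Algebra.Properties.CommutativeSemiring.Binomial S using (theorem; binomialTerm)
    import Relation.Binary.Reasoning.Setoid setoid as R

    module CharacteristicP {q : ℕ} (pr : Prime q) (char : ∀ x → q · x ≈ 0#) where

      private
        multiple : ∀ {n} x → q ℕ.∣ n → n · x ≈ 0#
        multiple x (ℕ.divides-refl k) = trans (reflexive (cong (_· x) (ℕ.*-comm k q)))
          (trans (sym (×-assocˡ x q k)) (char (k · x)))

      -- Binomial theorem: the coefficients of all middle terms are multiples of q.
      ^-+ : ∀ x y → (x + y) ^ q ≈ x ^ q + y ^ q
      ^-+ x y = go q refl
        where
        -- The module parameter `q` cannot be split itself, so the cases are taken on a copy with an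
        -- equation. The same device recurs below for the prime.
        go : ∀ n → q ≡ n → (x + y) ^ q ≈ x ^ q + y ^ q
        go zero refl = ⊥-elim (ℕ.<⇒≱ (ℕ.nonTrivial⇒n>1 q {{prime⇒nonTrivial pr}}) z≤n)
        go (suc n) refl = R.begin
          (x + y) ^ q                                       R.≈⟨ theorem q x y ⟩
          binomialTerm x y q zero + sum (λ i → binomialTerm x y q (suc i))
            R.≈⟨ +-cong (trans (+-identityʳ _) (*-identityˡ _)) (sum-init-last (λ i → binomialTerm x y q (suc i))) ⟩
          y ^ q + (sum (λ i → binomialTerm x y q (suc (inject₁ i))) + binomialTerm x y q (suc (fromℕ n)))
            R.≈⟨ +-congˡ (+-cong (trans (sum-cong-≋ middle) (sum-replicate-zero n)) top) ⟩
          y ^ q + (0# + x ^ q)                              R.≈⟨ +-congˡ (+-identityˡ _) ⟩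
          y ^ q + x ^ q                                     R.≈⟨ +-comm _ _ ⟩
          x ^ q + y ^ q                                     R.∎
          where
          middle : ∀ (i : Fin n) → binomialTerm x y q (suc (inject₁ i)) ≈ 0#
          middle i = multiple _ (prime-∣-binomial pr _ (s≤s z≤n)
            (s≤s (subst (_< n) (≡.sym (toℕ-inject₁ i)) (toℕ<n i))))
          top : binomialTerm x y q (suc (fromℕ n)) ≈ x ^ q
          top rewrite toℕ-fromℕ n | nCn≡1 (suc n) | ℕ.n∸n≡0 n = trans (+-identityʳ _) (*-identityʳ _)

      ^-zero : 0# ^ q ≈ 0#
      ^-zero = go q refl
        where
        go : ∀ n → q ≡ n → 0# ^ q ≈ 0#
        go zero refl = ⊥-elim (ℕ.<⇒≱ (ℕ.nonTrivial⇒n>1 q {{prime⇒nonTrivial pr}}) z≤n)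
        go (suc n) refl = zeroˡ _

      ^-sum : ∀ {n} (xs : Fin n → A) → sum xs ^ q ≈ sum (λ i → xs i ^ q)
      ^-sum {zero} xs = ^-zero
      ^-sum {suc n} xs = trans (^-+ (xs zero) (sum (xs ∘ suc))) (+-congˡ (^-sum (xs ∘ suc)))

-- Convolution and the group ring of a cyclic group over a prime field.

module GroupRing where
  open Congruence
  open FiniteSums
  open Frobenius
  open import Algebra.Bundles using (CommutativeSemiring)
  open import Algebra.Structures.Biased using (isCommutativeSemiringˡ)
  open import Data.Nat as ℕ using (ℕ; zero; suc; _+_; _*_; NonZero)
  open import Data.Nat.Properties hiding (_≟_)
  open import Data.Nat.Primality using (Prime)
  open import Data.Integer as ℤ using (ℤ; +_; 0ℤ; _-_)
  import Data.Integer.Properties as ℤ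
  open import Data.Integer.Tactic.RingSolver using (solve-∀)
  open import Data.Fin using (Fin; zero; suc; toℕ; _≟_)
  open import Data.Product using (_,_)
  open import Relation.Binary.PropositionalEquality
  open import Function using (_∘_)
  open import Level using (0ℓ)

  sum-≈ : ∀ {q n} {f g : Fin n → ℕ} → (∀ i → + f i ≈ + g i mod q) → + sum f ≈ + sum g mod q
  sum-≈ {n = zero} h = ≈-refl
  sum-≈ {q} {suc n} {f} {g} h = subst₂ (λ a b → a ≈ b mod q) (sym (ℤ.pos-+ (f zero) _)) (sym (ℤ.pos-+ (g zero) _))
    (≈-+ (h zero) (sum-≈ (h ∘ suc)))

  module _ (M : ℕ) .{{_ : NonZero M}} where

    ∑-δ : ∀ f → Periodic M f → ∀ a → ∑ M (λ z → ⟦ z ≈? a mod + M ⟧ * f z) ≡ f a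
    ∑-δ f per a = trans (sum-cong-≗ {M} λ i → cong (_* f (+ toℕ i)) (⟦⟧-cong (+ toℕ i ≈? a mod + M) (i ≟ residue M a)
        (λ h → trans (sym (residue-toℕ M i)) (residue-cong M h))
        (λ h → ≈-trans (≈-reflexive (cong (λ j → + toℕ j) h)) (residue-≈ M a))))
      (trans (sum-δ (residue M a) (λ i → f (+ toℕ i))) (per (residue-≈ M a)))

    convolve : (ℤ → ℕ) → (ℤ → ℕ) → ℤ → ℕ
    convolve f g w = ∑ M (λ z → f z * g (w - z))

    convolve-comm : ∀ {f g} → Periodic M f → Periodic M g → ∀ w → convolve f g w ≡ convolve g f w
    convolve-comm {f} {g} pf pg w = ∑-reindex M (λ z → w - z) (λ z → w - z)
      (λ h → cong₂ _*_ (pg h) (pf (≈--ˡ w h)))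
      (≈--ˡ w) (≈--ˡ w)
      (λ a → ≈-reflexive (lem w a)) (λ a → ≈-reflexive (lem w a))
      (λ a → trans (*-comm (f a) (g (w - a))) (cong (λ x → g (w - a) * f x) (sym (lem w a))))
      where
      lem : ∀ w a → w - (w - a) ≡ a
      lem = solve-∀

    convolve-periodic : ∀ f {g} → Periodic M g → Periodic M (convolve f g)
    convolve-periodic f pg h = ∑-cong M (λ z → cong (f z *_) (pg (≈--ʳ z h)))

    convolve-assoc : ∀ {f g h} → Periodic M g → Periodic M h → ∀ w →
                     convolve (convolve f g) h w ≡ convolve f (convolve g h) w
    convolve-assoc {f} {g} {h} pg ph w = begin
      ∑ M (λ z → ∑ M (λ y → f y * g (z - y)) * h (w - z))
        ≡⟨ ∑-cong M (λ z → *-distribʳ-sum {M} (h (w - z)) (λ i → f (+ toℕ i) * g (z - + toℕ i))) ⟩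
      ∑ M (λ z → ∑ M (λ y → f y * g (z - y) * h (w - z)))
        ≡⟨ ∑-comm {M} {M} (λ i j → f (+ toℕ j) * g (+ toℕ i - + toℕ j) * h (w - + toℕ i)) ⟩
      ∑ M (λ y → ∑ M (λ z → f y * g (z - y) * h (w - z)))
        ≡⟨ ∑-cong M (λ y → trans (∑-cong M (λ z → *-assoc (f y) (g (z - y)) (h (w - z))))
             (sym (*-distribˡ-sum {M} (f y) (λ i → g (+ toℕ i - y) * h (w - + toℕ i))))) ⟩
      ∑ M (λ y → f y * ∑ M (λ z → g (z - y) * h (w - z)))
        ≡⟨ ∑-cong M (λ y → cong (f y *_) (∑-reindex M (λ z → z - y) (λ z → z ℤ.+ y)
             (λ e → cong₂ _*_ (pg e) (ph (≈--ˡ (w - y) e)))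
             (≈--ʳ y) (≈-+ʳ y)
             (λ a → ≈-reflexive (l₁ a y)) (λ a → ≈-reflexive (l₂ a y))
             (λ a → cong (λ x → g (a - y) * h x) (l₃ w a y)))) ⟩
      ∑ M (λ y → f y * ∑ M (λ z → g z * h (w - y - z))) ∎
      where
      open ≡-Reasoning
      l₁ : ∀ a y → a ℤ.+ y - y ≡ a
      l₁ = solve-∀
      l₂ : ∀ a y → a - y ℤ.+ y ≡ a
      l₂ = solve-∀
      l₃ : ∀ w a y → w - a ≡ w - y - (a - y)
      l₃ = solve-∀

    convolve-distribʳ : ∀ f g h w → convolve (λ z → f z + g z) h w ≡ convolve f h w + convolve g h w
    convolve-distribʳ f g h w = trans (∑-cong M (λ z → *-distribʳ-+ (h (w - z)) (f z) (g z)))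
      (∑-distrib-+ {M} (λ i → f (+ toℕ i) * h (w - + toℕ i)) (λ i → g (+ toℕ i) * h (w - + toℕ i)))

    monomial : ℕ → ℤ → ℤ → ℕ
    monomial c x w = c * ⟦ w ≈? x mod + M ⟧

    monomial-periodic : ∀ c x → Periodic M (monomial c x)
    monomial-periodic c x h = cong (c *_) (⟦⟧-cong (_ ≈? x mod + M) (_ ≈? x mod + M)
      (≈-trans (≈-sym h)) (≈-trans h))

    convolve-monomialˡ : ∀ c x {g} → Periodic M g → ∀ w → convolve (monomial c x) g w ≡ c * g (w - x)
    convolve-monomialˡ c x {g} pg w = begin
      ∑ M (λ z → c * ⟦ z ≈? x mod + M ⟧ * g (w - z))
        ≡⟨ trans (∑-cong M (λ z → *-assoc c ⟦ z ≈? x mod + M ⟧ (g (w - z))))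
             (sym (*-distribˡ-sum {M} c (λ i → ⟦ + toℕ i ≈? x mod + M ⟧ * g (w - + toℕ i)))) ⟩
      c * ∑ M (λ z → ⟦ z ≈? x mod + M ⟧ * g (w - z))
        ≡⟨ cong (c *_) (∑-δ (λ z → g (w - z)) (λ h → pg (≈--ˡ w h)) x) ⟩
      c * g (w - x) ∎
      where open ≡-Reasoning

    convolve-monomial : ∀ c x d y w → convolve (monomial c x) (monomial d y) w ≡ monomial (c * d) (x ℤ.+ y) w
    convolve-monomial c x d y w = trans (convolve-monomialˡ c x (monomial-periodic d y) w)
      (trans (sym (*-assoc c d ⟦ w - x ≈? y mod + M ⟧)) (cong (c * d *_) (⟦⟧-cong (w - x ≈? y mod + M) (w ≈? x ℤ.+ y mod + M)
        (λ h → ≈-trans (≈-reflexive (l₁ w x)) (≈-+ˡ x h))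
        (λ h → ≈-trans (≈--ʳ x h) (≈-reflexive (l₂ x y))))))
      where
      l₁ : ∀ w x → w ≡ x ℤ.+ (w - x)
      l₁ = solve-∀
      l₂ : ∀ x y → x ℤ.+ y - x ≡ y
      l₂ = solve-∀

    convolve-power : (ℤ → ℕ) → ℕ → ℤ → ℕ
    convolve-power f zero = monomial 1 0ℤ
    convolve-power f (suc k) = convolve f (convolve-power f k)

    module _ {q : ℕ} (pr : Prime q) where

      record Element : Set where
        field
          fn : ℤ → ℕ
          periodic : Periodic M fn
      open Element

      private
        infix 4 _≋_
        _≋_ : Element → Element → Set
        f ≋ g = ∀ w → + fn f w ≈ + fn g w mod + q

        exact : ∀ {f g : Element} → (∀ w → fn f w ≡ fn g w) → f ≋ g
        exact h w = ≈-reflexive (cong +_ (h w))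

      -- The group ring of ℤ/M over the field of q elements. Coefficients stay natural numbers and
      -- only equality is taken modulo q, so that exact counts can be carried into it directly.
      groupRing : CommutativeSemiring 0ℓ 0ℓ
      groupRing = record
        { Carrier = Element ; _≈_ = _≋_
        ; _+_ = λ f g → record { fn = λ w → fn f w + fn g w
                               ; periodic = λ h → cong₂ _+_ (periodic f h) (periodic g h) }
        ; _*_ = λ f g → record { fn = convolve (fn f) (fn g) ; periodic = convolve-periodic (fn f) (periodic g) }
        ; 0# = record { fn = λ _ → 0 ; periodic = λ _ → refl }
        ; 1# = record { fn = monomial 1 0ℤ ; periodic = monomial-periodic 1 0ℤ }
        ; isCommutativeSemiring = isCommutativeSemiringˡ record
          { +-isCommutativeMonoid = record
            { isMonoid = record
              { isSemigroup = record
                { isMagma = record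
                  { isEquivalence = record
                    { refl = λ w → ≈-refl
                    ; sym = λ h w → ≈-sym (h w)
                    ; trans = λ h k w → ≈-trans (h w) (k w) }
                  ; ∙-cong = λ {f} {f′} {g} {g′} h k w →
                      subst₂ (λ a b → a ≈ b mod + q) (sym (ℤ.pos-+ (fn f w) _)) (sym (ℤ.pos-+ (fn f′ w) _)) (≈-+ (h w) (k w)) }
                ; assoc = λ f g h w → ≈-reflexive (cong +_ (+-assoc (fn f w) (fn g w) (fn h w))) }
              ; identity = (λ f w → ≈-refl) , (λ f w → ≈-reflexive (cong +_ (+-identityʳ (fn f w)))) }
            ; comm = λ f g w → ≈-reflexive (cong +_ (+-comm (fn f w) (fn g w))) }
          ; *-isCommutativeMonoid = record
            { isMonoid = record
              { isSemigroup = record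
                { isMagma = record
                  { isEquivalence = record
                    { refl = λ w → ≈-refl
                    ; sym = λ h w → ≈-sym (h w)
                    ; trans = λ h k w → ≈-trans (h w) (k w) }
                  ; ∙-cong = λ {f} {f′} {g} {g′} h k w → sum-≈ {n = M} λ i →
                      subst₂ (λ a b → a ≈ b mod + q) (sym (ℤ.pos-* (fn f (+ toℕ i)) _)) (sym (ℤ.pos-* (fn f′ (+ toℕ i)) _))
                        (≈-* (h (+ toℕ i)) (k (w - + toℕ i))) }
                ; assoc = λ f g h w → ≈-reflexive (cong +_ (convolve-assoc {fn f} (periodic g) (periodic h) w)) }
              ; identity = (λ f w → ≈-reflexive (cong +_ (idˡ f w)))
                         , (λ f w → ≈-reflexive (cong +_ (trans
                             (convolve-comm (periodic f) (monomial-periodic 1 0ℤ) w) (idˡ f w)))) }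
            ; comm = λ f g w → ≈-reflexive (cong +_ (convolve-comm (periodic f) (periodic g) w)) }
          ; distribʳ = λ h f g w → ≈-reflexive (cong +_ (convolve-distribʳ (fn f) (fn g) (fn h) w))
          ; zeroˡ = λ f w → ≈-reflexive (cong +_ (sum-zero {M} λ _ → refl)) } }
        where
        idˡ : ∀ f w → convolve (monomial 1 0ℤ) (fn f) w ≡ fn f w
        idˡ f w = trans (convolve-monomialˡ 1 0ℤ (periodic f) w)
          (trans (+-identityʳ _) (cong (fn f) (ℤ.+-identityʳ w)))

      open CommutativeSemiring groupRing using () renaming (_≈_ to _≃_; semiring to gr)
      open import Algebra.Properties.Semiring.Exp gr using (^-congˡ) renaming (_^_ to _^ᵍ_)
      open import Algebra.Properties.Semiring.Mult gr using () renaming (_×_ to _·_)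
      open import Algebra.Properties.Semiring.Sum gr using () renaming (sum to sumᵍ; sum-cong-≋ to sumᵍ-cong)

      private
        module G = CommutativeSemiring groupRing

        fn-· : ∀ n f w → fn (n · f) w ≡ n * fn f w
        fn-· zero f w = refl
        fn-· (suc n) f w = cong (_+_ (fn f w)) (fn-· n f w)

        fn-sum : ∀ {n} (fs : Fin n → Element) w → fn (sumᵍ fs) w ≡ sum (λ i → fn (fs i) w)
        fn-sum {zero} fs w = refl
        fn-sum {suc n} fs w = cong (_+_ (fn (fs zero) w)) (fn-sum (fs ∘ suc) w)

        char : ∀ f → q · f ≃ G.0#
        char f w = mod-by (+ fn f w) (trans (cong +_ (trans (fn-· q f w) (*-comm q _)))
          (trans (ℤ.pos-* (fn f w) q) (sym (ℤ.+-identityˡ _))))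

        open CharacteristicP groupRing pr char using (^-sum)

        mono : ℕ → ℤ → Element
        mono c x = record { fn = monomial c x ; periodic = monomial-periodic c x }

        mono-^ : ∀ c x k w → fn (mono c x ^ᵍ k) w ≡ monomial (c ℕ.^ k) (+ k ℤ.* x) w
        mono-^ c x zero w = refl
        mono-^ c x (suc k) w = trans
          (∑-cong M (λ z → cong (monomial c x z *_) (mono-^ c x k (w - z))))
          (trans (convolve-monomial c x (c ℕ.^ k) (+ k ℤ.* x) w)
            (cong (λ y → monomial (c ℕ.^ suc k) y w) (lem (+ k) x)))
          where
          lem : ∀ k x → x ℤ.+ k ℤ.* x ≡ (+ 1 ℤ.+ k) ℤ.* x
          lem = solve-∀

        fn-^ : ∀ f k w → fn (f ^ᵍ k) w ≡ convolve-power (fn f) k w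
        fn-^ f zero w = refl
        fn-^ f (suc k) w = ∑-cong M (λ z → cong (fn f z *_) (fn-^ f k (w - z)))

      -- A function is the sum of its monomials, and in characteristic q the q-th power of a sum is
      -- the sum of the q-th powers; a monomial at x goes to one at q x.
      convolve-frobenius : ∀ f → Periodic M f → ∀ w →
        + convolve-power f q w ≈ + ∑ M (λ x → f x ℕ.^ q * ⟦ w ≈? + q ℤ.* x mod + M ⟧) mod + q
      convolve-frobenius f per w = begin
        + convolve-power f q w  ≡⟨ cong +_ (fn-^ F q w) ⟨
        + fn (F ^ᵍ q) w         ≈⟨ ^-congˡ q {F} {sumᵍ terms} expand w ⟩
        + fn (sumᵍ terms ^ᵍ q) w  ≈⟨ ^-sum terms w ⟩
        + fn (sumᵍ (λ i → terms i ^ᵍ q)) w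
          ≡⟨ cong +_ (trans (fn-sum (λ i → terms i ^ᵍ q) w)
               (sum-cong-≗ {M} (λ i → mono-^ (f (+ toℕ i)) (+ toℕ i) q w))) ⟩
        _ ∎
        where
        open import Relation.Binary.Reasoning.Setoid (≈-setoid (+ q))
        F : Element
        F = record { fn = f ; periodic = per }
        terms : Fin M → Element
        terms i = mono (f (+ toℕ i)) (+ toℕ i)
        expand : F ≃ sumᵍ terms
        expand w = ≈-reflexive (cong +_ (sym (trans (fn-sum terms w) (trans
          (∑-cong M (λ z → trans (*-comm (f z) ⟦ w ≈? z mod + M ⟧) (cong (_* f z) (⟦⟧-cong (w ≈? z mod + M) (z ≈? w mod + M) ≈-sym ≈-sym))))
          (∑-δ f per w)))))

-- S-rings over cyclic groups and Schur's theorem on multipliers.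

module SchurRings where
  open Congruence
  open FiniteSums
  open GroupRing
  open import Data.Nat as ℕ using (ℕ; zero; suc; _+_; _*_; _^_; NonZero)
  open import Data.Nat.Properties hiding (_≟_)
  open import Data.Nat.Primality using (Prime; prime⇒nonTrivial; prime⇒nonZero)
  open import Data.Nat.Primality.Factorisation using (factorise)
  import Data.Nat.Divisibility as ℕ
  open import Data.Nat.ListAction using (product)
  open import Data.Integer as ℤ using (ℤ; +_; -_; _-_; 0ℤ; 1ℤ)
  import Data.Integer.Properties as ℤ
  open import Data.Integer.Divisibility.Signed using (_∣_; ∣⇒∣ᵤ; ∣ᵤ⇒∣)
  open import Data.Integer.Tactic.RingSolver using (solve-∀)
  open import Data.Fin using (toℕ)
  open import Data.List using ([]; _∷_)
  open import Data.List.Relation.Unary.All using (All; []; _∷_)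
  open import Data.Product using (∃; _×_; _,_; proj₂)
  open import Data.Empty using (⊥-elim)
  open import Relation.Nullary using (¬_; Dec; yes; no)
  open import Relation.Binary.PropositionalEquality hiding ([_])
  open import Function using (_∘_)

  -- An S-ring over ℤ/M, presented by the partition of ℤ into unions of residue classes.
  record SchurRing (M : ℕ) .{{_ : NonZero M}} : Set₁ where
    infix 4 _~_ _~?_
    field
      _~_ : ℤ → ℤ → Set
      _~?_ : ∀ a b → Dec (a ~ b)
      ~-sym : ∀ {a b} → a ~ b → b ~ a
      ~-trans : ∀ {a b c} → a ~ b → b ~ c → a ~ c
      ≈⇒~ : ∀ {a b} → a ≈ b mod + M → a ~ b
      ~0⇒≈0 : ∀ {a} → a ~ 0ℤ → a ≈ 0ℤ mod + M
      ~-neg : ∀ {a b} → a ~ b → - a ~ - b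

    Invariant : (ℤ → ℕ) → Set
    Invariant f = ∀ {a b} → a ~ b → f a ≡ f b

    field
      convolve-invariant : ∀ f g → Invariant f → Invariant g → Invariant (convolve M f g)

    ~-refl : ∀ {a} → a ~ a
    ~-refl = ≈⇒~ ≈-refl

    ~-reflexive : ∀ {a b} → a ≡ b → a ~ b
    ~-reflexive refl = ~-refl

    ≈-~ : ∀ {a b c} → a ≈ b mod + M → b ~ c → a ~ c
    ≈-~ h = ~-trans (≈⇒~ h)

    ~-≈ : ∀ {a b c} → a ~ b → b ≈ c mod + M → a ~ c
    ~-≈ h e = ~-trans h (≈⇒~ e)

    invariant⇒periodic : ∀ {f} → Invariant f → Periodic M f
    invariant⇒periodic inv h = inv (≈⇒~ h)

    [_] : ℤ → ℤ → ℕ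
    [ a ] z = ⟦ a ~? z ⟧

    []-invariant : ∀ a → Invariant [ a ]
    []-invariant a h = ⟦⟧-cong (a ~? _) (a ~? _) (λ e → ~-trans e h) (λ e → ~-trans e (~-sym h))

    -- The structure constant that counts ways to write an element as a sum from the classes of z
    -- and a - z is constant on classes, and positive at a.
    decompose : ∀ {a b} → a ~ b → ∀ z → ∃ λ z′ → z′ ~ z × b - z′ ~ a - z
    decompose {a} {b} a~b z with ∑-≢0⇒∃ M (λ y → [ z ] y * [ a - z ] (b - y)) nonzero
      where
      nonzero : convolve M [ z ] [ a - z ] b ≢ 0
      nonzero e = ∃⇒∑-≢0 M (λ y → [ z ] y * [ a - z ] (a - y))
        (λ h → cong₂ _*_ ([]-invariant z (≈⇒~ h)) ([]-invariant (a - z) (≈⇒~ (≈--ˡ a h)))) z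
        (λ e′ → 0≢1+n (trans (sym e′) (cong₂ _*_ (⟦⟧-yes (z ~? z) ~-refl) (⟦⟧-yes (a - z ~? a - z) ~-refl))))
        (trans (convolve-invariant [ z ] [ a - z ] ([]-invariant z) ([]-invariant (a - z)) a~b) e)
    ... | y , h = y , ~-sym (⟦⟧-≢0 (z ~? y) (*-≢0ˡ h)) , ~-sym (⟦⟧-≢0 (a - z ~? b - y) (*-≢0ʳ {[ z ] y} h))

    -- The number of x in the class of c with q x = w; up to congruence modulo a prime q
    -- this is the coefficient of w in the q-th power of the class sum.
    rootCount : ℕ → ℤ → ℤ → ℕ
    rootCount q c w = ∑ M (λ x → [ c ] x * ⟦ w ≈? + q ℤ.* x mod + M ⟧)

    convolve-power-invariant : ∀ f → Invariant f → ∀ k → Invariant (convolve-power M f k)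
    convolve-power-invariant f inv zero {a} {b} a~b = cong (1 *_) (⟦⟧-cong (a ≈? 0ℤ mod + M) (b ≈? 0ℤ mod + M)
      (λ e → ~0⇒≈0 (~-≈ (~-sym a~b) e)) (λ e → ~0⇒≈0 (~-≈ a~b e)))
    convolve-power-invariant f inv (suc k) =
      convolve-invariant f (convolve-power M f k) inv (convolve-power-invariant f inv k)

    -- Powers of a class sum are constant on classes, and its coefficients 0 and 1 are unchanged by
    -- the q-th powers in Frobenius.
    rootCount-invariant : ∀ {q} → Prime q → ∀ c {a b} → a ~ b →
                          + rootCount q c a ≈ + rootCount q c b mod + q
    rootCount-invariant {q} pr c {a} {b} a~b = ≈-trans (≈-sym (frob a)) (≈-trans
      (≈-reflexive (cong +_ (convolve-power-invariant [ c ] ([]-invariant c) q a~b))) (frob b))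
      where
      idem : ∀ {A : Set} (d : Dec A) n .{{_ : NonZero n}} → ⟦ d ⟧ ^ n ≡ ⟦ d ⟧
      idem (yes _) n = ^-zeroˡ n
      idem (no _) (suc n) = refl
      frob : ∀ w → + convolve-power M [ c ] q w ≈ + rootCount q c w mod + q
      frob w = ≈-trans (convolve-frobenius M pr [ c ] (invariant⇒periodic ([]-invariant c)) w)
        (≈-reflexive (cong +_ (∑-cong M (λ x → cong (_* ⟦ w ≈? + q ℤ.* x mod + M ⟧)
          (idem (c ~? x) q {{prime⇒nonZero pr}})))))

    -- As q is invertible modulo M, the only x with q x = q c is c, so the root count at q c is the
    -- indicator of the class of a at c. Its values 1 and 0 are distinct modulo q.
    ~-cancel-prime : ∀ {q v} → Prime q → + q ℤ.* v ≈ 1ℤ mod + M → ∀ {a b} → + q ℤ.* a ~ + q ℤ.* b → a ~ b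
    ~-cancel-prime {q} {v} pr qv≈1 {a} {b} qa~qb = conclude (a ~? b)
      where
      cancel : ∀ {x y} → + q ℤ.* x ≈ + q ℤ.* y mod + M → x ≈ y mod + M
      cancel {x} {y} h = begin
        x                   ≈⟨ unit x ⟨
        v ℤ.* (+ q ℤ.* x)   ≈⟨ ≈-*ˡ v h ⟩
        v ℤ.* (+ q ℤ.* y)   ≈⟨ unit y ⟩
        y                   ∎
        where
        open import Relation.Binary.Reasoning.Setoid (≈-setoid (+ M))
        l₁ : ∀ v q x → v ℤ.* (q ℤ.* x) ≡ q ℤ.* v ℤ.* x
        l₁ = solve-∀
        unit : ∀ x → v ℤ.* (+ q ℤ.* x) ≈ x mod + M
        unit x = ≈-trans (≈-reflexive (l₁ v (+ q) x)) (≈-trans (≈-*ʳ x qv≈1) (≈-reflexive (ℤ.*-identityˡ x)))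
      count : ∀ c → rootCount q a (+ q ℤ.* c) ≡ [ a ] c
      count c = trans (∑-cong M (λ x → trans (*-comm ([ a ] x) ⟦ + q ℤ.* c ≈? + q ℤ.* x mod + M ⟧)
          (cong (_* [ a ] x) (⟦⟧-cong (+ q ℤ.* c ≈? + q ℤ.* x mod + M) (x ≈? c mod + M)
            (λ h → ≈-sym (cancel h)) (λ h → ≈-*ˡ (+ q) (≈-sym h))))))
        (∑-δ M [ a ] (invariant⇒periodic ([]-invariant a)) c)
      conclude : Dec (a ~ b) → a ~ b
      conclude (yes h) = h
      conclude (no h) = ⊥-elim (<⇒≱ (ℕ.nonTrivial⇒n>1 q {{prime⇒nonTrivial pr}}) (ℕ.∣⇒≤ (∣⇒∣ᵤ (≈0⇒∣ (begin
        1ℤ                                ≡⟨ cong +_ (trans (count a) (⟦⟧-yes (a ~? a) ~-refl)) ⟨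
        + rootCount q a (+ q ℤ.* a)       ≈⟨ rootCount-invariant pr a qa~qb ⟩
        + rootCount q a (+ q ℤ.* b)       ≡⟨ cong +_ (trans (count b) (⟦⟧-no (a ~? b) h)) ⟩
        0ℤ                                ∎)))))
        where open import Relation.Binary.Reasoning.Setoid (≈-setoid (+ q))

  module Multipliers (p : ℕ) (pr : Prime p) where
    open PrimePower p pr

    module _ {m : ℕ} .{{_ : NonZero (p ^ m)}} (B : SchurRing (p ^ m)) where
      open SchurRing B

      private
        prime-unit : ∀ {q} → Prime q → ¬ p ℕ.∣ q → ∃ λ v → + q ℤ.* v ≈ 1ℤ mod pow m
        prime-unit {q} prq h = inverse m (+ q) (h ∘ ∣⇒∣ᵤ)

        cancel-product : ∀ qs → All Prime qs → ¬ p ℕ.∣ product qs → ∀ {a b} →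
          + product qs ℤ.* a ~ + product qs ℤ.* b → a ~ b
        cancel-product [] _ _ {a} {b} h = subst₂ _~_ (ℤ.*-identityˡ a) (ℤ.*-identityˡ b) h
        cancel-product (q ∷ qs) (prq ∷ prqs) np {a} {b} h with prime-unit prq (np ∘ ℕ.∣m⇒∣m*n (product qs))
        ... | v , e = cancel-product qs prqs (np ∘ ℕ.∣n⇒∣m*n q) (~-cancel-prime {q} {v} prq e
                (subst₂ _~_ (split a) (split b) h))
          where
          split : ∀ a → + (q * product qs) ℤ.* a ≡ + q ℤ.* (+ product qs ℤ.* a)
          split a = trans (cong (ℤ._* a) (ℤ.pos-* q (product qs))) (ℤ.*-assoc (+ q) (+ product qs) a)

        cancel-ℕ : ∀ n .{{_ : NonZero n}} → ¬ p ℕ.∣ n → ∀ {a b} → + n ℤ.* a ~ + n ℤ.* b → a ~ b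
        cancel-ℕ n np {a} {b} h with factorise n
        ... | record { factors = qs ; isFactorisation = eq ; factorsPrime = prs } =
          cancel-product qs prs (subst (λ n → ¬ p ℕ.∣ n) eq np) (subst (λ n → + n ℤ.* a ~ + n ℤ.* b) eq h)

      -- Cancellation is applied with a natural number n inverse to u, which is a product of primes
      -- other than p: n (u a) = a ~ b = n (u b).
      ~-multiplier : ∀ u → ¬ P ∣ u → ∀ {a b} → a ~ b → u ℤ.* a ~ u ℤ.* b
      ~-multiplier u nu {a} {b} a~b with m ℕ.≟ 0
      ... | yes refl = ≈⇒~ (mod-by (u ℤ.* a - u ℤ.* b) (lem (u ℤ.* a) (u ℤ.* b)))
        where
        lem : ∀ x y → x ≡ y ℤ.+ (x - y) ℤ.* + 1
        lem = solve-∀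
      ... | no m≢0 with inverse m u nu
      ...   | v , uv≈1 = cancel-ℕ n {{nonZero}} np (≈-~ (undo a) (~-≈ a~b (≈-sym (undo b))))
        where
        open import Relation.Binary.Reasoning.Setoid (≈-setoid (pow m))
        n : ℕ
        n = toℕ (residue (p ^ m) v)
        n≈v : + n ≈ v mod pow m
        n≈v = residue-≈ (p ^ m) v
        np : ¬ p ℕ.∣ n
        np h = proj₂ (unit-∣ {m} {u} {v} (n≢0⇒n>0 m≢0) uv≈1)
          (∣-resp-≈ (≈-coarsen (p-∣-pow {m} (n≢0⇒n>0 m≢0)) (≈-sym n≈v)) (∣ᵤ⇒∣ h))
        nonZero : NonZero n
        nonZero = ℕ.≢-nonZero λ e → np (subst (p ℕ.∣_) (sym e) (p ℕ.∣0))
        undo : ∀ x → + n ℤ.* (u ℤ.* x) ≈ x mod pow m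
        undo x = begin
          + n ℤ.* (u ℤ.* x)  ≈⟨ ≈-*ʳ (u ℤ.* x) n≈v ⟩
          v ℤ.* (u ℤ.* x)    ≡⟨ l₁ v u x ⟩
          u ℤ.* v ℤ.* x      ≈⟨ ≈-*ʳ x uv≈1 ⟩
          1ℤ ℤ.* x           ≡⟨ ℤ.*-identityˡ x ⟩
          x                  ∎
          where
          l₁ : ∀ v u x → v ℤ.* (u ℤ.* x) ≡ u ℤ.* v ℤ.* x
          l₁ = solve-∀

-- Elements of maximal valuation in a class with trivial radical.

module ClassStructure where
  open Congruence
  open FiniteSums
  open GroupRing
  open SchurRings
  open import Data.Nat as ℕ using (ℕ; zero; suc; NonZero)
  import Data.Nat.Properties as ℕ
  import Data.Nat.Divisibility as ℕ
  open import Data.Nat.Primality using (Prime; prime⇒nonZero; prime⇒nonTrivial)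
  open import Data.Integer as ℤ using (ℤ; +_; -_; _+_; _-_; _*_; _^_; 0ℤ; 1ℤ)
  import Data.Integer.Properties as ℤ
  open import Data.Integer.Divisibility.Signed using (_∣_; divides; _∣?_; ∣⇒∣ᵤ; ∣-trans; ∣m∣n⇒∣m+n; ∣m+n∣n⇒∣m; ∣m⇒∣m*n; ∣-refl)
  open import Data.Integer.Tactic.RingSolver using (solve-∀)
  open import Data.Fin as Fin using (Fin; toℕ)
  open import Data.Fin.Properties using (toℕ<n)
  open import Data.Product using (∃; ∃₂; _×_; _,_; proj₂)
  open import Data.Sum using (_⊎_; inj₁; inj₂)
  open import Data.Empty using (⊥-elim)
  open import Relation.Nullary using (¬_; Dec; yes; no)
  open import Relation.Nullary.Decidable using (decidable-stable; _×-dec_)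
  open import Relation.Binary.PropositionalEquality hiding ([_])
  open import Function using (_∘_)

  module PrimePowerUnits (p : ℕ) (pr : Prime p) where
    open PrimePower p pr

    complement : ∀ {s t} → s ℕ.≤ t → ∃ λ d → pow t ≡ pow d * pow s × d ℕ.+ s ≡ t
    complement {s} {t} s≤t = t ℕ.∸ s , trans (cong pow (sym (ℕ.m∸n+n≡m s≤t))) (pow-+ (t ℕ.∸ s) s) , ℕ.m∸n+n≡m s≤t

    1+pow-unit : ∀ {j} z → 1 ℕ.≤ j → ¬ P ∣ 1ℤ + pow j * z
    1+pow-unit {j} z 1≤j h = ∤1 (∣m+n∣n⇒∣m h (∣m⇒∣m*n z (p-∣-pow {j} 1≤j)))

    pow-val : ∀ {s t c} → pow s ∣ pow t * c → ¬ P ∣ c → s ℕ.≤ t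
    pow-val {zero} _ _ = ℕ.z≤n
    pow-val {suc s} {zero} {c} h nc = ⊥-elim (nc (∣-trans (p-∣-pow {suc s} (ℕ.s≤s ℕ.z≤n)) (subst (pow (suc s) ∣_) (ℤ.*-identityˡ c) h)))
    pow-val {suc s} {suc t} {c} h nc = ℕ.s≤s (pow-val {s} {t} {c} (cancel (subst₂ _∣_ (pow-suc s) (trans (cong (_* c) (pow-suc t)) (ℤ.*-assoc P (pow t) c)) h)) nc)
      where
      cancel : ∀ {a b} → P * a ∣ P * b → a ∣ b
      cancel = Data.Integer.Divisibility.Signed.*-cancelˡ-∣ P {{ prime⇒nonZero pr }}

    -- The binomial coefficient n (n - 1) / 2, without division.
    triangle : ℕ → ℤ
    triangle zero = 0ℤ
    triangle (suc n) = triangle n + + n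

    2triangle : ∀ n → (1ℤ + 1ℤ) * triangle (suc n) ≡ + suc n * + n
    2triangle zero = refl
    2triangle (suc n) = trans (l₁ (triangle (suc n)) (+ suc n)) (trans (cong (_+ (1ℤ + 1ℤ) * + suc n) (2triangle n)) (l₂ (+ n)))
      where
      l₁ : ∀ t s → (1ℤ + 1ℤ) * (t + s) ≡ (1ℤ + 1ℤ) * t + (1ℤ + 1ℤ) * s
      l₁ = solve-∀
      l₂ : ∀ n → (1ℤ + n) * n + (1ℤ + 1ℤ) * (1ℤ + n) ≡ (1ℤ + (1ℤ + n)) * (1ℤ + n)
      l₂ = solve-∀

    expand : ∀ t n → ∃ λ r → (1ℤ + t) ^ n ≡ 1ℤ + + n * t + triangle n * (t * t) + t * t * t * r
    expand t zero = 0ℤ , lem t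
      where
      lem : ∀ t → 1ℤ ≡ 1ℤ + 0ℤ * t + 0ℤ * (t * t) + t * t * t * 0ℤ
      lem = solve-∀
    expand t (suc n) with expand t n
    ... | r , eq = triangle n + r + t * r , trans (cong ((1ℤ + t) *_) eq) (lem t (+ n) (triangle n) r)
      where
      lem : ∀ t n T r → (1ℤ + t) * (1ℤ + n * t + T * (t * t) + t * t * t * r) ≡
            1ℤ + (1ℤ + n) * t + (T + n) * (t * t) + t * t * t * (T + r + t * r)
      lem = solve-∀

    p-∣-triangle : p ≢ 2 → P ∣ triangle p
    p-∣-triangle p≢2 = go p refl
      where
      go : ∀ n → p ≡ n → P ∣ triangle p
      go zero eq = ⊥-elim (ℕ.<⇒≱ (ℕ.nonTrivial⇒n>1 p {{prime⇒nonTrivial pr}}) (subst (ℕ._≤ 1) (sym eq) ℕ.z≤n))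
      go (suc n) refl with ∣-* {1ℤ + 1ℤ} {triangle p} (divides (+ n) (trans (2triangle n) (ℤ.*-comm (+ suc n) (+ n))))
      ... | inj₂ h = h
      ... | inj₁ h = ⊥-elim (p≢2 (ℕ.≤-antisym (ℕ.∣⇒≤ (∣⇒∣ᵤ h)) (ℕ.nonTrivial⇒n>1 p {{prime⇒nonTrivial pr}})))

    -- In the expansion of the p-th power the linear term has valuation a + 1 and has to dominate.
    -- For p = 2 the quadratic term has valuation 2 a, which exceeds a + 1 only from a = 2 on.
    lift-exponent : ∀ a c → 1 ℕ.≤ a → (p ≡ 2 → 2 ℕ.≤ a) → ¬ P ∣ c →
      ∃ λ c′ → (1ℤ + pow a * c) ^ p ≡ 1ℤ + pow (suc a) * c′ × ¬ P ∣ c′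
    lift-exponent (suc a) c (ℕ.s≤s _) 2≤ nc with p ℕ.≟ 2 | expand (pow (suc a) * c) p
    ... | no p≢2 | r , eq with p-∣-triangle p≢2
    ...   | divides T′ T≡ = c + P * x , trans eq (trans (cong (λ T → 1ℤ + P * t + T * (t * t) + t * t * t * r) T≡)
              (trans (cong (λ A → 1ℤ + P * (A * c) + T′ * P * (A * c * (A * c)) + A * c * (A * c) * (A * c) * r) (pow-suc a))
              (trans (lem P (pow a) c T′ r) (cong (λ A → 1ℤ + A * (c + P * x)) (sym (trans (pow-suc (suc a)) (cong (P *_) (pow-suc a)))))))) ,
              λ h → nc (∣m+n∣n⇒∣m h (∣m⇒∣m*n x ∣-refl))
      where
      t = pow (suc a) * c
      A = pow a
      x = A * (T′ * (c * c)) + A * A * r * (c * c * c)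
      lem : ∀ P A c T r → 1ℤ + P * (P * A * c) + T * P * (P * A * c * (P * A * c)) + P * A * c * (P * A * c) * (P * A * c) * r ≡
            1ℤ + P * (P * A) * (c + P * (A * (T * (c * c)) + A * A * r * (c * c * c)))
      lem = solve-∀
    lift-exponent (suc zero) c _ 2≤ nc | yes p≡2 | _ = ⊥-elim (ℕ.<⇒≱ (2≤ p≡2) ℕ.≤-refl)
    lift-exponent (suc (suc a)) c _ 2≤ nc | yes p≡2 | r , eq =
        c + P * x , trans eq (trans (cong (λ T → 1ℤ + P * t + T * (t * t) + t * t * t * r) (cong triangle p≡2))
          (trans (cong (λ B → 1ℤ + P * (B * c) + 1ℤ * (B * c * (B * c)) + B * c * (B * c) * (B * c) * r) 2powers)
          (trans (lem P (pow a) c r) (cong (λ B → 1ℤ + B * (c + P * x)) (sym (trans (pow-suc (suc (suc a))) (cong (P *_) 2powers))))))) ,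
        λ h → nc (∣m+n∣n⇒∣m h (∣m⇒∣m*n x ∣-refl))
      where
      t = pow (suc (suc a)) * c
      A = pow a
      x = A * (c * c) + P * (P * (A * (A * (r * (c * c * c)))))
      2powers : pow (suc (suc a)) ≡ P * (P * pow a)
      2powers = trans (pow-suc (suc a)) (cong (P *_) (pow-suc a))
      lem : ∀ P A c r → 1ℤ + P * (P * (P * A) * c) + 1ℤ * (P * (P * A) * c * (P * (P * A) * c)) + P * (P * A) * c * (P * (P * A) * c) * (P * (P * A) * c) * r ≡
            1ℤ + P * (P * (P * A)) * (c + P * (A * (c * c) + P * (P * (A * (A * (r * (c * c * c)))))))
      lem = solve-∀

    odd : p ≡ 2 → ∀ {a} → ¬ P ∣ a → a ≈ 1ℤ mod P
    odd refl {a} na with toℕ (residue 2 a) | toℕ<n (residue 2 a) | residue-≈ 2 a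
    ... | 0 | _ | h = ⊥-elim (na (≈0⇒∣ (≈-sym h)))
    ... | 1 | _ | h = ≈-sym h
    ... | suc (suc _) | ℕ.s≤s (ℕ.s≤s ()) | _

    2-∣-odd+odd : p ≡ 2 → ∀ {a b} → ¬ P ∣ a → ¬ P ∣ b → P ∣ a + b
    2-∣-odd+odd p≡2 na nb = ∣-resp-≈ (≈-+ (odd p≡2 na) (odd p≡2 nb)) (divides 1ℤ (trans (cong +_ (sym p≡2)) (sym (ℤ.*-identityˡ P))))

    natural-inverse : ∀ n a → ¬ P ∣ a → ∃ λ e → a * + e ≈ 1ℤ mod pow n
    natural-inverse n a na with inverse n a na
    ... | b , h = toℕ (residue (p ℕ.^ n) {{pow-nonZero n}} b) ,
      ≈-trans (≈-*ˡ a (residue-≈ (p ℕ.^ n) {{pow-nonZero n}} b)) h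

  -- With i in the role of 1 / x, multiplication by the unit 1 + J z / x acts at the point W x as
  -- translation by T z. This is how multipliers turn into periods.
  unit-shift : ∀ {M T} J W x i z → T ≡ J * W → x * i ≈ 1ℤ mod M →
               (1ℤ + J * (z * i)) * (W * x) ≈ W * x + T * z mod M
  unit-shift {M} J W x i z refl (mod-by r eq) = mod-by (J * W * z * r)
    (trans (l₁ J W z i x) (trans (cong (λ e → W * x + J * W * z * e) eq) (l₂ (W * x) (J * W) z r M)))
    where
    l₁ : ∀ J W z i x → (1ℤ + J * (z * i)) * (W * x) ≡ W * x + J * W * z * (x * i)
    l₁ = solve-∀
    l₂ : ∀ X T z r M → X + T * z * (1ℤ + r * M) ≡ X + T * z + T * z * r * M
    l₂ = solve-∀

  unit-fix : ∀ {M} J c V u → J * (V * (c * u)) ≈ 0ℤ mod M → (1ℤ + J * c) * (V * u) ≈ V * u mod M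
  unit-fix {M} J c V u h = ≈-trans (≈-reflexive (lem J c V u))
    (≈-trans (≈-+ˡ (V * u) h) (≈-reflexive (ℤ.+-identityʳ (V * u))))
    where
    lem : ∀ J c V u → (1ℤ + J * c) * (V * u) ≡ V * u + J * (V * (c * u))
    lem = solve-∀

  unit-step : ∀ {M T} J c V x s → T ≡ J * V → J * (T * (c * s)) ≈ 0ℤ mod M →
              (1ℤ + J * c) * (V * x + T * s) ≈ V * x + T * (c * x + s) mod M
  unit-step {M} J c V x s refl (mod-by q eq) = mod-by q (trans (l₁ J c V x s)
    (cong (_+_ (V * x + J * V * (c * x + s))) (trans eq (ℤ.+-identityˡ (q * M)))))
    where
    l₁ : ∀ J c V x s → (1ℤ + J * c) * (V * x + J * V * s) ≡ V * x + J * V * (c * x + s) + J * (J * V * (c * s))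
    l₁ = solve-∀

  ≡-unless-zero : ∀ {a b : ℕ} → (a ≢ 0 → a ≡ b) → (b ≢ 0 → a ≡ b) → a ≡ b
  ≡-unless-zero {zero} {zero} _ _ = refl
  ≡-unless-zero {suc a} h _ = h λ ()
  ≡-unless-zero {zero} {suc b} _ h = h λ ()

  module Classes (p : ℕ) (pr : Prime p) (k : ℕ) .{{_ : NonZero (p ℕ.^ suc k)}} (B : SchurRing (p ℕ.^ suc k)) where
    open PrimePower p pr
    open PrimePowerUnits p pr
    open Multipliers p pr using (~-multiplier)
    open SchurRing B

    m : ℕ
    m = suc k

    top : ℤ
    top = pow k

    mul : ∀ u → ¬ P ∣ u → ∀ {a b} → a ~ b → u * a ~ u * b
    mul = ~-multiplier {suc k} B

    pow-vanish : ∀ {i j} z → m ℕ.≤ i ℕ.+ j → pow i * (pow j * z) ≈ 0ℤ mod pow m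
    pow-vanish {i} {j} z h = ∣⇒≈0 (subst (pow m ∣_) (trans (cong (_* z) (pow-+ i j)) (ℤ.*-assoc (pow i) (pow j) z))
      (∣m⇒∣m*n z (pow-∣ {m} {i ℕ.+ j} h)))

    top-≢0 : ∀ {z} → top * z ≈ 0ℤ mod pow m → P ∣ z
    top-≢0 {z} h = decidable-stable (P ∣? z) λ nz → ℕ.<⇒≱ (ℕ.n<1+n k) (pow-val {m} {k} (≈0⇒∣ h) nz)

    -- By `decompose`, an element of the class of s b splits, one summand at a time, into s elements
    -- of the class of b.
    multiples : ∀ {D b} → D ∣ pow m → (∀ {w} → w ~ b → D ∣ w) → ∀ s {w} → w ~ + s * b → D ∣ w
    multiples {D} {b} D∣M base zero {w} h =
      ∣-resp-≈ (≈-coarsen D∣M (~0⇒≈0 (subst (w ~_) (ℤ.*-zeroˡ b) h))) (divides 0ℤ (sym (ℤ.*-zeroˡ D)))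
    multiples {D} {b} D∣M base (suc s) {w} h =
      let (z , z~b , w-z~) = decompose (~-sym h) b
      in subst (D ∣_) (l₁ w z) (∣m∣n⇒∣m+n
          (multiples D∣M base s (subst (w - z ~_) (l₂ (+ s) b) w-z~)) (base z~b))
      where
      l₁ : ∀ w z → w - z + z ≡ w
      l₁ = solve-∀
      l₂ : ∀ s b → (1ℤ + s) * b - b ≡ s * b
      l₂ = solve-∀

    pow-*-multiple : ∀ {i u} → i ℕ.≤ k → ¬ P ∣ u → ∃ λ s → + s * (pow i * u) ≈ top mod pow m
    pow-*-multiple {i} {u} i≤k nu =
      let (j , top≡ , _) = complement {i} {k} i≤k
          (t , ut≈1) = inverse m u nu
      in toℕ (residue (p ℕ.^ m) (pow j * t)) ,
         ≈-trans (≈-*ʳ (pow i * u) (residue-≈ (p ℕ.^ m) (pow j * t))) (lem (pow j) t (pow i) u top≡ ut≈1)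
      where
      lem : ∀ J t I u → top ≡ J * I → u * t ≈ 1ℤ mod pow m → J * t * (I * u) ≈ top mod pow m
      lem J t I u top≡ (mod-by r eq) = mod-by (top * r)
          (trans (l₁ J t I u) (trans (cong₂ _*_ (sym top≡) eq) (l₂ top r (pow m))))
        where
        l₁ : ∀ J t I u → J * t * (I * u) ≡ J * I * (u * t)
        l₁ = solve-∀
        l₂ : ∀ T r M → T * (1ℤ + r * M) ≡ T + T * r * M
        l₂ = solve-∀

    -- `aperiodic` expresses that the radical of the class is trivial, since every nonzero subgroup
    -- contains the one of order p, generated by `top`.
    module Class (v : ℕ) (u : ℤ) (nu : ¬ P ∣ u) (v≤k : v ℕ.≤ k)
                 (maximal : ∀ {x} → x ~ pow v * u → ¬ pow (suc v) ∣ x)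
                 (aperiodic : ¬ (∀ x → x ~ pow v * u → x + top ~ pow v * u)) where

      y : ℤ
      y = pow v * u

      stabilise : ∀ {κ x} → ¬ P ∣ κ → κ * y ~ y → x ~ y → κ * x ~ y
      stabilise {κ} nκ κy~y x~y = ~-trans (mul κ nκ x~y) κy~y

      -- 1 + p^(k-w) z / x₀ moves p^w x₀ by p^k z but fixes y.
      shift-lower : ∀ {w x₀} z → ¬ P ∣ x₀ → w ℕ.< v → pow w * x₀ ~ y → pow w * x₀ + top * z ~ y
      shift-lower {w} {x₀} z nx w<v h =
        let (j , top≡ , j+w≡k) = complement {w} {k} (ℕ.≤-trans (ℕ.<⇒≤ w<v) v≤k)
            (i , x₀i≈1) = inverse m x₀ nx
        in go j i top≡ j+w≡k x₀i≈1
        where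
        go : ∀ j i → top ≡ pow j * pow w → j ℕ.+ w ≡ k → x₀ * i ≈ 1ℤ mod pow m → pow w * x₀ + top * z ~ y
        go j i top≡ j+w≡k x₀i≈1 = ≈-~ (≈-sym (unit-shift (pow j) (pow w) x₀ i z top≡ x₀i≈1))
          (~-trans (mul (1ℤ + pow j * (z * i)) (1+pow-unit {j} (z * i) 1≤j) h)
            (≈⇒~ (unit-fix (pow j) (z * i) (pow v) u (pow-vanish {j} {v} (z * i * u) m≤j+v))))
          where
          1≤j : 1 ℕ.≤ j
          1≤j = ℕ.+-cancelʳ-≤ w 1 j (subst (suc w ℕ.≤_) (sym j+w≡k) (ℕ.≤-trans w<v v≤k))
          m≤j+v : m ℕ.≤ j ℕ.+ v
          m≤j+v = subst (ℕ._≤ j ℕ.+ v) (trans (ℕ.+-suc j w) (cong suc j+w≡k)) (ℕ.+-monoʳ-≤ j w<v)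

      decompose-val : ∀ {x} → x ~ y → ∃₂ λ w x₀ → w ℕ.≤ v × x ≡ pow w * x₀ × ¬ P ∣ x₀
      decompose-val {x} x~y with valuation (suc v) x (maximal x~y)
      ... | w , x₀ , ℕ.s≤s w≤v , eq , nx = w , x₀ , w≤v , eq , nx

      -- If 1 + p^(k-v) c with p ∤ c stabilises the class, then so do its powers, and all
      -- elements of valuation v are moved by every multiple of p^k.
      shift-equal : suc v ℕ.≤ k → ∀ {z} → ¬ P ∣ z → y + top * z ~ y → ∀ {x₀} → ¬ P ∣ x₀ → pow v * x₀ ~ y → pow v * x₀ + top ~ y
      shift-equal v<k {z} nz h {x₀} nx x~y =
        let (j , top≡ , j+v≡k) = complement {v} {k} v≤k
            (i , ui≈1) = inverse m u nu
            (e , σe≈1) = natural-inverse 1 (z * i * x₀) (∤-* (∤-* nz (proj₂ (unit-∣ {m} {u} {i} (ℕ.s≤s ℕ.z≤n) ui≈1))) nx)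
        in go j i e top≡ j+v≡k ui≈1 σe≈1
        where
        go : ∀ j i e → top ≡ pow j * pow v → j ℕ.+ v ≡ k → u * i ≈ 1ℤ mod pow m → z * i * x₀ * + e ≈ 1ℤ mod pow 1 → pow v * x₀ + top ~ y
        go j i e top≡ j+v≡k ui≈1 σe≈1 = ~-trans (≈⇒~ (≈-+ˡ x (≈-sym topσe))) (iterate e)
          where
          x = pow v * x₀
          σ = z * i * x₀
          1≤j : 1 ℕ.≤ j
          1≤j = ℕ.+-cancelʳ-≤ v 1 j (subst (suc v ℕ.≤_) (sym j+v≡k) v<k)
          κy~y : (1ℤ + pow j * (z * i)) * y ~ y
          κy~y = ≈-~ (unit-shift (pow j) (pow v) u i z top≡ ui≈1) h
          κstep : ∀ s → (1ℤ + pow j * (z * i)) * (x + top * s) ≈ x + top * (σ + s) mod pow m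
          κstep s = unit-step (pow j) (z * i) (pow v) x₀ s top≡ (pow-vanish {j} {k} (z * i * s) (ℕ.+-monoˡ-≤ k 1≤j))
          l₅ : ∀ σ e → σ + σ * e ≡ σ * (1ℤ + e)
          l₅ = solve-∀
          l₆ : ∀ X T σ → X ≡ X + T * (σ * 0ℤ)
          l₆ = solve-∀
          iterate : ∀ e → x + top * (σ * + e) ~ y
          iterate zero = subst (_~ y) (l₆ x top σ) x~y
          iterate (suc e) = ≈-~ (≈-sym (≈-trans (κstep (σ * + e)) (≈-reflexive (cong (λ s → x + top * s) (l₅ σ (+ e))))))
            (stabilise (1+pow-unit {j} (z * i) 1≤j) κy~y (iterate e))
          topσe : top * (σ * + e) ≈ top mod pow m
          topσe = subst₂ (λ a M → top * (σ * + e) ≈ a mod M) (ℤ.*-identityʳ top)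
            (trans (sym (pow-+ k 1)) (cong pow (ℕ.+-comm k 1))) (≈-scale top σe≈1)

      -- Otherwise `top` would be a period of the class: elements of valuation below v can be moved
      -- by it in any case (`shift-lower`), and those of valuation v by `shift-equal`.
      unique-lift : suc v ℕ.≤ k → ∀ {z} → y + top * z ~ y → P ∣ z
      unique-lift v<k {z} h = decidable-stable (P ∣? z) λ nz → aperiodic (λ x x~y → period nz x~y (decompose-val x~y))
        where
        period : ¬ P ∣ z → ∀ {x} → x ~ y → (∃₂ λ w x₀ → w ℕ.≤ v × x ≡ pow w * x₀ × ¬ P ∣ x₀) → x + top ~ y
        period nz x~y (w , x₀ , w≤v , refl , nx) with ℕ.m≤n⇒m<n∨m≡n w≤v
        ... | inj₁ w<v = subst (λ t → pow w * x₀ + t ~ y) (ℤ.*-identityʳ top) (shift-lower 1ℤ nx w<v x~y)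
        ... | inj₂ refl = shift-equal v<k nz h nx x~y

      stabilise-^ : ∀ {κ} → ¬ P ∣ κ → κ * y ~ y → ∀ n → κ ^ n * y ~ y
      stabilise-^ {κ} nκ h zero = ~-reflexive (ℤ.*-identityˡ y)
      stabilise-^ {κ} nκ h (suc n) = subst (_~ y) (sym (ℤ.*-assoc κ (κ ^ n) y)) (stabilise nκ h (stabilise-^ nκ h n))

      -- Induction on d = k - a - v. The p-th power of the unit also stabilises the class and has a
      -- larger by one; at d = 0 the unit moves y by `top` c u, which `unique-lift` forbids. For p =
      -- 2 and a = 1 the exponent cannot be lifted, hence the alternative d = 0.
      stabiliser-trivial : ∀ d a c → 1 ℕ.≤ a → (p ≡ 2 → 2 ℕ.≤ a ⊎ d ≡ 0) → ¬ P ∣ c →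
                           (1ℤ + pow a * c) * y ~ y → ¬ d ℕ.+ (a ℕ.+ v) ≡ k
      stabiliser-trivial zero a c 1≤a _ nc h refl = ∤-* nc nu
          (unique-lift (ℕ.+-monoˡ-≤ v 1≤a) (subst (_~ y) (trans (l₁ (pow a) c (pow v) u)
            (cong (λ T → y + T * (c * u)) (sym (pow-+ a v)))) h))
        where
        l₁ : ∀ A c V u → (1ℤ + A * c) * (V * u) ≡ V * u + A * V * (c * u)
        l₁ = solve-∀
      stabiliser-trivial (suc d) a c 1≤a 2≤ nc h eq with lift-exponent a c 1≤a 2≤a nc
        where
        2≤a : p ≡ 2 → 2 ℕ.≤ a
        2≤a e with 2≤ e
        ... | inj₁ x = x
        ... | inj₂ ()
      ... | c′ , κ^p≡ , nc′ = stabiliser-trivial d (suc a) c′ (ℕ.s≤s ℕ.z≤n) (λ _ → inj₁ (ℕ.s≤s 1≤a)) nc′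
          (subst (λ κ → κ * y ~ y) κ^p≡ (stabilise-^ (1+pow-unit {a} c 1≤a) h p)) (trans (ℕ.+-suc d (a ℕ.+ v)) eq)

      private
        PT : ∀ x z → P * (x + top * z) ≈ P * x mod pow m
        PT x z = mod-by z (trans (lem P x top z) (cong (λ M → P * x + z * M) (sym (pow-suc k))))
          where
          lem : ∀ P x T z → P * (x + T * z) ≡ P * x + z * (P * T)
          lem = solve-∀

      -- All roots then have valuation below v, so by `shift-lower` the set of roots is invariant
      -- under `top`, and its size is a multiple of p.
      rootCount-zero : ∀ {w} → (∀ {x} → x ~ y → w ≈ P * x mod pow m → ¬ pow v ∣ x) → + rootCount p y w ≈ 0ℤ mod P
      rootCount-zero {w} none = mod-by (+ ∑ (p ℕ.^ k) F) (trans
          (cong +_ (trans (∑-periodic p (p ℕ.^ k) F-periodic) (ℕ.*-comm p (∑ (p ℕ.^ k) F))))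
          (trans (ℤ.pos-* (∑ (p ℕ.^ k) F) p) (sym (ℤ.+-identityˡ (+ ∑ (p ℕ.^ k) F * P)))))
        where
        F : ℤ → ℕ
        F x = [ y ] x ℕ.* ⟦ w ≈? P * x mod pow m ⟧
        shift : ∀ {x} z → x ~ y → w ≈ P * x mod pow m → (∃₂ λ w x₀ → w ℕ.≤ v × x ≡ pow w * x₀ × ¬ P ∣ x₀) → x + top * z ~ y
        shift z x~y wx (w′ , x₀ , w′≤v , refl , nx) with ℕ.m≤n⇒m<n∨m≡n w′≤v
        ... | inj₁ w′<v = shift-lower z nx w′<v x~y
        ... | inj₂ refl = ⊥-elim (none x~y wx (∣m⇒∣m*n x₀ ∣-refl))
        F-shift : ∀ x z → F x ≢ 0 → F (x + top * z) ≡ 1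
        F-shift x z h = cong₂ ℕ._*_
            (⟦⟧-yes (y ~? x + top * z) (~-sym (shift z x~y wx (decompose-val x~y))))
            (⟦⟧-yes (w ≈? P * (x + top * z) mod pow m) (≈-trans wx (≈-sym (PT x z))))
          where
          x~y : x ~ y
          x~y = ~-sym (⟦⟧-≢0 (y ~? x) (*-≢0ˡ h))
          wx : w ≈ P * x mod pow m
          wx = ⟦⟧-≢0 (w ≈? P * x mod pow m) (*-≢0ʳ {[ y ] x} h)
        F-01 : ∀ x → F x ≢ 0 → F x ≡ 1
        F-01 x h = subst (λ a → F a ≡ 1) (trans (cong (_+_ x) (ℤ.*-zeroʳ top)) (ℤ.+-identityʳ x)) (F-shift x 0ℤ h)
        F-shift≡ : ∀ x z → F x ≢ 0 → F x ≡ F (x + top * z)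
        F-shift≡ x z h = trans (F-01 x h) (sym (F-shift x z h))
        F-≡ : ∀ x z → F x ≡ F (x + top * z)
        F-≡ x z = ≡-unless-zero (F-shift≡ x z)
          (λ h → sym (trans (F-shift≡ (x + top * z) (- z) h) (cong F (lem x top z))))
          where
          lem : ∀ x T z → x + T * z + T * - z ≡ x
          lem = solve-∀
        F-periodic : Periodic (p ℕ.^ k) F
        F-periodic {b = b} (mod-by q refl) = sym (trans (F-≡ b q) (cong (λ e → F (b + e)) (ℤ.*-comm top q)))

      -- Two solutions of p x = p y differ by a multiple of `top`, and `unique-lift` leaves only y
      -- in the class.
      rootCount-one : suc v ℕ.≤ k → rootCount p y (P * y) ≡ 1
      rootCount-one v<k = trans (∑-cong (p ℕ.^ m) (λ x → trans (prod (y ~? x) (P * y ≈? P * x mod pow m) (x ≈? y mod pow m)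
            only (λ e → ≈⇒~ (≈-sym e)) (λ e → ≈-*ˡ P (≈-sym e))) (sym (ℕ.*-identityʳ ⟦ x ≈? y mod pow m ⟧))))
          (∑-δ (p ℕ.^ m) (λ _ → 1) (λ _ → refl) y)
        where
        prod : ∀ {A B C : Set} (d : Dec A) (e : Dec B) (f : Dec C) → (A → B → C) → (C → A) → (C → B) → ⟦ d ⟧ ℕ.* ⟦ e ⟧ ≡ ⟦ f ⟧
        prod (yes a) (yes b) f to l r = sym (⟦⟧-yes f (to a b))
        prod (yes a) (no nb) f to l r = sym (⟦⟧-no f (nb ∘ r))
        prod (no na) e f to l r = sym (⟦⟧-no f (na ∘ l))
        lift : ∀ {x} → y ~ x → x ≈ y mod top → x ≈ y mod pow m
        lift y~x (mod-by q refl) with unique-lift v<k {q} (subst (_~ y) (cong (_+_ y) (ℤ.*-comm q top)) (~-sym y~x))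
        ... | divides r refl = mod-by r (cong (_+_ y) (trans (ℤ.*-assoc r P top) (cong (r *_) (sym (pow-suc k)))))
        only : ∀ {x} → y ~ x → P * y ≈ P * x mod pow m → x ≈ y mod pow m
        only {x} y~x h = lift y~x (≈-unscale {top} {x} {y} P {{prime⇒nonZero pr}}
          (subst (λ M → P * x ≈ P * y mod M) (pow-suc k) (≈-sym h)))

      -- Modulo p the number of roots is constant on the class of p y, where it is 1; without a root
      -- of valuation v it would be 0 by `rootCount-zero`.
      root-lift : suc v ℕ.≤ k → ∀ {w} → w ~ P * y → ∃ λ x₀ → ¬ P ∣ x₀ × pow v * x₀ ~ y × w ≈ P * (pow v * x₀) mod pow m
      root-lift v<k {w} w~py = search (Data.Fin.Properties.any? {n = p ℕ.^ m} good?)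
        where
        Good : ℤ → Set
        Good x = x ~ y × w ≈ P * x mod pow m × pow v ∣ x
        good? : ∀ (i : Fin (p ℕ.^ m)) → Dec (Good (+ toℕ i))
        good? i = (+ toℕ i ~? y) ×-dec (w ≈? P * + toℕ i mod pow m) ×-dec (pow v ∣? + toℕ i)
        found : ∀ x → Good x → ∃ λ x₀ → ¬ P ∣ x₀ × pow v * x₀ ~ y × w ≈ P * (pow v * x₀) mod pow m
        found x (x~y , wx , divides x₀ eq) = x₀ , (λ d → maximal x~y (∣-step d)) ,
            subst (_~ y) x≡ x~y , subst (λ x → w ≈ P * x mod pow m) x≡ wx
          where
          x≡ : x ≡ pow v * x₀
          x≡ = trans eq (ℤ.*-comm x₀ (pow v))
          ∣-step : P ∣ x₀ → pow (suc v) ∣ x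
          ∣-step (divides q e) = divides q (trans eq (trans (cong (_* pow v) e)
            (trans (ℤ.*-assoc q P (pow v)) (cong (q *_) (sym (pow-suc v))))))
        none : ¬ (∃ λ i → Good (+ toℕ i)) → ∀ {x} → x ~ y → w ≈ P * x mod pow m → ¬ pow v ∣ x
        none no-i {x} x~y wx v∣x = no-i (residue (p ℕ.^ m) x , ≈-~ r≈ x~y , ≈-trans wx (≈-*ˡ P (≈-sym r≈)) ,
            ∣-resp-≈ (≈-coarsen (pow-∣ {v} {m} (ℕ.≤-trans v≤k (ℕ.n≤1+n k))) r≈) v∣x)
          where
          r≈ : + toℕ (residue (p ℕ.^ m) x) ≈ x mod pow m
          r≈ = residue-≈ (p ℕ.^ m) x
        search : Dec (∃ λ i → Good (+ toℕ i)) → ∃ λ x₀ → ¬ P ∣ x₀ × pow v * x₀ ~ y × w ≈ P * (pow v * x₀) mod pow m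
        search (yes (i , g)) = found (+ toℕ i) g
        search (no no-i) = ⊥-elim (∤1 (≈0⇒∣ (≈-trans (≈-reflexive (cong +_ (sym (rootCount-one v<k))))
            (≈-trans (≈-sym (rootCount-invariant pr y w~py)) (rootCount-zero (none no-i))))))

      private
        Py≡ : P * y ≡ pow (suc v) * u
        Py≡ = trans (sym (ℤ.*-assoc P (pow v) u)) (cong (_* u) (sym (pow-suc v)))

        top-multiple : ∀ {D i u′ w} → i ℕ.≤ k → ¬ P ∣ u′ → D ∣ pow m → (∀ {w} → w ~ pow i * u′ → D ∣ w) → w ~ top → D ∣ w
        top-multiple i≤k nu′ D∣M base w~top =
          let (s , h) = pow-*-multiple i≤k nu′ in multiples D∣M base s (~-≈ w~top (≈-sym h))

      -- By `root-lift` the class of p y consists of multiples of p^(v+1). As `top` is a multiple of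
      -- p y, its class consists of sums of such elements.
      top-class : suc v ℕ.≤ k → ∀ {w} → w ~ top → pow (suc v) ∣ w
      top-class v<k = top-multiple {i = suc v} v<k nu D∣M base
        where
        D∣M : pow (suc v) ∣ pow m
        D∣M = pow-∣ {suc v} {m} (ℕ.m≤n⇒m≤1+n v<k)
        base : ∀ {w} → w ~ pow (suc v) * u → pow (suc v) ∣ w
        base {w} h =
          let (x₀ , _ , _ , w≈) = root-lift v<k (subst (w ~_) (sym Py≡) h)
          in ∣-resp-≈ (≈-coarsen D∣M w≈) (divides x₀ (trans (sym (ℤ.*-assoc P (pow v) x₀))
               (trans (cong (_* x₀) (sym (pow-suc v))) (ℤ.*-comm (pow (suc v)) x₀))))

      -- One factor 2 more: 2^(v+2) u = p y + p y, so the elements of its class are sums of two odd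
      -- multiples of 2^(v+1).
      top-class-2 : p ≡ 2 → suc (suc v) ℕ.≤ k → ∀ {w} → w ~ top → pow (suc (suc v)) ∣ w
      top-class-2 p≡2 2+v≤k = top-multiple {i = suc (suc v)} 2+v≤k nu D∣M base
        where
        D = pow (suc (suc v))
        D∣M : D ∣ pow m
        D∣M = pow-∣ {suc (suc v)} {m} (ℕ.m≤n⇒m≤1+n 2+v≤k)
        v<k : suc v ℕ.≤ k
        v<k = ℕ.≤-trans (ℕ.n≤1+n (suc v)) 2+v≤k
        add : ∀ {a b} x₀ x₁ → ¬ P ∣ x₀ → ¬ P ∣ x₁ → a ≈ P * (pow v * x₀) mod pow m → b ≈ P * (pow v * x₁) mod pow m → D ∣ a + b
        add x₀ x₁ n₀ n₁ ha hb = ∣-resp-≈ (≈-coarsen D∣M (≈-+ ha hb)) (sum-∣ (2-∣-odd+odd p≡2 n₀ n₁))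
          where
          sum-∣ : P ∣ x₀ + x₁ → D ∣ P * (pow v * x₀) + P * (pow v * x₁)
          sum-∣ (divides q e) = divides q (trans (l₁ P (pow v) x₀ x₁) (trans (cong (λ s → P * pow v * s) e) (trans (l₂ P (pow v) q)
            (cong (q *_) (sym (trans (pow-suc (suc v)) (cong (P *_) (pow-suc v))))))))
            where
            l₁ : ∀ P V x y → P * (V * x) + P * (V * y) ≡ P * V * (x + y)
            l₁ = solve-∀
            l₂ : ∀ P V q → P * V * (q * P) ≡ q * (P * (P * V))
            l₂ = solve-∀
        D-eq : pow (suc (suc v)) * u ≡ P * y + P * y
        D-eq = trans (cong (_* u) (trans (pow-suc (suc v)) (cong (P *_) (pow-suc v))))
          (trans (cong (λ q → q * (P * pow v) * u) (cong +_ p≡2)) (l₃ P (pow v) u))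
          where
          l₃ : ∀ P V u → (1ℤ + 1ℤ) * (P * V) * u ≡ P * (V * u) + P * (V * u)
          l₃ = solve-∀
        base : ∀ {w} → w ~ pow (suc (suc v)) * u → D ∣ w
        base {w} h =
          let (z , z~ , w-z~) = decompose (~-sym (subst (w ~_) D-eq h)) (P * y)
              (x₀ , n₀ , _ , h₀) = root-lift v<k (subst (w - z ~_) (l₄ (P * y)) w-z~)
              (x₁ , n₁ , _ , h₁) = root-lift v<k z~
          in subst (D ∣_) (l₅ w z) (add x₀ x₁ n₀ n₁ h₀ h₁)
          where
          l₄ : ∀ a → a + a - a ≡ a
          l₄ = solve-∀
          l₅ : ∀ w z → w - z + z ≡ w
          l₅ = solve-∀

-- S-rings in which the class of 1 contains nonunits.

module TrivialRadical where
  open Congruence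
  open FiniteSums
  open GroupRing
  open SchurRings
  open ClassStructure
  open import Data.Nat as ℕ using (ℕ; zero; suc; NonZero)
  import Data.Nat.Properties as ℕ
  import Data.Nat.Divisibility as ℕ
  open import Data.Nat.Primality using (Prime; prime⇒nonTrivial)
  open import Data.Integer as ℤ using (ℤ; +_; -_; _+_; _-_; _*_; 0ℤ; 1ℤ)
  import Data.Integer.Properties as ℤ
  open import Data.Integer.Divisibility.Signed using (_∣_; divides; _∣?_; ∣-trans)
  open import Data.Integer.Tactic.RingSolver using (solve-∀)
  open import Data.Fin using (Fin; toℕ; _≟_)
  open import Data.Fin.Properties using (toℕ<n; any?)
  open import Data.Product using (∃; _×_; _,_; proj₁; proj₂)
  open import Data.Sum using (_⊎_; inj₁; inj₂)
  open import Data.Empty using (⊥; ⊥-elim)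
  open import Relation.Nullary using (¬_; Dec; yes; no)
  open import Relation.Nullary.Decidable using (decidable-stable; _×-dec_)
  open import Relation.Binary.PropositionalEquality hiding ([_])

  module Radical (p : ℕ) (pr : Prime p) (k : ℕ) .{{_ : NonZero (p ℕ.^ suc k)}} (B : SchurRing (p ℕ.^ suc k)) where
    open PrimePower p pr
    open PrimePowerUnits p pr
    open SchurRing B
    open Classes p pr k B

    private
      r : ℤ → ℤ
      r x = + toℕ (residue (p ℕ.^ m) x)

      r≈ : ∀ x → r x ≈ x mod pow m
      r≈ = residue-≈ (p ℕ.^ m)

    search : ∀ {Q : ℤ → Set} → (∀ x → Dec (Q x)) → (∀ {x x′} → x ≈ x′ mod pow m → Q x → Q x′) →
             (∃ λ x → Q x) ⊎ (∀ x → ¬ Q x)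
    search {Q} Q? resp = found (any? {n = p ℕ.^ m} (λ i → Q? (+ toℕ i)))
      where
      found : Dec (∃ λ i → Q (+ toℕ i)) → (∃ λ x → Q x) ⊎ (∀ x → ¬ Q x)
      found (yes (i , q)) = inj₁ (+ toℕ i , q)
      found (no h) = inj₂ λ x q → h (residue (p ℕ.^ m) x , resp (≈-sym (r≈ x)) q)

    record Valuated (b : ℤ) : Set where
      field
        v : ℕ
        u : ℤ
        v≤k : v ℕ.≤ k
        nu : ¬ P ∣ u
        ~b : pow v * u ~ b
        maximal : ∀ {x} → x ~ b → ¬ pow (suc v) ∣ x

    max-valuation : ∀ {b} → ¬ pow m ∣ b → Valuated b
    max-valuation {b} nb = descend m ℕ.≤-refl
        (λ {x} x~b h → nb (≈0⇒∣ (~0⇒≈0 (~-≈ (~-sym x~b) (∣⇒≈0 h)))))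
      where
      descend : ∀ j → j ℕ.≤ m → (∀ {x} → x ~ b → ¬ pow j ∣ x) → Valuated b
      descend zero _ h = ⊥-elim (h ~-refl (divides b (sym (ℤ.*-identityʳ b))))
      descend (suc j) (ℕ.s≤s j≤k) h = step (search {Q = λ x → x ~ b × pow j ∣ x} (λ x → (x ~? b) ×-dec (pow j ∣? x))
          (λ e (x~b , d) → ≈-~ (≈-sym e) x~b , ∣-resp-≈ (≈-coarsen (pow-∣ {j} {m} (ℕ.m≤n⇒m≤1+n j≤k)) (≈-sym e)) d))
        where
        step : (∃ λ x → x ~ b × pow j ∣ x) ⊎ (∀ x → ¬ (x ~ b × pow j ∣ x)) → Valuated b
        step (inj₂ none) = descend j (ℕ.m≤n⇒m≤1+n j≤k) (λ {x} x~b d → none x (x~b , d))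
        step (inj₁ (x , x~b , divides q eq)) = record
          { v = j ; u = q ; v≤k = j≤k ; nu = λ d → h x~b (divisible d)
          ; ~b = subst (_~ b) (trans eq (ℤ.*-comm q (pow j))) x~b ; maximal = h }
          where
          divisible : P ∣ q → pow (suc j) ∣ x
          divisible (divides q′ e) = divides q′ (trans eq (trans (cong (_* pow j) e)
            (trans (ℤ.*-assoc q′ P (pow j)) (cong (q′ *_) (sym (pow-suc j))))))

    -- The class of 1 contains y = p^v u with 1 ≤ v < k.  Since 1 + p^k ~ 1 ~ y, some w ~ p^k has
    -- y + w ~ y; then w is a multiple of p y and 1 + w / y stabilises the class.
    module NonUnit (v : ℕ) (u : ℤ) (nu : ¬ P ∣ u) (1≤v : 1 ℕ.≤ v) (v<k : suc v ℕ.≤ k)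
                   (y~1 : pow v * u ~ 1ℤ)
                   (maximal : ∀ {x} → x ~ pow v * u → ¬ pow (suc v) ∣ x)
                   (aperiodic : ¬ (∀ x → x ~ pow v * u → x + top ~ pow v * u)) where
      open Class v u nu (ℕ.≤-trans (ℕ.n≤1+n v) v<k) maximal aperiodic

      private
        1+top~y : 1ℤ + top ~ y
        1+top~y = subst (λ t → 1ℤ + t ~ y) (ℤ.*-identityʳ top) (shift-lower {0} {1ℤ} 1ℤ ∤1 1≤v (~-sym y~1))

        multiplier-absurd : ∀ {w v′ c} → w ≡ pow v′ * c → ¬ P ∣ c → v′ ℕ.≤ k → suc v ℕ.≤ v′ → w ~ top → ¬ y + w ~ y
        multiplier-absurd {w} {v′} {c} refl nc v′≤k v<v′ w~top h =
          let (a , v′≡ , a+v≡v′) = complement {v} {v′} (ℕ.<⇒≤ v<v′)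
              (i , ui≈1) = inverse m u nu
              (d , _ , d+v′≡k) = complement {v′} {k} v′≤k
          in stabiliser-trivial d a (c * i)
               (ℕ.+-cancelʳ-≤ v 1 a (subst (suc v ℕ.≤_) (sym a+v≡v′) v<v′))
               (two d a a+v≡v′ d+v′≡k) (∤-* nc (proj₂ (unit-∣ {m} {u} {i} (ℕ.s≤s ℕ.z≤n) ui≈1)))
               (≈-~ (unit-shift (pow a) (pow v) u i c v′≡ ui≈1) h)
               (trans (cong (d ℕ.+_) a+v≡v′) d+v′≡k)
          where
          -- The condition at p = 2: if v + 2 ≤ k, then `top-class-2` supplies the second factor 2;
          -- otherwise k = v + 1, which forces v′ = k and d = 0.
          two : ∀ d a → a ℕ.+ v ≡ v′ → d ℕ.+ v′ ≡ k → p ≡ 2 → 2 ℕ.≤ a ⊎ d ≡ 0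
          two d a a+v≡v′ d+v′≡k p≡2 with suc (suc v) ℕ.≤? k
          ... | yes 2+v≤k = inj₁ (ℕ.+-cancelʳ-≤ v 2 a (subst (suc (suc v) ℕ.≤_) (sym a+v≡v′)
                  (pow-val {suc (suc v)} {v′} (top-class-2 p≡2 2+v≤k w~top) nc)))
          ... | no 2+v≰k = inj₂ (ℕ.n≤0⇒n≡0 (ℕ.+-cancelʳ-≤ v′ d 0 (subst (ℕ._≤ v′) (sym d+v′≡k)
                  (ℕ.≤-trans (ℕ.s≤s⁻¹ (ℕ.≰⇒> 2+v≰k)) v<v′))))

      absurd : ⊥
      absurd =
        let (z , z~ , y-z~) = decompose (~-sym y~1) (1ℤ + top)
            w~top = subst₂ _~_ (l₁ y z) (l₂ top) (~-neg y-z~)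
            (v′ , c , v′<m , w≡ , nc) = valuation m (z - y) (λ d → ∤1 (top-≢0 (subst (_≈ 0ℤ mod pow m) (sym (ℤ.*-identityʳ top))
               (~0⇒≈0 (~-≈ (~-sym w~top) (∣⇒≈0 d))))))
        in multiplier-absurd w≡ nc (ℕ.s≤s⁻¹ v′<m)
             (pow-val {suc v} {v′} (subst (pow (suc v) ∣_) w≡ (top-class v<k w~top)) nc) w~top
             (subst (_~ y) (l₃ z y) (~-trans z~ 1+top~y))
        where
        l₁ : ∀ y z → - (y - z) ≡ z - y
        l₁ = solve-∀
        l₂ : ∀ t → - (1ℤ - (1ℤ + t)) ≡ t
        l₂ = solve-∀
        l₃ : ∀ z y → z ≡ y + (z - y)
        l₃ = solve-∀

    -- Here the class of 1 reaches the subgroup of order p, so `top` is equivalent to a unit i. This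
    -- brings every nonzero class into contact with that subgroup (`meets-top`), and a count then
    -- identifies it with the class of 1.
    module Full (1≤k : 1 ℕ.≤ k) (u : ℤ) (nu : ¬ P ∣ u) (y~1 : top * u ~ 1ℤ)
                (aperiodic : ¬ (∀ x → x ~ top * u → x + top ~ top * u)) where

      private
        i : ℤ
        i = proj₁ (inverse m u nu)
        ui≈1 : u * i ≈ 1ℤ mod pow m
        ui≈1 = proj₂ (inverse m u nu)
        ni : ¬ P ∣ i
        ni = proj₂ (unit-∣ {m} {u} {i} (ℕ.s≤s ℕ.z≤n) ui≈1)

        cancel-i : ∀ a → i * (a * u) ≈ a mod pow m
        cancel-i a = ≈-trans (≈-reflexive (l₁ i a u)) (≈-trans (≈-*ˡ a ui≈1) (≈-reflexive (ℤ.*-identityʳ a)))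
          where
          l₁ : ∀ i a u → i * (a * u) ≡ a * (u * i)
          l₁ = solve-∀

        top~i : top ~ i
        top~i = ≈-~ (≈-sym (cancel-i top)) (subst (i * (top * u) ~_) (ℤ.*-identityʳ i) (mul i ni y~1))

        top-maximal : ∀ {x} → x ~ top * u → ¬ pow (suc k) ∣ x
        top-maximal x~y d = ∤1 (top-≢0 (subst (_≈ 0ℤ mod pow m) (sym (ℤ.*-identityʳ top))
          (≈-trans (≈-sym (cancel-i top)) (≈-trans (≈-*ˡ i (~0⇒≈0 (~-≈ (~-sym x~y) (∣⇒≈0 d)))) (≈-reflexive (ℤ.*-zeroʳ i))))))

        module C = Class k u nu ℕ.≤-refl top-maximal aperiodic

        1-shift : ∀ z → 1ℤ + top * z ~ 1ℤ
        1-shift z = ~-trans (C.shift-lower {0} {1ℤ} z ∤1 1≤k (~-sym y~1)) y~1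

        module Meets {b} (nb : ¬ pow m ∣ b) (V : Valuated b) (v<k : suc (Valuated.v V) ℕ.≤ k) where
          open Valuated V hiding (u; nu)

          -- With `top` the equivalent element i would be a period as well; being a unit, i
          -- generates the whole group, so that 0 would lie in the class of b.
          period-absurd : ¬ (∀ x → x ~ b → x + top ~ b)
          period-absurd h = nb (≈0⇒∣ (~0⇒≈0 (~-trans (~-sym (iterate (toℕ e))) (≈⇒~ vanish))))
            where
            i-period : ∀ x → x ~ b → x + i ~ b
            i-period x x~b =
              let (z , z~ , top-z~) = decompose (~-sym top~i) (i + x)
                  z-top~x = subst₂ _~_ (l₁ top z) (l₂ i x) (~-neg top-z~)
              in ~-trans (~-sym (subst (z ~_) (ℤ.+-comm i x) z~))
                   (subst (_~ b) (l₃ z top) (h (z - top) (~-trans z-top~x x~b)))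
              where
              l₁ : ∀ t z → - (t - z) ≡ z - t
              l₁ = solve-∀
              l₂ : ∀ i x → - (i - (i + x)) ≡ x
              l₂ = solve-∀
              l₃ : ∀ z t → z - t + t ≡ z
              l₃ = solve-∀
            iterate : ∀ n → b + + n * i ~ b
            iterate zero = ~-reflexive (trans (cong (_+_ b) (ℤ.*-zeroˡ i)) (ℤ.+-identityʳ b))
            iterate (suc n) = subst (_~ b) (l₁ b (+ n) i) (i-period (b + + n * i) (iterate n))
              where
              l₁ : ∀ b n i → b + n * i + i ≡ b + (1ℤ + n) * i
              l₁ = solve-∀
            e : Fin (p ℕ.^ m)
            e = residue (p ℕ.^ m) (- b * u)
            vanish : b + + toℕ e * i ≈ 0ℤ mod pow m
            vanish = ≈-trans (≈-+ˡ b (≈-*ʳ i (r≈ (- b * u)))) (≈-trans (≈-reflexive (l₁ b u i))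
              (≈-trans (≈-+ˡ b (≈-neg (≈-*ˡ b ui≈1))) (≈-reflexive (l₂ b))))
              where
              l₁ : ∀ b u i → b + - b * u * i ≡ b + - (b * (u * i))
              l₁ = solve-∀
              l₂ : ∀ b → b + - (b * 1ℤ) ≡ 0ℤ
              l₂ = solve-∀

          -- `top-class` would make all elements equivalent to `top` divisible by p, but the unit i
          -- is among them.
          absurd : ⊥
          absurd = ni (∣-trans (p-∣-pow {suc v} (ℕ.s≤s ℕ.z≤n)) (D.top-class v<k (~-sym top~i)))
            where
            b-maximal : ∀ {x} → x ~ pow v * Valuated.u V → ¬ pow (suc v) ∣ x
            b-maximal x~ = maximal (~-trans x~ ~b)
            b-aperiodic : ¬ (∀ x → x ~ pow v * Valuated.u V → x + top ~ pow v * Valuated.u V)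
            b-aperiodic h = period-absurd λ x x~b → ~-trans (h x (~-trans x~b (~-sym ~b))) ~b
            module D = Class v (Valuated.u V) (Valuated.nu V) v≤k b-maximal b-aperiodic

      meets-top : ∀ {b} → ¬ pow m ∣ b → ∃ λ c → ¬ P ∣ c × top * c ~ b
      meets-top {b} nb = conclude (ℕ.m≤n⇒m<n∨m≡n (Valuated.v≤k V))
        where
        V = max-valuation nb
        open Valuated V using (v) renaming (u to c; nu to nc; ~b to ~b)
        conclude : v ℕ.< k ⊎ v ≡ k → ∃ λ c → ¬ P ∣ c × top * c ~ b
        conclude (inj₁ v<k) = ⊥-elim (Meets.absurd nb V v<k)
        conclude (inj₂ v≡k) = c , nc , subst (λ v → pow v * c ~ b) v≡k ~b

      -- If u′ is not in the class of 1 (and b ~ u′), count the x ~ 1 with x - w ~ b: there are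
      -- at least p of them for w = 1 - u′ but fewer than p for any w in the subgroup of order p.
      private
        module Other {b u′} (nu′ : ¬ P ∣ u′) (u′~b : u′ ~ b) (nb : ¬ b ~ 1ℤ) where

          g : ℤ → ℕ
          g z = [ b ] (- z)

          F : ℤ → ℤ → ℕ
          F w x = [ 1ℤ ] x ℕ.* g (w - x)

          count : ℤ → ℕ
          count = convolve (p ℕ.^ m) [ 1ℤ ] g

          count-invariant : ∀ {w w′} → w ~ w′ → count w ≡ count w′
          count-invariant = convolve-invariant [ 1ℤ ] g ([]-invariant 1ℤ) (λ h → []-invariant b (~-neg h))

          F-yes : ∀ {w x} → x ~ 1ℤ → x - w ~ b → F w x ≡ 1
          F-yes {w} {x} x~1 h = cong₂ ℕ._*_ (⟦⟧-yes (1ℤ ~? x) (~-sym x~1))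
            (⟦⟧-yes (b ~? - (w - x)) (~-sym (subst (_~ b) (l₁ w x) h)))
            where
            l₁ : ∀ w x → x - w ≡ - (w - x)
            l₁ = solve-∀

          F-≢0 : ∀ {w x} → F w x ≢ 0 → x ~ 1ℤ × x - w ~ b
          F-≢0 {w} {x} h = ~-sym (⟦⟧-≢0 (1ℤ ~? x) (*-≢0ˡ h)) ,
            subst (_~ b) (l₁ w x) (~-sym (⟦⟧-≢0 (b ~? - (w - x)) (*-≢0ʳ {[ 1ℤ ] x} h)))
            where
            l₁ : ∀ w x → - (w - x) ≡ x - w
            l₁ = solve-∀

          F≤1 : ∀ w x → F w x ℕ.≤ 1
          F≤1 w x = ℕ.*-mono-≤ (≤1 (1ℤ ~? x)) (≤1 (b ~? - (w - x)))
            where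
            ≤1 : ∀ {A : Set} (d : Dec A) → ⟦ d ⟧ ℕ.≤ 1
            ≤1 (yes _) = ℕ.≤-refl
            ≤1 (no _) = ℕ.z≤n

          u′-shift : ∀ z → u′ + top * z ~ b
          u′-shift z =
            let (i′ , u′i′≈1) = inverse m u′ nu′
            in ~-trans (≈-~ (≈-sym (eq i′ u′i′≈1)) (subst (u′ * (1ℤ + top * (z * i′)) ~_) (ℤ.*-identityʳ u′)
                 (mul u′ nu′ (1-shift (z * i′))))) u′~b
            where
            eq : ∀ i′ → u′ * i′ ≈ 1ℤ mod pow m → u′ * (1ℤ + top * (z * i′)) ≈ u′ + top * z mod pow m
            eq i′ h = ≈-trans (≈-reflexive (l₁ u′ top z i′)) (≈-+ˡ u′ (≈-trans (≈-*ˡ (top * z) h) (≈-reflexive (ℤ.*-identityʳ (top * z)))))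
              where
              l₁ : ∀ u T z i → u * (1ℤ + T * (z * i)) ≡ u + T * z * (u * i)
              l₁ = solve-∀

          K : ℕ
          K = p ℕ.^ k

          instance
            K≢0 : NonZero K
            K≢0 = pow-nonZero k

          rows : ∀ w → count w ≡ sumℕ p (λ i → sumℕ K (λ j → F w (+ (i ℕ.* K ℕ.+ j))))
          rows w = sumℕ-* p K (λ n → F w (+ n))

          -- All p elements x = 1 + `top` q are counted, because both 1 and u′ can be translated by
          -- multiples of `top` within their classes.
          many : p ℕ.≤ count (1ℤ - u′)
          many = subst₂ ℕ._≤_ (trans (sum-const p 1) (ℕ.*-identityʳ p)) (sym (rows (1ℤ - u′)))
            (sum-mono {p} (λ i → ℕ.≤-trans (ℕ.≤-reflexive (sym (one (toℕ i))))
              (term≤sum {K} (λ j → F (1ℤ - u′) (+ (toℕ i ℕ.* K ℕ.+ toℕ j))) j₁)))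
            where
            j₁ : Fin K
            j₁ = residue K 1ℤ
            near : ∀ i → + (i ℕ.* K ℕ.+ toℕ j₁) ≈ 1ℤ mod top
            near i = ≈-trans (mod-by (+ i) (trans (ℤ.pos-+ (i ℕ.* K) (toℕ j₁)) (trans (cong (_+ + toℕ j₁) (ℤ.pos-* i K))
              (ℤ.+-comm (+ i * + K) (+ toℕ j₁))))) (residue-≈ K 1ℤ)
            at : ∀ {x} → x ≈ 1ℤ mod top → F (1ℤ - u′) x ≡ 1
            at (mod-by q refl) = F-yes (subst (λ e → 1ℤ + e ~ 1ℤ) (ℤ.*-comm top q) (1-shift q))
                (subst (_~ b) (trans (cong (_+_ u′) (ℤ.*-comm top q)) (l₁ u′ (q * top))) (u′-shift q))
              where
              l₁ : ∀ u e → u + e ≡ 1ℤ + e - (1ℤ - u)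
              l₁ = solve-∀
            one : ∀ i → F (1ℤ - u′) (+ (i ℕ.* K ℕ.+ toℕ j₁)) ≡ 1
            one i = at (near i)

          -- A counted x that is not a multiple of `top` has valuation below k, hence stays
          -- equivalent to 1 after subtracting `top` c; this would put b into the class of 1. Only
          -- the p multiples of `top` remain, one in each row.
          few : ∀ c → count (top * c) ℕ.< p
          few c = bound p refl
            where
            in-top : ∀ {x} → F (top * c) x ≢ 0 → top ∣ x
            in-top {x} h = decidable-stable (top ∣? x) λ nt →
                let (w , x₀ , w<k , x≡ , nx) = valuation k x nt
                in nb (~-trans (~-sym (subst (_~ b) (l₁ x top c) (proj₂ (F-≢0 {top * c} {x} h))))
                     (lower w x₀ w<k x≡ nx (proj₁ (F-≢0 {top * c} {x} h))))
              where
              l₁ : ∀ x T c → x - T * c ≡ x + T * - c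
              l₁ = solve-∀
              lower : ∀ w x₀ → w ℕ.< k → x ≡ pow w * x₀ → ¬ P ∣ x₀ → x ~ 1ℤ → x + top * - c ~ 1ℤ
              lower w x₀ w<k refl nx x~1 = ~-trans (C.shift-lower {w} {x₀} (- c) nx w<k (~-trans x~1 (~-sym y~1))) y~1
            row≤ : ∀ n → sumℕ K (λ j → F (top * c) (+ (n ℕ.* K ℕ.+ j))) ℕ.≤ 1
            row≤ n = subst (sumℕ K (λ j → F (top * c) (+ (n ℕ.* K ℕ.+ j))) ℕ.≤_)
                (sum-δ (residue K 0ℤ) (λ _ → 1)) (sum-mono {K} λ j → term j)
              where
              term : ∀ j → F (top * c) (+ (n ℕ.* K ℕ.+ toℕ j)) ℕ.≤ ⟦ j ≟ residue K 0ℤ ⟧ ℕ.* 1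
              term j with j ≟ residue K 0ℤ
              ... | yes _ = F≤1 (top * c) (+ (n ℕ.* K ℕ.+ toℕ j))
              ... | no ne = ℕ.≤-reflexive (decidable-stable (F (top * c) (+ (n ℕ.* K ℕ.+ toℕ j)) ℕ.≟ 0) λ h →
                      ne (trans (sym (residue-toℕ K j)) (residue-cong K (≈-trans (≈-sym shift) (∣⇒≈0 (in-top h))))))
                where
                shift : + (n ℕ.* K ℕ.+ toℕ j) ≈ + toℕ j mod top
                shift = mod-by (+ n) (trans (ℤ.pos-+ (n ℕ.* K) (toℕ j)) (trans (cong (_+ + toℕ j) (ℤ.pos-* n K))
                  (ℤ.+-comm (+ n * + K) (+ toℕ j))))
            -- The multiple in the first row is 0, which is not equivalent to 1. This makes the
            -- bound strict.
            row0 : sumℕ K (λ j → F (top * c) (+ j)) ≡ 0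
            row0 = sum-zero {K} λ j → decidable-stable (F (top * c) (+ toℕ j) ℕ.≟ 0) λ h →
                let j≡0 = small-≈ (toℕ<n j) (ℕ.>-nonZero⁻¹ K) (∣⇒≈0 (in-top h))
                in ∤1 (≈0⇒∣ (≈-coarsen (p-∣-pow {m} (ℕ.s≤s ℕ.z≤n)) (~0⇒≈0 (~-sym
                     (subst (λ n → + n ~ 1ℤ) j≡0 (proj₁ (F-≢0 {top * c} {+ toℕ j} h)))))))
            bound : ∀ n → p ≡ n → count (top * c) ℕ.< p
            bound zero eq = ⊥-elim (ℕ.<⇒≱ (ℕ.nonTrivial⇒n>1 p {{prime⇒nonTrivial pr}}) (subst (ℕ._≤ 1) (sym eq) ℕ.z≤n))
            bound (suc n) eq = subst (count (top * c) ℕ.<_) (sym eq) (ℕ.s≤s (subst (ℕ._≤ n) (sym (trans (rows (top * c))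
                (trans (cong (λ n → sumℕ n row) eq) (cong (ℕ._+ sum {n} (λ i → row (suc (toℕ i)))) row0))))
                (subst (sum {n} (λ i → row (suc (toℕ i))) ℕ.≤_) (trans (sum-const n 1) (ℕ.*-identityʳ n))
                  (sum-mono {n} λ i → row≤ (suc (toℕ i))))))
              where
              row : ℕ → ℕ
              row i = sumℕ K (λ j → F (top * c) (+ (i ℕ.* K ℕ.+ j)))

          absurd : ⊥
          absurd =
            let (c , _ , c~) = meets-top {1ℤ - u′} (λ d → nb (~-trans (~-sym u′~b) (~-sym (≈⇒~ (∣⇒≈ d)))))
            in ℕ.<⇒≱ (few c) (ℕ.≤-trans many (ℕ.≤-reflexive (count-invariant (~-sym c~))))

      -- Multiplying `top` u ~ 1 by c i shows that the representative `top` c of the class of b is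
      -- equivalent to the unit c i, and `Other` applies.
      full : ∀ b → ¬ pow m ∣ b → b ~ 1ℤ
      full b nb = decidable-stable (b ~? 1ℤ) λ nb1 →
        let (c , nc , c~b) = meets-top nb
        in Other.absurd (∤-* nc ni) (~-trans (≈-~ (≈-sym (≈-reflexive (ℤ.*-identityʳ (c * i))))
             (~-trans (~-sym (mul (c * i) (∤-* nc ni) y~1)) (≈⇒~ (≈-trans (≈-reflexive (l₁ c i top u)) (cancel-i (top * c)))))) c~b) nb1
        where
        l₁ : ∀ c i T u → c * i * (T * u) ≡ i * (T * c * u)
        l₁ = solve-∀

-- S-rings in which the class of 1 consists of units.

module Cyclotomic where
  open Congruence
  open SchurRings
  open ClassStructure
  open TrivialRadical
  open import Data.Nat as ℕ using (ℕ; zero; suc; NonZero)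
  import Data.Nat.Properties as ℕ
  open import Data.Nat.Primality using (Prime; prime⇒nonZero)
  open import Data.Integer as ℤ using (ℤ; +_; -_; _+_; _-_; _*_; 0ℤ; 1ℤ)
  import Data.Integer.Properties as ℤ
  open import Data.Integer.Divisibility.Signed using (_∣_; divides; _∣?_; ∣-trans; ∣m∣n⇒∣m+n; ∣n⇒∣m*n; ∣-refl; ∣m∣n⇒∣m-n)
  open import Data.Integer.Tactic.RingSolver using (solve-∀)
  open import Data.Fin using (toℕ)
  open import Data.Fin.Properties using (toℕ<n)
  open import Data.Product using (∃; _×_; _,_; proj₂)
  open import Data.Sum using (_⊎_; inj₁; inj₂)
  open import Data.Empty using (⊥; ⊥-elim)
  open import Relation.Nullary using (¬_; Dec; yes; no)
  open import Relation.Nullary.Decidable using (decidable-stable; _×-dec_; ¬?)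
  open import Relation.Binary.PropositionalEquality hiding ([_])
  open import Function using (_∘_)

  module _ (p : ℕ) (pr : Prime p) (k : ℕ) .{{_ : NonZero (p ℕ.^ suc k)}} (B : SchurRing (p ℕ.^ suc k)) where
    open PrimePower p pr
    open SchurRing B

    -- B is the partition into orbits of the group {κ : κ ~ 1} of units, and a relation
    -- that respects differences and fixes 0 and 1 is contained in the identity.
    record IsCyclotomic : Set₁ where
      field
        units : ∀ {x} → x ~ 1ℤ → ¬ P ∣ x
        orbit : ∀ {κ} → κ ~ 1ℤ → ∀ a → κ * a ~ a
        rigid : (θ : ℤ → ℤ → Set) →
                (∀ {a b} → θ a b → ∀ z → ∃ λ w → θ z w × z - a ~ w - b) →
                (∀ {w} → θ 0ℤ w → w ≈ 0ℤ mod pow (suc k)) →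
                (∀ {w} → θ 1ℤ w → w ≈ 1ℤ mod pow (suc k)) →
                ∀ {a b} → θ a b → a ≈ b mod pow (suc k)

  module UnitClass (p : ℕ) (pr : Prime p) (k : ℕ) .{{_ : NonZero (p ℕ.^ suc k)}} (B : SchurRing (p ℕ.^ suc k))
                   (1≤k : 1 ℕ.≤ k)
                   (units : ∀ {x} → SchurRing._~_ B x 1ℤ → ¬ (+ p) ∣ x)
                   (aperiodic : ¬ (∀ x → SchurRing._~_ B x 1ℤ → SchurRing._~_ B (x + + (p ℕ.^ k)) 1ℤ)) where
    open PrimePower p pr
    open PrimePowerUnits p pr
    open SchurRing B
    open Classes p pr k B
    open Radical p pr k B

    private
      one-maximal : ∀ {x} → x ~ pow 0 * 1ℤ → ¬ pow 1 ∣ x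
      one-maximal {x} x~1 d = units x~1 (subst (_∣ x) pow-1 d)

      module C = Class 0 1ℤ ∤1 ℕ.z≤n one-maximal aperiodic

      M : ℤ
      M = pow m

      P∣M : P ∣ M
      P∣M = p-∣-pow {m} (ℕ.s≤s ℕ.z≤n)

    ~-product : ∀ {κ κ′} → κ ~ 1ℤ → κ′ ~ 1ℤ → κ * κ′ ~ 1ℤ
    ~-product {κ} {κ′} h h′ = ~-trans (mul κ (units h) h′) (subst (_~ 1ℤ) (sym (ℤ.*-identityʳ κ)) h)

    ~-inverse : ∀ {κ ι} → κ ~ 1ℤ → κ * ι ≈ 1ℤ mod M → ι ~ 1ℤ
    ~-inverse {κ} {ι} h e = ~-trans (~-reflexive (sym (ℤ.*-identityʳ ι)))
      (~-trans (~-sym (mul ι (proj₂ (unit-∣ {m} {κ} {ι} (ℕ.s≤s ℕ.z≤n) e)) h))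
        (≈⇒~ (≈-trans (≈-reflexive (ℤ.*-comm ι κ)) e)))

    unit-orbit : ∀ {κ} → κ ~ 1ℤ → ∀ {a} → ¬ P ∣ a → κ * a ~ a
    unit-orbit {κ} h {a} na = subst₂ _~_ (ℤ.*-comm a κ) (ℤ.*-identityʳ a) (mul a na h)

    unit-quotient : ∀ {a b} → ¬ P ∣ a → b ~ a → ∃ λ κ → κ ~ 1ℤ × b ≈ κ * a mod M
    unit-quotient {a} {b} na b~a =
      let (i , ai≈1) = inverse m a na
      in b * i , ~-≈ (subst (_~ i * a) (ℤ.*-comm i b) (mul i (proj₂ (unit-∣ {m} {a} {i} (ℕ.s≤s ℕ.z≤n) ai≈1)) b~a))
                   (≈-trans (≈-reflexive (ℤ.*-comm i a)) ai≈1) ,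
         ≈-sym (≈-trans (≈-reflexive (l₁ b i a)) (≈-trans (≈-*ˡ b ai≈1) (≈-reflexive (ℤ.*-identityʳ b))))
      where
      l₁ : ∀ b i a → b * i * a ≡ b * (a * i)
      l₁ = solve-∀

    nonunits-closed : ∀ {a b} → a ~ b → P ∣ a → P ∣ b
    nonunits-closed {a} {b} a~b pa = decidable-stable (P ∣? b) λ nb →
      let (κ , κ~1 , a≈) = unit-quotient nb a~b
      in ∤-* (units κ~1) nb (∣-resp-≈ (≈-coarsen P∣M (≈-sym a≈)) pa)

    -- A unit equivalent to 1 stabilises the class of 1. If κ differed from 1, the valuation of κ -
    -- 1 would be at most k, against `stabiliser-trivial`.
    near-one : ∀ {a₀ κ} → 1 ℕ.≤ a₀ → (p ≡ 2 → 2 ℕ.≤ a₀) → κ ~ 1ℤ → κ ≈ 1ℤ mod pow a₀ → κ ≈ 1ℤ mod M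
    near-one {a₀} {κ} 1≤a₀ 2≤a₀ κ~1 κ≈1 = ∣⇒≈ (decidable-stable (M ∣? (κ - 1ℤ)) λ h →
      let (a , c , a<m , eq , nc) = valuation m (κ - 1ℤ) h
          a₀≤a = pow-val {a₀} {a} (subst (pow a₀ ∣_) eq (≈⇒∣ κ≈1)) nc
          (d , _ , d+a≡k) = complement {a} {k} (ℕ.s≤s⁻¹ a<m)
      in C.stabiliser-trivial d a c (ℕ.≤-trans 1≤a₀ a₀≤a) (λ e → inj₁ (ℕ.≤-trans (2≤a₀ e) a₀≤a)) nc
           (subst (_~ 1ℤ) (trans (l₁ κ) (trans (cong (_+_ 1ℤ) eq) (sym (ℤ.*-identityʳ (1ℤ + pow a * c))))) κ~1)
           (trans (cong (d ℕ.+_) (ℕ.+-identityʳ a)) d+a≡k))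
      where
      l₁ : ∀ κ → κ ≡ 1ℤ + (κ - 1ℤ)
      l₁ = solve-∀

    -- Reduction modulo p is injective on the group of units equivalent to 1, so these can be
    -- identified by their residues.
    module Tame (tame : ∀ {κ} → κ ~ 1ℤ → κ ≈ 1ℤ mod P → κ ≈ 1ℤ mod M) where

      tame-≈ : ∀ {κ κ′} → κ ~ 1ℤ → κ′ ~ 1ℤ → κ ≈ κ′ mod P → κ ≈ κ′ mod M
      tame-≈ {κ} {κ′} h h′ e =
        let (ι , κ′ι≈1) = inverse m κ′ (units h′)
            κι≈1 = tame (~-product h (~-inverse h′ κ′ι≈1)) (≈-trans (≈-*ʳ ι e) (≈-coarsen P∣M κ′ι≈1))
        in ≈-trans (≈-sym (cancel κ ι κ′ι≈1)) (≈-trans (≈-*ʳ κ′ κι≈1) (≈-reflexive (ℤ.*-identityˡ κ′)))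
        where
        l₁ : ∀ κ ι κ′ → κ * ι * κ′ ≡ κ * (κ′ * ι)
        l₁ = solve-∀
        cancel : ∀ κ ι → κ′ * ι ≈ 1ℤ mod M → κ * ι * κ′ ≈ κ mod M
        cancel κ ι e = ≈-trans (≈-reflexive (l₁ κ ι κ′)) (≈-trans (≈-*ˡ κ e) (≈-reflexive (ℤ.*-identityʳ κ)))

      -- Compare the classes of 1 + a and κ (1 + a).
      orbit : ∀ {κ} → κ ~ 1ℤ → ∀ a → κ * a ~ a
      orbit {κ} κ~1 a with P ∣? a
      ... | no na = unit-orbit κ~1 na
      ... | yes pa =
        let (z , z~1 , b~a) = decompose (~-sym (unit-orbit κ~1 {1ℤ + a} n1+a)) 1ℤ
            b~a′ = subst (κ * (1ℤ + a) - z ~_) (l₁ a) b~a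
            pb = nonunits-closed (~-sym b~a′) pa
            z≈κ = tame-≈ z~1 κ~1 (≈-sym (∣⇒≈ (subst (P ∣_) (l₂ κ a z) (∣m∣n⇒∣m-n pb (∣n⇒∣m*n κ pa)))))
        in ≈-~ (≈-trans (≈-reflexive (l₃ κ a)) (≈--ˡ (κ * (1ℤ + a)) (≈-sym z≈κ))) b~a′
        where
        n1+a : ¬ P ∣ 1ℤ + a
        n1+a h = ∤1 (Data.Integer.Divisibility.Signed.∣m+n∣n⇒∣m h pa)
        l₁ : ∀ a → 1ℤ + a - 1ℤ ≡ a
        l₁ = solve-∀
        l₂ : ∀ κ a z → κ * (1ℤ + a) - z - κ * a ≡ κ - z
        l₂ = solve-∀
        l₃ : ∀ κ a → κ * a ≡ κ * (1ℤ + a) - κ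
        l₃ = solve-∀

      unit-≈ : ∀ {a b} → ¬ P ∣ a → b ~ a → b ≈ a mod P → b ≈ a mod M
      unit-≈ {a} {b} na b~a b≈a =
        let (κ , κ~1 , b≈κa) = unit-quotient na b~a
            (i , ai≈1) = inverse m a na
            κ≈1 = ≈-trans (≈-sym (cancel κ i (≈-coarsen P∣M ai≈1)))
                    (≈-trans (≈-*ʳ i (≈-trans (≈-sym (≈-coarsen P∣M b≈κa)) b≈a)) (≈-coarsen P∣M ai≈1))
        in ≈-trans b≈κa (≈-trans (≈-*ʳ a (tame κ~1 κ≈1)) (≈-reflexive (ℤ.*-identityˡ a)))
        where
        cancel : ∀ κ i → a * i ≈ 1ℤ mod P → κ * a * i ≈ κ mod P
        cancel κ i e = ≈-trans (≈-reflexive (ℤ.*-assoc κ a i)) (≈-trans (≈-*ˡ κ e) (≈-reflexive (ℤ.*-identityʳ κ)))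

      -- If a or 1 - a is a multiple of p, the other one is a unit whose class and residue modulo p
      -- are known, which determines it. In particular p itself is fixed and serves as a third
      -- point: the multipliers κ for a and κ′ for p - a agree modulo p, hence agree, and adding
      -- gives κ p = p. As k ≥ 1, κ = 1 modulo p, so κ = 1.
      rigid : (θ : ℤ → ℤ → Set) →
              (∀ {a b} → θ a b → ∀ z → ∃ λ w → θ z w × z - a ~ w - b) →
              (∀ {w} → θ 0ℤ w → w ≈ 0ℤ mod M) → (∀ {w} → θ 1ℤ w → w ≈ 1ℤ mod M) →
              ∀ {a b} → θ a b → a ≈ b mod M
      rigid θ step fix0 fix1 {a} {b} ab = cases (P ∣? a) (P ∣? (1ℤ - a))
        where
        fixed : ∀ {z a b} → (∀ {w} → θ z w → w ≈ z mod M) → θ a b → z - a ~ z - b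
        fixed {z} {a} {b} fix ab = let (w , zw , h) = step ab z in ~-≈ h (≈--ʳ b (fix zw))
        from0 : ∀ {a b} → θ a b → a ~ b
        from0 {a} {b} ab = subst₂ _~_ (l₁ a) (l₁ b) (~-neg (fixed fix0 ab))
          where
          l₁ : ∀ a → - (0ℤ - a) ≡ a
          l₁ = solve-∀
        from1 : ∀ {a b} → θ a b → 1ℤ - a ~ 1ℤ - b
        from1 = fixed fix1
        l₀ : ∀ a → a ≡ 1ℤ - (1ℤ - a)
        l₀ = solve-∀
        in0 : ∀ {a b} → P ∣ a → θ a b → b ≈ a mod M
        in0 {a} {b} pa ab = subst₂ (λ x y → x ≈ y mod M) (sym (l₀ b)) (sym (l₀ a))
          (≈--ˡ 1ℤ (unit-≈ {1ℤ - a} {1ℤ - b} n1-a (~-sym (from1 ab))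
            (≈--ˡ 1ℤ (≈-trans (∣⇒≈0 (nonunits-closed (from0 ab) pa)) (≈-sym (∣⇒≈0 pa))))))
          where
          n1-a : ¬ P ∣ 1ℤ - a
          n1-a h = ∤1 (subst (P ∣_) (l₂ a) (∣m∣n⇒∣m+n h pa))
            where
            l₂ : ∀ a → 1ℤ - a + a ≡ 1ℤ
            l₂ = solve-∀
        cases : Dec (P ∣ a) → Dec (P ∣ 1ℤ - a) → a ≈ b mod M
        cases (yes pa) _ = ≈-sym (in0 pa ab)
        cases (no na) (yes p1) = ≈-sym (unit-≈ na (~-sym (from0 ab))
          (subst₂ (λ x y → x ≈ y mod P) (sym (l₀ b)) (sym (l₀ a)) (≈--ˡ 1ℤ
            (≈-trans (∣⇒≈0 (nonunits-closed (from1 ab) p1)) (≈-sym (∣⇒≈0 p1))))))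
        cases (no na) (no _) =
          let (κ , κ~1 , b≈κa) = unit-quotient na (~-sym (from0 ab))
              (κ′ , κ′~1 , e) = unit-quotient nP-a (~-sym (fixed (in0 ∣-refl) ab))
              κ′≈κ = tame-≈ κ′~1 κ~1 (same κ κ′ (≈-coarsen P∣M b≈κa) (≈-coarsen P∣M e))
              κ≈1 = ≈-coarsen (p-∣-pow {k} 1≤k) (≈-unscale {pow k} {κ} {1ℤ} P {{prime⇒nonZero pr}}
                      (subst (λ N → P * κ ≈ P * 1ℤ mod N) (pow-suc k) (scaled κ κ′ b≈κa e κ′≈κ)))
          in ≈-sym (≈-trans b≈κa (≈-trans (≈-*ʳ a (tame κ~1 κ≈1)) (≈-reflexive (ℤ.*-identityˡ a))))
          where
          nP-a : ¬ P ∣ P - a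
          nP-a h = na (subst (P ∣_) (l₁ P a) (∣m∣n⇒∣m-n ∣-refl h))
            where
            l₁ : ∀ P a → P - (P - a) ≡ a
            l₁ = solve-∀
          same : ∀ κ κ′ → b ≈ κ * a mod P → P - b ≈ κ′ * (P - a) mod P → κ′ ≈ κ mod P
          same κ κ′ h h′ =
            let (i , ai≈1) = inverse m a na
                ai≈1′ = ≈-coarsen P∣M ai≈1
            in ≈-trans (≈-sym (cancel κ′ i ai≈1′)) (≈-trans (≈-*ʳ i κ′a≈κa) (cancel κ i ai≈1′))
            where
            P≈0 : P ≈ 0ℤ mod P
            P≈0 = ∣⇒≈0 ∣-refl
            l₁ : ∀ κ a → κ * a ≡ - (κ * (0ℤ - a))
            l₁ = solve-∀
            l₂ : ∀ b → - (0ℤ - b) ≡ b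
            l₂ = solve-∀
            κ′a≈κa : κ′ * a ≈ κ * a mod P
            κ′a≈κa = ≈-trans (≈-reflexive (l₁ κ′ a)) (≈-trans (≈-neg (≈-*ˡ κ′ (≈--ʳ a (≈-sym P≈0))))
              (≈-trans (≈-neg (≈-sym h′)) (≈-trans (≈-neg (≈--ʳ b P≈0)) (≈-trans (≈-reflexive (l₂ b)) h))))
            cancel : ∀ κ i → a * i ≈ 1ℤ mod P → κ * a * i ≈ κ mod P
            cancel κ i e = ≈-trans (≈-reflexive (ℤ.*-assoc κ a i)) (≈-trans (≈-*ˡ κ e) (≈-reflexive (ℤ.*-identityʳ κ)))
          scaled : ∀ κ κ′ → b ≈ κ * a mod M → P - b ≈ κ′ * (P - a) mod M → κ′ ≈ κ mod M → P * κ ≈ P * 1ℤ mod M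
          scaled κ κ′ h h′ e = ≈-trans (≈-reflexive (l₁ P κ a)) (≈-trans (≈-+ (≈-sym (≈-trans h′ (≈-*ʳ (P - a) e))) (≈-sym h))
              (≈-reflexive (l₂ P b)))
            where
            l₁ : ∀ P κ a → P * κ ≡ κ * (P - a) + κ * a
            l₁ = solve-∀
            l₂ : ∀ P b → P - b + b ≡ P * 1ℤ
            l₂ = solve-∀

    -- The units equivalent to 1 are here 1 and ε, with ε = -1 modulo 4, because `near-one` leaves
    -- only 1 among those that are 1 modulo 4. Residues modulo 2 distinguish nothing, so the classes
    -- of twice an odd number and divisibility by 4 take their place.
    module Wild (p≡2 : p ≡ 2) (ε : ℤ) (ε~1 : ε ~ 1ℤ) (ε≉1 : ¬ ε ≈ 1ℤ mod M) where

      private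
        4∣M : pow 2 ∣ M
        4∣M = pow-∣ {2} {m} (ℕ.s≤s 1≤k)

        4≡ : pow 2 ≡ + 4
        4≡ = cong (λ q → + (q ℕ.^ 2)) p≡2

        ±1 : ∀ {a} → ¬ P ∣ a → a ≈ 1ℤ mod pow 2 ⊎ a ≈ - 1ℤ mod pow 2
        ±1 {a} na = subst (λ q → a ≈ 1ℤ mod q ⊎ a ≈ - 1ℤ mod q) (sym 4≡) (cases (subst (λ q → ¬ + q ∣ a) p≡2 na))
          where
          cases : ¬ + 2 ∣ a → a ≈ 1ℤ mod + 4 ⊎ a ≈ - 1ℤ mod + 4
          cases n2 with toℕ (residue 4 a) | toℕ<n (residue 4 a) | residue-≈ 4 a
          ... | 0 | _ | h = ⊥-elim (n2 (∣-resp-≈ (≈-coarsen (divides (+ 2) refl) (≈-sym h)) (divides 0ℤ refl)))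
          ... | 1 | _ | h = inj₁ (≈-sym h)
          ... | 2 | _ | h = ⊥-elim (n2 (∣-resp-≈ (≈-coarsen (divides (+ 2) refl) (≈-sym h)) (divides 1ℤ refl)))
          ... | 3 | _ | h = inj₂ (≈-trans (≈-sym h) (mod-by 1ℤ refl))
          ... | suc (suc (suc (suc _))) | ℕ.s≤s (ℕ.s≤s (ℕ.s≤s (ℕ.s≤s ()))) | _

        2∤1 : ¬ P * 1ℤ ≈ 0ℤ mod pow 2
        2∤1 h = ∤1 (≈0⇒∣ (≈-unscale {P} {1ℤ} {0ℤ} P {{prime⇒nonZero pr}}
          (subst₂ (λ a N → P * 1ℤ ≈ a mod N) (sym (ℤ.*-zeroʳ P)) (trans (pow-suc 1) (cong (P *_) pow-1)) h)))

        near-one-4 : ∀ {κ} → κ ~ 1ℤ → κ ≈ 1ℤ mod pow 2 → κ ≈ 1ℤ mod M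
        near-one-4 = near-one {2} (ℕ.s≤s ℕ.z≤n) (λ _ → ℕ.≤-refl)

        ε≈-1 : ε ≈ - 1ℤ mod pow 2
        ε≈-1 = decide (±1 (units ε~1))
          where
          decide : ε ≈ 1ℤ mod pow 2 ⊎ ε ≈ - 1ℤ mod pow 2 → ε ≈ - 1ℤ mod pow 2
          decide (inj₁ h) = ⊥-elim (ε≉1 (near-one-4 ε~1 h))
          decide (inj₂ h) = h

        εε≈1 : ε * ε ≈ 1ℤ mod M
        εε≈1 = near-one-4 (~-product ε~1 ε~1) (≈-* ε≈-1 ε≈-1)

      two-units : ∀ {κ} → κ ~ 1ℤ → κ ≈ 1ℤ mod M ⊎ κ ≈ ε mod M
      two-units {κ} κ~1 = decide (±1 (units κ~1))
        where
        decide : κ ≈ 1ℤ mod pow 2 ⊎ κ ≈ - 1ℤ mod pow 2 → κ ≈ 1ℤ mod M ⊎ κ ≈ ε mod M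
        decide (inj₁ h) = inj₁ (near-one-4 κ~1 h)
        decide (inj₂ h) = inj₂ (≈-trans (≈-reflexive (sym (ℤ.*-identityʳ κ))) (≈-trans (≈-*ˡ κ (≈-sym εε≈1))
          (≈-trans (≈-reflexive (sym (ℤ.*-assoc κ ε ε))) (≈-trans (≈-*ʳ ε (near-one-4 (~-product κ~1 ε~1) (≈-* h ε≈-1)))
            (≈-reflexive (ℤ.*-identityˡ ε))))))

      unit-class : ∀ {a b} → ¬ P ∣ a → b ~ a → b ≈ a mod M ⊎ b ≈ ε * a mod M
      unit-class {a} {b} na b~a = let (κ , κ~1 , b≈) = unit-quotient na b~a in decide κ b≈ (two-units κ~1)
        where
        decide : ∀ κ → b ≈ κ * a mod M → κ ≈ 1ℤ mod M ⊎ κ ≈ ε mod M → b ≈ a mod M ⊎ b ≈ ε * a mod M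
        decide κ h (inj₁ e) = inj₁ (≈-trans h (≈-trans (≈-*ʳ a e) (≈-reflexive (ℤ.*-identityˡ a))))
        decide κ h (inj₂ e) = inj₂ (≈-trans h (≈-*ʳ a e))

      abstract
        root : ∀ {w} → w ~ P * 1ℤ → ∃ λ x₀ → x₀ ~ 1ℤ × w ≈ P * x₀ mod M
        root {w} w~P = clean (C.root-lift 1≤k {w} (subst (λ a → w ~ P * a) (sym pow0) w~P))
          where
          pow0 : pow 0 * 1ℤ ≡ 1ℤ
          pow0 = refl
          clean : (∃ λ x₀ → ¬ P ∣ x₀ × pow 0 * x₀ ~ C.y × w ≈ P * (pow 0 * x₀) mod M) → ∃ λ x₀ → x₀ ~ 1ℤ × w ≈ P * x₀ mod M
          clean (x₀ , _ , x~1 , w≈) = pow 0 * x₀ , subst (pow 0 * x₀ ~_) pow0 x~1 , w≈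

      -- `root` describes the class of 2, and the multiplier a carries it to the class of 2 a.
      even-class : ∀ {a b} → ¬ P ∣ a → b ~ P * a → b ≈ P * a mod M ⊎ b ≈ ε * (P * a) mod M
      even-class {a} {b} na b~ = let (i , ai≈1) = inverse m a na in finish i ai≈1 (root (reduce i ai≈1))
        where
        l₁ : ∀ i P a → i * (P * a) ≡ P * (a * i)
        l₁ = solve-∀
        reduce : ∀ i → a * i ≈ 1ℤ mod M → i * b ~ P * 1ℤ
        reduce i e = ~-trans (mul i (proj₂ (unit-∣ {m} {a} {i} (ℕ.s≤s ℕ.z≤n) e)) b~) (≈⇒~ iPa)
          where
          iPa : i * (P * a) ≈ P * 1ℤ mod M
          iPa = subst (λ x → x ≈ P * 1ℤ mod M) (sym (l₁ i P a)) (≈-*ˡ P e)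
        l₂ : ∀ a i b → a * (i * b) ≡ b * (a * i)
        l₂ = solve-∀
        l₃ : ∀ a P x → a * (P * x) ≡ x * (P * a)
        l₃ = solve-∀
        decide : ∀ i → a * i ≈ 1ℤ mod M → ∀ x₀ → i * b ≈ P * x₀ mod M → x₀ ≈ 1ℤ mod M ⊎ x₀ ≈ ε mod M →
                 b ≈ P * a mod M ⊎ b ≈ ε * (P * a) mod M
        decide i ai≈1 x₀ h e = final e
          where
          b≈ : b ≈ x₀ * (P * a) mod M
          b≈ = ≈-trans (≈-sym (≈-trans (≈-reflexive (l₂ a i b)) (≈-trans (≈-*ˡ b ai≈1) (≈-reflexive (ℤ.*-identityʳ b)))))
            (≈-trans (≈-*ˡ a h) (≈-reflexive (l₃ a P x₀)))
          final : x₀ ≈ 1ℤ mod M ⊎ x₀ ≈ ε mod M → b ≈ P * a mod M ⊎ b ≈ ε * (P * a) mod M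
          final (inj₁ e) = inj₁ (≈-trans b≈ (≈-trans (≈-*ʳ (P * a) e) (≈-reflexive (ℤ.*-identityˡ (P * a)))))
          final (inj₂ e) = inj₂ (≈-trans b≈ (≈-*ʳ (P * a) e))
        finish : ∀ i → a * i ≈ 1ℤ mod M → (∃ λ x₀ → x₀ ~ 1ℤ × i * b ≈ P * x₀ mod M) → b ≈ P * a mod M ⊎ b ≈ ε * (P * a) mod M
        finish i e (x₀ , x~1 , ib≈) = decide i e x₀ ib≈ (two-units x~1)

      private
        4∤2odd : ∀ {x y κ} → ¬ P ∣ y → ¬ P ∣ κ → x ≈ κ * (P * y) mod M → ¬ pow 2 ∣ x
        4∤2odd {x} {y} {κ} ny nκ h d = ∤-* nκ ny (≈0⇒∣ (≈-unscale {P} {κ * y} {0ℤ} P {{prime⇒nonZero pr}}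
          (subst₂ (λ a N → a ≈ P * 0ℤ mod N) (l₁ κ P y) (trans (pow-suc 1) (cong (P *_) pow-1))
            (≈-trans (≈-sym (≈-coarsen 4∣M h)) (≈-trans (∣⇒≈0 d) (≈-reflexive (sym (ℤ.*-zeroʳ P))))))))
          where
          l₁ : ∀ κ P y → κ * (P * y) ≡ P * (κ * y)
          l₁ = solve-∀

      four-closed : ∀ {x y} → x ~ y → pow 2 ∣ x → pow 2 ∣ y
      four-closed {x} {y} x~y 4∣x = step (nonunits-closed x~y (∣-trans (p-∣-pow {2} (ℕ.s≤s ℕ.z≤n)) 4∣x))
        where
        step : P ∣ y → pow 2 ∣ y
        step (divides y′ refl) = parity (P ∣? y′)
          where
          parity : Dec (P ∣ y′) → pow 2 ∣ y′ * P
          parity (yes (divides q refl)) = divides q (trans (ℤ.*-assoc q P P) (cong (q *_) (sym (trans (pow-suc 1) (cong (P *_) pow-1)))))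
          parity (no n) = absurd (even-class n (subst (x ~_) (ℤ.*-comm y′ P) x~y))
            where
            absurd : x ≈ P * y′ mod M ⊎ x ≈ ε * (P * y′) mod M → pow 2 ∣ y′ * P
            absurd (inj₁ h) = ⊥-elim (4∤2odd n ∤1 (≈-trans h (≈-reflexive (sym (ℤ.*-identityˡ (P * y′))))) 4∣x)
            absurd (inj₂ h) = ⊥-elim (4∤2odd n (units ε~1) h 4∣x)

      private
        ε-cancel : ∀ {a} → ¬ P ∣ a → ε * a ≈ a mod M → ⊥
        ε-cancel {a} na h =
          let (i , ai≈1) = inverse m a na
          in ε≉1 (≈-trans (≈-sym (≈-trans (≈-reflexive (ℤ.*-assoc ε a i)) (≈-trans (≈-*ˡ ε ai≈1) (≈-reflexive (ℤ.*-identityʳ ε)))))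
               (≈-trans (≈-*ʳ i h) ai≈1))

        -- If e is twice an odd number, `even-class` leaves two values for the left side, and each
        -- forces ε = 1. If 4 divides e, the left side is -2 modulo 4, against `four-closed`.
        twisted : ∀ {e} → P ∣ e → ¬ ε * (1ℤ + e) - 1ℤ ~ e
        twisted {e} (divides e′ refl) h = parity (P ∣? e′)
          where
          l₁ : ∀ ε P e → ε * (1ℤ + e * P) - 1ℤ + 1ℤ ≡ ε * (1ℤ + e * P)
          l₁ = solve-∀
          n1+e : ¬ P ∣ 1ℤ + e′ * P
          n1+e d = ∤1 (Data.Integer.Divisibility.Signed.∣m+n∣n⇒∣m d (divides e′ refl))
          parity : Dec (P ∣ e′) → ⊥
          parity (no n) = cases (even-class n (subst (ε * (1ℤ + e′ * P) - 1ℤ ~_) (ℤ.*-comm e′ P) h))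
            where
            l₂ : ∀ P e → P * e + 1ℤ ≡ 1ℤ + e * P
            l₂ = solve-∀
            l₃ : ∀ ε P e → ε ≡ ε * (1ℤ + e * P) - ε * (P * e)
            l₃ = solve-∀
            l₄ : ∀ ε P e → ε * (P * e) + 1ℤ - ε * (P * e) ≡ 1ℤ
            l₄ = solve-∀
            cases : ε * (1ℤ + e′ * P) - 1ℤ ≈ P * e′ mod M ⊎ ε * (1ℤ + e′ * P) - 1ℤ ≈ ε * (P * e′) mod M → ⊥
            cases (inj₁ x) = ε-cancel n1+e (subst₂ (λ a b → a ≈ b mod M) (l₁ ε P e′) (l₂ P e′) (≈-+ʳ 1ℤ x))
            cases (inj₂ x) = ε≉1 (≈-trans (≈-reflexive (l₃ ε P e′)) (≈-trans
              (≈--ʳ (ε * (P * e′)) (subst (λ a → a ≈ ε * (P * e′) + 1ℤ mod M) (l₁ ε P e′) (≈-+ʳ 1ℤ x))) (≈-reflexive (l₄ ε P e′))))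
          parity (yes (divides q refl)) = 2∤1 (≈-trans (≈-reflexive (trans (ℤ.*-identityʳ P) (cong +_ p≡2)))
              (≈-neg (≈-trans (≈-sym (≈--ʳ 1ℤ (≈-* ε≈-1 (≈-+ˡ 1ℤ (∣⇒≈0 4∣e))))) (∣⇒≈0 (four-closed (~-sym h) 4∣e)))))
            where
            4∣e : pow 2 ∣ q * P * P
            4∣e = divides q (trans (ℤ.*-assoc q P P) (cong (q *_) (sym (trans (pow-suc 1) (cong (P *_) pow-1)))))

      -- For even a, some z ~ 1 has ε (1 + a) - z ~ a. `twisted` excludes z = 1, and z = ε gives ε a
      -- ~ a.
      orbit : ∀ {κ} → κ ~ 1ℤ → ∀ a → κ * a ~ a
      orbit {κ} κ~1 a = cases (two-units κ~1) (P ∣? a)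
        where
        l₁ : ∀ a → 1ℤ + a - 1ℤ ≡ a
        l₁ = solve-∀
        l₂ : ∀ ε a → ε * (1ℤ + a) - ε ≡ ε * a
        l₂ = solve-∀
        cases : κ ≈ 1ℤ mod M ⊎ κ ≈ ε mod M → Dec (P ∣ a) → κ * a ~ a
        cases _ (no na) = unit-orbit κ~1 na
        cases (inj₁ h) _ = ≈⇒~ (≈-trans (≈-*ʳ a h) (≈-reflexive (ℤ.*-identityˡ a)))
        cases (inj₂ h) (yes pa) =
          let (z , z~1 , b~a) = decompose (~-sym (unit-orbit ε~1 {1ℤ + a} n1+a)) 1ℤ
          in ≈-~ (≈-*ʳ a h) (conclude z (subst (ε * (1ℤ + a) - z ~_) (l₁ a) b~a) (two-units z~1))
          where
          n1+a : ¬ P ∣ 1ℤ + a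
          n1+a d = ∤1 (Data.Integer.Divisibility.Signed.∣m+n∣n⇒∣m d pa)
          conclude : ∀ z → ε * (1ℤ + a) - z ~ a → z ≈ 1ℤ mod M ⊎ z ≈ ε mod M → ε * a ~ a
          conclude z b~a (inj₁ e) = ⊥-elim (twisted pa (≈-~ (≈--ˡ (ε * (1ℤ + a)) (≈-sym e)) b~a))
          conclude z b~a (inj₂ e) = ≈-~ (≈-trans (≈-reflexive (sym (l₂ ε a))) (≈--ˡ (ε * (1ℤ + a)) (≈-sym e))) b~a

      -- For odd a the only alternative to b = a is b = ε a, and then 1 - a ~ 1 - ε a contradicts
      -- `twisted` with e = a - 1. Even a are treated through 1 - a, which exchanges the fixed
      -- points 0 and 1.
      rigid : (θ : ℤ → ℤ → Set) →
              (∀ {a b} → θ a b → ∀ z → ∃ λ w → θ z w × z - a ~ w - b) →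
              (∀ {w} → θ 0ℤ w → w ≈ 0ℤ mod M) → (∀ {w} → θ 1ℤ w → w ≈ 1ℤ mod M) →
              ∀ {a b} → θ a b → a ≈ b mod M
      rigid θ step fix0 fix1 {a} {b} ab = cases (P ∣? a)
        where
        from0 : a ~ b
        from0 = let (w , zw , h) = step ab 0ℤ in subst₂ _~_ (l₁ a) (l₁ b) (~-neg (~-≈ h (≈--ʳ b (fix0 zw))))
          where
          l₁ : ∀ a → - (0ℤ - a) ≡ a
          l₁ = solve-∀
        from1 : 1ℤ - a ~ 1ℤ - b
        from1 = let (w , zw , h) = step ab 1ℤ in ~-≈ h (≈--ʳ b (fix1 zw))
        l₀ : ∀ a → a ≡ 1ℤ - (1ℤ - a)
        l₀ = solve-∀
        odd-case : ∀ {a b} → ¬ P ∣ a → P ∣ 1ℤ - a → a ~ b → 1ℤ - a ~ 1ℤ - b → b ≈ a mod M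
        odd-case {a} {b} na p1-a a~b h = decide (unit-class na (~-sym a~b))
          where
          l₁ : ∀ ε a → ε * (1ℤ + - (1ℤ - a)) - 1ℤ ≡ - (1ℤ - ε * a)
          l₁ = solve-∀
          p-neg : P ∣ - (1ℤ - a)
          p-neg = Data.Integer.Divisibility.Signed.∣m⇒∣-m p1-a
          decide : b ≈ a mod M ⊎ b ≈ ε * a mod M → b ≈ a mod M
          decide (inj₁ e) = e
          decide (inj₂ e) = ⊥-elim (twisted p-neg (subst (_~ - (1ℤ - a)) (sym (l₁ ε a))
            (~-neg (~-sym (~-≈ h (≈--ˡ 1ℤ e))))))
        even-or-odd : ∀ {a} → ¬ P ∣ a → P ∣ 1ℤ - a
        even-or-odd na = ≈⇒∣ (≈-sym (odd p≡2 na))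
        n1-a : ∀ {a} → P ∣ a → ¬ P ∣ 1ℤ - a
        n1-a {a} pa d = ∤1 (subst (P ∣_) (l₂ a) (∣m∣n⇒∣m+n d pa))
          where
          l₂ : ∀ a → 1ℤ - a + a ≡ 1ℤ
          l₂ = solve-∀
        cases : Dec (P ∣ a) → a ≈ b mod M
        cases (no na) = ≈-sym (odd-case na (even-or-odd na) from0 from1)
        cases (yes pa) = subst₂ (λ x y → x ≈ y mod M) (sym (l₀ a)) (sym (l₀ b)) (≈--ˡ 1ℤ (≈-sym
          (odd-case (n1-a pa) (subst (P ∣_) (l₀ a) pa) from1 (subst₂ _~_ (l₀ a) (l₀ b) from0))))

    cyclotomic : IsCyclotomic p pr k B
    cyclotomic = choose (search {Q = λ κ → κ ~ 1ℤ × κ ≈ 1ℤ mod P × ¬ κ ≈ 1ℤ mod M}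
        (λ κ → (κ ~? 1ℤ) ×-dec (κ ≈? 1ℤ mod P) ×-dec ¬? (κ ≈? 1ℤ mod M))
        (λ e (h₁ , h₂ , h₃) → ≈-~ (≈-sym e) h₁ , ≈-trans (≈-sym (≈-coarsen P∣M e)) h₂ , λ h → h₃ (≈-trans e h)))
      where
      choose : (∃ λ κ → κ ~ 1ℤ × κ ≈ 1ℤ mod P × ¬ κ ≈ 1ℤ mod M) ⊎ (∀ κ → ¬ (κ ~ 1ℤ × κ ≈ 1ℤ mod P × ¬ κ ≈ 1ℤ mod M)) →
               IsCyclotomic p pr k B
      choose (inj₂ none) = record { units = units ; orbit = T.orbit ; rigid = T.rigid }
        where
        tame : ∀ {κ} → κ ~ 1ℤ → κ ≈ 1ℤ mod P → κ ≈ 1ℤ mod M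
        tame {κ} κ~1 κ≈1 = decidable-stable (κ ≈? 1ℤ mod M) λ n → none κ (κ~1 , κ≈1 , n)
        module T = Tame tame
      choose (inj₁ (ε , ε~1 , ε≈1 , ε≉1)) = record { units = units ; orbit = W.orbit ; rigid = W.rigid }
        where
        p≡2 : p ≡ 2
        p≡2 = decidable-stable (p ℕ.≟ 2) λ p≢2 → ε≉1 (near-one {1} ℕ.≤-refl (⊥-elim ∘ p≢2) ε~1 (subst (λ q → ε ≈ 1ℤ mod q) (sym pow-1) ε≈1))
        module W = Wild p≡2 ε ε~1 ε≉1

  module _ (p : ℕ) (pr : Prime p) (k : ℕ) .{{_ : NonZero (p ℕ.^ suc k)}} (B : SchurRing (p ℕ.^ suc k)) where
    open PrimePower p pr
    open SchurRing B
    open Radical p pr k B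

    -- The cases are the position of v, the largest valuation in the class of 1: for v = 0 the class
    -- consists of units, for v = k it meets the subgroup of order p, and `NonUnit` excludes
    -- everything in between.
    trivial-radical : ¬ (∀ x → x ~ 1ℤ → x + pow k ~ 1ℤ) →
      (∀ b → ¬ pow (suc k) ∣ b → b ~ 1ℤ) ⊎ k ≡ 0 ⊎ IsCyclotomic p pr k B
    trivial-radical aperiodic = cases v refl (ℕ.m≤n⇒m<n∨m≡n v≤k)
      where
      V : Valuated 1ℤ
      V = max-valuation (λ d → ∤1 (∣-trans (p-∣-pow {suc k} (ℕ.s≤s ℕ.z≤n)) d))
      open Valuated V
      y-maximal : ∀ {x} → x ~ pow v * u → ¬ pow (suc v) ∣ x
      y-maximal x~ = maximal (~-trans x~ ~b)
      y-aperiodic : ¬ (∀ x → x ~ pow v * u → x + pow k ~ pow v * u)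
      y-aperiodic h = aperiodic λ x x~ → ~-trans (h x (~-trans x~ (~-sym ~b))) ~b
      full : 1 ℕ.≤ k → v ≡ k → ∀ b → ¬ pow (suc k) ∣ b → b ~ 1ℤ
      full 1≤k v≡k = Full.full 1≤k u nu (subst (λ v → pow v * u ~ 1ℤ) v≡k ~b)
        (subst (λ v → ¬ (∀ x → x ~ pow v * u → x + pow k ~ pow v * u)) v≡k y-aperiodic)
      cases : ∀ w → v ≡ w → v ℕ.< k ⊎ v ≡ k → (∀ b → ¬ pow (suc k) ∣ b → b ~ 1ℤ) ⊎ k ≡ 0 ⊎ IsCyclotomic p pr k B
      cases zero v≡0 (inj₂ v≡k) = inj₂ (inj₁ (trans (sym v≡k) v≡0))
      cases zero v≡0 (inj₁ v<k) = inj₂ (inj₂ (UnitClass.cyclotomic p pr k B (ℕ.≤-trans (ℕ.s≤s ℕ.z≤n) v<k)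
        (λ {x} x~1 d → maximal x~1 (subst (λ v → pow (suc v) ∣ x) (sym v≡0) (subst (_∣ x) (sym pow-1) d))) aperiodic))
      cases (suc w) v≡ (inj₁ v<k) = ⊥-elim (NonUnit.absurd v u nu (subst (1 ℕ.≤_) (sym v≡) (ℕ.s≤s ℕ.z≤n)) v<k ~b y-maximal y-aperiodic)
      cases (suc w) v≡ (inj₂ v≡k) = inj₁ (full (subst (1 ℕ.≤_) (trans (sym v≡) v≡k) (ℕ.s≤s ℕ.z≤n)) v≡k)

-- Existence of one-point extensions by Weisfeiler-Leman refinement.

module OnePoint where
  open import Defs
  open FiniteSums
  open import Data.Nat as ℕ using (ℕ; zero; suc; _+_; _*_; _≤_; _<_; s≤s)
  open import Data.Nat.Properties using (≤-trans; ≤-reflexive; +-suc; +-identityʳ; <⇒≱; +-monoˡ-≤; <-≤-trans; 1+n≢0; m≤n+m)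
  open import Data.Fin using (Fin; zero; suc; _≟_; combine; remQuot)
  open import Data.Fin.Properties using (all?; any?; injective⇒≤; remQuot-combine; combine-remQuot; suc-injective; combine-injective)
  open import Data.Product using (Σ; ∃; ∃₂; _×_; _,_; proj₁; proj₂)
  open import Data.Sum using (_⊎_; inj₁; inj₂)
  open import Data.Empty using (⊥-elim)
  open import Relation.Nullary using (¬_; Dec; yes; no)
  open import Relation.Nullary.Decidable using (_×-dec_; ¬?; decidable-stable)
  open import Relation.Binary.PropositionalEquality
  open import Function using (_∘_)

  record Quotient {n : ℕ} (R : Fin n → Fin n → Set) : Set where
    field
      size : ℕ
      class : Fin n → Fin size
      rep : Fin size → Fin n
      class-rep : ∀ s → class (rep s) ≡ s
      class-≡ : ∀ {x y} → R x y → class x ≡ class y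
      class-R : ∀ {x y} → class x ≡ class y → R x y

  quotient : ∀ {n} (R : Fin n → Fin n → Set) → (∀ x y → Dec (R x y)) → (∀ {x} → R x x) →
             (∀ {x y} → R x y → R y x) → (∀ {x y z} → R x y → R y z → R x z) → Quotient R
  quotient {zero} R R? rf sy tr = record
    { size = 0 ; class = λ () ; rep = λ () ; class-rep = λ () ; class-≡ = λ { {()} } ; class-R = λ { {()} } }
  quotient {suc n} R R? rf sy tr with quotient {n} (λ x y → R (suc x) (suc y)) (λ x y → R? (suc x) (suc y)) rf sy tr
                                    | any? (λ i → R? zero (suc i))
  ... | Q | yes (i , r) = record
    { size = size ; class = cl ; rep = suc ∘ rep ; class-rep = class-rep ; class-≡ = eq ; class-R = back }
    where
    open Quotient Q
    cl : Fin (suc n) → Fin size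
    cl zero = class i
    cl (suc x) = class x
    eq : ∀ {x y} → R x y → cl x ≡ cl y
    eq {zero} {zero} h = refl
    eq {zero} {suc y} h = class-≡ (tr (sy r) h)
    eq {suc x} {zero} h = class-≡ (tr h r)
    eq {suc x} {suc y} h = class-≡ h
    back : ∀ {x y} → cl x ≡ cl y → R x y
    back {zero} {zero} h = rf
    back {zero} {suc y} h = tr r (class-R h)
    back {suc x} {zero} h = tr (class-R h) (sy r)
    back {suc x} {suc y} h = class-R h
  ... | Q | no none = record
    { size = suc size ; class = cl ; rep = rp ; class-rep = cr ; class-≡ = eq ; class-R = back }
    where
    open Quotient Q
    cl : Fin (suc n) → Fin (suc size)
    cl zero = zero
    cl (suc x) = suc (class x)
    rp : Fin (suc size) → Fin (suc n)
    rp zero = zero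
    rp (suc s) = suc (rep s)
    cr : ∀ s → cl (rp s) ≡ s
    cr zero = refl
    cr (suc s) = cong suc (class-rep s)
    eq : ∀ {x y} → R x y → cl x ≡ cl y
    eq {zero} {zero} h = refl
    eq {zero} {suc y} h = ⊥-elim (none (y , h))
    eq {suc x} {zero} h = ⊥-elim (none (x , sy h))
    eq {suc x} {suc y} h = cong suc (class-≡ h)
    back : ∀ {x y} → cl x ≡ cl y → R x y
    back {zero} {zero} h = rf
    back {suc x} {suc y} h = class-R (suc-injective h)

  module _ {m : ℕ} where

    record Classifies (R : Fin m → Fin m → Fin m → Fin m → Set) {k : ℕ} (f : Coloring m k) : Set where
      field
        hit : ∀ s → ∃₂ λ x y → f x y ≡ s
        to : ∀ {x y u v} → R x y u v → f x y ≡ f u v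
        from : ∀ {x y u v} → f x y ≡ f u v → R x y u v

    classify : (R : Fin m → Fin m → Fin m → Fin m → Set) → (∀ x y u v → Dec (R x y u v)) → (∀ {x y} → R x y x y) →
      (∀ {x y u v} → R x y u v → R u v x y) → (∀ {x y u v a b} → R x y u v → R u v a b → R x y a b) →
      ∃ λ k → Σ (Coloring m k) (Classifies R)
    classify R R? rf sy tr = size , (λ x y → class (combine x y)) , record
      { hit = λ s → proj₁ (remQuot {m} m (rep s)) , proj₂ (remQuot {m} m (rep s)) ,
          trans (cong class (combine-remQuot {m} m (rep s))) (class-rep s)
      ; to = λ {x} {y} {u} {v} h → class-≡ (subst₂ (λ a b → R (proj₁ a) (proj₂ a) (proj₁ b) (proj₂ b))
          (sym (remQuot-combine x y)) (sym (remQuot-combine u v)) h)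
      ; from = λ {x} {y} {u} {v} h → subst₂ (λ a b → R (proj₁ a) (proj₂ a) (proj₁ b) (proj₂ b))
          (remQuot-combine x y) (remQuot-combine u v) (class-R h) }
      where
      R′ : Fin (m * m) → Fin (m * m) → Set
      R′ a b = R (proj₁ (remQuot {m} m a)) (proj₂ (remQuot {m} m a)) (proj₁ (remQuot {m} m b)) (proj₂ (remQuot {m} m b))
      open Quotient (quotient R′ (λ a b → R? _ _ _ _) rf sy tr)

    Same : ∀ {k} → Coloring m k → Fin m → Fin m → Fin m → Fin m → Set
    Same f x y u v = f x y ≡ f u v × f y x ≡ f v u × (∀ s t → inum f s t x y ≡ inum f s t u v)

    same? : ∀ {k} (f : Coloring m k) x y u v → Dec (Same f x y u v)
    same? f x y u v = (f x y ≟ f u v) ×-dec (f y x ≟ f v u) ×-dec all? λ s → all? λ t → inum f s t x y ℕ.≟ inum f s t u v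

    refine : ∀ {k} (f : Coloring m k) → ∃ λ k′ → Σ (Coloring m k′) (Classifies (Same f))
    refine f = classify (Same f) (same? f)
      (refl , refl , λ s t → refl)
      (λ (a , b , c) → sym a , sym b , λ s t → sym (c s t))
      (λ (a , b , c) (a′ , b′ , c′) → trans a a′ , trans b b′ , λ s t → trans (c s t) (c′ s t))

    Hit : ∀ {k} → Coloring m k → Set
    Hit f = ∀ s → ∃₂ λ x y → f x y ≡ s

    bounded : ∀ {k} (f : Coloring m k) → Hit f → k ≤ m * m
    bounded f hit = injective⇒≤ {f = λ s → combine (proj₁ (hit s)) (proj₁ (proj₂ (hit s)))} λ {s} {t} e →
      let e₁ , e₂ = combine-injective (proj₁ (hit s)) _ (proj₁ (hit t)) _ e
      in trans (sym (proj₂ (proj₂ (hit s)))) (trans (cong₂ f e₁ e₂) (proj₂ (proj₂ (hit t))))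

    -- The pairs representing the old colours have distinct new colours, and a pair split off from
    -- its representative adds one more. Together with `bounded` this ends the iteration.
    grows : ∀ {k k′} (f : Coloring m k) (f′ : Coloring m k′) → Hit f → Refines f′ f →
            ∀ x y u v → f x y ≡ f u v → f′ x y ≢ f′ u v → k < k′
    grows {k} {k′} f f′ hit ref x y u v same differ = injective⇒≤ {f = h} h-inj
      where
      g : Fin k → Fin k′
      g s = f′ (proj₁ (hit s)) (proj₁ (proj₂ (hit s)))
      g-inj : ∀ {s a b} → g s ≡ f′ a b → f a b ≡ s
      g-inj {s} e = trans (sym (ref _ _ _ _ e)) (proj₂ (proj₂ (hit s)))
      new : ∃₂ λ a b → f a b ≡ f x y × f′ a b ≢ g (f x y)
      new with f′ x y ≟ g (f x y)
      ... | yes e = u , v , sym same , λ e′ → differ (trans e (sym e′))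
      ... | no ne = x , y , refl , ne
      extra : Fin k′
      extra = f′ (proj₁ new) (proj₁ (proj₂ new))
      fresh : ∀ s → g s ≢ extra
      fresh s e = proj₂ (proj₂ (proj₂ new)) (trans (sym e) (cong g (trans (sym (g-inj e)) (proj₁ (proj₂ (proj₂ new))))))
      h : Fin (suc k) → Fin k′
      h zero = extra
      h (suc s) = g s
      h-inj : ∀ {s t} → h s ≡ h t → s ≡ t
      h-inj {zero} {zero} e = refl
      h-inj {zero} {suc t} e = ⊥-elim (fresh t (sym e))
      h-inj {suc s} {zero} e = ⊥-elim (fresh s e)
      h-inj {suc s} {suc t} e = cong suc (trans (sym (proj₂ (proj₂ (hit s)))) (g-inj (sym e)))

    coherent-sum : ∀ {r} {c : Coloring m r} → IsCC c → ∀ {x y u v} → c x y ≡ c u v →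
      (H H′ : Fin m → ℕ) → (∀ i j → c x i ≡ c u j → c i y ≡ c j v → H i ≡ H′ j) → sum H ≡ sum H′
    coherent-sum {c = c} cc {x} {y} {u} {v} e = sum-transfer (c x) (λ i → c i y) (c u) (λ j → c j v)
      (λ s t → trans (sym (inum-sum c s t x y)) (trans (IsCC.inter cc s t x y u v e) (inum-sum c s t u v)))

    coherent-∃ : ∀ {r} {c : Coloring m r} → IsCC c → ∀ {x y u v} → c x y ≡ c u v →
      ∀ z → ∃ λ w → c u w ≡ c x z × c w v ≡ c z y
    coherent-∃ {c = c} cc {x} {y} {u} {v} e z with sum≢0⇒∃ (λ w → ⟦ c u w ≟ c x z ⟧ * ⟦ c w v ≟ c z y ⟧) nonzero
      where
      nonzero : sum (λ w → ⟦ c u w ≟ c x z ⟧ * ⟦ c w v ≟ c z y ⟧) ≢ 0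
      nonzero h = ∃⇒sum≢0 (λ w → ⟦ c x w ≟ c x z ⟧ * ⟦ c w y ≟ c z y ⟧) z
        (λ h′ → 1+n≢0 (trans (sym (cong₂ _*_ (⟦⟧-yes (c x z ≟ c x z) refl) (⟦⟧-yes (c z y ≟ c z y) refl))) h′))
        (trans (coherent-sum cc e _ (λ w → ⟦ c u w ≟ c x z ⟧ * ⟦ c w v ≟ c z y ⟧)
          (λ i j p q → cong₂ (λ a b → ⟦ a ≟ c x z ⟧ * ⟦ b ≟ c z y ⟧) p q)) h)
    ... | w , h = w , ⟦⟧-≢0 (c u w ≟ c x z) (*-≢0ˡ h) , ⟦⟧-≢0 (c w v ≟ c z y) (*-≢0ʳ {⟦ c u w ≟ c x z ⟧} h)

    -- The counts of a refinement step are sums over the finer colours of `e`, which coherence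
    -- controls. Hence the iteration never gets below a coherent refinement.
    coherent-refines : ∀ {k r₂} (f : Coloring m k) {e : Coloring m r₂} → IsCC e → Refines e f →
      ∀ {x y u v} → e x y ≡ e u v → Same f x y u v
    coherent-refines f {e} cc ref {x} {y} {u} {v} h =
      ref x y u v h , ref y x v u (IsCC.transp cc x y u v h) , λ s t → trans (inum-sum f s t x y)
        (trans (coherent-sum cc h (λ γ → ⟦ f x γ ≟ s ⟧ * ⟦ f γ y ≟ t ⟧) (λ γ → ⟦ f u γ ≟ s ⟧ * ⟦ f γ v ≟ t ⟧)
          (λ i j p q → cong₂ (λ a b → ⟦ a ≟ s ⟧ * ⟦ b ≟ t ⟧) (ref x i u j p) (ref i y j v q)))
        (sym (inum-sum f s t u v)))

    module Closure {r : ℕ} (c : Coloring m r) (cc : IsCC c) (α : Fin m) where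

      Above : ∀ {k} → Coloring m k → Set
      Above f = ∀ {r₂} (e : Coloring m r₂) → IsCC e → Refines e c → SingletonBasis e α → Refines e f

      -- Both endpoints are compared with α, not just the pair with (α , α); every coherent
      -- configuration with that singleton separates them anyway (`start-above`).
      Start : Fin m → Fin m → Fin m → Fin m → Set
      Start x y u v = c x y ≡ c u v × ⟦ x ≟ α ⟧ ≡ ⟦ u ≟ α ⟧ × ⟦ y ≟ α ⟧ ≡ ⟦ v ≟ α ⟧

      start : ∃ λ k → Σ (Coloring m k) (Classifies Start)
      start = classify Start (λ x y u v → (c x y ≟ c u v) ×-dec (⟦ x ≟ α ⟧ ℕ.≟ ⟦ u ≟ α ⟧) ×-dec (⟦ y ≟ α ⟧ ℕ.≟ ⟦ v ≟ α ⟧))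
        (refl , refl , refl) (λ (a , b , d) → sym a , sym b , sym d)
        (λ (a , b , d) (a′ , b′ , d′) → trans a a′ , trans b b′ , trans d d′)

      start-above : Above (proj₁ (proj₂ start))
      start-above e ecc ref single x y u v h = Classifies.to (proj₂ (proj₂ start))
        (ref x y u v h , left , right)
        where
        source : ∀ {x y u v} → e x y ≡ e u v → x ≡ α → u ≡ α
        source h refl with coherent-∃ ecc h α
        ... | w , p , _ = proj₁ (single _ _ p)
        target : ∀ {x y u v} → e x y ≡ e u v → y ≡ α → v ≡ α
        target h refl with coherent-∃ ecc h α
        ... | w , _ , p = proj₂ (single _ _ p)
        left : ⟦ x ≟ α ⟧ ≡ ⟦ u ≟ α ⟧
        left = ⟦⟧-cong (x ≟ α) (u ≟ α) (source h) (source (sym h))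
        right : ⟦ y ≟ α ⟧ ≡ ⟦ v ≟ α ⟧
        right = ⟦⟧-cong (y ≟ α) (v ≟ α) (target h) (target (sym h))

      Good : ∀ {k} → Coloring m k → Set
      Good f = Hit f × Refines f (proj₁ (proj₂ start)) × Above f

      Stable : ∀ {k} → Coloring m k → Set
      Stable f = ∀ x y u v → f x y ≡ f u v → Same f x y u v

      stable? : ∀ {k} (f : Coloring m k) → Stable f ⊎ (∃ λ x → ∃ λ y → ∃ λ u → ∃ λ v → f x y ≡ f u v × ¬ Same f x y u v)
      stable? f = decide (any? λ x → any? λ y → any? λ u → any? λ v → (f x y ≟ f u v) ×-dec ¬? (same? f x y u v))
        where
        decide : Dec (∃ λ x → ∃ λ y → ∃ λ u → ∃ λ v → f x y ≡ f u v × ¬ Same f x y u v) → Stable f ⊎ _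
        decide (yes h) = inj₂ h
        decide (no none) = inj₁ λ x y u v e → decidable-stable (same? f x y u v) λ n → none (x , y , u , v , e , n)

      iterate : ∀ fuel {k} (f : Coloring m k) → Good f → m * m < k + fuel → ∃ λ k′ → Σ (Coloring m k′) λ f′ → Good f′ × Stable f′
      iterate fuel {k} f good lt with stable? f
      iterate fuel {k} f good lt | inj₁ st = k , f , good , st
      iterate zero {k} f (hit , _) lt | inj₂ _ = ⊥-elim (<⇒≱ lt (≤-trans (≤-reflexive (+-identityʳ k)) (bounded f hit)))
      iterate (suc fuel) {k} f (hit , ref , above) lt | inj₂ (x , y , u , v , e , n) with refine f
      ... | k′ , f′ , cl = iterate fuel f′
          ( Classifies.hit cl
          , (λ x y u v h → ref x y u v (proj₁ (Classifies.from cl h)))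
          , (λ e ecc er es x y u v h → Classifies.to cl (coherent-refines f ecc (above e ecc er es) h)))
          (<-≤-trans lt (≤-trans (≤-reflexive (+-suc k fuel)) (+-monoˡ-≤ fuel
            (grows f f′ hit (λ x y u v h → proj₁ (Classifies.from cl h)) x y u v e (λ h → n (Classifies.from cl h))))))

      -- `IsSesquiclosed` quantifies over given one-point extensions, so one has to be produced on
      -- each side before it yields anything. Stability is coherence, and `Above` is minimality.
      onePoint : ∃ λ r₁ → Σ (Coloring m r₁) (IsOnePointExt c α)
      onePoint with iterate (suc (m * m)) (proj₁ (proj₂ start))
                      (Classifies.hit (proj₂ (proj₂ start)) , (λ _ _ _ _ h → h) , start-above)
                      (≤-trans (s≤s (m≤n+m (m * m) (proj₁ start))) (≤-reflexive (sym (+-suc (proj₁ start) (m * m)))))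
      ... | r₁ , d , (hit , ref , above) , stable = r₁ , d , record
            { nonempty = hit
            ; diagUnion = λ x y z h → IsCC.diagUnion cc x y z (proj₁ (back h))
            ; transp = λ x y u v h → proj₁ (proj₂ (stable x y u v h))
            ; inter = λ s t x y u v h → proj₂ (proj₂ (stable x y u v h)) s t } ,
            (λ x y u v h → proj₁ (back h)) , singleton , above
        where
        back : ∀ {x y u v} → d x y ≡ d u v → Start x y u v
        back h = Classifies.from (proj₂ (proj₂ start)) (ref _ _ _ _ h)
        singleton : SingletonBasis d α
        singleton u v h with back h
        ... | _ , a , b = ⟦⟧-≢0 (u ≟ α) (λ e → 1+n≢0 (trans (sym (⟦⟧-yes (α ≟ α) refl)) (trans (sym a) e))) ,
                          ⟦⟧-≢0 (v ≟ α) (λ e → 1+n≢0 (trans (sym (⟦⟧-yes (α ≟ α) refl)) (trans (sym b) e)))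

-- S-rings induced on closed subgroups and on quotients.

module Sections where
  open Congruence
  open FiniteSums
  open GroupRing
  open SchurRings
  open import Data.Nat as ℕ using (ℕ; zero; suc; NonZero)
  import Data.Nat.Properties as ℕ
  open import Data.Integer as ℤ using (ℤ; +_; -_; _+_; _-_; _*_; 0ℤ)
  import Data.Integer.Properties as ℤ
  open import Data.Integer.Divisibility.Signed using (_∣_; divides; _∣?_; ∣m+n∣m⇒∣n)
  open import Data.Integer.Tactic.RingSolver using (solve-∀)
  open import Data.Fin using (Fin; toℕ; zero; suc)
  open import Data.Fin.Properties using (any?; toℕ<n)
  open import Data.Product using (∃; _,_)
  open import Data.Empty using (⊥-elim)
  open import Relation.Nullary using (¬_; yes; no)
  open import Relation.Nullary.Decidable using (map′)
  open import Relation.Binary.PropositionalEquality hiding ([_])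
  open import Function using (_∘_)

  module _ {M : ℕ} .{{_ : NonZero M}} (A : SchurRing M) where
    open SchurRing A

    Closed : ℤ → Set
    Closed D = ∀ {a b} → a ~ b → D ∣ a → D ∣ b

    -- The part of b that `decompose` splits off is equivalent to a multiple of D, hence a multiple
    -- of D itself. So equivalence passes to cosets.
    coset-shift : ∀ {D} → Closed D → ∀ {a b} → a ~ b → ∀ r → ∃ λ r′ → a + D * r ~ b + D * r′
    coset-shift {D} closed {a} {b} a~b r =
      let (z , z~ , b-z~) = decompose a~b (a + D * r)
      in extract z z~ (closed (~-sym b-z~) (divides (- r) (l₁ a D r)))
      where
      l₁ : ∀ a K r → a - (a + K * r) ≡ - r * K
      l₁ = solve-∀
      l₂ : ∀ b z → z ≡ b + - (b - z)
      l₂ = solve-∀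
      extract : ∀ z → z ~ a + D * r → D ∣ b - z → ∃ λ r′ → a + D * r ~ b + D * r′
      extract z z~ (divides q eq) = - q , ~-trans (~-sym z~) (~-reflexive (trans (l₂ b z)
        (cong (_+_ b) (trans (cong -_ eq) (trans (ℤ.neg-distribˡ-* q D) (ℤ.*-comm (- q) D))))))

  module Multiples (e : ℕ) .{{_ : NonZero e}} where

    -- Extension by zero along z ↦ e z, under which convolution on the subgroup becomes convolution
    -- on the whole group.
    extend : (ℤ → ℕ) → ℤ → ℕ
    extend f x with + e ∣? x
    ... | yes (divides q _) = f q
    ... | no _ = 0

    extend-no : ∀ f {x} → ¬ + e ∣ x → extend f x ≡ 0
    extend-no f {x} h with + e ∣? x
    ... | yes d = ⊥-elim (h d)
    ... | no _ = refl

    extend-yes : ∀ f z → extend f (+ e * z) ≡ f z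
    extend-yes f z with + e ∣? + e * z
    ... | yes (divides q eq) = cong f (sym (ℤ.*-cancelˡ-≡ (+ e) z q (trans eq (ℤ.*-comm q (+ e)))))
    ... | no h = ⊥-elim (h (divides z (ℤ.*-comm (+ e) z)))

    sum-multiples : ∀ {M N} → M ≡ N ℕ.* e → ∀ F → (∀ x → ¬ + e ∣ x → F x ≡ 0) → ∑ M F ≡ ∑ N (λ z → F (+ e * z))
    sum-multiples {M} {N} M≡ F h = trans (cong (λ M → ∑ M F) M≡) (trans (sumℕ-* N e (λ i → F (+ i)))
      (sum-cong-≗ {N} λ i → row (toℕ i)))
      where
      row : ∀ i → sumℕ e (λ j → F (+ (i ℕ.* e ℕ.+ j))) ≡ F (+ e * + i)
      row i = go e refl
        where
        go : ∀ e′ → e ≡ e′ → sumℕ e (λ j → F (+ (i ℕ.* e ℕ.+ j))) ≡ F (+ e * + i)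
        go zero eq = ⊥-elim (ℕ.≢-nonZero⁻¹ e eq)
        go (suc e′) eq = trans (cong (λ n → sumℕ n (λ j → F (+ (i ℕ.* e ℕ.+ j)))) eq) (trans
            (cong₂ ℕ._+_ (cong F (trans (cong +_ (ℕ.+-identityʳ (i ℕ.* e))) (trans (ℤ.pos-* i e) (ℤ.*-comm (+ i) (+ e)))))
              (sum-zero {e′} λ j → h (+ (i ℕ.* e ℕ.+ suc (toℕ j))) (off (suc (toℕ j)) (ℕ.s≤s ℕ.z≤n)
                (subst (suc (toℕ j) ℕ.<_) (sym eq) (ℕ.s≤s (toℕ<n j))))))
            (ℕ.+-identityʳ _))
          where
          off : ∀ j → 0 ℕ.< j → j ℕ.< e → ¬ + e ∣ + (i ℕ.* e ℕ.+ j)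
          off j 0<j j<e d = ℕ.<⇒≢ 0<j (sym (small-≈ j<e (ℕ.<-trans 0<j j<e) (∣⇒≈0
            (∣m+n∣m⇒∣n (subst (+ e ∣_) (trans (ℤ.pos-+ (i ℕ.* e) j) (cong (_+ + j) (ℤ.pos-* i e))) d) (divides (+ i) refl)))))

  module Subring {M : ℕ} .{{_ : NonZero M}} (A : SchurRing M) (e N : ℕ) .{{_ : NonZero e}} .{{_ : NonZero N}}
                 (M≡ : M ≡ N ℕ.* e) (closed : Closed A (+ e)) where
    open SchurRing A
    open Multiples e

    private
      M≡ℤ : + M ≡ + e * + N
      M≡ℤ = trans (cong +_ M≡) (trans (ℤ.pos-* N e) (ℤ.*-comm (+ N) (+ e)))

      extend-invariant : ∀ f → (∀ {a b} → + e * a ~ + e * b → f a ≡ f b) → Invariant (extend f)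
      extend-invariant f inv {x} {y} x~y with + e ∣? x | + e ∣? y
      ... | yes (divides q refl) | yes (divides q′ refl) = inv (subst₂ _~_ (ℤ.*-comm q (+ e)) (ℤ.*-comm q′ (+ e)) x~y)
      ... | yes d | no h = ⊥-elim (h (closed x~y d))
      ... | no h | yes d = ⊥-elim (h (closed (~-sym x~y) d))
      ... | no _ | no _ = refl

    subring : SchurRing N
    subring = record
      { _~_ = λ a b → + e * a ~ + e * b
      ; _~?_ = λ a b → + e * a ~? + e * b
      ; ~-sym = ~-sym
      ; ~-trans = ~-trans
      ; ≈⇒~ = λ h → ≈⇒~ (subst (λ D → _ ≈ _ mod D) (sym M≡ℤ) (≈-scale (+ e) h))
      ; ~0⇒≈0 = λ {a} h → ≈-unscale {+ N} {a} {0ℤ} (+ e) (subst₂ (λ x D → + e * a ≈ x mod D) (sym (ℤ.*-zeroʳ (+ e))) M≡ℤ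
          (~0⇒≈0 (subst (+ e * a ~_) (ℤ.*-zeroʳ (+ e)) h)))
      ; ~-neg = λ {a} {b} h → subst₂ _~_ (ℤ.neg-distribʳ-* (+ e) a) (ℤ.neg-distribʳ-* (+ e) b) (~-neg h)
      ; convolve-invariant = λ f g fi gi {a} {b} a~b → trans (sym (conv f g a)) (trans
          (convolve-invariant (extend f) (extend g) (extend-invariant f fi) (extend-invariant g gi) a~b) (conv f g b)) }
      where
      conv : ∀ f g a → convolve M (extend f) (extend g) (+ e * a) ≡ convolve N f g a
      conv f g a = trans (sum-multiples {M} {N} M≡ (λ z → extend f z ℕ.* extend g (+ e * a - z)) (λ x h → cong (ℕ._* extend g (+ e * a - x)) (extend-no f h)))
        (∑-cong N (λ z → cong₂ ℕ._*_ (extend-yes f z) (trans (cong (extend g) (lem (+ e) a z)) (extend-yes g (a - z)))))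
        where
        lem : ∀ e a z → e * a - e * z ≡ e * (a - z)
        lem = solve-∀

  module QuotientRing {M : ℕ} .{{_ : NonZero M}} (A : SchurRing M) (ρ K : ℕ) .{{_ : NonZero ρ}} .{{_ : NonZero K}}
                      (M≡ : M ≡ ρ ℕ.* K) (closed : Closed A (+ K)) where
    open SchurRing A

    _≃_ : ℤ → ℤ → Set
    a ≃ b = ∃ λ r → a ~ b + + K * r

    shift : ∀ {a b} → a ~ b → ∀ r → ∃ λ r′ → a + + K * r ~ b + + K * r′
    shift = coset-shift A closed

    private
      l₀ : ∀ b K → b ≡ b + K * 0ℤ
      l₀ = solve-∀

      M≡ℤ : + M ≡ + ρ * + K
      M≡ℤ = trans (cong +_ M≡) (ℤ.pos-* ρ K)

    quotientRing : SchurRing K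
    quotientRing = record
      { _~_ = _≃_
      ; _~?_ = λ a b → map′ (λ (i , h) → + toℕ i , h)
          (λ (r , h) → residue ρ r , ~-≈ h (≈-+ˡ b (subst (λ D → + K * r ≈ + K * + toℕ (residue ρ r) mod D)
            (trans (ℤ.*-comm (+ K) (+ ρ)) (sym M≡ℤ)) (≈-scale (+ K) (≈-sym (residue-≈ ρ r))))))
          (any? λ (i : Fin ρ) → a ~? b + + K * + toℕ i)
      ; ~-sym = λ {a} {b} (r , h) → let (r′ , e) = shift (~-sym h) (- r) in r′ , subst (_~ a + + K * r′) (l₁ b (+ K) r) e
      ; ~-trans = λ {a} {b} {c} (r , h) (r′ , h′) → let (r″ , e) = shift h′ r
          in r′ + r″ , ~-trans h (subst (b + + K * r ~_) (l₂ c (+ K) r′ r″) e)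
      ; ≈⇒~ = λ {a} {b} (mod-by q eq) → q , ~-reflexive (trans eq (cong (_+_ b) (ℤ.*-comm q (+ K))))
      ; ~0⇒≈0 = λ {a} (r , h) → ∣⇒≈0 (closed (~-sym h) (divides r (l₃ (+ K) r)))
      ; ~-neg = λ {a} {b} (r , h) → - r , subst (- a ~_) (l₄ b (+ K) r) (~-neg h)
      -- For functions of period K, the convolution modulo M is ρ times the one modulo K, and ρ
      -- cancels.
      ; convolve-invariant = λ f g fi gi {a} {b} (r , h) → ℕ.*-cancelˡ-≡ (convolve K f g a) (convolve K f g b) ρ
          (trans (sym (conv f g gi fi a)) (trans
          (convolve-invariant f g (fi ∘ up) (gi ∘ up) h) (trans (conv f g gi fi (b + + K * r))
            (cong (ρ ℕ.*_) (convolve-periodic K f {g} (λ e → gi (inc e)) {b + + K * r} {b} (mod-by r (cong (_+_ b) (ℤ.*-comm (+ K) r))))))))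
      }
      where
      up : ∀ {a b} → a ~ b → a ≃ b
      up {a} {b} h = 0ℤ , subst (a ~_) (l₀ b (+ K)) h
      inc : ∀ {a b} → a ≈ b mod + K → a ≃ b
      inc {a} {b} (mod-by q eq) = q , ~-reflexive (trans eq (cong (_+_ b) (ℤ.*-comm q (+ K))))
      l₁ : ∀ b K r → b + K * r + K * - r ≡ b
      l₁ = solve-∀
      l₂ : ∀ c K r s → c + K * r + K * s ≡ c + K * (r + s)
      l₂ = solve-∀
      l₃ : ∀ K r → 0ℤ + K * r ≡ r * K
      l₃ = solve-∀
      l₄ : ∀ b K r → - (b + K * r) ≡ - b + K * - r
      l₄ = solve-∀
      conv : ∀ f g → (∀ {a b} → a ≃ b → g a ≡ g b) → (∀ {a b} → a ≃ b → f a ≡ f b) → ∀ a → convolve M f g a ≡ ρ ℕ.* convolve K f g a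
      conv f g gi fi a = trans (cong (λ M → ∑ M (λ z → f z ℕ.* g (a - z))) M≡)
        (∑-periodic ρ K (λ e → cong₂ ℕ._*_ (fi (inc e)) (gi (inc (≈--ˡ a e)))))

-- The filtration by closed subgroups and the three kinds of sections.

module Layers where
  open Congruence
  open SchurRings
  open ClassStructure
  open Cyclotomic
  open Sections
  open import Data.Nat as ℕ using (ℕ; zero; suc; NonZero)
  import Data.Nat.Properties as ℕ
  open import Data.Nat.Primality using (Prime)
  open import Data.Integer as ℤ using (ℤ; +_; -_; _+_; _-_; _*_; 0ℤ; 1ℤ)
  import Data.Integer.Properties as ℤ
  open import Data.Integer.Divisibility.Signed using (_∣_; divides; _∣?_; ∣-trans; ∣m⇒∣m*n; ∣-refl; *-cancelˡ-∣; *-monoʳ-∣)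
  open import Data.Integer.Tactic.RingSolver using (solve-∀)
  open import Data.Fin using (toℕ)
  open import Data.Fin.Properties using (any?)
  open import Data.Product using (∃; _×_; _,_; proj₂)
  open import Data.Sum using (_⊎_; inj₁; inj₂)
  open import Data.Empty using (⊥; ⊥-elim)
  open import Relation.Nullary using (¬_; Dec; yes; no)
  open import Relation.Nullary.Decidable using (decidable-stable; _×-dec_; ¬?)
  open import Relation.Binary.PropositionalEquality hiding ([_])
  open import Function using (_∘_)

  module Filtration (p : ℕ) (pr : Prime p) (n : ℕ) .{{_ : NonZero (p ℕ.^ n)}} (A : SchurRing (p ℕ.^ n)) where
    open PrimePower p pr
    open PrimePowerUnits p pr
    open Multipliers p pr using (~-multiplier)
    open SchurRing A

    mul : ∀ u → ¬ P ∣ u → ∀ {a b} → a ~ b → u * a ~ u * b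
    mul = ~-multiplier {n} A

    Closedₚ : ℕ → Set
    Closedₚ s = Closed A (pow s)

    -- The classes of the quotient modulo p^t.
    infix 4 _~[_]_
    _~[_]_ : ℤ → ℕ → ℤ → Set
    a ~[ t ] b = ∃ λ r → a ~ b + pow t * r

    closed-n : Closedₚ n
    closed-n a~b d = ≈0⇒∣ (~0⇒≈0 (~-≈ (~-sym a~b) (∣⇒≈0 d)))

    -- `IsCyclotomic` for the section p^s / p^t, expressed by elements of the original group so that
    -- sections with different s and t can be compared.
    record CyclotomicSection (s t : ℕ) : Set₁ where
      field
        t≤n : t ℕ.≤ n
        closed-s : Closedₚ s
        closed-t : Closedₚ t
        units : ∀ a → pow s * a ~[ t ] pow s → ¬ P ∣ a
        orbit : ∀ κ → pow s * κ ~[ t ] pow s → ∀ a → pow s * (κ * a) ~[ t ] pow s * a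
        rigid : (θ : ℤ → ℤ → Set) →
                (∀ {a b} → θ a b → ∀ z → ∃ λ w → θ z w × pow s * (z - a) ~[ t ] pow s * (w - b)) →
                (∀ {w} → θ 0ℤ w → pow s * w ≈ 0ℤ mod pow t) →
                (∀ {w} → θ 1ℤ w → pow s * w ≈ pow s mod pow t) →
                ∀ {a b} → θ a b → pow s * a ≈ pow s * b mod pow t

    -- The radical p^t of the class of p^s, and the largest closed subgroup p^next below p^s
    -- outside of which every class in p^s is a union of cosets of p^t.
    record Layer (s : ℕ) : Set₁ where
      field
        t next : ℕ
        s<next : s ℕ.< next
        next≤t : next ℕ.≤ t
        t≤n : t ℕ.≤ n
        closed-t : Closedₚ t
        closed-next : Closedₚ next
        periodic : ∀ b → ¬ pow next ∣ pow s * b → ∀ x r → x ~ pow s * b → x + pow t * r ~ pow s * b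
        kind : (next ≡ t × (∀ b → ¬ pow t ∣ pow s * b → pow s * b ~ pow s))
               ⊎ (next ≡ t × t ≡ suc s × ∃ λ b → ¬ P ∣ b × ¬ pow s * b ~ pow s)
               ⊎ CyclotomicSection s t

    private
      search : ∀ {Q : ℤ → Set} → (∀ x → Dec (Q x)) → (∀ {x x′} → x ≈ x′ mod pow n → Q x → Q x′) →
               (∃ λ x → Q x) ⊎ (∀ x → ¬ Q x)
      search {Q} Q? resp = found (any? {n = p ℕ.^ n} (λ i → Q? (+ toℕ i)))
        where
        found : Dec (∃ λ i → Q (+ toℕ i)) → (∃ λ x → Q x) ⊎ (∀ x → ¬ Q x)
        found (yes (i , q)) = inj₁ (+ toℕ i , q)
        found (no h) = inj₂ λ x q → h (residue (p ℕ.^ n) x , resp (≈-sym (residue-≈ (p ℕ.^ n) x)) q)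

      pow-s-cancel : ∀ {s d a} → pow (s ℕ.+ d) ∣ pow s * a → pow d ∣ a
      pow-s-cancel {s} {d} {a} h = *-cancelˡ-∣ (pow s) {pow d} {a} {{pow-nonZero s}} (subst (_∣ pow s * a) (pow-+ s d) h)

    module Section (s k : ℕ) (t≤n : s ℕ.+ suc k ℕ.≤ n) (closed-s : Closedₚ s) (closed-t : Closedₚ (s ℕ.+ suc k)) where

      t : ℕ
      t = s ℕ.+ suc k

      private
        instance
          nz-s : NonZero (p ℕ.^ s)
          nz-s = pow-nonZero s
          nz-n∸s : NonZero (p ℕ.^ (n ℕ.∸ s))
          nz-n∸s = pow-nonZero (n ℕ.∸ s)
          nz-n∸t : NonZero (p ℕ.^ (n ℕ.∸ (s ℕ.+ suc k)))
          nz-n∸t = pow-nonZero (n ℕ.∸ (s ℕ.+ suc k))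
          nz-k : NonZero (p ℕ.^ suc k)
          nz-k = pow-nonZero (suc k)

        s≤n : s ℕ.≤ n
        s≤n = ℕ.≤-trans (ℕ.m≤m+n s (suc k)) t≤n

        size₁ : p ℕ.^ n ≡ p ℕ.^ (n ℕ.∸ s) ℕ.* p ℕ.^ s
        size₁ = trans (cong (p ℕ.^_) (sym (ℕ.m∸n+n≡m s≤n))) (ℕ.^-distribˡ-+-* p (n ℕ.∸ s) s)

        size₂ : p ℕ.^ (n ℕ.∸ s) ≡ p ℕ.^ (n ℕ.∸ t) ℕ.* p ℕ.^ suc k
        size₂ = trans (cong (p ℕ.^_) (trans (cong (ℕ._∸ s) (trans (sym (ℕ.m∸n+n≡m t≤n)) (trans (cong ((n ℕ.∸ t) ℕ.+_) (ℕ.+-comm s (suc k)))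
            (sym (ℕ.+-assoc (n ℕ.∸ t) (suc k) s))))) (ℕ.m+n∸n≡m (n ℕ.∸ t ℕ.+ suc k) s)))
          (ℕ.^-distribˡ-+-* p (n ℕ.∸ t) (suc k))

        A₁ : SchurRing (p ℕ.^ (n ℕ.∸ s))
        A₁ = Subring.subring A (p ℕ.^ s) (p ℕ.^ (n ℕ.∸ s)) size₁ closed-s

        closed₁ : Closed A₁ (pow (suc k))
        closed₁ {a} {b} h (divides q eq) = pow-s-cancel {s} {suc k} (closed-t h
          (divides q (trans (cong (pow s *_) eq) (trans (l₁ (pow s) q (pow (suc k))) (cong (q *_) (sym (pow-+ s (suc k))))))))
          where
          l₁ : ∀ S q K → S * (q * K) ≡ q * (S * K)
          l₁ = solve-∀

      B : SchurRing (p ℕ.^ suc k)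
      B = QuotientRing.quotientRing A₁ (p ℕ.^ (n ℕ.∸ t)) (p ℕ.^ suc k) size₂ closed₁

      private
        pow-t : ∀ b r → pow s * (b + pow (suc k) * r) ≡ pow s * b + pow t * r
        pow-t b r = trans (l₁ (pow s) b (pow (suc k)) r) (cong (λ T → pow s * b + T * r) (sym (pow-+ s (suc k))))
          where
          l₁ : ∀ S b K r → S * (b + K * r) ≡ S * b + S * K * r
          l₁ = solve-∀

      to-B : ∀ {a b} → pow s * a ~[ t ] pow s * b → SchurRing._~_ B a b
      to-B {a} {b} (r , h) = r , subst (pow s * a ~_) (sym (pow-t b r)) h

      from-B : ∀ {a b} → SchurRing._~_ B a b → pow s * a ~[ t ] pow s * b
      from-B {a} {b} (r , h) = r , subst (pow s * a ~_) (pow-t b r) h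

      private
        pow-1ℤ : pow s * 1ℤ ≡ pow s
        pow-1ℤ = ℤ.*-identityʳ (pow s)

      cyclotomicSection : IsCyclotomic p pr k B → CyclotomicSection s t
      cyclotomicSection C = record
        { t≤n = t≤n ; closed-s = closed-s ; closed-t = closed-t
        ; units = λ a h → C.units (to-B (subst (pow s * a ~[ t ]_) (sym pow-1ℤ) h))
        ; orbit = λ κ h a → from-B (C.orbit (to-B (subst (pow s * κ ~[ t ]_) (sym pow-1ℤ) h)) a)
        ; rigid = λ θ step fix0 fix1 ab → up (C.rigid θ
            (λ ab z → let (w , zw , h) = step ab z in w , zw , to-B h)
            (λ {w} zw → down (subst (λ x → pow s * w ≈ x mod pow t) (sym (ℤ.*-zeroʳ (pow s))) (fix0 zw)))
            (λ {w} zw → down (subst (λ x → pow s * w ≈ x mod pow t) (sym pow-1ℤ) (fix1 zw))) ab) }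
        where
        module C = IsCyclotomic {p} {pr} {k} {{pow-nonZero (suc k)}} {B} C
        up : ∀ {a b} → a ≈ b mod pow (suc k) → pow s * a ≈ pow s * b mod pow t
        up {a} {b} h = subst (λ T → pow s * a ≈ pow s * b mod T) (sym (pow-+ s (suc k))) (≈-scale (pow s) h)
        down : ∀ {a b} → pow s * a ≈ pow s * b mod pow t → a ≈ b mod pow (suc k)
        down {a} {b} h = ≈-unscale {pow (suc k)} {a} {b} (pow s) {{pow-nonZero s}}
          (subst (λ T → pow s * a ≈ pow s * b mod T) (pow-+ s (suc k)) h)

    module Radicals (s : ℕ) (s<n : s ℕ.< n) (closed-s : Closedₚ s) where

      Period : ℤ → Set
      Period w = ∀ x → x ~ pow s → x + w ~ pow s

      -- The radical is a union of classes: `decompose` replaces b + x by an equivalent z for which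
      -- z - a is in the class of x, and there the period a applies.
      period-closed : ∀ {a b} → a ~ b → Period a → Period b
      period-closed {a} {b} a~b per x x~ =
        let (z , z~ , a-z~) = decompose (~-sym a~b) (b + x)
            z-a~x = subst₂ _~_ (l₁ a z) (l₂ b x) (~-neg a-z~)
        in ~-trans (~-sym (subst (z ~_) (ℤ.+-comm b x) z~)) (subst (_~ pow s) (l₃ z a) (per (z - a) (~-trans z-a~x x~)))
        where
        l₁ : ∀ t z → - (t - z) ≡ z - t
        l₁ = solve-∀
        l₂ : ∀ i x → - (i - (i + x)) ≡ x
        l₂ = solve-∀
        l₃ : ∀ z t → z - t + t ≡ z
        l₃ = solve-∀

      period-multiple : ∀ {w} → Period w → ∀ e → Period (+ e * w)
      period-multiple {w} per zero x x~ = subst (_~ pow s) (sym (trans (cong (_+_ x) (ℤ.*-zeroˡ w)) (ℤ.+-identityʳ x))) x~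
      period-multiple {w} per (suc e) x x~ = subst (_~ pow s) (l₁ x (+ e) w) (per (x + + e * w) (period-multiple per e x x~))
        where
        l₁ : ∀ x e w → x + e * w + w ≡ x + (1ℤ + e) * w
        l₁ = solve-∀

      period-≈ : ∀ {w w′} → w ≈ w′ mod pow n → Period w → Period w′
      period-≈ h per x x~ = ≈-~ (≈-+ˡ x (≈-sym h)) (per x x~)

      period-any : ∀ {w} → Period w → ∀ r → Period (w * r)
      period-any {w} per r = period-≈ (≈-trans (≈-*ʳ w (residue-≈ (p ℕ.^ n) r)) (≈-reflexive (ℤ.*-comm r w)))
        (period-multiple per (toℕ (residue (p ℕ.^ n) r)))

      period-val : ∀ {v u j} → ¬ P ∣ u → v ℕ.≤ j → Period (pow v * u) → Period (pow j)
      period-val {v} {u} {j} nu v≤j per =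
        let (d , j≡ , _) = complement {v} {j} v≤j
            (i , ui≈1) = inverse n u nu
        in period-≈ (eq d i j≡ ui≈1) (period-any per (pow d * i))
        where
        l₁ : ∀ V u D i → V * u * (D * i) ≡ D * V * (u * i)
        l₁ = solve-∀
        eq : ∀ d i → pow j ≡ pow d * pow v → u * i ≈ 1ℤ mod pow n → pow v * u * (pow d * i) ≈ pow j mod pow n
        eq d i j≡ e = ≈-trans (≈-reflexive (trans (l₁ (pow v) u (pow d) i) (cong (_* (u * i)) (sym j≡))))
          (≈-trans (≈-*ˡ (pow j) e) (≈-reflexive (ℤ.*-identityʳ (pow j))))

      period? : ∀ w → Period w ⊎ ¬ Period w
      period? w = decide (search {Q = λ x → x ~ pow s × ¬ x + w ~ pow s} (λ x → (x ~? pow s) ×-dec ¬? (x + w ~? pow s))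
          (λ e (h , h′) → ≈-~ (≈-sym e) h , λ h″ → h′ (≈-~ (≈-+ʳ w e) h″)))
        where
        decide : (∃ λ x → x ~ pow s × ¬ x + w ~ pow s) ⊎ (∀ x → ¬ (x ~ pow s × ¬ x + w ~ pow s)) → Period w ⊎ ¬ Period w
        decide (inj₁ (x , h , h′)) = inj₂ λ per → h′ (per x h)
        decide (inj₂ none) = inj₁ λ x x~ → decidable-stable (x + w ~? pow s) λ h → none x (x~ , h)

      -- With p^s also -p^s would be a period, putting 0 into the class of p^s.
      ¬period-s : ¬ Period (pow s)
      ¬period-s per = ℕ.<⇒≱ s<n (pow-val {n} {s} {1ℤ} (subst (pow n ∣_) (sym (ℤ.*-identityʳ (pow s)))
        (≈0⇒∣ (~0⇒≈0 (~-trans (~-sym (period-any per (- 1ℤ) (pow s) ~-refl)) (~-reflexive (l₁ (pow s))))))) ∤1)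
        where
        l₁ : ∀ S → S + S * - 1ℤ ≡ 0ℤ
        l₁ = solve-∀

      radical : ∃ λ k → s ℕ.+ suc k ℕ.≤ n × Period (pow (s ℕ.+ suc k)) × ¬ Period (pow (s ℕ.+ k))
      radical = descend (n ℕ.∸ s) (ℕ.≤-reflexive s+d≡n) (subst (Period ∘ pow) (sym s+d≡n) period-n)
        where
        s+d≡n : s ℕ.+ (n ℕ.∸ s) ≡ n
        s+d≡n = trans (ℕ.+-comm s (n ℕ.∸ s)) (ℕ.m∸n+n≡m (ℕ.<⇒≤ s<n))
        period-n : Period (pow n)
        period-n x x~ = ≈-~ (mod-by 1ℤ (cong (_+_ x) (sym (ℤ.*-identityˡ (pow n))))) x~
        descend : ∀ d → s ℕ.+ d ℕ.≤ n → Period (pow (s ℕ.+ d)) → ∃ λ k → s ℕ.+ suc k ℕ.≤ n × Period (pow (s ℕ.+ suc k)) × ¬ Period (pow (s ℕ.+ k))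
        descend zero _ per = ⊥-elim (¬period-s (subst (Period ∘ pow) (ℕ.+-identityʳ s) per))
        descend (suc d) le per = step (period? (pow (s ℕ.+ d)))
          where
          step : Period (pow (s ℕ.+ d)) ⊎ ¬ Period (pow (s ℕ.+ d)) → ∃ λ k → s ℕ.+ suc k ℕ.≤ n × Period (pow (s ℕ.+ suc k)) × ¬ Period (pow (s ℕ.+ k))
          step (inj₁ per′) = descend d (ℕ.≤-trans (ℕ.+-monoʳ-≤ s (ℕ.n≤1+n d)) le) per′
          step (inj₂ nper) = d , le , per , nper

      -- The classes of p^s b with b a unit are images of one class under multipliers, and these
      -- preserve the subgroup of periods.
      unit-periodic : ∀ {w} → Period w → ∀ b → ¬ P ∣ b → ∀ x r → x ~ pow s * b → x + w * r ~ pow s * b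
      unit-periodic {w} per b nb x r x~ =
        let (i , bi≈1) = inverse n b nb
        in go i bi≈1
        where
        l₁ : ∀ b i x w r → b * (i * x + w * (i * r)) ≡ (x + w * r) * (b * i)
        l₁ = solve-∀
        l₂ : ∀ i S b → i * (S * b) ≡ S * (b * i)
        l₂ = solve-∀
        go : ∀ i → b * i ≈ 1ℤ mod pow n → x + w * r ~ pow s * b
        go i e = by-size n refl
          where
          ni : 1 ℕ.≤ n → ¬ P ∣ i
          ni 1≤n = proj₂ (unit-∣ {n} {b} {i} 1≤n e)
          ix~ : 1 ℕ.≤ n → i * x ~ pow s
          ix~ 1≤n = ~-trans (mul i (ni 1≤n) x~) (≈⇒~ (≈-trans (≈-reflexive (l₂ i (pow s) b))
            (≈-trans (≈-*ˡ (pow s) e) (≈-reflexive (ℤ.*-identityʳ (pow s))))))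
          by-size : ∀ n′ → n ≡ n′ → x + w * r ~ pow s * b
          by-size zero eq = ⊥-elim (ℕ.<⇒≱ s<n (subst (ℕ._≤ s) (sym eq) ℕ.z≤n))
          by-size (suc n′) eq = ≈-~ (≈-sym (≈-trans (≈-reflexive (l₁ b i x w r)) (≈-trans (≈-*ˡ (x + w * r) e) (≈-reflexive (ℤ.*-identityʳ (x + w * r))))))
              (subst (b * (i * x + w * (i * r)) ~_) (ℤ.*-comm b (pow s)) (mul b nb (period-any per (i * r) (i * x) (ix~ 1≤n))))
            where
            1≤n : 1 ℕ.≤ n
            1≤n = subst (1 ℕ.≤_) (sym eq) (ℕ.s≤s ℕ.z≤n)

      module _ (k : ℕ) (t≤n : s ℕ.+ suc k ℕ.≤ n) (per : Period (pow (s ℕ.+ suc k))) (aper : ¬ Period (pow (s ℕ.+ k))) where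

        private
          instance
            nz : NonZero (p ℕ.^ suc k)
            nz = pow-nonZero (suc k)

          t : ℕ
          t = s ℕ.+ suc k

          s≤t : s ℕ.≤ t
          s≤t = ℕ.m≤m+n s (suc k)

        -- An element equivalent to a multiple of p^t is again a period; if it lay outside p^t, its
        -- multiples would include p^(s+k), against the choice of t.
        closed-t : Closedₚ t
        closed-t {a} {b} a~b (divides q refl) = decidable-stable (pow t ∣? b) λ nd →
          let (v , u , v<t , b≡ , nu) = valuation t b nd
          in aper (period-val {v} {u} nu (ℕ.s≤s⁻¹ (subst (v ℕ.<_) (ℕ.+-suc s k) v<t))
               (subst Period b≡ (period-closed (subst (_~ b) (ℤ.*-comm q (pow t)) a~b) (period-any per q))))

        private
          module S = Section s k t≤n closed-s closed-t
          open SchurRing S.B using () renaming (_~_ to _~B_)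

          absorb : ∀ {a} → a ~[ t ] pow s → a ~ pow s
          absorb (r , h) = ~-trans h (period-any per r (pow s) ~-refl)

          from1 : ∀ {a} → a ~B 1ℤ → pow s * a ~ pow s
          from1 {a} h = absorb (subst (pow s * a ~[ t ]_) (ℤ.*-identityʳ (pow s)) (S.from-B h))

          to1 : ∀ {a} → pow s * a ~ pow s → a ~B 1ℤ
          to1 {a} h = S.to-B (0ℤ , subst (pow s * a ~_) (l₁ (pow s) (pow t)) h)
            where
            l₁ : ∀ S T → S ≡ S * 1ℤ + T * 0ℤ
            l₁ = solve-∀

          aperiodic : ¬ (∀ x → x ~B 1ℤ → x + pow k ~B 1ℤ)
          aperiodic h = aper λ x x~ → go x x~ (closed-s (~-sym x~) ∣-refl)
            where
            go : ∀ x → x ~ pow s → pow s ∣ x → x + pow (s ℕ.+ k) ~ pow s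
            go x x~ (divides q refl) = subst (_~ pow s) (trans (l₁ (pow s) q (pow k)) (cong (λ T → q * pow s + T) (sym (pow-+ s k))))
                (from1 (h q (to1 (subst (_~ pow s) (ℤ.*-comm q (pow s)) x~))))
              where
              l₁ : ∀ S q K → S * (q + K) ≡ q * S + S * K
              l₁ = solve-∀

          next-unit : ∀ {b} → ¬ pow (suc s) ∣ pow s * b → ¬ P ∣ b
          next-unit {b} h (divides q refl) = h (divides q (trans (l₁ (pow s) q P) (cong (q *_) (sym (pow-suc s)))))
            where
            l₁ : ∀ S q P → S * (q * P) ≡ q * (P * S)
            l₁ = solve-∀

        -- A multiplier takes any element of p^s outside p^(s+1) to p^s, whose class contains no
        -- multiple of p^(s+1) by `units`.
        closed-suc : (∀ {x} → x ~B 1ℤ → ¬ P ∣ x) → Closedₚ (suc s)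
        closed-suc units {a} {b} a~b d = decide (closed-s a~b (∣-trans (pow-∣ {s} {suc s} (ℕ.n≤1+n s)) d))
          where
          decide : pow s ∣ b → pow (suc s) ∣ b
          decide (divides q refl) = decidable-stable (pow (suc s) ∣? q * pow s) λ nd →
              let nq = next-unit (λ d′ → nd (subst (pow (suc s) ∣_) (ℤ.*-comm (pow s) q) d′))
                  (i , qi≈1) = inverse n q nq
              in contradiction nq i qi≈1 d
            where
            contradiction : ¬ P ∣ q → ∀ i → q * i ≈ 1ℤ mod pow n → pow (suc s) ∣ a → ⊥
            contradiction nq i qi≈1 (divides c refl) = units (to1 (subst (_~ pow s) (trans (cong (λ T → i * (c * T)) (pow-suc s)) (l₁ i c P (pow s)))
                (~-trans (mul i ni a~b) (≈⇒~ (≈-trans (≈-reflexive (l₂ i q (pow s))) (≈-trans (≈-*ˡ (pow s) qi≈1) (≈-reflexive (ℤ.*-identityʳ (pow s)))))))))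
                (∣m⇒∣m*n (i * c) ∣-refl)
              where
              ni : ¬ P ∣ i
              ni = proj₂ (unit-∣ {n} {q} {i} (ℕ.≤-trans (ℕ.s≤s ℕ.z≤n) s<n) qi≈1)
              l₁ : ∀ i c P S → i * (c * (P * S)) ≡ S * (P * (i * c))
              l₁ = solve-∀
              l₂ : ∀ i q S → i * (q * S) ≡ S * (q * i)
              l₂ = solve-∀

        private
          full-layer : (∀ b → ¬ pow t ∣ pow s * b → pow s * b ~ pow s) → Layer s
          full-layer full = record
            { t = t ; next = t ; s<next = subst (s ℕ.<_) (sym (ℕ.+-suc s k)) (ℕ.s≤s (ℕ.m≤m+n s k)) ; next≤t = ℕ.≤-refl
            ; t≤n = t≤n ; closed-t = closed-t ; closed-next = closed-t
            ; periodic = λ b nb x r x~ → ~-trans (period-any per r x (~-trans x~ (full b nb))) (~-sym (full b nb))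
            ; kind = inj₁ (refl , full) }

          prime-layer : k ≡ 0 → (∃ λ b → ¬ P ∣ b × ¬ pow s * b ~ pow s) → Layer s
          prime-layer k≡0 other = record
            { t = t ; next = t ; s<next = subst (s ℕ.<_) (sym (ℕ.+-suc s k)) (ℕ.s≤s (ℕ.m≤m+n s k)) ; next≤t = ℕ.≤-refl
            ; t≤n = t≤n ; closed-t = closed-t ; closed-next = closed-t
            ; periodic = λ b nb x r x~ → unit-periodic per b (next-unit (λ d → nb (subst (λ t → pow t ∣ pow s * b) (sym t≡) d))) x r x~
            ; kind = inj₂ (inj₁ (refl , t≡ , other)) }
            where
            t≡ : t ≡ suc s
            t≡ = trans (cong (λ k → s ℕ.+ suc k) k≡0) (ℕ.+-comm s 1)

          cyclotomic-layer : IsCyclotomic p pr k S.B → Layer s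
          cyclotomic-layer C = record
            { t = t ; next = suc s ; s<next = ℕ.≤-refl
            ; next≤t = subst (suc s ℕ.≤_) (sym (ℕ.+-suc s k)) (ℕ.s≤s (ℕ.m≤m+n s k))
            ; t≤n = t≤n ; closed-t = closed-t ; closed-next = closed-suc (IsCyclotomic.units {p} {pr} {k} {{pow-nonZero (suc k)}} {S.B} C)
            ; periodic = λ b nb x r x~ → unit-periodic per b (next-unit nb) x r x~
            ; kind = inj₂ (inj₂ (S.cyclotomicSection C)) }

        layer′ : Layer s
        layer′ = choose (trivial-radical p pr k S.B aperiodic)
          where
          -- A section of order p may still have a single nonzero class. Only otherwise is the group
          -- of units equivalent to 1 proper, as the polynomial identity requires.
          k≡0⇒ : k ≡ 0 → Layer s
          k≡0⇒ k≡0 = decide (search {Q = λ b → ¬ P ∣ b × ¬ pow s * b ~ pow s} (λ b → ¬? (P ∣? b) ×-dec ¬? (pow s * b ~? pow s))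
              (λ e (h , h′) → ∤-resp-≈ (≈-coarsen (p-∣-pow {n} (ℕ.≤-trans (ℕ.s≤s ℕ.z≤n) s<n)) e) h , λ h″ → h′ (≈-~ (≈-*ˡ (pow s) e) h″)))
            where
            decide : (∃ λ b → ¬ P ∣ b × ¬ pow s * b ~ pow s) ⊎ (∀ b → ¬ (¬ P ∣ b × ¬ pow s * b ~ pow s)) → Layer s
            decide (inj₁ other) = prime-layer k≡0 other
            decide (inj₂ none) = full-layer λ b nb → decidable-stable (pow s * b ~? pow s) λ nh →
              none b ((λ { (divides q refl) → nb (divides q (trans (l₁ (pow s) q P) (cong (q *_) (sym (trans (cong pow (trans (cong (λ k → s ℕ.+ suc k) k≡0) (ℕ.+-comm s 1))) (pow-suc s)))))) }) , nh)
              where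
              l₁ : ∀ S q P → S * (q * P) ≡ q * (P * S)
              l₁ = solve-∀
          choose : (∀ b → ¬ pow (suc k) ∣ b → b ~B 1ℤ) ⊎ k ≡ 0 ⊎ IsCyclotomic p pr k S.B → Layer s
          choose (inj₁ full) = full-layer λ b nb → from1 (full b λ d → nb (subst (_∣ pow s * b) (sym (pow-+ s (suc k))) (*-monoʳ-∣ (pow s) d)))
          choose (inj₂ (inj₁ k≡0)) = k≡0⇒ k≡0
          choose (inj₂ (inj₂ C)) = cyclotomic-layer C

      layer : Layer s
      layer = let (k , t≤n , per , aper) = radical in layer′ k t≤n per aper

-- Power sums modulo p and Fermat's theorem.

module PowerSums where
  open Congruence
  open FiniteSums using (⟦_⟧; ⟦⟧-yes; ⟦⟧-no; ⟦⟧-cong; sumℕ-+) renaming (sum to sumₙ; sumℕ to sumℕ; sum-δ to sumₙ-δ; sum-cong-≗ to sumₙ-cong; ∑-distrib-+ to sumₙ-+; *-distribˡ-sum to sumₙ-*ˡ; ∑ to ∑ₙ)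
  open import Algebra.Bundles using (CommutativeMonoid)
  open import Data.Nat as ℕ using (ℕ; zero; suc; NonZero)
  import Data.Nat.Properties as ℕ
  import Data.Nat.Divisibility as ℕ
  open import Data.Nat.Primality using (Prime; euclidsLemma; prime⇒nonZero; prime⇒nonTrivial)
  import Data.Nat.Tactic.RingSolver as ℕS
  open import Data.Integer as ℤ using (ℤ; +_; -_; _+_; _-_; _*_; _^_; 0ℤ; 1ℤ)
  import Data.Integer.Properties as ℤ
  open import Data.Integer.Divisibility.Signed using (_∣_; divides; _∣?_; ∣⇒∣ᵤ; ∣ᵤ⇒∣)
  open import Data.Integer.Tactic.RingSolver using (solve-∀)
  open import Data.Fin using (Fin; zero; suc; toℕ; _≟_)
  import Data.Fin.Permutation as Perm
  open import Data.Product using (_,_)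
  open import Data.Sum using (inj₁; inj₂)
  open import Data.Empty using (⊥-elim)
  open import Relation.Nullary using (¬_; Dec; yes; no)
  open import Relation.Nullary.Decidable using (¬?)
  open import Relation.Binary.PropositionalEquality
  open import Function using (_∘_)
  open import Level using (0ℓ)
  open import Algebra.Properties.Semiring.Sum ℤ.+-*-semiring public
    using (sum; sum-cong-≗; *-distribˡ-sum; *-distribʳ-sum; ∑-comm; ∑-distrib-+)

  sum-≈ : ∀ {M n} {f g : Fin n → ℤ} → (∀ i → f i ≈ g i mod M) → sum f ≈ sum g mod M
  sum-≈ {n = zero} h = ≈-refl
  sum-≈ {n = suc n} h = ≈-+ (h zero) (sum-≈ (h ∘ suc))

  sum-0 : ∀ {n} {f : Fin n → ℤ} → (∀ i → f i ≡ 0ℤ) → sum f ≡ 0ℤ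
  sum-0 {zero} h = refl
  sum-0 {suc n} h = trans (cong₂ _+_ (h zero) (sum-0 (h ∘ suc))) refl

  pos-sum : ∀ {n} (f : Fin n → ℕ) → + sumₙ f ≡ sum (λ i → + f i)
  pos-sum {zero} f = refl
  pos-sum {suc n} f = trans (ℤ.pos-+ (f zero) _) (cong (_+_ (+ f zero)) (pos-sum (f ∘ suc)))

  sum-δ : ∀ {n} (j : Fin n) (f : Fin n → ℤ) → sum (λ i → + ⟦ i ≟ j ⟧ * f i) ≡ f j
  sum-δ {suc n} zero f = trans (cong₂ _+_ (ℤ.*-identityˡ (f zero))
    (sum-0 {f = λ i → + ⟦ suc i ≟ zero ⟧ * f (suc i)} λ i → ℤ.*-zeroˡ (f (suc i)))) (ℤ.+-identityʳ _)
  sum-δ {suc n} (suc j) f = trans (cong₂ _+_ (ℤ.*-zeroˡ (f zero))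
    (trans (sum-cong-≗ (λ i → cong (λ e → + e * f (suc i)) (⟦⟧-cong (suc i ≟ suc j) (i ≟ j) (λ { refl → refl }) (cong suc))))
      (sum-δ j (f ∘ suc)))) (ℤ.+-identityˡ _)

  ^-≈ : ∀ {M a b} n → a ≈ b mod M → a ^ n ≈ b ^ n mod M
  ^-≈ zero h = ≈-refl
  ^-≈ (suc n) h = ≈-* h (^-≈ n h)

  ^-*-distrib : ∀ a b n → (a * b) ^ n ≡ a ^ n * b ^ n
  ^-*-distrib a b zero = refl
  ^-*-distrib a b (suc n) = trans (cong (a * b *_) (^-*-distrib a b n)) (lem a b (a ^ n) (b ^ n))
    where
    lem : ∀ a b x y → a * b * (x * y) ≡ a * x * (b * y)
    lem = solve-∀

  pos-^ : ∀ a n → + (a ℕ.^ n) ≡ (+ a) ^ n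
  pos-^ a zero = refl
  pos-^ a (suc n) = trans (ℤ.pos-* a (a ℕ.^ n)) (cong (+ a *_) (pos-^ a n))

  choose : ℕ → ℕ → ℕ
  choose n zero = 1
  choose zero (suc k) = 0
  choose (suc n) (suc k) = choose n k ℕ.+ choose n (suc k)

  choose-* : ∀ n k → suc k ℕ.* choose n (suc k) ℕ.+ k ℕ.* choose n k ≡ n ℕ.* choose n k
  choose-* zero zero = refl
  choose-* zero (suc k) = lem k
    where
    lem : ∀ k → suc (suc k) ℕ.* 0 ℕ.+ suc k ℕ.* 0 ≡ 0
    lem = ℕS.solve-∀
  choose-* (suc n) zero = trans (l₁ (choose n 1)) (cong suc (trans (sym (l₂ (choose n 1))) (choose-* n 0)))
    where
    l₁ : ∀ x → 1 ℕ.* (1 ℕ.+ x) ℕ.+ 0 ℕ.* 1 ≡ suc x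
    l₁ = ℕS.solve-∀
    l₂ : ∀ x → 1 ℕ.* x ℕ.+ 0 ℕ.* 1 ≡ x
    l₂ = ℕS.solve-∀
  choose-* (suc n) (suc k) = trans (l₁ k b₀ b₁ b₂) (trans (cong₂ (λ x y → x ℕ.+ y ℕ.+ b₀ ℕ.+ b₁) (choose-* n (suc k)) (choose-* n k)) (l₂ n b₀ b₁))
    where
    b₀ = choose n k
    b₁ = choose n (suc k)
    b₂ = choose n (suc (suc k))
    l₁ : ∀ k b₀ b₁ b₂ → suc (suc k) ℕ.* (b₁ ℕ.+ b₂) ℕ.+ suc k ℕ.* (b₀ ℕ.+ b₁) ≡
         (suc (suc k) ℕ.* b₂ ℕ.+ suc k ℕ.* b₁) ℕ.+ (suc k ℕ.* b₁ ℕ.+ k ℕ.* b₀) ℕ.+ b₀ ℕ.+ b₁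
    l₁ = ℕS.solve-∀
    l₂ : ∀ n b₀ b₁ → n ℕ.* b₁ ℕ.+ n ℕ.* b₀ ℕ.+ b₀ ℕ.+ b₁ ≡ suc n ℕ.* (b₀ ℕ.+ b₁)
    l₂ = ℕS.solve-∀

  hockey-stick : ∀ n k → sumℕ n (λ z → choose z k) ≡ choose n (suc k)
  hockey-stick zero k = refl
  hockey-stick (suc n) k = trans (cong (λ m → sumℕ m (λ z → choose z k)) (ℕ.+-comm 1 n)) (trans (sumℕ-+ n 1 (λ z → choose z k))
    (trans (cong₂ ℕ._+_ (hockey-stick n k) (trans (ℕ.+-identityʳ _) (cong (λ z → choose z k) (ℕ.+-identityʳ n))))
      (ℕ.+-comm (choose n (suc k)) (choose n k))))

  module PowerSum (p : ℕ) (pr : Prime p) where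
    open PrimePower p pr

    private
      instance
        p≢0 : NonZero p
        p≢0 = prime⇒nonZero pr

      1<p : 1 ℕ.< p
      1<p = ℕ.nonTrivial⇒n>1 p {{prime⇒nonTrivial pr}}

    prime-∣-choose : ∀ k → 0 ℕ.< k → k ℕ.< p → p ℕ.∣ choose p k
    prime-∣-choose (suc k) _ k<p with euclidsLemma (suc k) (choose p (suc k)) pr divisible
      where
      go : ∀ q → p ≡ q → suc k ℕ.* choose q (suc k) ≡ q ℕ.* choose (ℕ.pred q) k
      go zero eq = ⊥-elim (ℕ.<⇒≱ k<p (subst (ℕ._≤ suc k) (sym eq) ℕ.z≤n))
      go (suc q) _ = trans (l₁ k (choose q k) (choose q (suc k))) (trans (cong (ℕ._+ choose q k) (choose-* q k))
          (ℕ.+-comm (q ℕ.* choose q k) (choose q k)))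
        where
        l₁ : ∀ k a b → suc k ℕ.* (a ℕ.+ b) ≡ suc k ℕ.* b ℕ.+ k ℕ.* a ℕ.+ a
        l₁ = ℕS.solve-∀
      divisible : p ℕ.∣ suc k ℕ.* choose p (suc k)
      divisible = subst (p ℕ.∣_) (sym (go p refl)) (ℕ.m∣m*n (choose (ℕ.pred p) k))
    ... | inj₁ h = ⊥-elim (ℕ.<⇒≱ k<p (ℕ.∣⇒≤ h))
    ... | inj₂ h = h

    -- Each factor z is absorbed by z C(z,k) = (k+1) C(z,k+1) + k C(z,k), which is `choose-*`, until
    -- `hockey-stick` leaves a binomial coefficient C(p,i) with 0 < i < p.
    power-choose-sum : ∀ j k → suc (k ℕ.+ j) ℕ.< p → p ℕ.∣ sumℕ p (λ z → z ℕ.^ j ℕ.* choose z k)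
    power-choose-sum zero k h = subst (p ℕ.∣_) (sym (trans (sumₙ-cong {p} (λ z → ℕ.+-identityʳ (choose (toℕ z) k))) (hockey-stick p k)))
      (prime-∣-choose (suc k) (ℕ.s≤s ℕ.z≤n) (subst (λ x → suc x ℕ.< p) (ℕ.+-identityʳ k) h))
    power-choose-sum (suc j) k h = subst (p ℕ.∣_) (sym (trans (sumₙ-cong {p} (λ z → step (toℕ z)))
        (trans (sumₙ-+ {p} (λ z → suc k ℕ.* (toℕ z ℕ.^ j ℕ.* choose (toℕ z) (suc k))) (λ z → k ℕ.* (toℕ z ℕ.^ j ℕ.* choose (toℕ z) k)))
          (cong₂ ℕ._+_ (sym (sumₙ-*ˡ {p} (suc k) (λ z → toℕ z ℕ.^ j ℕ.* choose (toℕ z) (suc k)))) (sym (sumₙ-*ˡ {p} k (λ z → toℕ z ℕ.^ j ℕ.* choose (toℕ z) k)))))))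
      (ℕ.∣m∣n⇒∣m+n (ℕ.∣n⇒∣m*n (suc k) (power-choose-sum j (suc k) (subst (λ x → suc x ℕ.< p) (ℕ.+-suc k j) h)))
                   (ℕ.∣n⇒∣m*n k (power-choose-sum j k (ℕ.≤-trans (ℕ.s≤s (ℕ.s≤s (ℕ.+-monoʳ-≤ k (ℕ.n≤1+n j)))) h))))
      where
      l₁ : ∀ z Z c → z ℕ.* Z ℕ.* c ≡ Z ℕ.* (z ℕ.* c)
      l₁ = ℕS.solve-∀
      l₂ : ∀ Z k c c′ → Z ℕ.* (suc k ℕ.* c′ ℕ.+ k ℕ.* c) ≡ suc k ℕ.* (Z ℕ.* c′) ℕ.+ k ℕ.* (Z ℕ.* c)
      l₂ = ℕS.solve-∀
      step : ∀ z → z ℕ.^ suc j ℕ.* choose z k ≡ suc k ℕ.* (z ℕ.^ j ℕ.* choose z (suc k)) ℕ.+ k ℕ.* (z ℕ.^ j ℕ.* choose z k)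
      step z = trans (l₁ z (z ℕ.^ j) (choose z k)) (trans (cong (z ℕ.^ j ℕ.*_) (sym (choose-* z k)))
        (l₂ (z ℕ.^ j) k (choose z k) (choose z (suc k))))

    powerSum : ℕ → ℤ
    powerSum j = sum {p} (λ z → (+ toℕ z) ^ j)

    powerSum-small : ∀ j → suc j ℕ.< p → powerSum j ≈ 0ℤ mod P
    powerSum-small j h = subst (_≈ 0ℤ mod P) (trans (pos-sum {p} (λ z → toℕ z ℕ.^ j ℕ.* 1)) (sum-cong-≗ {p} λ z →
        trans (cong +_ (ℕ.*-identityʳ (toℕ z ℕ.^ j))) (pos-^ (toℕ z) j)))
      (∣⇒≈0 (∣ᵤ⇒∣ {+ p} (power-choose-sum j 0 h)))

    -- Multiplication by κ permutes a set Q of units that it stabilises; comparing the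
    -- products of the elements of Q gives κ^|Q| = 1.
    module Stabilised {Q : ℤ → Set} (Q? : ∀ x → Dec (Q x)) (Q-≈ : ∀ {x y} → x ≈ y mod P → Q x → Q y)
                      (units : ∀ {x} → Q x → ¬ P ∣ x) where

      private
        monoid : CommutativeMonoid 0ℓ 0ℓ
        monoid = record
          { Carrier = ℤ ; _≈_ = λ a b → a ≈ b mod P ; _∙_ = _*_ ; ε = 1ℤ
          ; isCommutativeMonoid = record
            { isMonoid = record
              { isSemigroup = record
                { isMagma = record
                  { isEquivalence = record { refl = ≈-refl ; sym = ≈-sym ; trans = ≈-trans }
                  ; ∙-cong = ≈-* }
                ; assoc = λ a b c → ≈-reflexive (ℤ.*-assoc a b c) }
              ; identity = (λ a → ≈-reflexive (ℤ.*-identityˡ a)) , (λ a → ≈-reflexive (ℤ.*-identityʳ a)) }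
            ; comm = λ a b → ≈-reflexive (ℤ.*-comm a b) } }
        open import Algebra.Properties.CommutativeMonoid.Sum monoid using ()
          renaming (sum to ∏; sum-cong-≋ to ∏-cong; ∑-distrib-+ to ∏-*; sum-permute to ∏-permute)

        g : ℤ → ℤ
        g x with Q? x
        ... | yes _ = x
        ... | no _ = 1ℤ

        g-unit : ∀ x → ¬ P ∣ g x
        g-unit x with Q? x
        ... | yes q = units q
        ... | no _ = ∤1

        g-≈ : ∀ {x y} → x ≈ y mod P → g x ≈ g y mod P
        g-≈ {x} {y} h with Q? x | Q? y
        ... | yes _ | yes _ = h
        ... | no _ | no _ = ≈-refl
        ... | yes q | no n = ⊥-elim (n (Q-≈ h q))
        ... | no n | yes q = ⊥-elim (n (Q-≈ (≈-sym h) q))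

        ∏-unit : ∀ {n} (f : Fin n → ℤ) → (∀ i → ¬ P ∣ f i) → ¬ P ∣ ∏ f
        ∏-unit {zero} f h = ∤1
        ∏-unit {suc n} f h = ∤-* (h zero) (∏-unit (f ∘ suc) (h ∘ suc))

      size : ℕ
      size = ∑ₙ p (λ x → ⟦ Q? x ⟧)

      module _ {κ ι : ℤ} (κι≈1 : κ * ι ≈ 1ℤ mod P) (to : ∀ {x} → Q x → Q (κ * x)) (from : ∀ {x} → Q (κ * x) → Q x) where

        private
          ι-κ : ∀ x → ι * (κ * x) ≈ x mod P
          ι-κ x = ≈-trans (≈-reflexive (l₁ ι κ x)) (≈-trans (≈-*ʳ x κι≈1) (≈-reflexive (ℤ.*-identityˡ x)))
            where
            l₁ : ∀ ι κ x → ι * (κ * x) ≡ κ * ι * x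
            l₁ = solve-∀

          κ-ι : ∀ x → κ * (ι * x) ≈ x mod P
          κ-ι x = ≈-trans (≈-reflexive (sym (ℤ.*-assoc κ ι x))) (≈-trans (≈-*ʳ x κι≈1) (≈-reflexive (ℤ.*-identityˡ x)))

          inv : ∀ (a b : ℤ) → (∀ x → a * (b * x) ≈ x mod P) → ∀ i → residue p (a * + toℕ (residue p (b * + toℕ i))) ≡ i
          inv a b h i = trans (residue-cong p (≈-trans (≈-*ˡ a (residue-≈ p (b * + toℕ i))) (h (+ toℕ i)))) (residue-toℕ p i)

          π : Perm.Permutation p p
          π = Perm.permutation (λ i → residue p (κ * + toℕ i)) (λ i → residue p (ι * + toℕ i)) (inv κ ι κ-ι) (inv ι κ ι-κ)

          h : ℤ → ℤ
          h x = κ ^ ⟦ Q? x ⟧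

          g-κ : ∀ x → g (κ * x) ≈ h x * g x mod P
          g-κ x with Q? x | Q? (κ * x)
          ... | yes _ | yes _ = ≈-reflexive (cong (_* x) (sym (ℤ.*-identityʳ κ)))
          ... | no _ | no _ = ≈-refl
          ... | yes q | no n = ⊥-elim (n (to q))
          ... | no n | yes q = ⊥-elim (n (from q))

          ∏h : ∀ {n} (f : Fin n → ℤ) → ∏ (λ i → h (f i)) ≡ κ ^ sumₙ (λ i → ⟦ Q? (f i) ⟧)
          ∏h {zero} f = refl
          ∏h {suc n} f = trans (cong (h (f zero) *_) (∏h (f ∘ suc))) (sym (ℤ.^-distribˡ-+-* κ ⟦ Q? (f zero) ⟧ _))

        power-size : κ ^ size ≈ 1ℤ mod P
        power-size =
          let (i , Gi≈1) = inverse 1 G (∏-unit {p} (λ i → g (+ toℕ i)) (λ i → g-unit (+ toℕ i)))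
          in cancel i (subst (λ D → G * i ≈ 1ℤ mod D) pow-1 Gi≈1)
          where
          G : ℤ
          G = ∏ {p} (λ i → g (+ toℕ i))
          equal : G ≈ κ ^ size * G mod P
          equal = ≈-trans (∏-permute (λ i → g (+ toℕ i)) π) (≈-trans
            (∏-cong {p} (λ i → ≈-trans (g-≈ (residue-≈ p (κ * + toℕ i))) (g-κ (+ toℕ i))))
            (≈-trans (∏-* {p} (λ i → h (+ toℕ i)) (λ i → g (+ toℕ i))) (≈-*ʳ G (≈-reflexive (∏h {p} (λ i → + toℕ i))))))
          cancel : ∀ i → G * i ≈ 1ℤ mod P → κ ^ size ≈ 1ℤ mod P
          cancel i e = ≈-trans (≈-reflexive (sym (ℤ.*-identityʳ (κ ^ size)))) (≈-trans (≈-*ˡ (κ ^ size) (≈-sym e))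
            (≈-trans (≈-reflexive (sym (ℤ.*-assoc (κ ^ size) G i))) (≈-trans (≈-*ʳ i (≈-sym equal)) e)))

    private
      module U = Stabilised {λ x → ¬ P ∣ x} (λ x → ¬? (P ∣? x)) ∤-resp-≈ (λ n → n)

      nonzero-count : ∀ n k → (∀ i → i ℕ.< n → ¬ P ∣ + suc (k ℕ.+ i)) → sumₙ {n} (λ i → ⟦ ¬? (P ∣? + suc (k ℕ.+ toℕ i)) ⟧) ≡ n
      nonzero-count zero k h = refl
      nonzero-count (suc n) k h = cong₂ ℕ._+_ (⟦⟧-yes (¬? (P ∣? + suc (k ℕ.+ 0))) (h 0 (ℕ.s≤s ℕ.z≤n)))
        (trans (sumₙ-cong {n} (λ i → cong (λ x → ⟦ ¬? (P ∣? + suc x) ⟧) (ℕ.+-suc k (toℕ i))))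
          (nonzero-count n (suc k) (λ i i<n → subst (λ x → ¬ P ∣ + suc x) (ℕ.+-suc k i) (h (suc i) (ℕ.s≤s i<n)))))

    p-1 : ℕ
    p-1 = ℕ.pred p

    suc-p-1 : suc p-1 ≡ p
    suc-p-1 = ℕ.suc-pred p

    units-count : U.size ≡ p-1
    units-count = trans (cong (λ q → sumₙ {q} (λ i → ⟦ ¬? (P ∣? + toℕ i) ⟧)) (sym suc-p-1))
      (trans (cong (ℕ._+ sumₙ {p-1} (λ i → ⟦ ¬? (P ∣? + suc (toℕ i)) ⟧)) (⟦⟧-no (¬? (P ∣? + 0)) (λ h → h (divides 0ℤ refl))))
        (nonzero-count p-1 0 λ i i<p-1 d → ℕ.<⇒≱ (subst (suc i ℕ.<_) suc-p-1 (ℕ.s≤s i<p-1)) (ℕ.∣⇒≤ (∣⇒∣ᵤ d))))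

    -- The set of all units is stable under multiplication by a and has p - 1 elements.
    fermat : ∀ {a} → ¬ P ∣ a → a ^ p-1 ≈ 1ℤ mod P
    fermat {a} na = subst (λ e → a ^ e ≈ 1ℤ mod P) units-count
      (let (i , ai≈1) = inverse 1 a na
       in U.power-size {a} {i} (subst (λ D → a * i ≈ 1ℤ mod D) pow-1 ai≈1) (∤-* na) (λ h d → h (Data.Integer.Divisibility.Signed.∣n⇒∣m*n a d)))

    private
      0^ : ∀ j → 0 ℕ.< j → 0ℤ ^ j ≡ 0ℤ
      0^ (suc j) _ = ℤ.*-zeroˡ (0ℤ ^ j)

      power-split : ∀ j a → 0 ℕ.< j → a ^ (p-1 ℕ.+ j) ≈ a ^ j mod P
      power-split j a 0<j with P ∣? a
      ... | no na = ≈-trans (≈-reflexive (ℤ.^-distribˡ-+-* a p-1 j)) (≈-trans (≈-*ʳ (a ^ j) (fermat na)) (≈-reflexive (ℤ.*-identityˡ (a ^ j))))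
      ... | yes pa = ≈-trans (^-≈ (p-1 ℕ.+ j) (∣⇒≈0 pa)) (≈-trans (≈-reflexive (trans (0^ (p-1 ℕ.+ j) (ℕ.≤-trans 0<j (ℕ.m≤n+m j p-1))) (sym (0^ j 0<j))))
                       (≈-sym (^-≈ j (∣⇒≈0 pa))))

    powerSum-large : ∀ j → 0 ℕ.< j → suc j ℕ.< p → powerSum (p-1 ℕ.+ j) ≈ 0ℤ mod P
    powerSum-large j 0<j h = ≈-trans (sum-≈ {n = p} (λ z → power-split j (+ toℕ z) 0<j)) (powerSum-small j h)

    powerSum-p-1 : powerSum p-1 ≈ - 1ℤ mod P
    powerSum-p-1 = ≈-trans (sum-≈ {n = p} (λ z → value (+ toℕ z))) (≈-trans
        (≈-reflexive (trans (sym (pos-sum {p} (λ z → ⟦ ¬? (P ∣? + toℕ z) ⟧))) (cong +_ units-count)))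
        (mod-by 1ℤ (trans (l₁ (+ p-1)) (cong (λ x → - 1ℤ + 1ℤ * x) (cong +_ suc-p-1)))))
      where
      l₁ : ∀ x → x ≡ - 1ℤ + 1ℤ * (1ℤ + x)
      l₁ = solve-∀
      0<p-1 : 0 ℕ.< p-1
      0<p-1 = ℕ.s≤s⁻¹ (subst (1 ℕ.<_) (sym suc-p-1) 1<p)
      value : ∀ a → a ^ p-1 ≈ + ⟦ ¬? (P ∣? a) ⟧ mod P
      value a with P ∣? a
      ... | no na = fermat na
      ... | yes pa = ≈-trans (^-≈ p-1 (∣⇒≈0 pa)) (≈-reflexive (0^ p-1 0<p-1))

-- Sections of order p: binary forms and their convolution.

module PrimeSection where
  open Congruence
  open FiniteSums using (⟦_⟧; ⟦⟧-yes; ⟦⟧-no; ⟦⟧-cong) renaming (sum to sumₙ; ∑ to ∑ₙ; sum-mono to sumₙ-mono; sum-const to sumₙ-const; ∑-distrib-+ to sumₙ-+; sum-δ to sumₙ-δ)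
  open GroupRing using (∑-δ)
  open Frobenius using (binomial-factorial; factorial-∤)
  open PowerSums
  import Data.Integer.Properties as ℤ
  open import Algebra.Properties.CommutativeSemiring.Binomial ℤ.+-*-commutativeSemiring using (theorem)
  open import Algebra.Properties.Semiring.Exp ℤ.+-*-semiring using () renaming (_^_ to _^ˢ_)
  open import Algebra.Properties.Semiring.Mult ℤ.+-*-semiring using () renaming (_×_ to _×ˢ_)
  open import Data.Nat as ℕ using (ℕ; zero; suc; NonZero; _∸_)
  import Data.Nat.Properties as ℕ
  import Data.Nat.Divisibility as ℕ
  open import Data.Nat.Combinatorics using (_C_)
  open import Data.Nat.Primality using (Prime; prime⇒nonZero)
  open import Data.Integer as ℤ using (ℤ; +_; -_; _+_; _-_; _*_; _^_; 0ℤ; 1ℤ)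
  import Data.Integer.Properties as ℤ
  open import Data.Integer.Divisibility.Signed using (_∣_; divides; _∣?_; ∣⇒∣ᵤ; ∣n⇒∣m*n)
  open import Data.Integer.Tactic.RingSolver using (solve-∀)
  open import Data.Fin using (Fin; zero; suc; toℕ; _≟_)
  open import Data.Fin.Properties using (toℕ<n; toℕ-injective; any?)
  open import Data.Product using (∃; _×_; _,_; proj₁; proj₂)
  open import Data.Sum using (_⊎_; inj₁; inj₂)
  open import Data.Empty using (⊥; ⊥-elim)
  open import Relation.Nullary using (¬_; Dec; yes; no)
  open import Relation.Nullary.Decidable using (decidable-stable; _×-dec_; ¬?)
  open import Relation.Binary.Definitions using (tri<; tri≈; tri>)
  open import Relation.Binary.PropositionalEquality

  -- Σ_{i ≤ e} a_i x^(e-i) y^i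
  form : ∀ e → (ℕ → ℤ) → ℤ → ℤ → ℤ
  form e a x y = sum {suc e} (λ i → a (toℕ i) * (x ^ (e ∸ toℕ i) * y ^ toℕ i))

  -- The form with all coefficients 1, that is (y^(e+1) - x^(e+1)) / (y - x).
  geometric : ℕ → ℤ → ℤ → ℤ
  geometric zero x y = 1ℤ
  geometric (suc e) x y = x ^ suc e + y * geometric e x y

  geometric-telescope : ∀ e x y → (y - x) * geometric e x y ≡ y ^ suc e - x ^ suc e
  geometric-telescope zero x y = lem x y
    where
    lem : ∀ x y → (y - x) * 1ℤ ≡ y * 1ℤ - x * 1ℤ
    lem = solve-∀
  geometric-telescope (suc e) x y = trans (l₁ x y (x ^ suc e) (geometric e x y))
    (trans (cong (λ g → (y - x) * x ^ suc e + y * g) (geometric-telescope e x y)) (l₂ x y (x ^ suc e) (y ^ suc e)))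
    where
    l₁ : ∀ x y X g → (y - x) * (X + y * g) ≡ (y - x) * X + y * ((y - x) * g)
    l₁ = solve-∀
    l₂ : ∀ x y X Y → (y - x) * X + y * (Y - X) ≡ y * Y - x * X
    l₂ = solve-∀

  form-constant : ∀ e σ x y → form e (λ _ → σ) x y ≡ σ * geometric e x y
  form-constant zero σ x y = lem σ
    where
    lem : ∀ σ → σ * (1ℤ * 1ℤ) + 0ℤ ≡ σ * 1ℤ
    lem = solve-∀
  form-constant (suc e) σ x y = trans (cong₂ _+_ (l₁ σ (x ^ suc e)) (trans
      (sum-cong-≗ {suc e} (λ i → l₂ σ (x ^ (e ∸ toℕ i)) y (y ^ toℕ i)))
      (trans (sym (*-distribˡ-sum {suc e} y (λ i → σ * (x ^ (e ∸ toℕ i) * y ^ toℕ i)))) (cong (y *_) (form-constant e σ x y)))))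
    (l₃ σ (x ^ suc e) y (geometric e x y))
    where
    l₁ : ∀ σ X → σ * (X * 1ℤ) ≡ σ * X
    l₁ = solve-∀
    l₂ : ∀ σ X y Y → σ * (X * (y * Y)) ≡ y * (σ * (X * Y))
    l₂ = solve-∀
    l₃ : ∀ σ X y g → σ * X + y * (σ * g) ≡ σ * (X + y * g)
    l₃ = solve-∀

  private
    ^ˢ≡ : ∀ x n → x ^ˢ n ≡ x ^ n
    ^ˢ≡ x zero = refl
    ^ˢ≡ x (suc n) = cong (x *_) (^ˢ≡ x n)

    ×ˢ≡ : ∀ n x → n ×ˢ x ≡ + n * x
    ×ˢ≡ zero x = sym (ℤ.*-zeroˡ x)
    ×ˢ≡ (suc n) x = trans (cong (_+_ x) (×ˢ≡ n x)) (lem x (+ n))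
      where
      lem : ∀ x n → x + n * x ≡ (1ℤ + n) * x
      lem = solve-∀

  coefficient : ℕ → ℕ → ℤ
  coefficient e i = + (e C i) * (- 1ℤ) ^ (e ∸ i)

  difference-form : ∀ e x y → (y - x) ^ e ≡ form e (coefficient e) x y
  difference-form e x y = trans (sym (^ˢ≡ (y - x) e)) (trans (theorem e y (- x)) (sum-cong-≗ {suc e} λ i → term (toℕ i)))
    where
    l₁ : ∀ c Y s X → c * (Y * (s * X)) ≡ c * s * (X * Y)
    l₁ = solve-∀
    l₂ : ∀ x → - x ≡ - 1ℤ * x
    l₂ = solve-∀
    term : ∀ i → (e C i) ×ˢ (y ^ˢ i * (- x) ^ˢ (e ∸ i)) ≡ coefficient e i * (x ^ (e ∸ i) * y ^ i)
    term i = trans (×ˢ≡ (e C i) _) (trans (cong₂ (λ a b → + (e C i) * (a * b)) (^ˢ≡ y i)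
        (trans (^ˢ≡ (- x) (e ∸ i)) (trans (cong (_^ (e ∸ i)) (l₂ x)) (^-*-distrib (- 1ℤ) x (e ∸ i)))))
      (l₁ (+ (e C i)) (y ^ i) ((- 1ℤ) ^ (e ∸ i)) (x ^ (e ∸ i))))

  module Orthogonality (p : ℕ) (pr : Prime p) where
    open PrimePower p pr
    open PowerSum p pr

    coefficient-unit : ∀ {e} → e ℕ.< p → ∀ i → i ℕ.≤ e → ¬ P ∣ coefficient e i
    coefficient-unit {e} e<p i i≤e = ∤-* binomial (sign (e ∸ i))
      where
      binomial : ¬ P ∣ + (e C i)
      binomial d = factorial-∤ pr e e<p (subst (p ℕ.∣_) (binomial-factorial i≤e) (ℕ.∣m⇒∣m*n _ (∣⇒∣ᵤ d)))
      sign : ∀ n → ¬ P ∣ (- 1ℤ) ^ n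
      sign zero = ∤1
      sign (suc n) = ∤-* (λ d → ∤1 (Data.Integer.Divisibility.Signed.∣m⇒∣-m d)) (sign n)

    module _ {e : ℕ} (1≤e : 1 ℕ.≤ e) (e+2≤p : suc (suc e) ℕ.≤ p) where

      -- Chosen so that the exponent i + `weight` + (e - j), which arises in a convolution, equals p
      -- - 1 exactly for i = j.
      weight : ℕ
      weight = p-1 ∸ e

      private
        e<p-1 : suc e ℕ.≤ p-1
        e<p-1 = ℕ.s≤s⁻¹ (subst (suc (suc e) ℕ.≤_) (sym suc-p-1) e+2≤p)

        e≤p-1 : e ℕ.≤ p-1
        e≤p-1 = ℕ.≤-trans (ℕ.n≤1+n e) e<p-1

        -- The exponent is p - 1 + i - j. Since i and j differ by at most e ≤ p - 2, it lies
        -- strictly between 0 and 2 (p - 1), and there only the exponent p - 1 has a nonzero power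
        -- sum.
        power-diagonal : ∀ {i j} → i ℕ.≤ e → j ℕ.≤ e → powerSum (i ℕ.+ (weight ℕ.+ (e ∸ j))) ≈ - (+ ⟦ i ℕ.≟ j ⟧) mod P
        power-diagonal {i} {j} i≤e j≤e = cases (ℕ.<-cmp i j)
          where
          total : weight ℕ.+ (e ∸ j) ≡ p-1 ∸ j
          total = trans (cong (weight ℕ.+_) refl) (ℕ.+-cancelʳ-≡ j (weight ℕ.+ (e ∸ j)) (p-1 ∸ j)
            (trans (ℕ.+-assoc weight (e ∸ j) j) (trans (cong (weight ℕ.+_) (ℕ.m∸n+n≡m j≤e))
              (trans (ℕ.m∸n+n≡m e≤p-1) (sym (ℕ.m∸n+n≡m (ℕ.≤-trans j≤e e≤p-1)))))))
          cases : _ → powerSum (i ℕ.+ (weight ℕ.+ (e ∸ j))) ≈ - (+ ⟦ i ℕ.≟ j ⟧) mod P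
          cases (tri≈ _ refl _) = subst₂ (λ n δ → powerSum n ≈ - (+ δ) mod P)
            (sym (trans (cong (i ℕ.+_) total) (trans (ℕ.+-comm i (p-1 ∸ i)) (ℕ.m∸n+n≡m (ℕ.≤-trans i≤e e≤p-1)))))
            (sym (⟦⟧-yes (i ℕ.≟ i) refl)) powerSum-p-1
          cases (tri< i<j i≢j _) = subst (λ δ → powerSum (i ℕ.+ (weight ℕ.+ (e ∸ j))) ≈ - (+ δ) mod P)
            (sym (⟦⟧-no (i ℕ.≟ j) i≢j)) (powerSum-small (i ℕ.+ (weight ℕ.+ (e ∸ j))) (subst (suc (i ℕ.+ (weight ℕ.+ (e ∸ j))) ℕ.<_) suc-p-1
              (ℕ.s≤s (subst (λ n → suc (i ℕ.+ n) ℕ.≤ p-1) (sym total)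
                (ℕ.≤-trans (ℕ.+-monoˡ-≤ (p-1 ∸ j) i<j) (ℕ.≤-reflexive (trans (ℕ.+-comm j (p-1 ∸ j)) (ℕ.m∸n+n≡m (ℕ.≤-trans j≤e e≤p-1)))))))))
          cases (tri> _ i≢j j<i) = subst₂ (λ n δ → powerSum n ≈ - (+ δ) mod P)
            (sym index) (sym (⟦⟧-no (i ℕ.≟ j) i≢j)) (powerSum-large (i ∸ j) (ℕ.m<n⇒0<n∸m j<i)
              (ℕ.≤-trans (ℕ.s≤s (ℕ.s≤s (ℕ.≤-trans (ℕ.m∸n≤m i j) i≤e))) e+2≤p))
            where
            index : i ℕ.+ (weight ℕ.+ (e ∸ j)) ≡ p-1 ℕ.+ (i ∸ j)
            index = trans (cong₂ ℕ._+_ (sym (ℕ.m∸n+n≡m (ℕ.<⇒≤ j<i))) total) (trans (ℕ.+-assoc (i ∸ j) j (p-1 ∸ j))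
              (trans (cong ((i ∸ j) ℕ.+_) (trans (ℕ.+-comm j (p-1 ∸ j)) (ℕ.m∸n+n≡m (ℕ.≤-trans j≤e e≤p-1)))) (ℕ.+-comm (i ∸ j) p-1)))

        collect : ∀ a i u b j v x y z → a * (x ^ u * z ^ i) * (z ^ weight * (b * (z ^ v * y ^ j))) ≡
                  a * x ^ u * (b * y ^ j) * z ^ (i ℕ.+ (weight ℕ.+ v))
        collect a i u b j v x y z = trans (l₁ a (x ^ u) (z ^ i) (z ^ weight) b (z ^ v) (y ^ j))
            (cong (a * x ^ u * (b * y ^ j) *_) (sym (trans (ℤ.^-distribˡ-+-* z i (weight ℕ.+ v)) (cong (z ^ i *_) (ℤ.^-distribˡ-+-* z weight v)))))
          where
          l₁ : ∀ a X Z W b Z′ Y → a * (X * Z) * (W * (b * (Z′ * Y))) ≡ a * X * (b * Y) * (Z * (W * Z′))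
          l₁ = solve-∀

      -- After expanding both forms, the sum over z is -1 for equal indices and 0 otherwise, so
      -- convolution multiplies the coefficients termwise, up to sign.
      convolve-forms : ∀ a b x y → sum {p} (λ z → form e a x (+ toℕ z) * ((+ toℕ z) ^ weight * form e b (+ toℕ z) y)) ≈
                       form e (λ i → - (a i * b i)) x y mod P
      convolve-forms a b x y = begin
        sum {p} (λ z → form e a x (+ toℕ z) * ((+ toℕ z) ^ weight * form e b (+ toℕ z) y))
          ≡⟨ sum-cong-≗ {p} (λ z → expand (+ toℕ z)) ⟩
        sum {p} (λ z → sum {suc e} (λ i → sum {suc e} (λ j → A i j * (+ toℕ z) ^ E i j)))
          ≡⟨ ∑-comm {p} {suc e} (λ z i → sum {suc e} (λ j → A i j * (+ toℕ z) ^ E i j)) ⟩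
        sum {suc e} (λ i → sum {p} (λ z → sum {suc e} (λ j → A i j * (+ toℕ z) ^ E i j)))
          ≡⟨ sum-cong-≗ {suc e} (λ i → trans (∑-comm {p} {suc e} (λ z j → A i j * (+ toℕ z) ^ E i j))
               (sum-cong-≗ {suc e} λ j → sym (*-distribˡ-sum {p} (A i j) (λ z → (+ toℕ z) ^ E i j)))) ⟩
        sum {suc e} (λ i → sum {suc e} (λ j → A i j * powerSum (E i j)))
          ≈⟨ sum-≈ {n = suc e} (λ i → sum-≈ {n = suc e} (λ j → ≈-*ˡ (A i j) (power-diagonal (ℕ.s≤s⁻¹ (toℕ<n i)) (ℕ.s≤s⁻¹ (toℕ<n j))))) ⟩
        sum {suc e} (λ i → sum {suc e} (λ j → A i j * - (+ ⟦ toℕ i ℕ.≟ toℕ j ⟧)))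
          ≡⟨ sum-cong-≗ {suc e} (λ i → trans (sum-cong-≗ {suc e} (λ j → trans (l₂ (A i j) (+ ⟦ toℕ i ℕ.≟ toℕ j ⟧))
               (cong (λ δ → + δ * - A i j) (⟦⟧-cong (toℕ i ℕ.≟ toℕ j) (j ≟ i) (λ h → toℕ-injective (sym h)) (λ h → cong toℕ (sym h))))))
               (trans (sum-δ i (λ j → - A i j)) (l₃ (a (toℕ i)) (x ^ (e ∸ toℕ i)) (b (toℕ i)) (y ^ toℕ i)))) ⟩
        form e (λ i → - (a i * b i)) x y ∎
        where
        open import Relation.Binary.Reasoning.Setoid (≈-setoid P)
        A : Fin (suc e) → Fin (suc e) → ℤ
        A i j = a (toℕ i) * x ^ (e ∸ toℕ i) * (b (toℕ j) * y ^ toℕ j)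
        E : Fin (suc e) → Fin (suc e) → ℕ
        E i j = toℕ i ℕ.+ (weight ℕ.+ (e ∸ toℕ j))
        l₂ : ∀ A δ → A * - δ ≡ δ * - A
        l₂ = solve-∀
        l₃ : ∀ a X b Y → - (a * X * (b * Y)) ≡ - (a * b) * (X * Y)
        l₃ = solve-∀
        expand : ∀ z → form e a x z * (z ^ weight * form e b z y) ≡ sum {suc e} (λ i → sum {suc e} (λ j → A i j * z ^ E i j))
        expand z = trans (*-distribʳ-sum {suc e} (z ^ weight * form e b z y) (λ i → a (toℕ i) * (x ^ (e ∸ toℕ i) * z ^ toℕ i)))
          (sum-cong-≗ {suc e} λ i → trans (cong (a (toℕ i) * (x ^ (e ∸ toℕ i) * z ^ toℕ i) *_)
              (*-distribˡ-sum {suc e} (z ^ weight) (λ j → b (toℕ j) * (z ^ (e ∸ toℕ j) * y ^ toℕ j))))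
            (trans (*-distribˡ-sum {suc e} (a (toℕ i) * (x ^ (e ∸ toℕ i) * z ^ toℕ i)) (λ j → z ^ weight * (b (toℕ j) * (z ^ (e ∸ toℕ j) * y ^ toℕ j))))
              (sum-cong-≗ {suc e} λ j → collect (a (toℕ i)) (toℕ i) (e ∸ toℕ i) (b (toℕ j)) (toℕ j) (e ∸ toℕ j) x y z)))

  -- A coherent structure on ℤ/p, given by an equivalence E of pairs, that is invariant under
  -- a proper subgroup of units.  With e the order of the subgroup, E respects the forms
  -- (y - x)^e; convolving p-1 times turns all their coefficients into the same unit, so E
  -- respects x^e + x^(e-1) y + … + y^e, from which y can be computed unless x^e = y^e.
  module Separation (p : ℕ) (pr : Prime p)
      (_~_ : ℤ → ℤ → Set) (_~?_ : ∀ a b → Dec (a ~ b))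
      (~-sym : ∀ {a b} → a ~ b → b ~ a) (~-trans : ∀ {a b c} → a ~ b → b ~ c → a ~ c)
      (≈⇒~ : ∀ {a b} → a ≈ b mod + p → a ~ b)
      (~-∣ : ∀ {a b} → a ~ b → + p ∣ a → + p ∣ b)
      (mul : ∀ u → ¬ + p ∣ u → ∀ {a b} → a ~ b → (u * a) ~ (u * b))
      (other : ∃ λ b → ¬ + p ∣ b × ¬ (b ~ 1ℤ))
      (E : ℤ → ℤ → ℤ → ℤ → Set)
      (E-difference : ∀ {a b a′ b′} → E a b a′ b′ → (b - a) ~ (b′ - a′))
      (E-left : ∀ {a b a′ b′} → E a b a′ b′ → a ~ a′)
      (E-right : ∀ {a b a′ b′} → E a b a′ b′ → b ~ b′)
      (E-step : ∀ {a b a′ b′} → E a b a′ b′ → ∀ z → ∃ λ z′ → E a z a′ z′ × E z b z′ b′)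
      (E-sum : ∀ (F G : ℤ → ℤ → ℕ) → (∀ {a z z′} → z ≈ z′ mod + p → F a z ≡ F a z′) → (∀ {b z z′} → z ≈ z′ mod + p → G z b ≡ G z′ b) →
         (∀ {a b a′ b′} → E a b a′ b′ → F a b ≡ F a′ b′) → (∀ {a b a′ b′} → E a b a′ b′ → G a b ≡ G a′ b′) →
         ∀ {a b a′ b′} → E a b a′ b′ → ∑ₙ p (λ z → F a z ℕ.* G z b) ≡ ∑ₙ p (λ z → F a′ z ℕ.* G z b′)) where
    open PrimePower p pr
    open PowerSum p pr
    open Orthogonality p pr

    private
      instance
        p≢0 : NonZero p
        p≢0 = prime⇒nonZero pr

      ~-units : ∀ {x} → x ~ 1ℤ → ¬ P ∣ x
      ~-units h d = ∤1 (~-∣ h d)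

      module K = Stabilised {λ x → x ~ 1ℤ} (λ x → x ~? 1ℤ) (λ h q → ~-trans (≈⇒~ (≈-sym h)) q) ~-units

    e : ℕ
    e = K.size

    private
      inverse-p : ∀ a → ¬ P ∣ a → ∃ λ i → a * i ≈ 1ℤ mod P
      inverse-p a na = let (i , h) = inverse 1 a na in i , subst (λ D → a * i ≈ 1ℤ mod D) pow-1 h

      inverse-unit : ∀ {a i} → a * i ≈ 1ℤ mod P → ¬ P ∣ i
      inverse-unit {a} {i} h d = ∤1 (∣-resp-≈ (≈-sym h) (∣n⇒∣m*n a d))

      K-power : ∀ {κ} → κ ~ 1ℤ → κ ^ e ≈ 1ℤ mod P
      K-power {κ} κ~1 = let (ι , κι≈1) = inverse-p κ (~-units κ~1) in K.power-size {κ} {ι} κι≈1 to (from ι κι≈1)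
        where
        κ1 : (κ * 1ℤ) ~ 1ℤ
        κ1 = subst (_~ 1ℤ) (sym (ℤ.*-identityʳ κ)) κ~1
        to : ∀ {x} → x ~ 1ℤ → (κ * x) ~ 1ℤ
        to x~1 = ~-trans (mul κ (~-units κ~1) x~1) κ1
        from : ∀ ι → κ * ι ≈ 1ℤ mod P → ∀ {x} → (κ * x) ~ 1ℤ → x ~ 1ℤ
        from ι h {x} κx~1 = ~-trans (≈⇒~ (≈-sym (cancel x))) (~-trans (mul ι (inverse-unit {κ} h) (~-trans κx~1 (~-sym κ1))) (≈⇒~ (cancel 1ℤ)))
          where
          l₁ : ∀ ι κ x → ι * (κ * x) ≡ κ * ι * x
          l₁ = solve-∀
          cancel : ∀ x → ι * (κ * x) ≈ x mod P
          cancel x = ≈-trans (≈-reflexive (l₁ ι κ x)) (≈-trans (≈-*ʳ x h) (≈-reflexive (ℤ.*-identityˡ x)))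

      1≤e : 1 ℕ.≤ e
      1≤e = ℕ.≤-trans (ℕ.≤-reflexive (sym (⟦⟧-yes ((+ toℕ (residue p 1ℤ)) ~? 1ℤ) (≈⇒~ (residue-≈ p 1ℤ)))))
        (FiniteSums.term≤sum {p} (λ i → ⟦ (+ toℕ i) ~? 1ℤ ⟧) (residue p 1ℤ))

      -- Both 0 and the unit supplied by `other` lie outside the class of 1.
      e+2≤p : suc (suc e) ℕ.≤ p
      e+2≤p = subst₂ ℕ._≤_ total (trans (sumₙ-const p 1) (ℕ.*-identityʳ p)) (sumₙ-mono {p} bound)
        where
        b₀ = proj₁ other
        δ₀ : ℤ → ℕ
        δ₀ x = ⟦ x ≈? 0ℤ mod P ⟧
        δ₁ : ℤ → ℕ
        δ₁ x = ⟦ x ≈? b₀ mod P ⟧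
        count : ∀ a → sumₙ {p} (λ i → ⟦ + toℕ i ≈? a mod P ⟧) ≡ 1
        count a = trans (FiniteSums.sum-cong-≗ {p} (λ i → sym (ℕ.*-identityʳ ⟦ + toℕ i ≈? a mod P ⟧))) (∑-δ p (λ _ → 1) (λ _ → refl) a)
        total : sumₙ {p} (λ i → δ₀ (+ toℕ i) ℕ.+ (δ₁ (+ toℕ i) ℕ.+ ⟦ (+ toℕ i) ~? 1ℤ ⟧)) ≡ suc (suc e)
        total = trans (sumₙ-+ {p} (λ i → δ₀ (+ toℕ i)) (λ i → δ₁ (+ toℕ i) ℕ.+ ⟦ (+ toℕ i) ~? 1ℤ ⟧))
          (cong₂ ℕ._+_ (count 0ℤ) (trans (sumₙ-+ {p} (λ i → δ₁ (+ toℕ i)) (λ i → ⟦ (+ toℕ i) ~? 1ℤ ⟧)) (cong (ℕ._+ e) (count b₀))))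
        disjoint : ∀ x (d₀ : Dec (x ≈ 0ℤ mod P)) (d₁ : Dec (x ≈ b₀ mod P)) (d₂ : Dec (x ~ 1ℤ)) → ⟦ d₀ ⟧ ℕ.+ (⟦ d₁ ⟧ ℕ.+ ⟦ d₂ ⟧) ℕ.≤ 1
        disjoint x (yes h) (yes h′) _ = ⊥-elim (proj₁ (proj₂ other) (≈0⇒∣ (≈-trans (≈-sym h′) h)))
        disjoint x (yes h) (no _) (yes q) = ⊥-elim (~-units q (≈0⇒∣ h))
        disjoint x (yes h) (no _) (no _) = ℕ.≤-refl
        disjoint x (no _) (yes h) (yes q) = ⊥-elim (proj₂ (proj₂ other) (~-trans (≈⇒~ (≈-sym h)) q))
        disjoint x (no _) (yes h) (no _) = ℕ.≤-refl
        disjoint x (no _) (no _) (yes _) = ℕ.≤-refl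
        disjoint x (no _) (no _) (no _) = ℕ.z≤n
        bound : ∀ (i : Fin p) → δ₀ (+ toℕ i) ℕ.+ (δ₁ (+ toℕ i) ℕ.+ ⟦ (+ toℕ i) ~? 1ℤ ⟧) ℕ.≤ 1
        bound i = disjoint (+ toℕ i) (+ toℕ i ≈? 0ℤ mod P) (+ toℕ i ≈? b₀ mod P) ((+ toℕ i) ~? 1ℤ)

      w : ℕ
      w = weight {e} 1≤e e+2≤p

      e+w : e ℕ.+ w ≡ p-1
      e+w = trans (ℕ.+-comm e w) (ℕ.m∸n+n≡m {p-1} {e} (ℕ.≤-trans (ℕ.n≤1+n e) (ℕ.s≤s⁻¹ (subst (suc (suc e) ℕ.≤_) (sym suc-p-1) e+2≤p))))

      1≤w : 1 ℕ.≤ w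
      1≤w = ℕ.m<n⇒0<n∸m {e} {p-1} (ℕ.s≤s⁻¹ (subst (suc (suc e) ℕ.≤_) (sym suc-p-1) e+2≤p))

      K-weight : ∀ {κ} → κ ~ 1ℤ → κ ^ w ≈ 1ℤ mod P
      K-weight {κ} h = ≈-trans (≈-reflexive (sym (ℤ.*-identityˡ (κ ^ w)))) (≈-trans (≈-*ʳ (κ ^ w) (≈-sym (K-power h)))
        (≈-trans (≈-reflexive (trans (sym (ℤ.^-distribˡ-+-* κ e w)) (cong (κ ^_) e+w))) (fermat (~-units h))))

      0^ : ∀ j → 1 ℕ.≤ j → 0ℤ ^ j ≡ 0ℤ
      0^ (suc j) _ = ℤ.*-zeroˡ (0ℤ ^ j)

      ~-power : ∀ j → 1 ℕ.≤ j → (∀ {κ} → κ ~ 1ℤ → κ ^ j ≈ 1ℤ mod P) → ∀ {x y} → x ~ y → x ^ j ≈ y ^ j mod P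
      ~-power j 1≤j K-inv {x} {y} x~y = cases (P ∣? y)
        where
        cases : Dec (P ∣ y) → x ^ j ≈ y ^ j mod P
        cases (yes py) = ≈-trans (^-≈ j (∣⇒≈0 (~-∣ (~-sym x~y) py))) (≈-sym (^-≈ j (∣⇒≈0 py)))
        cases (no ny) = let (i , yi≈1) = inverse-p y ny in go i yi≈1
          where
          l₁ : ∀ x i y → x * i * y ≡ x * (y * i)
          l₁ = solve-∀
          go : ∀ i → y * i ≈ 1ℤ mod P → x ^ j ≈ y ^ j mod P
          go i h = ≈-trans (^-≈ j x≈) (≈-trans (≈-reflexive (^-*-distrib (x * i) y j)) (≈-trans (≈-*ʳ (y ^ j) (K-inv κ~1)) (≈-reflexive (ℤ.*-identityˡ (y ^ j)))))
            where
            κ~1 : (x * i) ~ 1ℤ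
            κ~1 = ~-trans (subst (_~ (i * y)) (ℤ.*-comm i x) (mul i (inverse-unit {y} h) x~y)) (≈⇒~ (≈-trans (≈-reflexive (ℤ.*-comm i y)) h))
            x≈ : x ≈ x * i * y mod P
            x≈ = ≈-sym (≈-trans (≈-reflexive (l₁ x i y)) (≈-trans (≈-*ˡ x h) (≈-reflexive (ℤ.*-identityʳ x))))

      e-power : ∀ {x y} → x ~ y → x ^ e ≈ y ^ e mod P
      e-power = ~-power e 1≤e K-power

      ρ : ℤ → ℕ
      ρ x = toℕ (residue p x)

      ρ-≈ : ∀ x → + ρ x ≈ x mod P
      ρ-≈ = residue-≈ p

      ρ-cong : ∀ {x y} → x ≈ y mod P → ρ x ≡ ρ y
      ρ-cong h = cong toℕ (residue-cong p h)

      Respects : (ℤ → ℤ → ℕ) → Set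
      Respects F = ∀ {a b a′ b′} → E a b a′ b′ → F a b ≡ F a′ b′

      -- `E-sum` concerns functions with values in ℕ, hence the passage to residues here and in
      -- `weighted`.
      base : ℤ → ℤ → ℕ
      base a b = ρ ((b - a) ^ e)

      -- The factor z^w depends only on the class of z, that is, on the position of z relative to
      -- the individualised point 0; so E respects it through `E-left`.
      weighted : ℤ → ℤ → ℕ
      weighted z b = ρ (z ^ w) ℕ.* base z b

      iterated : ℕ → ℤ → ℤ → ℕ
      iterated zero a b = base a b
      iterated (suc r) a b = ∑ₙ p (λ z → iterated r a z ℕ.* weighted z b)

      base-respects : Respects base
      base-respects h = ρ-cong (e-power (E-difference h))

      weighted-respects : Respects weighted
      weighted-respects h = cong₂ ℕ._*_ (ρ-cong (~-power w 1≤w K-weight (E-left h))) (base-respects h)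

      iterated-periodic : ∀ r {a z z′} → z ≈ z′ mod P → iterated r a z ≡ iterated r a z′
      iterated-periodic zero {a} h = ρ-cong (^-≈ e (≈--ʳ a h))
      iterated-periodic (suc r) {a} {z} {z′} h = FiniteSums.sum-cong-≗ {p} λ i →
        cong (λ x → iterated r a (+ toℕ i) ℕ.* (ρ ((+ toℕ i) ^ w) ℕ.* x)) (ρ-cong (^-≈ e (≈--ʳ (+ toℕ i) h)))

      iterated-respects : ∀ r → Respects (iterated r)
      iterated-respects zero = base-respects
      iterated-respects (suc r) = E-sum (iterated r) weighted (iterated-periodic r)
        (λ {b} h → cong₂ ℕ._*_ (ρ-cong (^-≈ w h)) (ρ-cong (^-≈ e (≈--ˡ b h)))) (iterated-respects r) weighted-respects

      coefficients : ℕ → ℕ → ℤ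
      coefficients zero i = coefficient e i
      coefficients (suc r) i = - (coefficients r i * coefficient e i)

      iterated-form : ∀ r a b → + iterated r a b ≈ form e (coefficients r) a b mod P
      iterated-form zero a b = ≈-trans (ρ-≈ ((b - a) ^ e)) (≈-reflexive (difference-form e a b))
      iterated-form (suc r) a b = ≈-trans (≈-reflexive (pos-sum {p} (λ i → iterated r a (+ toℕ i) ℕ.* weighted (+ toℕ i) b)))
        (≈-trans (sum-≈ {n = p} (λ i → ≈-trans (≈-reflexive (pos (iterated r a (+ toℕ i)) (ρ ((+ toℕ i) ^ w)) (base (+ toℕ i) b)))
          (≈-* (iterated-form r a (+ toℕ i)) (≈-* (ρ-≈ ((+ toℕ i) ^ w)) (iterated-form zero (+ toℕ i) b)))))
        (convolve-forms 1≤e e+2≤p (coefficients r) (coefficient e) a b))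
        where
        pos : ∀ x y z → + (x ℕ.* (y ℕ.* z)) ≡ + x * (+ y * + z)
        pos x y z = trans (ℤ.pos-* x (y ℕ.* z)) (cong (+ x *_) (ℤ.pos-* y z))

      coefficients-power : ∀ r i → coefficients r i ≡ (- 1ℤ) ^ r * coefficient e i ^ suc r
      coefficients-power zero i = lem (coefficient e i)
        where
        lem : ∀ c → c ≡ 1ℤ * (c * 1ℤ)
        lem = solve-∀
      coefficients-power (suc r) i = trans (cong (λ x → - (x * coefficient e i)) (coefficients-power r i)) (lem ((- 1ℤ) ^ r) (coefficient e i) (coefficient e i ^ r))
        where
        lem : ∀ s c d → - (s * (c * d) * c) ≡ - 1ℤ * s * (c * (c * d))
        lem = solve-∀

      p-2 : ℕ
      p-2 = ℕ.pred p-1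

      suc-p-2 : suc p-2 ≡ p-1
      suc-p-2 = ℕ.suc-pred p-1 {{ℕ.>-nonZero (subst (0 ℕ.<_) e+w (ℕ.≤-trans 1≤e (ℕ.m≤m+n e w)))}}

      σ : ℤ
      σ = (- 1ℤ) ^ p-2

      σ-unit : ¬ P ∣ σ
      σ-unit = go p-2
        where
        go : ∀ n → ¬ P ∣ (- 1ℤ) ^ n
        go zero = ∤1
        go (suc n) = ∤-* (λ d → ∤1 (Data.Integer.Divisibility.Signed.∣m⇒∣-m d)) (go n)

      -- The coefficients of the r-th iterate are powers c^(r+1) up to a common sign. With r = p -
      -- 2, Fermat turns every unit c into 1.
      uniform : ∀ i → i ℕ.≤ e → coefficients p-2 i ≈ σ mod P
      uniform i i≤e = ≈-trans (≈-reflexive (coefficients-power p-2 i)) (≈-trans (≈-*ˡ σ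
          (subst (λ n → coefficient e i ^ n ≈ 1ℤ mod P) (sym suc-p-2) (fermat (coefficient-unit (ℕ.≤-trans (ℕ.n≤1+n (suc e)) e+2≤p) i i≤e))))
        (≈-reflexive (ℤ.*-identityʳ σ)))

      iterated-geometric : ∀ a b → + iterated p-2 a b ≈ σ * geometric e a b mod P
      iterated-geometric a b = ≈-trans (iterated-form p-2 a b) (≈-trans
        (sum-≈ {n = suc e} (λ i → ≈-*ʳ (a ^ (e ∸ toℕ i) * b ^ toℕ i) (uniform (toℕ i) (ℕ.s≤s⁻¹ (toℕ<n i)))))
        (≈-reflexive (form-constant e σ a b)))

      geometric-respects : ∀ {a b a′ b′} → E a b a′ b′ → geometric e a b ≈ geometric e a′ b′ mod P
      geometric-respects {a} {b} {a′} {b′} h = let (i , σi≈1) = inverse-p σ σ-unit in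
          ≈-trans (≈-sym (cancel i σi≈1 (geometric e a b))) (≈-trans (≈-*ˡ i same) (cancel i σi≈1 (geometric e a′ b′)))
        where
        same : σ * geometric e a b ≈ σ * geometric e a′ b′ mod P
        same = ≈-trans (≈-sym (iterated-geometric a b)) (≈-trans (≈-reflexive (cong +_ (iterated-respects p-2 h))) (iterated-geometric a′ b′))
        l₁ : ∀ i σ g → i * (σ * g) ≡ σ * i * g
        l₁ = solve-∀
        cancel : ∀ i → σ * i ≈ 1ℤ mod P → ∀ g → i * (σ * g) ≈ g mod P
        cancel i h g = ≈-trans (≈-reflexive (l₁ i σ g)) (≈-trans (≈-*ʳ g h) (≈-reflexive (ℤ.*-identityˡ g)))

      geometric-≈ : ∀ e {a a′} b → a ≈ a′ mod P → geometric e a b ≈ geometric e a′ b mod P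
      geometric-≈ zero b h = ≈-refl
      geometric-≈ (suc e) b h = ≈-+ (^-≈ (suc e) h) (≈-*ˡ b (geometric-≈ e b h))

      -- With φ the geometric form and τ = b^e, telescoping gives b (φ - τ) = a φ - a^(e+1), which
      -- is linear in b. If φ = τ, the same equation gives τ = a^e, contrary to assumption.
      solve-for : ∀ {a b b′} → ¬ P ∣ a → ¬ a ^ e ≈ b ^ e mod P → b ^ e ≈ b′ ^ e mod P →
                  geometric e a b ≈ geometric e a b′ mod P → b ≈ b′ mod P
      solve-for {a} {b} {b′} na ne be ge = conclude (∣-* {b - b′} {geometric e a b - b ^ e} (≈0⇒∣ product))
        where
        φ = geometric e a b
        τ = b ^ e
        l₁ : ∀ b b′ φ τ a → (b - b′) * (φ - τ) ≡ ((b - a) * φ - b * τ) - ((b′ - a) * φ - b′ * τ)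
        l₁ = solve-∀
        l₂ : ∀ b τ A → b * τ - A - b * τ ≡ - A
        l₂ = solve-∀
        row : (b - a) * φ - b * τ ≡ - (a * a ^ e)
        row = trans (cong (_- b * τ) (geometric-telescope e a b)) (l₂ b τ (a * a ^ e))
        row′ : (b′ - a) * φ - b′ * τ ≈ - (a * a ^ e) mod P
        row′ = ≈-trans (≈-- (≈-*ˡ (b′ - a) ge) (≈-*ˡ b′ be)) (≈-reflexive (trans (cong (_- b′ * b′ ^ e) (geometric-telescope e a b′)) (l₂ b′ (b′ ^ e) (a * a ^ e))))
        product : (b - b′) * (φ - τ) ≈ 0ℤ mod P
        product = ≈-trans (≈-reflexive (l₁ b b′ φ τ a)) (≈-trans (≈-- (≈-reflexive row) row′) (≈-reflexive (ℤ.+-inverseʳ (- (a * a ^ e)))))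
        l₃ : ∀ b a τ φ → a * τ ≡ b * τ - (b - a) * φ + (b - a) * (φ - τ)
        l₃ = solve-∀
        l₄ : ∀ b τ A → b * τ - (b * τ - A) + 0ℤ ≡ A
        l₄ = solve-∀
        l₅ : ∀ x → x * 0ℤ ≡ 0ℤ
        l₅ = solve-∀
        impossible : P ∣ φ - τ → ⊥
        impossible d = let (i , ai≈1) = inverse-p a na in ne (≈-sym (cancel i ai≈1))
          where
          aτ : a * τ ≈ a * a ^ e mod P
          aτ = ≈-trans (≈-reflexive (l₃ b a τ φ)) (≈-trans (≈-+ˡ (b * τ - (b - a) * φ) (≈-trans (≈-*ˡ (b - a) (∣⇒≈0 d)) (≈-reflexive (l₅ (b - a)))))
            (≈-reflexive (trans (cong (λ x → b * τ - x + 0ℤ) (geometric-telescope e a b)) (l₄ b τ (a * a ^ e)))))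
          l₆ : ∀ a x i → a * x * i ≡ x * (a * i)
          l₆ = solve-∀
          shrink : ∀ i → a * i ≈ 1ℤ mod P → ∀ x → a * x * i ≈ x mod P
          shrink i h x = ≈-trans (≈-reflexive (l₆ a x i)) (≈-trans (≈-*ˡ x h) (≈-reflexive (ℤ.*-identityʳ x)))
          cancel : ∀ i → a * i ≈ 1ℤ mod P → τ ≈ a ^ e mod P
          cancel i h = ≈-trans (≈-sym (shrink i h τ)) (≈-trans (≈-*ʳ i aτ) (shrink i h (a ^ e)))
        conclude : P ∣ b - b′ ⊎ P ∣ φ - τ → b ≈ b′ mod P
        conclude (inj₁ d) = ∣⇒≈ d
        conclude (inj₂ d) = ⊥-elim (impossible d)

      separated : ∀ {a b a′ b′} → E a b a′ b′ → a ≈ a′ mod P → ¬ P ∣ a → ¬ a ^ e ≈ b ^ e mod P → b ≈ b′ mod P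
      separated {a} {b} {a′} {b′} h a≈a′ na ne = solve-for na ne (e-power (E-right h))
        (≈-trans (geometric-respects h) (geometric-≈ e b′ (≈-sym a≈a′)))

      -- If z^e were 1 for all units z, the power sums for e and p - 1 would agree, but they are 0
      -- and -1.
      non-root : ∃ λ z → ¬ P ∣ z × ¬ 1ℤ ^ e ≈ z ^ e mod P
      non-root = decide (any? {n = p} (λ i → ¬? (P ∣? + toℕ i) ×-dec ¬? (1ℤ ^ e ≈? (+ toℕ i) ^ e mod P)))
        where
        decide : Dec (∃ λ i → ¬ P ∣ + toℕ i × ¬ 1ℤ ^ e ≈ (+ toℕ i) ^ e mod P) → ∃ λ z → ¬ P ∣ z × ¬ 1ℤ ^ e ≈ z ^ e mod P
        decide (yes (i , h)) = + toℕ i , h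
        decide (no none) = ⊥-elim (∤1 (∣-resp-≈ (≈-sym minus-one) (divides 0ℤ refl)))
          where
          same : ∀ (i : Fin p) → (+ toℕ i) ^ e ≈ (+ toℕ i) ^ p-1 mod P
          same i with P ∣? + toℕ i
          ... | yes d = ≈-trans (^-≈ e (∣⇒≈0 d)) (≈-trans (≈-reflexive (trans (0^ e 1≤e) (sym (0^ p-1 (subst (1 ℕ.≤_) e+w (ℕ.≤-trans 1≤e (ℕ.m≤m+n e w)))))))
                          (≈-sym (^-≈ p-1 (∣⇒≈0 d))))
          ... | no n = ≈-trans (≈-sym (decidable-stable (1ℤ ^ e ≈? (+ toℕ i) ^ e mod P) λ h → none (i , n , h)))
                         (≈-trans (≈-reflexive (ℤ.^-zeroˡ e)) (≈-sym (fermat n)))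
          minus-one : 0ℤ ≈ 1ℤ mod P
          minus-one = ≈-neg (≈-trans (≈-sym (powerSum-small e e+2≤p)) (≈-trans (sum-≈ {n = p} same) powerSum-p-1))

    -- For b^e = 1 the point 1 does not determine b through the identity. Then some z with z^e
    -- different from 1 is determined first, and z determines b.
    discrete : ∀ {b b′} → E 1ℤ b 1ℤ b′ → b ≈ b′ mod P
    discrete {b} {b′} h = cases (1ℤ ^ e ≈? b ^ e mod P)
      where
      cases : Dec (1ℤ ^ e ≈ b ^ e mod P) → b ≈ b′ mod P
      cases (no ne) = separated h ≈-refl ∤1 ne
      cases (yes eq) =
        let (z , nz , ne) = non-root
            (z′ , h₁ , h₂) = E-step h z
        in separated h₂ (separated h₁ ≈-refl ∤1 ne) nz (λ h → ne (≈-trans eq (≈-sym h)))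

-- Transport of points and sums along an algebraic isomorphism.

module Similarity where
  open import Defs
  open FiniteSums
  open import Data.Nat using (ℕ; _*_)
  open import Data.Nat.Properties using (1+n≢0)
  open import Data.Fin using (Fin; _≟_)
  open import Data.Product using (∃; _×_; _,_; proj₁; proj₂)
  open import Relation.Nullary using (Dec)
  open import Relation.Binary.PropositionalEquality

  -- S x y x′ y′ says that the colours of (x,y) and (x′,y′) correspond.
  record Similarity {m m′ : ℕ} (S : Fin m → Fin m → Fin m′ → Fin m′ → Set) : Set where
    field
      sums : ∀ {x y x′ y′} → S x y x′ y′ → (H : Fin m → ℕ) (H′ : Fin m′ → ℕ) →
             (∀ i j → S x i x′ j → S i y j y′ → H i ≡ H′ j) → sum H ≡ sum H′
      forth : ∀ {x y x′ y′} → S x y x′ y′ → ∀ z → ∃ λ z′ → S x z x′ z′ × S z y z′ y′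
      back : ∀ {x y x′ y′} → S x y x′ y′ → ∀ z′ → ∃ λ z → S x z x′ z′ × S z y z′ y′
      diagˡ : ∀ {x x′ y′} → S x x x′ y′ → x′ ≡ y′
      source : ∀ {x y x′ y′} → S x y x′ y′ → S x x x′ x′
      flip : ∀ {x y x′ y′} → S x y x′ y′ → S y x y′ x′

  module _ {m r m′ r′ : ℕ} {c : Coloring m r} {c′ : Coloring m′ r′} (cc : IsCC c) (cc′ : IsCC c′)
           {φ : Fin r → Fin r′} (iso : IsAlgIso c c′ φ) where

    Match : Fin m → Fin m → Fin m′ → Fin m′ → Set
    Match x y x′ y′ = c′ x′ y′ ≡ φ (c x y)

    private
      φ-injective : ∀ {s t} → φ s ≡ φ t → s ≡ t
      φ-injective = proj₁ (proj₁ iso) _ _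

      sums : ∀ {x y x′ y′} → Match x y x′ y′ → (H : Fin m → ℕ) (H′ : Fin m′ → ℕ) →
             (∀ i j → Match x i x′ j → Match i y j y′ → H i ≡ H′ j) → sum H ≡ sum H′
      sums {x} {y} {x′} {y′} h H H′ e = sum-transfer (λ i → φ (c x i)) (λ i → φ (c i y)) (c′ x′) (λ j → c′ j y′)
        counts H H′ (λ i j p q → e i j (sym p) (sym q))
        where
        counts : ∀ s t → sum (λ i → ⟦ φ (c x i) ≟ s ⟧ * ⟦ φ (c i y) ≟ t ⟧) ≡ sum (λ j → ⟦ c′ x′ j ≟ s ⟧ * ⟦ c′ j y′ ≟ t ⟧)
        counts s t with proj₂ (proj₁ iso) s | proj₂ (proj₁ iso) t
        ... | s₀ , refl | t₀ , refl = trans (sum-cong-≗ (λ i → cong₂ _*_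
                (⟦⟧-cong (φ (c x i) ≟ φ s₀) (c x i ≟ s₀) φ-injective (cong φ))
                (⟦⟧-cong (φ (c i y) ≟ φ t₀) (c i y ≟ t₀) φ-injective (cong φ))))
              (trans (sym (inum-sum c s₀ t₀ x y)) (trans (proj₂ iso s₀ t₀ x y x′ y′ h) (inum-sum c′ (φ s₀) (φ t₀) x′ y′)))

      nonzero : ∀ {A B : Set} (d : Dec A) (e : Dec B) → A → B → ⟦ d ⟧ * ⟦ e ⟧ ≢ 0
      nonzero d e a b h = 1+n≢0 (trans (sym (cong₂ _*_ (⟦⟧-yes d a) (⟦⟧-yes e b))) h)

      forth : ∀ {x y x′ y′} → Match x y x′ y′ → ∀ z → ∃ λ z′ → Match x z x′ z′ × Match z y z′ y′
      forth {x} {y} {x′} {y′} h z = found (sum≢0⇒∃ (H (c′ x′) (λ j → c′ j y′))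
          (λ e → ∃⇒sum≢0 (H (λ i → φ (c x i)) (λ i → φ (c i y))) z
            (nonzero (φ (c x z) ≟ φ (c x z)) (φ (c z y) ≟ φ (c z y)) refl refl)
            (trans (sums h (H (λ i → φ (c x i)) (λ i → φ (c i y))) (H (c′ x′) (λ j → c′ j y′))
              (λ i j p q → cong₂ (λ a b → ⟦ a ≟ φ (c x z) ⟧ * ⟦ b ≟ φ (c z y) ⟧) (sym p) (sym q))) e)))
        where
        H : ∀ {n} → (Fin n → Fin r′) → (Fin n → Fin r′) → Fin n → ℕ
        H f g i = ⟦ f i ≟ φ (c x z) ⟧ * ⟦ g i ≟ φ (c z y) ⟧
        found : (∃ λ j → H (c′ x′) (λ j → c′ j y′) j ≢ 0) → ∃ λ z′ → Match x z x′ z′ × Match z y z′ y′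
        found (j , hj) = j , ⟦⟧-≢0 (c′ x′ j ≟ φ (c x z)) (*-≢0ˡ hj) , ⟦⟧-≢0 (c′ j y′ ≟ φ (c z y)) (*-≢0ʳ {⟦ c′ x′ j ≟ φ (c x z) ⟧} hj)

      back : ∀ {x y x′ y′} → Match x y x′ y′ → ∀ z′ → ∃ λ z → Match x z x′ z′ × Match z y z′ y′
      back {x} {y} {x′} {y′} h z′ = found (sum≢0⇒∃ (H (λ i → φ (c x i)) (λ i → φ (c i y)))
          (λ e → ∃⇒sum≢0 (H (c′ x′) (λ j → c′ j y′)) z′
            (nonzero (c′ x′ z′ ≟ c′ x′ z′) (c′ z′ y′ ≟ c′ z′ y′) refl refl)
            (trans (sym (sums h (H (λ i → φ (c x i)) (λ i → φ (c i y))) (H (c′ x′) (λ j → c′ j y′))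
              (λ i j p q → cong₂ (λ a b → ⟦ a ≟ c′ x′ z′ ⟧ * ⟦ b ≟ c′ z′ y′ ⟧) (sym p) (sym q)))) e)))
        where
        H : ∀ {n} → (Fin n → Fin r′) → (Fin n → Fin r′) → Fin n → ℕ
        H f g i = ⟦ f i ≟ c′ x′ z′ ⟧ * ⟦ g i ≟ c′ z′ y′ ⟧
        found : (∃ λ i → H (λ i → φ (c x i)) (λ i → φ (c i y)) i ≢ 0) → ∃ λ z → Match x z x′ z′ × Match z y z′ y′
        found (i , hi) = i , sym (⟦⟧-≢0 (φ (c x i) ≟ c′ x′ z′) (*-≢0ˡ hi)) , sym (⟦⟧-≢0 (φ (c i y) ≟ c′ z′ y′) (*-≢0ʳ {⟦ φ (c x i) ≟ c′ x′ z′ ⟧} hi))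

      source-diag : ∀ {x z u} → Match x z u u → Match x x u u
      source-diag {x} {z} {u} h = let (w , p , q) = forth h x in
        subst (λ w → c′ u w ≡ φ (c x x)) (IsCC.diagUnion cc′ u w u (trans h (sym q))) p

      diagˡ : ∀ {x x′ y′} → Match x x x′ y′ → x′ ≡ y′
      diagˡ {x} {x′} {y′} h = let (z , p , _) = back h x′ in IsCC.diagUnion cc′ x′ x′ y′ (trans (source-diag p) (sym h))

      source : ∀ {x y x′ y′} → Match x y x′ y′ → Match x x x′ x′
      source {x} {x′ = x′} h = let (z′ , p , _) = forth h x in subst (λ w → c′ x′ w ≡ φ (c x x)) (sym (diagˡ p)) p

      flip : ∀ {x y x′ y′} → Match x y x′ y′ → Match y x y′ x′
      flip {x} {y} {x′} {y′} h = let (z′ , p , q) = forth (source h) y in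
        trans (IsCC.transp cc′ x′ y′ x′ z′ (trans h (sym p))) q

    similarity : Similarity Match
    similarity = record { sums = sums ; forth = forth ; back = back ; diagˡ = diagˡ ; source = source ; flip = flip }

-- Images of a circulant scheme and of its one-point extensions.

module Images where
  open Congruence
  open FiniteSums
  open SchurRings
  open import Data.Nat using (ℕ; NonZero)
  open import Data.Integer using (ℤ; +_; -_; _+_; _-_; 0ℤ)
  open import Data.Fin using (Fin)
  open import Data.Product using (∃; ∃₂; _×_)
  open import Relation.Binary.PropositionalEquality

  module _ {N : ℕ} .{{_ : NonZero N}} (A : SchurRing N) where
    open SchurRing A

    -- A coherent configuration on Fin m′ algebraically isomorphic to the circulant scheme of A:
    -- Col a x′ y′ says that (x′,y′) has the colour of the class of a.
    record Image (m′ : ℕ) : Set₁ where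
      field
        Col : ℤ → Fin m′ → Fin m′ → Set
        Col-~ : ∀ {a b x y} → a ~ b → Col a x y → Col b x y
        Col-injective : ∀ {a b x y} → Col a x y → Col b x y → a ~ b
        Col-total : ∀ x y → ∃ λ a → Col a x y
        Col-refl : ∀ x → Col 0ℤ x x
        Col-0 : ∀ {x y} → Col 0ℤ x y → x ≡ y
        Col-neg : ∀ {a x y} → Col a x y → Col (- a) y x
        Col-add : ∀ {a b x y z} → Col a x z → Col b z y → ∃₂ λ a′ b′ → a′ ~ a × b′ ~ b × Col (a′ + b′) x y
        Col-count : ∀ x (f : ℤ → ℕ) → Invariant f → (f′ : Fin m′ → ℕ) → (∀ a y → Col a x y → f a ≡ f′ y) → ∑ N f ≡ sum f′

    -- The one-point extensions at α and α′ with the algebraic isomorphism between them: U is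
    -- equality of colours in the first, T the correspondence of colours.
    record Extension {m′ : ℕ} (I : Image m′) (α : ℤ) (α′ : Fin m′) : Set₁ where
      open Image I
      field
        U : ℤ → ℤ → ℤ → ℤ → Set
        T : ℤ → ℤ → Fin m′ → Fin m′ → Set
        U-~ : ∀ {a b a′ b′} → U a b a′ b′ → b - a ~ b′ - a′
        U-step : ∀ {a b a′ b′} → U a b a′ b′ → ∀ z → ∃ λ z′ → U a z a′ z′ × U z b z′ b′
        U-diag : ∀ {a a′ b′} → U a a a′ b′ → a′ ≈ b′ mod + N
        U-left : ∀ {a b a′ b′} → U a b a′ b′ → U a α a′ α
        U-right : ∀ {a b a′ b′} → U a b a′ b′ → U α b α b′
        U-sum : ∀ {a b a′ b′} → U a b a′ b′ → (H H′ : ℤ → ℕ) → Periodic N H → Periodic N H′ →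
                (∀ i j → U a i a′ j → U i b j b′ → H i ≡ H′ j) → ∑ N H ≡ ∑ N H′
        T-U : ∀ {a b a′ b′ x y} → T a b x y → T a′ b′ x y → U a b a′ b′
        T-Col : ∀ {a b x y} → T a b x y → Col (b - a) x y
        T-base : T α α α′ α′
        T-forth : ∀ {a b x y} → T a b x y → ∀ z → ∃ λ z′ → T a z x z′ × T z b z′ y
        T-back : ∀ {a b x y} → T a b x y → ∀ z′ → ∃ λ z → T a z x z′ × T z b z′ y
        T-flip : ∀ {a b x y} → T a b x y → T b a y x

-- Discreteness of sections after individualising two points.

module Discrete where
  open Congruence
  open FiniteSums
  open SchurRings
  open Sections
  open Layers
  open PrimeSection
  open Images
  open import Data.Nat as ℕ using (ℕ; suc; NonZero)
  import Data.Nat.Properties as ℕ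
  open import Data.Nat.Primality using (Prime; prime⇒nonZero)
  open import Data.Integer as ℤ using (ℤ; +_; -_; _+_; _-_; _*_; 0ℤ; 1ℤ)
  import Data.Integer.Properties as ℤ
  open import Data.Integer.Divisibility.Signed using (_∣_; divides; _∣?_; ∣m∣n⇒∣m+n; ∣m⇒∣m*n; ∣m∣n⇒∣m-n; ∣-refl)
  open import Data.Integer.Tactic.RingSolver using (solve-∀)
  open import Data.Fin using (Fin)
  open import Data.Product using (∃; _×_; _,_)
  open import Data.Empty using (⊥-elim)
  open import Relation.Nullary using (¬_; Dec; yes; no)
  open import Relation.Binary.PropositionalEquality hiding ([_])
  open import Function using (_∘_)

  module Discreteness (p : ℕ) (pr : Prime p) (n : ℕ) .{{_ : NonZero (p ℕ.^ n)}} (A : SchurRing (p ℕ.^ n))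
                      {m′ : ℕ} (I : Image A m′) where
    open PrimePower p pr
    open SchurRing A
    open Filtration p pr n A
    open Image I

    module At {α : ℤ} {α′ : Fin m′} (X : Extension A I α α′) (s : ℕ) (closed-s : Closedₚ s) where
      open Extension X

      point : ℤ → ℤ
      point a = α + pow s * a

      private
        difference : ∀ a b → point b - point a ≡ pow s * (b - a)
        difference a b = lem α (pow s) a b
          where
          lem : ∀ α S a b → α + S * b - (α + S * a) ≡ S * (b - a)
          lem = solve-∀

      U-difference : ∀ {a b a′ b′} → U (point a) (point b) (point a′) (point b′) → pow s * (b - a) ~ pow s * (b′ - a′)
      U-difference {a} {b} {a′} {b′} h = subst₂ _~_ (difference a b) (difference a′ b′) (U-~ h)

      coset : ∀ {a a′ z z′} → U (point a) z (point a′) z′ → pow s ∣ z - α → pow s ∣ z′ - α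
      coset {a} {a′} {z} {z′} h d = subst (pow s ∣_) (lem z′ α (pow s * a′))
          (∣m∣n⇒∣m+n (closed-s (U-~ h) (subst (pow s ∣_) (lem′ z α (pow s * a)) (∣m∣n⇒∣m-n d (∣m⇒∣m*n a ∣-refl)))) (∣m⇒∣m*n a′ ∣-refl))
        where
        lem : ∀ z α b → z - (α + b) + b ≡ z - α
        lem = solve-∀
        lem′ : ∀ z α b → z - α - b ≡ z - (α + b)
        lem′ = solve-∀

      coordinate : ∀ {z} → pow s ∣ z - α → ∃ λ w → z ≡ point w
      coordinate {z} (divides q eq) = q , trans (lem z α) (cong (_+_ α) (trans eq (ℤ.*-comm q (pow s))))
        where
        lem : ∀ z α → z ≡ α + (z - α)
        lem = solve-∀

      point-∣ : ∀ a → pow s ∣ point a - α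
      point-∣ a = divides a (lem α (pow s) a)
        where
        lem : ∀ α S a → α + S * a - α ≡ a * S
        lem = solve-∀

      U-step-coset : ∀ {a b a′ b′} → U (point a) (point b) (point a′) (point b′) → ∀ z →
                     ∃ λ w → U (point a) (point z) (point a′) (point w) × U (point z) (point b) (point w) (point b′)
      U-step-coset {a} {b} {a′} {b′} h z =
        let (z′ , h₁ , h₂) = U-step h (point z)
        in place z′ h₁ h₂ (coordinate (coset {a} {a′} h₁ (point-∣ z)))
        where
        place : ∀ z′ → U (point a) (point z) (point a′) z′ → U (point z) (point b) z′ (point b′) → (∃ λ w → z′ ≡ point w) →
                ∃ λ w → U (point a) (point z) (point a′) (point w) × U (point z) (point b) (point w) (point b′)
        place z′ h₁ h₂ (w , refl) = w , h₁ , h₂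

      private
        point-0 : point 0ℤ ≡ α
        point-0 = lem α (pow s)
          where
          lem : ∀ α S → α + S * 0ℤ ≡ α
          lem = solve-∀

      U-left-coset : ∀ {a b a′ b′} → U (point a) (point b) (point a′) (point b′) → pow s * a ~ pow s * a′
      U-left-coset {a} {b} {a′} h = subst₂ _~_ (lem α (pow s) a) (lem α (pow s) a′) (~-neg (U-~ (U-left h)))
        where
        lem : ∀ α S a → - (α - (α + S * a)) ≡ S * a
        lem = solve-∀

      U-right-coset : ∀ {a b a′ b′} → U (point a) (point b) (point a′) (point b′) → pow s * b ~ pow s * b′
      U-right-coset {a} {b} {a′} {b′} h = subst₂ _~_ (lem α (pow s) b) (lem α (pow s) b′) (U-~ (U-right h))
        where
        lem : ∀ α S b → α + S * b - α ≡ S * b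
        lem = solve-∀

      Discrete : ℕ → Set
      Discrete t = ∀ {a b} → U (point 1ℤ) (point a) (point 1ℤ) (point b) → pow s * a ≈ pow s * b mod pow t

      -- `rigid` is applied to the relation of having the same colour as seen from the second point.
      -- Its fixed points 0 and 1 are the coordinates of α and of the second point, which are alone
      -- in their colours.
      cyclotomic-discrete : ∀ {t} → CyclotomicSection s t → Discrete t
      cyclotomic-discrete {t} C = C.rigid (λ a b → U (point 1ℤ) (point a) (point 1ℤ) (point b)) step fix0 fix1
        where
        module C = CyclotomicSection C
        mod-t : ∀ {a b} → a ≈ b mod pow n → a ≈ b mod pow t
        mod-t = ≈-coarsen (pow-∣ {t} {n} C.t≤n)
        l₁ : ∀ S a z → - (S * (a - z)) ≡ S * (z - a)
        l₁ = solve-∀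
        l₂ : ∀ S a → S * a ≡ S * a + 0ℤ
        l₂ = solve-∀
        step : ∀ {a b} → U (point 1ℤ) (point a) (point 1ℤ) (point b) → ∀ z →
               ∃ λ w → U (point 1ℤ) (point z) (point 1ℤ) (point w) × pow s * (z - a) ~[ t ] pow s * (w - b)
        step {a} {b} h z =
          let (w , h₁ , h₂) = U-step-coset h z
          in w , h₁ , 0ℤ , subst₂ _~_ (l₁ (pow s) a z) (trans (l₁ (pow s) b w) (trans (l₂ (pow s) (w - b))
               (cong (_+_ (pow s * (w - b))) (sym (ℤ.*-zeroʳ (pow t)))))) (~-neg (U-difference h₂))
        fix0 : ∀ {w} → U (point 1ℤ) (point 0ℤ) (point 1ℤ) (point w) → pow s * w ≈ 0ℤ mod pow t
        fix0 {w} h = mod-t (≈-trans (≈-reflexive (l₃ α (pow s) w))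
            (≈-trans (≈--ʳ α (≈-sym (U-diag (subst (λ z → U α z α (point w)) point-0 (U-right h))))) (≈-reflexive (ℤ.+-inverseʳ α))))
          where
          l₃ : ∀ α S w → S * w ≡ α + S * w - α
          l₃ = solve-∀
        fix1 : ∀ {w} → U (point 1ℤ) (point 1ℤ) (point 1ℤ) (point w) → pow s * w ≈ pow s mod pow t
        fix1 {w} h = mod-t (≈-trans (≈-reflexive (l₃ α (pow s) w)) (≈-trans (≈--ʳ α (≈-sym (U-diag h))) (≈-reflexive (l₄ α (pow s)))))
          where
          l₃ : ∀ α S w → S * w ≡ α + S * w - α
          l₃ = solve-∀
          l₄ : ∀ α S → α + S * 1ℤ - α ≡ S
          l₄ = solve-∀

      module _ (t≤n : suc s ℕ.≤ n) (closed-t : Closedₚ (suc s)) (other : ∃ λ b → ¬ P ∣ b × ¬ pow s * b ~[ suc s ] pow s) where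

        private
          closed-t′ : Closedₚ (s ℕ.+ 1)
          closed-t′ = subst Closedₚ (ℕ.+-comm 1 s) closed-t

          instance
            nz-1 : NonZero (p ℕ.^ 1)
            nz-1 = pow-nonZero 1
            nz-p : NonZero p
            nz-p = prime⇒nonZero pr
            nz-s : NonZero (p ℕ.^ s)
            nz-s = pow-nonZero s

          module S = Section s 0 (subst (ℕ._≤ n) (ℕ.+-comm 1 s) t≤n) closed-s closed-t′
          module B = SchurRing S.B

          to-B : ∀ {a b} → pow s * a ~ pow s * b → B._~_ a b
          to-B {a} {b} h = S.to-B (0ℤ , subst (pow s * a ~_) (trans (sym (ℤ.+-identityʳ (pow s * b))) (cong (_+_ (pow s * b)) (sym (ℤ.*-zeroʳ (pow (s ℕ.+ 1)))))) h)

          E : ℤ → ℤ → ℤ → ℤ → Set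
          E a b a′ b′ = U (point a) (point b) (point a′) (point b′)

          size : p ℕ.^ n ≡ p ℕ.^ (n ℕ.∸ suc s) ℕ.* p ℕ.* p ℕ.^ s
          size = trans (cong (p ℕ.^_) (sym (ℕ.m∸n+n≡m t≤n))) (trans (ℕ.^-distribˡ-+-* p (n ℕ.∸ suc s) (suc s))
            (sym (ℕ.*-assoc (p ℕ.^ (n ℕ.∸ suc s)) p (p ℕ.^ s))))

          open Multiples (p ℕ.^ s)

          -- Functions modulo p become functions on the whole group supported on the coset of α, to
          -- which `U-sum` applies; the factor p^(n-s-1) that appears in `spread-sum` is cancelled
          -- in `E-sum`.
          spread : (ℤ → ℕ) → ℤ → ℕ
          spread f x = extend f (x - α)

          spread-periodic : ∀ f → (∀ {z z′} → z ≈ z′ mod P → f z ≡ f z′) → Periodic (p ℕ.^ n) (spread f)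
          spread-periodic f per {x} {y} x≈y = cases (pow s ∣? (x - α)) (pow s ∣? (y - α))
            where
            x≈y′ : x - α ≈ y - α mod pow (suc s)
            x≈y′ = ≈-coarsen (pow-∣ {suc s} {n} t≤n) (≈--ʳ α x≈y)
            x≈y-s : x - α ≈ y - α mod pow s
            x≈y-s = ≈-coarsen (pow-∣ {s} {suc s} (ℕ.n≤1+n s)) x≈y′
            cases : Dec (pow s ∣ x - α) → Dec (pow s ∣ y - α) → spread f x ≡ spread f y
            cases (no h) (no h′) = trans (extend-no f h) (sym (extend-no f h′))
            cases (yes d) (no h′) = ⊥-elim (h′ (∣-resp-≈ (≈-sym x≈y-s) d))
            cases (no h) (yes d) = ⊥-elim (h (∣-resp-≈ x≈y-s d))
            cases (yes (divides q e)) (yes (divides q′ e′)) = trans (cong (extend f) (trans e (ℤ.*-comm q (pow s)))) (trans (extend-yes f q)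
              (trans (per (≈-unscale {P} {q} {q′} (pow s) (subst₂ (λ u D → u ≈ pow s * q′ mod D) (trans e (ℤ.*-comm q (pow s)))
                  (trans (pow-suc s) (ℤ.*-comm P (pow s))) (≈-trans x≈y′ (≈-reflexive (trans e′ (ℤ.*-comm q′ (pow s))))))))
                (sym (trans (cong (extend f) (trans e′ (ℤ.*-comm q′ (pow s)))) (extend-yes f q′)))))

          spread-sum : ∀ f → (∀ {z z′} → z ≈ z′ mod P → f z ≡ f z′) → ∑ (p ℕ.^ n) (spread f) ≡ p ℕ.^ (n ℕ.∸ suc s) ℕ.* ∑ p f
          spread-sum f per = trans (∑-reindex (p ℕ.^ n) (λ x → x - α) (λ x → x + α)
              (λ {a} {b} h → trans (cong (extend f) (l₁ a α)) (trans (spread-periodic f per {a + α} {b + α} (≈-+ʳ α h)) (cong (extend f) (sym (l₁ b α)))))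
              (≈--ʳ α) (≈-+ʳ α) (λ a → ≈-reflexive (sym (l₁ a α))) (λ a → ≈-reflexive (l₂ a α)) (λ a → refl))
            (trans (sum-multiples {p ℕ.^ n} {p ℕ.^ (n ℕ.∸ suc s) ℕ.* p} size (extend f) (λ x h → extend-no f h))
              (trans (∑-cong (p ℕ.^ (n ℕ.∸ suc s) ℕ.* p) (extend-yes f)) (∑-periodic (p ℕ.^ (n ℕ.∸ suc s)) p per)))
            where
            l₁ : ∀ a α → a ≡ a + α - α
            l₁ = solve-∀
            l₂ : ∀ a α → a - α + α ≡ a
            l₂ = solve-∀

          spread-point : ∀ f z → spread f (point z) ≡ f z
          spread-point f z = trans (cong (extend f) (lem α (pow s) z)) (extend-yes f z)
            where
            lem : ∀ α S z → α + S * z - α ≡ S * z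
            lem = solve-∀

          E-sum : ∀ (F G : ℤ → ℤ → ℕ) → (∀ {a z z′} → z ≈ z′ mod + p → F a z ≡ F a z′) → (∀ {b z z′} → z ≈ z′ mod + p → G z b ≡ G z′ b) →
            (∀ {a b a′ b′} → E a b a′ b′ → F a b ≡ F a′ b′) → (∀ {a b a′ b′} → E a b a′ b′ → G a b ≡ G a′ b′) →
            ∀ {a b a′ b′} → E a b a′ b′ → ∑ p (λ z → F a z ℕ.* G z b) ≡ ∑ p (λ z → F a′ z ℕ.* G z b′)
          E-sum F G Fper Gper Finv Ginv {a} {b} {a′} {b′} h = ℕ.*-cancelˡ-≡ (∑ p (f a b)) (∑ p (f a′ b′)) (p ℕ.^ (n ℕ.∸ suc s)) {{pow-nonZero (n ℕ.∸ suc s)}}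
              (trans (sym (spread-sum (f a b) (f-per a b))) (trans (U-sum h (spread (f a b)) (spread (f a′ b′))
                (spread-periodic (f a b) (f-per a b)) (spread-periodic (f a′ b′) (f-per a′ b′)) same) (spread-sum (f a′ b′) (f-per a′ b′))))
            where
            f : ℤ → ℤ → ℤ → ℕ
            f a b z = F a z ℕ.* G z b
            f-per : ∀ a b {z z′} → z ≈ z′ mod P → f a b z ≡ f a b z′
            f-per a b e = cong₂ ℕ._*_ (Fper e) (Gper e)
            same : ∀ i j → U (point a) i (point a′) j → U i (point b) j (point b′) → spread (f a b) i ≡ spread (f a′ b′) j
            same i j h₁ h₂ = cases (pow s ∣? (i - α)) (pow s ∣? (j - α))
              where
              reverse : pow s ∣ j - α → pow s ∣ i - α
              reverse d = subst (pow s ∣_) (l₁ i α (pow s * a)) (∣m∣n⇒∣m+n (closed-s (~-sym (U-~ h₁))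
                  (subst (pow s ∣_) (l₂ j α (pow s * a′)) (∣m∣n⇒∣m-n d (∣m⇒∣m*n a′ ∣-refl)))) (∣m⇒∣m*n a ∣-refl))
                where
                l₁ : ∀ z α b → z - (α + b) + b ≡ z - α
                l₁ = solve-∀
                l₂ : ∀ z α b → z - α - b ≡ z - (α + b)
                l₂ = solve-∀
              both : ∀ q q′ → i ≡ point q → j ≡ point q′ → spread (f a b) i ≡ spread (f a′ b′) j
              both q q′ refl refl = trans (spread-point (f a b) q) (trans (cong₂ ℕ._*_ (Finv h₁) (Ginv h₂)) (sym (spread-point (f a′ b′) q′)))
              cases : Dec (pow s ∣ i - α) → Dec (pow s ∣ j - α) → spread (f a b) i ≡ spread (f a′ b′) j
              cases (no h) (no h′) = trans (extend-no (f a b) h) (sym (extend-no (f a′ b′) h′))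
              cases (yes d) (no h′) = ⊥-elim (h′ (coset {a} {a′} h₁ d))
              cases (no h) (yes d) = ⊥-elim (h (reverse d))
              cases (yes d) (yes d′) = let (q , e) = coordinate d ; (q′ , e′) = coordinate d′ in both q q′ e e′

          1ℤ-B : ∀ {b} → B._~_ b 1ℤ → pow s * b ~[ suc s ] pow s
          1ℤ-B {b} h = subst₂ (λ x t → pow s * b ~[ t ] x) (ℤ.*-identityʳ (pow s)) (ℕ.+-comm s 1) (S.from-B h)

          mod-1 : ∀ {a b} → a ≈ b mod P → a ≈ b mod pow 1
          mod-1 {a} {b} = subst (λ D → a ≈ b mod D) (sym pow-1)

        -- `Separation`, with α and α + p^s in the roles of the points 0 and 1.
        prime-discrete : Discrete (suc s)
        prime-discrete {a} {b} h = subst (λ D → pow s * a ≈ pow s * b mod D) (trans (ℤ.*-comm (pow s) P) (sym (pow-suc s)))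
          (≈-scale (pow s) (Separation.discrete p pr B._~_ B._~?_ B.~-sym (λ {a} {b} {c} → B.~-trans {a} {b} {c}) (B.≈⇒~ ∘ mod-1)
            (λ {x} {y} x~y d → subst (_∣ y) pow-1 (≈0⇒∣ (B.~0⇒≈0 (B.~-≈ (B.~-sym x~y) (mod-1 (∣⇒≈0 d))))))
            (Multipliers.~-multiplier p pr {1} S.B)
            (let (b , nb , n~) = other in b , nb , n~ ∘ 1ℤ-B)
            E (to-B ∘ U-difference) (to-B ∘ U-left-coset) (to-B ∘ U-right-coset) U-step-coset E-sum h))

-- Isomorphisms between cosets modulo a smaller subgroup.

module CosetIsomorphisms where
  open Congruence
  open SchurRings
  open ClassStructure
  open Sections
  open Layers
  open Images
  open Discrete
  open import Data.Nat as ℕ using (ℕ; NonZero)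
  import Data.Nat.Properties as ℕ
  open import Data.Nat.Primality using (Prime)
  open import Data.Integer as ℤ using (ℤ; +_; -_; _+_; _-_; _*_; 0ℤ; 1ℤ)
  import Data.Integer.Properties as ℤ
  open import Data.Integer.Divisibility.Signed using (_∣_; divides; ∣m∣n⇒∣m+n; ∣m⇒∣m*n; ∣-refl)
  open import Data.Integer.Tactic.RingSolver using (solve-∀)
  open import Data.Fin using (Fin)
  open import Data.Product using (∃; ∃₂; _×_; _,_; proj₂)
  open import Relation.Binary.PropositionalEquality hiding ([_])

  module Cosets (p : ℕ) (pr : Prime p) (n : ℕ) .{{_ : NonZero (p ℕ.^ n)}} (A : SchurRing (p ℕ.^ n))
                {m′ : ℕ} (I : Image A m′) where
    open PrimePower p pr
    open PrimePowerUnits p pr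
    open SchurRing A
    open Filtration p pr n A
    open Image I

    -- The image has no group structure, so congruence modulo p^t is expressed by shifting the
    -- colour, here and in `Near`.
    record ColMod (t : ℕ) (a : ℤ) (x y : Fin m′) : Set where
      constructor col-mod
      field
        shift : ℤ
        col : Col (a + pow t * shift) x y

    record Near (t : ℕ) (x y : Fin m′) : Set where
      constructor near
      field
        multiple : ℤ
        col : Col (pow t * multiple) x y

    module Quot {t : ℕ} (closed-t : Closedₚ t) where

      ~[]-sym : ∀ {a b} → a ~[ t ] b → b ~[ t ] a
      ~[]-sym {a} {b} (r , h) = let (r′ , e) = coset-shift A closed-t (~-sym h) (- r) in r′ , subst (_~ a + pow t * r′) (lem b (pow t) r) e
        where
        lem : ∀ b K r → b + K * r + K * - r ≡ b
        lem = solve-∀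

      ~[]-trans : ∀ {a b c} → a ~[ t ] b → b ~[ t ] c → a ~[ t ] c
      ~[]-trans {a} {b} {c} (r , h) (r′ , h′) = let (r″ , e) = coset-shift A closed-t h′ r
        in r′ + r″ , ~-trans h (subst (b + pow t * r ~_) (lem c (pow t) r′ r″) e)
        where
        lem : ∀ c K r s → c + K * r + K * s ≡ c + K * (r + s)
        lem = solve-∀

      ~⇒~[] : ∀ {a b} → a ~ b → a ~[ t ] b
      ~⇒~[] {a} {b} h = 0ℤ , subst (a ~_) (lem b (pow t)) h
        where
        lem : ∀ b K → b ≡ b + K * 0ℤ
        lem = solve-∀

      ≈⇒~[] : ∀ {a b} → a ≈ b mod pow t → a ~[ t ] b
      ≈⇒~[] {a} {b} (mod-by q eq) = q , ~-reflexive (trans eq (cong (_+_ b) (ℤ.*-comm q (pow t))))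

      Colₜ : ℤ → Fin m′ → Fin m′ → Set
      Colₜ = ColMod t

      Colₜ-~ : ∀ {a b x y} → a ~[ t ] b → Colₜ a x y → Colₜ b x y
      Colₜ-~ {a} {b} (r , h) (col-mod r′ col) = let (r″ , e) = coset-shift A closed-t h r′
        in col-mod (r + r″) (Col-~ (subst (a + pow t * r′ ~_) (lem b (pow t) r r″) e) col)
        where
        lem : ∀ c K r s → c + K * r + K * s ≡ c + K * (r + s)
        lem = solve-∀

      Col⇒Colₜ : ∀ {a x y} → Col a x y → Colₜ a x y
      Col⇒Colₜ {a} h = col-mod 0ℤ (Col-~ (~-reflexive (lem a (pow t))) h)
        where
        lem : ∀ b K → b ≡ b + K * 0ℤ
        lem = solve-∀

      Colₜ-neg : ∀ {a x y} → Colₜ a x y → Colₜ (- a) y x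
      Colₜ-neg {a} (col-mod r h) = col-mod (- r) (Col-~ (~-reflexive (lem a (pow t) r)) (Col-neg h))
        where
        lem : ∀ b K r → - (b + K * r) ≡ - b + K * - r
        lem = solve-∀

      Colₜ-injective : ∀ {a b x y} → Colₜ a x y → Colₜ b x y → a ~[ t ] b
      Colₜ-injective {a} {b} (col-mod r h) (col-mod r′ h′) =
        let (r″ , e) = coset-shift A closed-t (Col-injective h h′) (- r)
        in r′ + r″ , subst₂ _~_ (l₁ a (pow t) r) (l₂ b (pow t) r′ r″) e
        where
        l₁ : ∀ b K r → b + K * r + K * - r ≡ b
        l₁ = solve-∀
        l₂ : ∀ c K r s → c + K * r + K * s ≡ c + K * (r + s)
        l₂ = solve-∀

      near-refl : ∀ x → Near t x x
      near-refl x = near 0ℤ (Col-~ (~-reflexive (sym (ℤ.*-zeroʳ (pow t)))) (Col-refl x))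

      near-sym : ∀ {x y} → Near t x y → Near t y x
      near-sym (near r h) = near (- r) (Col-~ (~-reflexive (ℤ.neg-distribʳ-* (pow t) r)) (Col-neg h))

      ∣⇒Near : ∀ {a x y} → pow t ∣ a → Col a x y → Near t x y
      ∣⇒Near (divides q eq) h = near q (Col-~ (~-reflexive (trans eq (ℤ.*-comm q (pow t)))) h)

      Near⇒∣ : ∀ {a x y} → Near t x y → Col a x y → pow t ∣ a
      Near⇒∣ (near r h) h′ = closed-t (Col-injective h h′) (∣m⇒∣m*n r ∣-refl)

      near-trans : ∀ {x y z} → Near t x y → Near t y z → Near t x z
      near-trans (near r h) (near r′ h′) = let (a , b , a~ , b~ , col) = Col-add h h′
        in ∣⇒Near (∣m∣n⇒∣m+n (closed-t (~-sym a~) (∣m⇒∣m*n r ∣-refl)) (closed-t (~-sym b~) (∣m⇒∣m*n r′ ∣-refl))) col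

      Colₜ-nearʳ : ∀ {a x y z} → Colₜ a x y → Near t y z → Colₜ a x z
      Colₜ-nearʳ {a} {x} {y} {z} (col-mod r h) (near r′ h′) = let (a′ , b′ , a~ , b~ , col) = Col-add h h′
        in place a′ b′ a~ col (closed-t (~-sym b~) (∣m⇒∣m*n r′ ∣-refl))
        where
        lem : ∀ c K r s → c + K * r + K * s ≡ c + K * (r + s)
        lem = solve-∀
        place : ∀ a′ b′ → a′ ~ a + pow t * r → Col (a′ + b′) x z → pow t ∣ b′ → Colₜ a x z
        place a′ b′ a~ col (divides q eq) = let (r″ , e) = coset-shift A closed-t a~ q
          in col-mod (r + r″) (Col-~ (~-trans (~-reflexive (cong (_+_ a′) (trans eq (ℤ.*-comm q (pow t))))) (subst (a′ + pow t * q ~_) (lem a (pow t) r r″) e)) col)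

      Colₜ-nearˡ : ∀ {a x y z} → Near t x z → Colₜ a x y → Colₜ a z y
      Colₜ-nearˡ {a} {x} {y} {z} nr h = subst (λ b → Colₜ b z y) (ℤ.neg-involutive a) (Colₜ-neg (Colₜ-nearʳ (Colₜ-neg h) nr))

      ∣⇒Near-Colₜ : ∀ {a x y} → pow t ∣ a → Colₜ a x y → Near t x y
      ∣⇒Near-Colₜ d (col-mod r h) = ∣⇒Near (∣m∣n⇒∣m+n d (∣m⇒∣m*n r ∣-refl)) h

      Near⇒Colₜ : ∀ {a x y} → pow t ∣ a → Near t x y → Colₜ a x y
      Near⇒Colₜ {a} {x} {y} (divides q eq) (near r h) = col-mod (r - q) (Col-~ (~-reflexive (trans (lem (pow t) q r) (cong (_+ pow t * (r - q)) (sym eq)))) h)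
        where
        lem : ∀ K q r → K * r ≡ q * K + K * (r - q)
        lem = solve-∀

    near-coarsen : ∀ {s t x y} → s ℕ.≤ t → Near t x y → Near s x y
    near-coarsen {s} {t} s≤t (near r h) = let (d , e , _) = complement s≤t in near (pow d * r) (Col-~ (~-reflexive (trans (cong (_* r) e) (lem (pow d) (pow s) r))) h)
      where
      lem : ∀ D S r → D * S * r ≡ S * (D * r)
      lem = solve-∀

    -- An isomorphism, given by its graph, from the coset α + p^s to the class of α′ modulo p^s,
    -- both taken modulo p^t.
    record PartialIso (s t : ℕ) (α : ℤ) (α′ : Fin m′) (ρ : ℤ → Fin m′ → Set) : Set where
      field
        inside : ∀ {y y′} → ρ y y′ → ∃ λ a → y ≡ α + pow s * a
        inside′ : ∀ {y y′} → ρ y y′ → Near s α′ y′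
        total : ∀ a → ∃ λ y′ → ρ (α + pow s * a) y′
        onto : ∀ {y′} → Near s α′ y′ → ∃ λ y → ρ y y′
        iso : ∀ {y z y′ z′} → ρ y y′ → ρ z z′ → ColMod t (z - y) y′ z′

    -- A saturated graph is a union of products of cosets of p^t, so that membership depends only on
    -- positions modulo p^t.
    record Saturated (t : ℕ) (ρ : ℤ → Fin m′ → Set) : Set where
      field
        satˡ : ∀ {y z y′} → ρ y y′ → y ≈ z mod pow t → ρ z y′
        satʳ : ∀ {y y′ z′} → ρ y y′ → Near t y′ z′ → ρ y z′

    Saturation : ℕ → (ℤ → Fin m′ → Set) → ℤ → Fin m′ → Set
    Saturation t ρ y y′ = ∃₂ λ z z′ → ρ z z′ × z ≈ y mod pow t × Near t z′ y′

    module _ {s t : ℕ} (s≤t : s ℕ.≤ t) (closed-s : Closedₚ s) (closed-t : Closedₚ t) where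
      private
        module Q = Quot {t} closed-t
        module S = Quot {s} closed-s

      saturated : ∀ ρ → Saturated t (Saturation t ρ)
      saturated ρ = record
        { satˡ = λ (z , z′ , h , e , nr) e′ → z , z′ , h , ≈-trans e e′ , nr
        ; satʳ = λ (z , z′ , h , e , nr) nr′ → z , z′ , h , e , Q.near-trans nr nr′ }

      module _ {α : ℤ} {α′ : Fin m′} {ρ : ℤ → Fin m′ → Set} (R : PartialIso s t α α′ ρ) where
        open PartialIso R

        saturate : PartialIso s t α α′ (Saturation t ρ)
        saturate = record
          { inside = λ {y} (z , z′ , h , mod-by q eq , nr) → let (a , e) = inside h ; (d , t≡ , _) = complement s≤t in
              a - q * pow d , place y a q (pow d) t≡ (trans (sym e) eq)
          ; inside′ = λ (z , z′ , h , e , nr) → S.near-trans (inside′ h) (near-coarsen s≤t nr)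
          ; total = λ a → let (y′ , h) = total a in y′ , _ , y′ , h , ≈-refl , Q.near-refl y′
          ; onto = λ {y′} nr → let (y , h) = onto nr in y , y , y′ , h , ≈-refl , Q.near-refl y′
          ; iso = λ (w , w′ , h , e , nr) (v , v′ , h′ , e′ , nr′) →
              Q.Colₜ-~ (Q.≈⇒~[] (≈-- e′ e)) (Q.Colₜ-nearʳ (Q.Colₜ-nearˡ nr (iso h h′)) nr′) }
          where
          place : ∀ y a q D → pow t ≡ D * pow s → α + pow s * a ≡ y + q * pow t → y ≡ α + pow s * (a - q * D)
          place y a q D t≡ eq = trans (l₁ y (q * pow t)) (trans (cong (_- q * pow t) (sym eq)) (trans (cong (λ T → α + pow s * a - q * T) t≡) (l₂ α (pow s) a q D)))
            where
            l₁ : ∀ y x → y ≡ y + x - x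
            l₁ = solve-∀
            l₂ : ∀ α S a q D → α + S * a - q * (D * S) ≡ α + S * (a - q * D)
            l₂ = solve-∀

        functional : ∀ {y y′ z′} → ρ y y′ → ρ y z′ → Near t y′ z′
        functional {y} h h′ = Q.∣⇒Near-Colₜ (divides 0ℤ (trans (ℤ.+-inverseʳ y) (sym (ℤ.*-zeroˡ (pow t))))) (iso h h′)

        module _ {u : ℕ} (s≤u : s ℕ.≤ u) (u≤t : u ℕ.≤ t) (closed-u : Closedₚ u) {β : ℤ} {β′ : Fin m′} (h₀ : ρ β β′) where

          restrict : PartialIso u t β β′ (λ y y′ → ρ y y′ × ∃ λ a → y ≡ β + pow u * a)
          restrict = record
            { inside = proj₂
            ; inside′ = λ (h , a , e) → V.∣⇒Near (∣m∣n⇒∣m+n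
                (divides a (trans (cong (_- β) e) (l₁ β (pow u) a))) (∣m⇒∣m*n (ColMod.shift (iso h₀ h)) (pow-∣ u≤t))) (ColMod.col (iso h₀ h))
            ; total = λ a → let (b , e) = inside h₀ ; (d , u≡ , _) = complement s≤u ; (y′ , h) = total (b + pow d * a)
                in y′ , subst (λ y → ρ y y′) (place a b (pow d) e u≡) h , a , refl
            ; onto = λ nr → let (y , h) = onto (S.near-trans (inside′ h₀) (near-coarsen s≤u nr))
                in y , h , coordinate y (ColMod.shift (iso h₀ h)) (V.Near⇒∣ nr (ColMod.col (iso h₀ h)))
            ; iso = λ (h , _) (h′ , _) → iso h h′ }
            where
            module V = Quot {u} closed-u
            l₁ : ∀ β U a → β + U * a - β ≡ a * U
            l₁ = solve-∀
            place : ∀ a b D → β ≡ α + pow s * b → pow u ≡ D * pow s → α + pow s * (b + D * a) ≡ β + pow u * a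
            place a b D e u≡ = trans (l₂ α (pow s) b D a) (cong₂ (λ x U → x + U * a) (sym e) (sym u≡))
              where
              l₂ : ∀ α S b D a → α + S * (b + D * a) ≡ α + S * b + D * S * a
              l₂ = solve-∀
            coordinate : ∀ y r → pow u ∣ y - β + pow t * r → ∃ λ a → y ≡ β + pow u * a
            coordinate y r (divides q eq) = let (d , t≡ , _) = complement u≤t in
                q - pow d * r , trans (l₃ y β (pow t * r)) (trans (cong (λ x → β + x - pow t * r) eq) (trans (cong (λ T → β + q * pow u - T * r) t≡) (l₄ β q (pow u) (pow d) r)))
              where
              l₃ : ∀ y β x → y ≡ β + (y - β + x) - x
              l₃ = solve-∀
              l₄ : ∀ β q U D r → β + q * U - D * U * r ≡ β + U * (q - D * r)
              l₄ = solve-∀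

    -- The image of y is to look from g′, the image of the second point α + p^s, as y looks from
    -- that point. Discreteness makes this well defined modulo p^t.
    module FromExtension {α : ℤ} {α′ : Fin m′} (X : Extension A I α α′) {s t : ℕ} (closed-s : Closedₚ s) (closed-t : Closedₚ t)
                         (discrete : Discreteness.At.Discrete p pr n A I X s closed-s t)
                         {g′ : Fin m′} (base : Extension.T X (α + pow s * 1ℤ) α g′ α′) where
      open Extension X
      open Discreteness.At p pr n A I X s closed-s
      private
        module Q = Quot {t} closed-t
        module S = Quot {s} closed-s

      graph : ℤ → Fin m′ → Set
      graph y y′ = T (point 1ℤ) y g′ y′ × ∃ λ a → y ≡ point a

      private
        near-base : Near s α′ g′
        near-base = S.∣⇒Near (point-∣ 1ℤ) (T-Col (T-flip base))

        -- Transporting z″ back gives a point w with the same colour as z from the second point.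
        -- `discrete` puts w into the coset of z modulo p^t, and the colour of (w , z) is carried to
        -- (z″ , z′).
        agree : ∀ {z z′ z″} → graph z z′ → T (point 1ℤ) z g′ z″ → Near t z″ z′
        agree {z} {z′} {z″} (h , a , refl) h″ = let (w , h₁ , h₂) = T-back h z″
          in place w h₁ h₂ (coordinate (coset {1ℤ} {1ℤ} (T-U h″ h₁) (point-∣ a)))
          where
          lem : ∀ α A B → α + A - (α + B) ≡ A - B
          lem = solve-∀
          place : ∀ w → T (point 1ℤ) w g′ z″ → T w (point a) z″ z′ → (∃ λ b → w ≡ point b) → Near t z″ z′
          place w h₁ h₂ (b , refl) = Q.∣⇒Near (subst (pow t ∣_) (sym (lem α (pow s * a) (pow s * b))) (≈⇒∣ (discrete {a} {b} (T-U h″ h₁)))) (T-Col h₂)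

      partialIso : PartialIso s t α α′ graph
      partialIso = record
        { inside = proj₂
        ; inside′ = λ (h , a , e) → S.near-trans near-base (S.∣⇒Near (divides (a - 1ℤ) (trans (cong (_- point 1ℤ) e) (l₁ α (pow s) a))) (T-Col h))
        ; total = λ a → let (z′ , h , _) = T-forth base (point a) in z′ , h , a , refl
        ; onto = λ {y′} nr → let (z , h₁ , h₂) = T-back base y′ in z , h₁ , coordinate (S.Near⇒∣ nr (T-Col (T-flip h₂)))
        ; iso = λ {y} {z} {y′} {z′} (h , _) h′ → let (z″ , h₁ , h₂) = T-forth h z
            in Q.Colₜ-nearʳ (Q.Col⇒Colₜ (T-Col (T-flip h₂))) (agree h′ h₁) }
        where
        l₁ : ∀ α S a → α + S * a - (α + S * 1ℤ) ≡ (a - 1ℤ) * S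
        l₁ = solve-∀

    -- Precomposition with multiplication by ι about β.
    module Twist {s t : ℕ} (s≤t : s ℕ.≤ t) (closed-s : Closedₚ s) (closed-t : Closedₚ t) {β : ℤ} {β′ : Fin m′} {ρ : ℤ → Fin m′ → Set}
                 (R : PartialIso s t β β′ ρ) (Rs : Saturated t ρ) (t≤n : t ℕ.≤ n)
                 (κ ι : ℤ) (κι≈1 : κ * ι ≈ 1ℤ mod pow n) (orbit : ∀ a → pow s * (ι * a) ~[ t ] pow s * a) where
      open PartialIso R
      open Saturated Rs
      private
        module Q = Quot {t} closed-t

      twisted : ℤ → Fin m′ → Set
      twisted y y′ = ∃ λ x → y ≡ β + pow s * x × ρ (β + pow s * (ι * x)) y′

      private
        mod-t : ∀ {a b} → a ≈ b mod pow n → a ≈ b mod pow t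
        mod-t = ≈-coarsen (pow-∣ {t} {n} t≤n)

        scaled : ∀ {x x′} → β + pow s * x ≈ β + pow s * x′ mod pow t → β + pow s * (ι * x) ≈ β + pow s * (ι * x′) mod pow t
        scaled {x} {x′} h = subst₂ (λ a b → a ≈ b mod pow t) (l₁ ι β (pow s) x) (l₁ ι β (pow s) x′) (≈-+ʳ (β - ι * β) (≈-*ˡ ι h))
          where
          l₁ : ∀ ι β S x → ι * (β + S * x) + (β - ι * β) ≡ β + S * (ι * x)
          l₁ = solve-∀

        ικ : ∀ a → β + pow s * (ι * (κ * a)) ≈ β + pow s * a mod pow t
        ικ a = ≈-+ˡ β (≈-*ˡ (pow s) (mod-t (≈-trans (≈-reflexive (l₁ ι κ a)) (≈-trans (≈-*ʳ a κι≈1) (≈-reflexive (ℤ.*-identityˡ a))))))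
          where
          l₁ : ∀ ι κ a → ι * (κ * a) ≡ κ * ι * a
          l₁ = solve-∀

      twistedIso : PartialIso s t β β′ twisted
      twistedIso = record
        { inside = λ (x , e , _) → x , e
        ; inside′ = λ (x , e , h) → inside′ h
        ; total = λ a → let (y′ , h) = total (ι * a) in y′ , a , refl , h
        ; onto = λ {y′} nr → let (y , h) = onto nr in place y h (inside h)
        ; iso = λ (x , e , h) (x′ , e′ , h′) → Q.Colₜ-~ (move x x′ e e′) (iso h h′) }
        where
        place : ∀ y {y′} → ρ y y′ → (∃ λ a → y ≡ β + pow s * a) → ∃ λ z → twisted z y′
        place y h (a , refl) = β + pow s * (κ * a) , κ * a , refl , satˡ h (≈-sym (ικ a))
        l₁ : ∀ β S ι x x′ → β + S * (ι * x′) - (β + S * (ι * x)) ≡ S * (ι * (x′ - x))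
        l₁ = solve-∀
        l₂ : ∀ β S x x′ → S * (x′ - x) ≡ β + S * x′ - (β + S * x)
        l₂ = solve-∀
        move : ∀ {y z} x x′ → y ≡ β + pow s * x → z ≡ β + pow s * x′ → β + pow s * (ι * x′) - (β + pow s * (ι * x)) ~[ t ] z - y
        move x x′ refl refl = subst₂ (λ a b → a ~[ t ] b) (sym (l₁ β (pow s) ι x x′)) (l₂ β (pow s) x x′) (orbit (x′ - x))

      twistedSaturated : Saturated t twisted
      twistedSaturated = record
        { satˡ = λ {y} {z} (x , e , h) (mod-by q eq) → let (d , t≡ , _) = complement s≤t in
            lift z x (pow d) q t≡ (trans (sym e) eq) h
        ; satʳ = λ (x , e , h) nr → x , e , satʳ h nr }
        where
        lift : ∀ z {y′} x D q → pow t ≡ D * pow s → β + pow s * x ≡ z + q * pow t → ρ (β + pow s * (ι * x)) y′ → twisted z y′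
        lift z {y′} x D q t≡ eq h = x - q * D , z≡ , satˡ h (scaled (≈-trans (mod-by q eq) (≈-reflexive z≡)))
          where
          l₁ : ∀ y x → y ≡ y + x - x
          l₁ = solve-∀
          l₂ : ∀ α S a q D → α + S * a - q * (D * S) ≡ α + S * (a - q * D)
          l₂ = solve-∀
          z≡ : z ≡ β + pow s * (x - q * D)
          z≡ = trans (l₁ z (q * pow t)) (trans (cong (_- q * pow t) (sym eq)) (trans (cong (λ T → β + pow s * x - q * T) t≡) (l₂ β (pow s) x q D)))

-- Gluing of isomorphisms, and sections with one nonzero class.

module Gluing where
  open Congruence
  open FiniteSums
  open SchurRings
  open ClassStructure
  open Sections
  open Layers
  open Images
  open CosetIsomorphisms
  open import Data.Nat as ℕ using (ℕ; zero; suc; NonZero)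
  import Data.Nat.Properties as ℕ
  open import Data.Nat.Primality using (Prime)
  open import Data.Integer as ℤ using (ℤ; +_; -_; _+_; _-_; _*_)
  import Data.Integer.Properties as ℤ
  open import Data.Integer.Divisibility.Signed using (_∣_; _∣?_; ∣m∣n⇒∣m+n; ∣m⇒∣m*n; ∣-refl; *-cancelˡ-∣; *-monoʳ-∣)
  open import Data.Integer.Tactic.RingSolver using (solve-∀)
  open import Data.Fin using (Fin; zero; suc; toℕ; _≟_)
  open import Data.Fin.Properties using (any?; suc-injective)
  open import Data.Product using (∃; Σ; _×_; _,_; proj₁; proj₂)
  open import Data.Empty using (⊥; ⊥-elim)
  open import Relation.Nullary using (¬_; Dec; yes; no)
  open import Relation.Nullary.Decidable using (map′; _×-dec_; ¬?; decidable-stable)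
  open import Relation.Binary.PropositionalEquality hiding ([_])
  open import Function using (_∘_)

  module GluingLemmas (p : ℕ) (pr : Prime p) (n : ℕ) .{{_ : NonZero (p ℕ.^ n)}} (A : SchurRing (p ℕ.^ n))
                      {m′ : ℕ} (I : Image A m′) where
    open PrimePower p pr
    open PrimePowerUnits p pr
    open SchurRing A
    open Filtration p pr n A
    open Image I
    open Cosets p pr n A I

    Lift : ℕ → ℤ → Fin m′ → (ℤ → Fin m′ → Set) → Set₁
    Lift s α α′ ρ₁ = Σ (ℤ → Fin m′ → Set) λ ρ → PartialIso s n α α′ ρ × (∀ {y y′} → ρ y y′ → ρ₁ y y′)

    module Glue {s next t : ℕ} (s<next : s ℕ.< next) (next≤t : next ℕ.≤ t)
                (closed-s : Closedₚ s) (closed-next : Closedₚ next)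
                (periodic : ∀ b → ¬ pow next ∣ pow s * b → ∀ x r → x ~ pow s * b → x + pow t * r ~ pow s * b)
                {α : ℤ} {α′ : Fin m′} {ρ₁ : ℤ → Fin m′ → Set} (R : PartialIso s t α α′ ρ₁)
                (sub : ∀ {β β′} → ρ₁ β β′ → Lift next β β′ ρ₁) where
      open PartialIso R

      private
        s≤next : s ℕ.≤ next
        s≤next = ℕ.<⇒≤ s<next

        d : ℕ
        d = proj₁ (complement s≤next)

        next≡ : pow next ≡ pow d * pow s
        next≡ = proj₁ (proj₂ (complement s≤next))

        instance
          nz : NonZero (p ℕ.^ d)
          nz = pow-nonZero d

        module V = Quot {next} closed-next
        module N = Quot {n} closed-n

        index : ℤ → Fin (p ℕ.^ d)
        index = residue (p ℕ.^ d)

        β : Fin (p ℕ.^ d) → ℤ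
        β i = α + pow s * + toℕ i

        β′ : Fin (p ℕ.^ d) → Fin m′
        β′ i = proj₁ (total (+ toℕ i))

        β-ρ₁ : ∀ i → ρ₁ (β i) (β′ i)
        β-ρ₁ i = proj₂ (total (+ toℕ i))

        piece : Fin (p ℕ.^ d) → ℤ → Fin m′ → Set
        piece i = proj₁ (sub (β-ρ₁ i))

        piece-iso : ∀ i → PartialIso next n (β i) (β′ i) (piece i)
        piece-iso i = proj₁ (proj₂ (sub (β-ρ₁ i)))

        piece-ρ₁ : ∀ i {y y′} → piece i y y′ → ρ₁ y y′
        piece-ρ₁ i = proj₂ (proj₂ (sub (β-ρ₁ i)))

        point≡ : ∀ i q → β i + pow next * q ≡ α + pow s * (+ toℕ i + q * pow d)
        point≡ i q = trans (cong (λ T → β i + T * q) next≡) (lem α (pow s) (+ toℕ i) (pow d) q)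
          where
          lem : ∀ α S i D q → α + S * i + D * S * q ≡ α + S * (i + q * D)
          lem = solve-∀

        next-∣ : ∀ {a b} → a ≈ b mod pow d → pow next ∣ pow s * (a - b)
        next-∣ {a} {b} h = subst (_∣ pow s * (a - b)) (trans (ℤ.*-comm (pow s) (pow d)) (sym next≡)) (*-monoʳ-∣ (pow s) (≈⇒∣ h))

        next-∣⁻¹ : ∀ {a b} → pow next ∣ pow s * (a - b) → a ≈ b mod pow d
        next-∣⁻¹ {a} {b} h = ∣⇒≈ {pow d} {a} {b} (*-cancelˡ-∣ (pow s) {pow d} {a - b} {{pow-nonZero s}} (subst (_∣ pow s * (a - b)) (trans next≡ (ℤ.*-comm (pow d) (pow s))) h))

      glued : ℤ → Fin m′ → Set
      glued y y′ = ∃ λ a → y ≡ α + pow s * a × piece (index a) y y′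

      private
        glued-total : ∀ a → ∃ λ y′ → glued (α + pow s * a) y′
        glued-total a = go (≈-sym (residue-≈ (p ℕ.^ d) a))
          where
          go : a ≈ + toℕ (index a) mod pow d → ∃ λ y′ → glued (α + pow s * a) y′
          go (mod-by q eq) = let (y′ , h) = PartialIso.total (piece-iso (index a)) q
            in y′ , a , refl , subst (λ y → piece (index a) y y′) (trans (point≡ (index a) q) (cong (λ b → α + pow s * b) (sym eq))) h

        index-shift : ∀ i q → index (+ toℕ i + q * pow d) ≡ i
        index-shift i q = trans (residue-cong (p ℕ.^ d) {+ toℕ i + q * pow d} {+ toℕ i} (mod-by q refl)) (residue-toℕ (p ℕ.^ d) i)

        glued-onto : ∀ {y′} → Near s α′ y′ → ∃ λ y → glued y y′
        glued-onto {y′} nr = let (y , h) = onto nr in go y h (inside h)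
          where
          go : ∀ y → ρ₁ y y′ → (∃ λ a → y ≡ α + pow s * a) → ∃ λ y → glued y y′
          go y h (a , refl) = let (z , h′) = PartialIso.onto (piece-iso i) near-i in place z h′ (PartialIso.inside (piece-iso i) h′)
            where
            i : Fin (p ℕ.^ d)
            i = index a
            lem : ∀ α S a b → α + S * a - (α + S * b) ≡ S * (a - b)
            lem = solve-∀
            near-i : Near next (β′ i) y′
            near-i = V.∣⇒Near (∣m∣n⇒∣m+n (subst (pow next ∣_) (sym (lem α (pow s) a (+ toℕ i))) (next-∣ {a} {+ toℕ i} (≈-sym (residue-≈ (p ℕ.^ d) a))))
              (∣m⇒∣m*n (ColMod.shift (iso (β-ρ₁ i) h)) (pow-∣ next≤t))) (ColMod.col (iso (β-ρ₁ i) h))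
            place : ∀ z → piece i z y′ → (∃ λ q → z ≡ β i + pow next * q) → ∃ λ y → glued y y′
            place z h′ (q , e) = z , + toℕ i + q * pow d , trans e (point≡ i q) , subst (λ j → piece j z y′) (sym (index-shift i q)) h′

        glued-iso : ∀ {y z y′ z′} → glued y y′ → glued z z′ → ColMod n (z - y) y′ z′
        glued-iso {y} {z} {y′} {z′} (a , refl , h) (b , refl , h′) = decide (index a ≟ index b)
          where
          lem : ∀ α S a b → α + S * b - (α + S * a) ≡ S * (b - a)
          lem = solve-∀
          decide : Dec (index a ≡ index b) → ColMod n (z - y) y′ z′
          decide (yes e) = PartialIso.iso (piece-iso (index b)) (subst (λ i → piece i y y′) e h) h′
          -- The graph ρ₁ gives the colour only up to a shift by p^t, which `periodic` absorbs since
          -- the difference is outside p^next.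
          decide (no ne) = N.Col⇒Colₜ (subst (λ w → Col w y′ z′) (sym (lem α (pow s) a b))
              (Col-~ (periodic (b - a) (λ e → ne (residue-cong (p ℕ.^ d) (≈-sym (next-∣⁻¹ {b} {a} e)))) (pow s * (b - a)) (ColMod.shift col) ~-refl)
                (subst (λ w → Col (w + pow t * ColMod.shift col) y′ z′) (lem α (pow s) a b) (ColMod.col col))))
            where
            col : ColMod t (z - y) y′ z′
            col = iso (piece-ρ₁ (index a) h) (piece-ρ₁ (index b) h′)

      glue : Lift s α α′ ρ₁
      glue = glued , record
          { inside = λ (a , e , _) → a , e
          ; inside′ = λ (a , e , h) → inside′ (piece-ρ₁ (index a) h)
          ; total = glued-total
          ; onto = glued-onto
          ; iso = glued-iso }
        , λ (a , e , h) → piece-ρ₁ (index a) h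

    -- If all elements of p^s outside p^t are in one class, any bijection between the
    -- cosets of p^t will do.
    module FullSection {s t : ℕ} (s≤t : s ℕ.≤ t) (t≤n : t ℕ.≤ n) (closed-s : Closedₚ s) (closed-t : Closedₚ t)
                       (full : ∀ b → ¬ pow t ∣ pow s * b → pow s * b ~ pow s) (α : ℤ) (α′ : Fin m′) where
      private
        module Q = Quot {t} closed-t
        module S = Quot {s} closed-s

        near? : ∀ {u} → Closedₚ u → ∀ x y → Dec (Near u x y)
        near? {u} closed-u x y = let (a , h) = Col-total x y in map′ (λ d → Quot.∣⇒Near {u} closed-u d h) (λ nr → Quot.Near⇒∣ {u} closed-u nr h) (pow u ∣? a)

        -- `Col-count` carries the count of the multiples of p^u over to the image.
        class-size : ∀ {u} (closed-u : Closedₚ u) → u ℕ.≤ n → ∀ x → sum (λ y → ⟦ near? {u} closed-u x y ⟧) ≡ p ℕ.^ (n ℕ.∸ u)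
        class-size {u} closed-u u≤n x = trans (sym (Col-count x (λ a → ⟦ pow u ∣? a ⟧)
            (λ {a} {b} a~b → ⟦⟧-cong (pow u ∣? a) (pow u ∣? b) (closed-u a~b) (closed-u (~-sym a~b)))
            (λ y → ⟦ near? {u} closed-u x y ⟧)
            (λ a y h → ⟦⟧-cong (pow u ∣? a) (near? {u} closed-u x y) (λ d → Quot.∣⇒Near {u} closed-u d h) (λ nr → Quot.Near⇒∣ {u} closed-u nr h))))
          (trans (Multiples.sum-multiples (p ℕ.^ u) {{pow-nonZero u}} {p ℕ.^ n} {p ℕ.^ (n ℕ.∸ u)}
              (trans (cong (p ℕ.^_) (sym (ℕ.m∸n+n≡m u≤n))) (ℕ.^-distribˡ-+-* p (n ℕ.∸ u) u))
              (λ a → ⟦ pow u ∣? a ⟧) (λ a h → ⟦⟧-no (pow u ∣? a) h))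
            (trans (∑-cong (p ℕ.^ (n ℕ.∸ u)) (λ z → ⟦⟧-yes (pow u ∣? pow u * z) (∣m⇒∣m*n z ∣-refl)))
              (trans (sum-const (p ℕ.^ (n ℕ.∸ u)) 1) (ℕ.*-identityʳ (p ℕ.^ (n ℕ.∸ u))))))

        σ : ℕ
        σ = p ℕ.^ (n ℕ.∸ t)

        q : ℕ
        q = p ℕ.^ (t ℕ.∸ s)

        instance
          nz-σ : NonZero σ
          nz-σ = pow-nonZero (n ℕ.∸ t)
          nz-q : NonZero q
          nz-q = pow-nonZero (t ℕ.∸ s)

        total-size : p ℕ.^ (n ℕ.∸ s) ≡ q ℕ.* σ
        total-size = trans (cong (p ℕ.^_) (trans (cong (ℕ._∸ s) (sym (ℕ.m+[n∸m]≡n t≤n))) (ℕ.+-∸-comm (n ℕ.∸ t) s≤t)))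
          (ℕ.^-distribˡ-+-* p (t ℕ.∸ s) (n ℕ.∸ t))

        inΔ : Fin m′ → ℕ
        inΔ y = ⟦ near? {s} closed-s α′ y ⟧

        size-Δ : sum inΔ ≡ q ℕ.* σ
        size-Δ = trans (class-size {s} closed-s (ℕ.≤-trans s≤t t≤n) α′) total-size

        -- The class of α′ modulo p^s has q σ points and the classes modulo p^t have σ each. Fewer
        -- than q representatives therefore do not cover it (`cover`), and more than q do not fit
        -- (`pack`).
        record Representatives (l : ℕ) : Set where
          field
            b : Fin l → Fin m′
            b-Δ : ∀ i → Near s α′ (b i)
            b-distinct : ∀ i j → Near t (b i) (b j) → i ≡ j

          hits : Fin m′ → ℕ
          hits y = sum (λ i → ⟦ near? {t} closed-t (b i) y ⟧)

          sum-hits : sum hits ≡ l ℕ.* σ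
          sum-hits = trans (∑-comm (λ y i → ⟦ near? {t} closed-t (b i) y ⟧)) (trans (sum-cong-≗ {l} (λ i → class-size {t} closed-t t≤n (b i))) (sum-const l σ))

          pack : l ℕ.* σ ℕ.≤ q ℕ.* σ
          pack = subst₂ ℕ._≤_ sum-hits size-Δ (sum-mono λ y → bound y)
            where
            at-most-one : ∀ {k} (f : Fin k → ℕ) → (∀ i → f i ℕ.≤ 1) → (∀ i j → f i ≢ 0 → f j ≢ 0 → i ≡ j) → sum f ℕ.≤ 1
            at-most-one {zero} f _ _ = ℕ.z≤n
            at-most-one {suc k} f ≤1 uniq with f zero ℕ.≟ 0
            ... | yes e = subst (λ x → x ℕ.+ sum (f ∘ suc) ℕ.≤ 1) (sym e) (at-most-one (f ∘ suc) (≤1 ∘ suc) (λ i j hi hj → suc-injective (uniq (suc i) (suc j) hi hj)))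
            ... | no ne = subst (λ x → f zero ℕ.+ x ℕ.≤ 1) (sym (sum-zero {k} λ i → decidable-stable (f (suc i) ℕ.≟ 0) λ h → absurd (uniq zero (suc i) ne h)))
                    (subst (ℕ._≤ 1) (sym (ℕ.+-identityʳ (f zero))) (≤1 zero))
              where
              absurd : ∀ {i : Fin k} → zero ≡ suc i → ⊥
              absurd ()
            ⟦⟧≤1 : ∀ {X : Set} (d : Dec X) → ⟦ d ⟧ ℕ.≤ 1
            ⟦⟧≤1 (yes _) = ℕ.≤-refl
            ⟦⟧≤1 (no _) = ℕ.z≤n
            bound : ∀ y → hits y ℕ.≤ inΔ y
            bound y = decide (hits y ℕ.≟ 0)
              where
              decide : Dec (hits y ≡ 0) → hits y ℕ.≤ inΔ y
              decide (yes e) = subst (ℕ._≤ inΔ y) (sym e) ℕ.z≤n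
              decide (no ne) = let (i , hi) = sum≢0⇒∃ (λ i → ⟦ near? {t} closed-t (b i) y ⟧) ne in
                subst (hits y ℕ.≤_) (sym (⟦⟧-yes (near? {s} closed-s α′ y) (S.near-trans (b-Δ i) (near-coarsen s≤t (⟦⟧-≢0 (near? {t} closed-t (b i) y) hi)))))
                  (at-most-one (λ i → ⟦ near? {t} closed-t (b i) y ⟧) (λ i → ⟦⟧≤1 (near? {t} closed-t (b i) y))
                    (λ i j hi hj → b-distinct i j (Q.near-trans (⟦⟧-≢0 (near? {t} closed-t (b i) y) hi) (Q.near-sym (⟦⟧-≢0 (near? {t} closed-t (b j) y) hj)))))

          Missed : Fin m′ → Set
          Missed y = Near s α′ y × ¬ (∃ λ i → Near t (b i) y)

          missed? : Dec (∃ λ y → Missed y)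
          missed? = any? λ y → near? {s} closed-s α′ y ×-dec ¬? (any? λ i → near? {t} closed-t (b i) y)

          cover : ¬ (∃ λ y → Missed y) → q ℕ.* σ ℕ.≤ l ℕ.* σ
          cover none = subst₂ ℕ._≤_ size-Δ sum-hits (sum-mono λ y → bound y (near? {s} closed-s α′ y))
            where
            bound : ∀ y (d : Dec (Near s α′ y)) → ⟦ d ⟧ ℕ.≤ hits y
            bound y (no _) = ℕ.z≤n
            bound y (yes nr) = let (i , h) = decidable-stable (any? λ i → near? {t} closed-t (b i) y) (λ no-i → none (y , nr , no-i)) in
              ℕ.≤-trans (ℕ.≤-reflexive (sym (⟦⟧-yes (near? {t} closed-t (b i) y) h))) (term≤sum (λ i → ⟦ near? {t} closed-t (b i) y ⟧) i)

        grow : ∀ {l} (B : Representatives l) → (∃ λ y → Representatives.Missed B y) → Representatives (suc l)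
        grow {l} B (y , nr , fresh) = record { b = b⁺ ; b-Δ = Δ⁺ ; b-distinct = distinct⁺ }
          where
          open Representatives B
          b⁺ : Fin (suc l) → Fin m′
          b⁺ zero = y
          b⁺ (suc i) = b i
          Δ⁺ : ∀ i → Near s α′ (b⁺ i)
          Δ⁺ zero = nr
          Δ⁺ (suc i) = b-Δ i
          distinct⁺ : ∀ i j → Near t (b⁺ i) (b⁺ j) → i ≡ j
          distinct⁺ zero zero _ = refl
          distinct⁺ zero (suc j) h = ⊥-elim (fresh (j , Q.near-sym h))
          distinct⁺ (suc i) zero h = ⊥-elim (fresh (i , h))
          distinct⁺ (suc i) (suc j) h = cong suc (b-distinct i j h)

        build : ∀ l → l ℕ.≤ q → Representatives l
        build zero _ = record { b = λ () ; b-Δ = λ () ; b-distinct = λ () }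
        build (suc l) l<q = step (build l (ℕ.<⇒≤ l<q))
          where
          step : Representatives l → Representatives (suc l)
          step B = decide (Representatives.missed? B)
            where
            decide : Dec (∃ λ y → Representatives.Missed B y) → Representatives (suc l)
            decide (yes m) = grow B m
            decide (no none) = ⊥-elim (ℕ.<⇒≱ l<q (ℕ.*-cancelʳ-≤ q l σ (Representatives.cover B none)))

        B : Representatives q
        B = build q ℕ.≤-refl
        open Representatives B using (b; b-Δ; b-distinct)

        covered : ∀ {y} → Near s α′ y → ∃ λ i → Near t (b i) y
        covered {y} nr = decidable-stable (any? λ i → near? {t} closed-t (b i) y) λ no-i →
          ℕ.<⇒≱ (ℕ.n<1+n q) (ℕ.*-cancelʳ-≤ (suc q) q σ (Representatives.pack (grow B (y , nr , no-i))))

        index : ℤ → Fin q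
        index = residue q

        t≡ : pow t ≡ pow s * pow (t ℕ.∸ s)
        t≡ = trans (cong pow (sym (ℕ.m+[n∸m]≡n s≤t))) (pow-+ s (t ℕ.∸ s))

        index-∣ : ∀ {a b} → index a ≡ index b → pow t ∣ pow s * (a - b)
        index-∣ {a} {b} e = subst (_∣ pow s * (a - b)) (sym t≡) (*-monoʳ-∣ (pow s) (≈⇒∣ (≈-trans (≈-sym (residue-≈ q a)) (≈-trans (≈-reflexive (cong (λ i → + toℕ i) e)) (residue-≈ q b)))))

        ∣-index : ∀ {a b} → pow t ∣ pow s * (a - b) → index a ≡ index b
        ∣-index {a} {b} h = residue-cong q (∣⇒≈ {pow (t ℕ.∸ s)} {a} {b} (*-cancelˡ-∣ (pow s) {pow (t ℕ.∸ s)} {a - b} {{pow-nonZero s}} (subst (_∣ pow s * (a - b)) t≡ h)))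

      graph : ℤ → Fin m′ → Set
      graph y y′ = ∃ λ a → y ≡ α + pow s * a × Near t (b (index a)) y′

      fullIso : PartialIso s t α α′ graph
      fullIso = record
        { inside = λ (a , e , _) → a , e
        ; inside′ = λ (a , e , h) → S.near-trans (b-Δ (index a)) (near-coarsen s≤t h)
        ; total = λ a → b (index a) , a , refl , Q.near-refl _
        ; onto = λ {y′} nr → let (i , h) = covered nr in α + pow s * + toℕ i , + toℕ i , refl , subst (λ j → Near t (b j) y′) (sym (residue-toℕ q i)) h
        ; iso = graph-iso }
        where
        lem : ∀ α S a c → α + S * c - (α + S * a) ≡ S * (c - a)
        lem = solve-∀
        graph-iso : ∀ {y z y′ z′} → graph y y′ → graph z z′ → ColMod t (z - y) y′ z′
        graph-iso {y} {z} {y′} {z′} (a , refl , h) (c , refl , h′) = subst (λ w → ColMod t w y′ z′) (sym (lem α (pow s) a c)) (decide (index a ≟ index c))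
          where
          decide : Dec (index a ≡ index c) → ColMod t (pow s * (c - a)) y′ z′
          decide (yes e) = Q.Near⇒Colₜ (index-∣ {c} {a} (sym e)) (Q.near-trans (Q.near-sym h) (subst (λ i → Near t (b i) z′) (sym e) h′))
          decide (no ne) = place (S.near-trans (S.near-sym (S.near-trans (b-Δ (index a)) (near-coarsen s≤t h))) (S.near-trans (b-Δ (index c)) (near-coarsen s≤t h′)))
            where
            place : Near s y′ z′ → ColMod t (pow s * (c - a)) y′ z′
            place (near r col) = Q.Col⇒Colₜ (Col-~ (~-trans (full r nr) (~-sym (full (c - a) (λ d → ne (sym (∣-index {c} {a} d)))))) col)
              where
              nr : ¬ pow t ∣ pow s * r
              nr d = ne (b-distinct (index a) (index c) (Q.near-trans (Q.near-trans h (Q.∣⇒Near d col)) (Q.near-sym h′)))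

-- Two overlapping cyclotomic sections.

module Overlaps where
  open Congruence
  open SchurRings
  open ClassStructure
  open Layers
  open Images
  open Discrete
  open CosetIsomorphisms
  open import Data.Nat as ℕ using (ℕ; NonZero)
  import Data.Nat.Properties as ℕ
  open import Data.Nat.Primality using (Prime)
  open import Data.Integer as ℤ using (ℤ; +_; -_; _+_; _-_; _*_; 0ℤ; 1ℤ)
  import Data.Integer.Properties as ℤ
  open import Data.Integer.Divisibility.Signed using (_∣_; ∣-trans; ∣m⇒∣m*n; ∣-refl)
  open import Data.Integer.Tactic.RingSolver using (solve-∀)
  open import Data.Fin using (Fin)
  open import Data.Product using (∃; Σ; _×_; _,_; proj₁; proj₂)
  open import Relation.Nullary using (¬_)
  open import Relation.Binary.PropositionalEquality hiding ([_])

  module OverlapLemmas (p : ℕ) (pr : Prime p) (n : ℕ) .{{_ : NonZero (p ℕ.^ n)}} (A : SchurRing (p ℕ.^ n))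
                       {m′ : ℕ} (I : Image A m′) (extension : ∀ α α′ → Extension A I α α′) where
    open PrimePower p pr
    open PrimePowerUnits p pr
    open SchurRing A
    open Filtration p pr n A
    open Image I
    open Discreteness p pr n A I
    open Cosets p pr n A I

    record Correction (s t t₁ : ℕ) (κ : ℤ) : Set where
      field
        κ₁ ι₁ : ℤ
        κ₁ι₁≈1 : κ₁ * ι₁ ≈ 1ℤ mod pow n
        agrees : pow s * κ₁ ≈ pow s * κ mod pow t
        orbit-ι : ∀ a → pow s * (ι₁ * a) ~[ t₁ ] pow s * a

    -- As p^t = D p^s, the error p^t r can be moved into the multiplier: κ₁ = κ + D r acts like κ
    -- modulo p^t and satisfies p^s κ₁ ~ p^s exactly, hence belongs to the units of the second
    -- section.
    module Correct {s t t₁ : ℕ} (C₁ : CyclotomicSection s t₁) (κ D r : ℤ) (t≡ : pow t ≡ D * pow s) (e : pow s ~ pow s * κ + pow t * r) where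
      private
        module C₁ = CyclotomicSection C₁
        module Q₁ = Quot {t₁} C₁.closed-t

        κ₁ : ℤ
        κ₁ = κ + D * r
        l₂ : ∀ S κ D r → S * κ + D * S * r ≡ S * (κ + D * r)
        l₂ = solve-∀
        κ₁≡ : pow s * κ + pow t * r ≡ pow s * κ₁
        κ₁≡ = trans (cong (λ T → pow s * κ + T * r) t≡) (l₂ (pow s) κ D r)
        κ₁~ : pow s * κ₁ ~ pow s
        κ₁~ = ~-sym (subst (λ x → pow s ~ x) κ₁≡ e)
        κ₁~[] : pow s * κ₁ ~[ t₁ ] pow s
        κ₁~[] = Q₁.~⇒~[] {pow s * κ₁} {pow s} κ₁~
        κ₁-agrees : pow s * κ₁ ≈ pow s * κ mod pow t
        κ₁-agrees = mod-by r (trans (sym κ₁≡) (cong (_+_ (pow s * κ)) (ℤ.*-comm (pow t) r)))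
        finish : (∃ λ ι → κ₁ * ι ≈ 1ℤ mod pow n) → Correction s t t₁ κ
        finish (ι₁ , inv) = record { κ₁ = κ₁ ; ι₁ = ι₁ ; κ₁ι₁≈1 = inv ; agrees = κ₁-agrees ; orbit-ι = C₁.orbit ι₁ ι₁-orbit }
          where
          κι : pow s * (κ₁ * ι₁) ≈ pow s mod pow t₁
          κι = ≈-coarsen (pow-∣ {t₁} {n} C₁.t≤n) (≈-trans (≈-*ˡ (pow s) inv) (≈-reflexive (ℤ.*-identityʳ (pow s))))
          ι₁-orbit : pow s * ι₁ ~[ t₁ ] pow s
          ι₁-orbit = Q₁.~[]-trans {pow s * ι₁} {pow s * (κ₁ * ι₁)} {pow s} (Q₁.~[]-sym {pow s * (κ₁ * ι₁)} {pow s * ι₁} (C₁.orbit κ₁ κ₁~[] ι₁))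
            (Q₁.≈⇒~[] {pow s * (κ₁ * ι₁)} {pow s} κι)

      result : Correction s t t₁ κ
      result = finish (inverse n κ₁ (C₁.units κ₁ κ₁~[]))

    private
      realign : ∀ {S₀ S T} β κ κ₁ ι b x → β + S₀ * b ≈ β + S * (ι * x) mod T → S * κ₁ ≈ S * κ mod T → κ₁ * ι ≈ 1ℤ mod T →
                β + S₀ * (κ * b) ≈ β + S * x mod T
      realign {S₀} {S} {T} β κ κ₁ ι b x h agrees inv = ≈-trans (≈-reflexive (l₁ β S₀ κ b)) (≈-trans (≈-+ʳ (β - κ * β) (≈-*ˡ κ h))
          (≈-trans (≈-reflexive (l₂ β S κ ι x)) (≈-trans (≈-+ˡ β (≈-*ʳ (ι * x) (≈-sym agrees)))
          (≈-trans (≈-reflexive (l₃ β S κ₁ ι x)) (≈-+ˡ β (≈-trans (≈-*ˡ (S * x) inv) (≈-reflexive (ℤ.*-identityʳ (S * x)))))))))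
        where
        l₁ : ∀ β S κ b → β + S * (κ * b) ≡ κ * (β + S * b) + (β - κ * β)
        l₁ = solve-∀
        l₂ : ∀ β S κ ι x → κ * (β + S * (ι * x)) + (β - κ * β) ≡ β + S * κ * (ι * x)
        l₂ = solve-∀
        l₃ : ∀ β S κ ι x → β + S * κ * (ι * x) ≡ β + S * x * (κ * ι)
        l₃ = solve-∀

    -- F is an isomorphism modulo p^t on a coset of p^s₀, where p^s₀ / p^t is cyclotomic, and
    -- p^s / p^t₁ is cyclotomic with s₀ < s < t < t₁.  Individualising β and β′, both sections
    -- become discrete and their isomorphisms agree on the overlap p^s / p^t; F differs from
    -- the first one by a multiplier κ, which can be corrected by a multiplier of the second.
    module Overlap {s₀ s t t₁ : ℕ} (C₀ : CyclotomicSection s₀ t) (C₁ : CyclotomicSection s t₁)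
                   (s₀<s : s₀ ℕ.< s) (s<t : s ℕ.< t) (t<t₁ : t ℕ.< t₁)
                   {α₀ : ℤ} {α₀′ : Fin m′} {F : ℤ → Fin m′ → Set}
                   (R : PartialIso s₀ t α₀ α₀′ F) (Rs : Saturated t F)
                   {β : ℤ} {β′ : Fin m′} (Fβ : F β β′) where

      private
        module C₀ = CyclotomicSection C₀
        module C₁ = CyclotomicSection C₁
        module R = PartialIso R
        open Saturated Rs
        module Q = Quot {t} C₀.closed-t
        module Q₁ = Quot {t₁} C₁.closed-t

        s₀≤t : s₀ ℕ.≤ t
        s₀≤t = ℕ.<⇒≤ (ℕ.<-trans s₀<s s<t)
        s≤t₁ : s ℕ.≤ t₁
        s≤t₁ = ℕ.<⇒≤ (ℕ.<-trans s<t t<t₁)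

        X : Extension A I β β′
        X = extension β β′
        open Extension X
        module D₀ = At X s₀ C₀.closed-s
        module D₁ = At X s C₁.closed-s

        g : ℤ
        g = D₀.point 1ℤ
        h : ℤ
        h = D₁.point 1ℤ

        g-data : ∃ λ g′ → T β g β′ g′ × T g β g′ β′
        g-data = T-forth T-base g
        g′ : Fin m′
        g′ = proj₁ g-data
        Tgβ : T g β g′ β′
        Tgβ = proj₂ (proj₂ g-data)
        -- The image h′ of h is taken relative to the pair (g , β), so that also (g , h) and (g′ ,
        -- h′) correspond. This ties the two sections to each other.
        h-data : ∃ λ h′ → T g h g′ h′ × T h β h′ β′
        h-data = T-forth Tgβ h
        h′ : Fin m′
        h′ = proj₁ h-data
        Tgh : T g h g′ h′
        Tgh = proj₁ (proj₂ h-data)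
        Thβ : T h β h′ β′
        Thβ = proj₂ (proj₂ h-data)

        module N = FromExtension X {s₀} {t} C₀.closed-s C₀.closed-t (D₀.cyclotomic-discrete C₀) Tgβ
        module H = FromExtension X {s} {t₁} C₁.closed-s C₁.closed-t (D₁.cyclotomic-discrete C₁) Thβ
        module NI = PartialIso N.partialIso
        module HI = PartialIso H.partialIso

        Fβ-iso : PartialIso s₀ t β β′ (λ y y′ → F y y′ × ∃ λ a → y ≡ β + pow s₀ * a)
        Fβ-iso = restrict s₀≤t C₀.closed-s C₀.closed-t R ℕ.≤-refl s₀≤t C₀.closed-s Fβ
        module FI = PartialIso Fβ-iso

        κ-data : ∃ λ κ → F (β + pow s₀ * κ) g′
        κ-data = place (FI.onto near-g)
          where
          near-g : Near s₀ β′ g′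
          near-g = Quot.∣⇒Near {s₀} C₀.closed-s {g - β} (D₀.point-∣ 1ℤ) (T-Col (T-flip Tgβ))
          place : (∃ λ y → F y g′ × ∃ λ a → y ≡ β + pow s₀ * a) → ∃ λ κ → F (β + pow s₀ * κ) g′
          place (y , Fy , a , refl) = a , Fy

        κ : ℤ
        κ = proj₁ κ-data
        Fκ : F (β + pow s₀ * κ) g′
        Fκ = proj₂ κ-data

        l-sub : ∀ β x → β + x - β ≡ x
        l-sub = solve-∀

        κ-orbit : pow s₀ * κ ~[ t ] pow s₀
        κ-orbit = Q.Colₜ-injective (subst (λ a → ColMod t a β′ g′) (l-sub β (pow s₀ * κ)) (R.iso Fβ Fκ))
          (Q.Col⇒Colₜ (subst (λ a → Col a β′ g′) (trans (l-sub β (pow s₀ * 1ℤ)) (ℤ.*-identityʳ (pow s₀))) (T-Col (T-flip Tgβ))))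

        nκ : ¬ P ∣ κ
        nκ = C₀.units κ κ-orbit

        κ⁻¹ : ∃ λ ι → κ * ι ≈ 1ℤ mod pow n
        κ⁻¹ = inverse n κ nκ

        mod-t : ∀ {a b} → a ≈ b mod pow n → a ≈ b mod pow t
        mod-t = ≈-coarsen (pow-∣ {t} {n} C₀.t≤n)

        -- Compares F after multiplication by κ with the isomorphism of the first section. As κ is
        -- the position at which F meets g′, both 0 and 1 are fixed, and `rigid` makes θ the
        -- identity modulo p^t.
        θ : ℤ → ℤ → Set
        θ a b = ∃ λ y′ → F (β + pow s₀ * (κ * a)) y′ × N.graph (D₀.point b) y′

        l-diff : ∀ β S a z → β + S * z - (β + S * a) ≡ S * (z - a)
        l-diff = solve-∀

        θ-step : ∀ {a b} → θ a b → ∀ z → ∃ λ w → θ z w × pow s₀ * (z - a) ~[ t ] pow s₀ * (w - b)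
        θ-step {a} {b} (y′ , Fa , Nb) z =
          let (z′ , Fz , _) = FI.total (κ * z)
              (w , Nw) = NI.onto (FI.inside′ (Fz , κ * z , refl))
          in place z′ Fz w Nw (NI.inside Nw)
          where
          lem : ∀ β S κ a z → β + S * (κ * z) - (β + S * (κ * a)) ≡ S * (κ * (z - a))
          lem = solve-∀
          place : ∀ z′ → F (β + pow s₀ * (κ * z)) z′ → ∀ v → N.graph v z′ → (∃ λ w → v ≡ D₀.point w) →
                  ∃ λ w → θ z w × pow s₀ * (z - a) ~[ t ] pow s₀ * (w - b)
          place z′ Fz v Nw (w , refl) = w , (z′ , Fz , Nw) , Q.~[]-trans {pow s₀ * (z - a)} {pow s₀ * (κ * (z - a))} {pow s₀ * (w - b)} (Q.~[]-sym (C₀.orbit κ κ-orbit (z - a)))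
            (Q.Colₜ-injective {pow s₀ * (κ * (z - a))} {pow s₀ * (w - b)} (subst (λ x → ColMod t x y′ z′) (lem β (pow s₀) κ a z) (R.iso Fa Fz))
              (subst (λ x → ColMod t x y′ z′) (l-diff β (pow s₀) b w) (NI.iso Nb Nw)))

        Nβ : N.graph β β′
        Nβ = Tgβ , 0ℤ , lem β (pow s₀)
          where
          lem : ∀ β S → β ≡ β + S * 0ℤ
          lem = solve-∀

        Ng : N.graph g g′
        Ng = let (z′ , p , q) = T-forth Tgβ g in place z′ p q
          where
          place : ∀ z′ → T g g g′ z′ → T g β z′ β′ → N.graph g g′
          place z′ p _ = subst (T g g g′) (sym (Col-0 (subst (λ a → Col a g′ z′) (ℤ.+-inverseʳ g) (T-Col p)))) p , 1ℤ , refl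

        near-zero : ∀ {a x y} → Near t x y → ColMod t a x y → pow t ∣ a
        near-zero {a} nr (col-mod r c) = Data.Integer.Divisibility.Signed.∣m+n∣n⇒∣m (Q.Near⇒∣ nr c) (∣m⇒∣m*n r ∣-refl)

        θ-fix0 : ∀ {w} → θ 0ℤ w → pow s₀ * w ≈ 0ℤ mod pow t
        θ-fix0 {w} (y′ , F0 , Nw) = ∣⇒≈0 (near-zero (functional s₀≤t C₀.closed-s C₀.closed-t R Fβ (subst (λ y → F y y′) (lem β (pow s₀) κ) F0))
            (subst (λ a → ColMod t a β′ y′) (l-sub β (pow s₀ * w)) (NI.iso Nβ Nw)))
          where
          lem : ∀ β S κ → β + S * (κ * 0ℤ) ≡ β
          lem = solve-∀

        θ-fix1 : ∀ {w} → θ 1ℤ w → pow s₀ * w ≈ pow s₀ mod pow t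
        θ-fix1 {w} (y′ , F1 , Nw) = ∣⇒≈ (near-zero (functional s₀≤t C₀.closed-s C₀.closed-t R Fκ (subst (λ x → F (β + pow s₀ * x) y′) (ℤ.*-identityʳ κ) F1))
            (subst (λ a → ColMod t a g′ y′) (lem β (pow s₀) w) (NI.iso Ng Nw)))
          where
          lem : ∀ β S w → β + S * w - (β + S * 1ℤ) ≡ S * w - S
          lem = solve-∀

        -- F is the isomorphism of the first section composed with multiplication by κ.
        F-κ : ∀ {b y′} → N.graph (D₀.point b) y′ → F (β + pow s₀ * (κ * b)) y′
        F-κ {b} {y′} Nb = place (FI.onto (NI.inside′ Nb)) κ⁻¹
          where
          place : (∃ λ y → F y y′ × ∃ λ x → y ≡ β + pow s₀ * x) → (∃ λ ι → κ * ι ≈ 1ℤ mod pow n) → F (β + pow s₀ * (κ * b)) y′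
          place (_ , Fx , x , refl) (ι , κι≈1) = satˡ Fa (≈-+ˡ β (scale {ι * x} {b} (C₀.rigid θ θ-step θ-fix0 θ-fix1 {ι * x} {b} (y′ , Fa , Nb))))
            where
            l₁ : ∀ κ ι x → κ * (ι * x) ≡ κ * ι * x
            l₁ = solve-∀
            Fa : F (β + pow s₀ * (κ * (ι * x))) y′
            Fa = satˡ Fx (≈-sym (≈-+ˡ β (≈-*ˡ (pow s₀) (mod-t (≈-trans (≈-reflexive (l₁ κ ι x)) (≈-trans (≈-*ʳ x κι≈1) (≈-reflexive (ℤ.*-identityˡ x))))))))
            l₂ : ∀ κ S a → κ * (S * a) ≡ S * (κ * a)
            l₂ = solve-∀
            scale : ∀ {a b} → pow s₀ * a ≈ pow s₀ * b mod pow t → pow s₀ * (κ * a) ≈ pow s₀ * (κ * b) mod pow t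
            scale {a} {b} e = subst₂ (λ u v → u ≈ v mod pow t) (l₂ κ (pow s₀) a) (l₂ κ (pow s₀) b) (≈-*ˡ κ e)

        κ-orbit-s : pow s ~[ t ] pow s * κ
        κ-orbit-s = place (complement {s₀} {s} (ℕ.<⇒≤ s₀<s))
          where
          l₁ : ∀ S κ D → S * (κ * D) ≡ D * S * κ
          l₁ = solve-∀
          move : ∀ D → pow s ≡ D * pow s₀ → pow s₀ * (κ * D) ≡ pow s * κ
          move D s≡ = trans (l₁ (pow s₀) κ D) (cong (λ S → S * κ) (sym s≡))
          place : (∃ λ d → pow s ≡ pow d * pow s₀ × d ℕ.+ s₀ ≡ s) → pow s ~[ t ] pow s * κ
          place (d , s≡ , _) = Q.~[]-sym {pow s * κ} {pow s} (subst₂ (λ a b → a ~[ t ] b) (move (pow d) s≡)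
            (trans (ℤ.*-comm (pow s₀) (pow d)) (sym s≡)) (C₀.orbit κ κ-orbit (pow d)))

        correction : Correction s t t₁ κ
        correction = place (complement {s} {t} (ℕ.<⇒≤ s<t)) κ-orbit-s
          where
          place : (∃ λ d → pow t ≡ pow d * pow s × d ℕ.+ s ≡ t) → pow s ~[ t ] pow s * κ → Correction s t t₁ κ
          place (d , t≡ , _) (r , e) = Correct.result C₁ κ (pow d) r t≡ e

        open Correction correction

        H⁺ : ℤ → Fin m′ → Set
        H⁺ = Saturation t₁ H.graph

        H⁺-iso : PartialIso s t₁ β β′ H⁺
        H⁺-iso = saturate s≤t₁ C₁.closed-s C₁.closed-t H.partialIso

        module W = Twist s≤t₁ C₁.closed-s C₁.closed-t H⁺-iso (saturated s≤t₁ C₁.closed-s C₁.closed-t H.graph) C₁.t≤n κ₁ ι₁ κ₁ι₁≈1 orbit-ι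

        coarse : ∀ {a b} → a ≈ b mod pow t₁ → a ≈ b mod pow t
        coarse = ≈-coarsen (pow-∣ {t} {t₁} (ℕ.<⇒≤ t<t₁))

        -- Since (g , h) and (g′ , h′) correspond, z has an image z″ with the right colours from g
        -- and h at once; from h it is determined modulo p^t₁.
        agree-on-overlap : ∀ {z z′} → H.graph z z′ → ∃ λ z″ → N.graph z z″ × Near t₁ z″ z′
        agree-on-overlap {z} {z′} (hz , a , refl) = let (z″ , p , q) = T-forth Tgh z in
            z″ , (p , D₀.coordinate (∣-trans (pow-∣ {s₀} {s} (ℕ.<⇒≤ s₀<s)) (D₁.point-∣ a))) ,
            functional s≤t₁ C₁.closed-s C₁.closed-t H.partialIso (T-flip q , a , refl) (hz , a , refl)

        -- About β, F at y is the first isomorphism at y divided by κ (`F-κ`), and the twist is the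
        -- second one at y divided by κ₁. The two isomorphisms agree on the overlap, and κ₁ acts
        -- there like κ modulo p^t.
        twisted-F : ∀ {y y′} → W.twisted y y′ → F y y′
        twisted-F {y} {y′} (x , refl , z , z′ , Hz , z≈ , nr) = place (agree-on-overlap Hz)
          where
          place′ : ∀ z″ → N.graph z z″ → Near t₁ z″ z′ → (∃ λ b → z ≡ D₀.point b) → F (β + pow s * x) y′
          place′ z″ Nz nr′ (b , refl) = satˡ (satʳ (F-κ {b} {z″} Nz) (near-coarsen (ℕ.<⇒≤ t<t₁) (Q₁.near-trans nr′ nr))) (realign {pow s₀} {pow s} {pow t} β κ κ₁ ι₁ b x (coarse z≈) agrees (mod-t κ₁ι₁≈1))
          place : (∃ λ z″ → N.graph z z″ × Near t₁ z″ z′) → F (β + pow s * x) y′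
          place (z″ , Nz , nr′) = place′ z″ Nz nr′ (NI.inside Nz)

      overlap-lift : Σ (ℤ → Fin m′ → Set) λ ρ → PartialIso s t₁ β β′ ρ × Saturated t₁ ρ × (∀ {y y′} → ρ y y′ → F y y′)
      overlap-lift = W.twisted , W.twistedIso , W.twistedSaturated , twisted-F

-- Descending induction over the closed subgroups.

module Lifting where
  open Congruence
  open SchurRings
  open ClassStructure
  open Layers
  open Images
  open Discrete
  open CosetIsomorphisms
  open Gluing
  open Overlaps
  open import Data.Nat as ℕ using (ℕ; zero; suc; NonZero)
  import Data.Nat.Properties as ℕ
  open import Data.Nat.Primality using (Prime)
  open import Data.Integer as ℤ using (ℤ; +_; _+_; _*_; 1ℤ)
  import Data.Integer.Properties as ℤ
  open import Data.Integer.Divisibility.Signed using (_∣_; ∣-trans; ∣-refl; *-cancelˡ-∣)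
  open import Data.Integer.Tactic.RingSolver using (solve-∀)
  open import Data.Fin using (Fin)
  open import Data.Product using (∃; Σ; _×_; _,_; proj₁; proj₂)
  open import Data.Sum using (_⊎_; inj₁; inj₂)
  open import Data.Empty using (⊥-elim)
  open import Data.Unit using (⊤)
  open import Relation.Nullary using (¬_)
  open import Relation.Binary.PropositionalEquality hiding ([_])

  module LiftingLemmas (p : ℕ) (pr : Prime p) (n : ℕ) .{{_ : NonZero (p ℕ.^ n)}} (A : SchurRing (p ℕ.^ n))
                       {m′ : ℕ} (I : Image A m′) (extension : ∀ α α′ → Extension A I α α′) where
    open PrimePower p pr
    open PrimePowerUnits p pr
    open SchurRing A
    open Filtration p pr n A
    open Image I
    open Discreteness p pr n A I
    open Cosets p pr n A I
    open GluingLemmas p pr n A I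
    open OverlapLemmas p pr n A I extension

    Anything : ℤ → Fin m′ → Set
    Anything _ _ = ⊤

    exact : ∀ {x y} → Near n x y → x ≡ y
    exact (near r c) = Col-0 (Col-~ (≈⇒~ (mod-by r (trans (ℤ.*-comm (pow n) r) (sym (ℤ.+-identityˡ (r * pow n)))))) c)

    private
      -- A saturated F relates every point of the coset β + p^t to every point near β′, so any
      -- isomorphism between these cosets lies inside F.
      saturated-sub : ∀ {t β β′ F} → Saturated t F → F β β′ → Lift t β β′ Anything → Lift t β β′ F
      saturated-sub {t} {β} {β′} {F} Fs Fβ (ρ , R , _) = ρ , R , include
        where
        include : ∀ {y y′} → ρ y y′ → F y y′
        include {y} {y′} h = let (a , e) = PartialIso.inside R h in
          Saturated.satˡ Fs (Saturated.satʳ Fs Fβ (PartialIso.inside′ R h))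
            (≈-sym (mod-by a (trans e (cong (_+_ β) (ℤ.*-comm (pow t) a)))))

      ∤-pow : ∀ {a b} → a ℕ.< b → ¬ pow b ∣ pow a
      ∤-pow {a} {b} a<b d = ∤1 (*-cancelˡ-∣ (pow a) {P} {1ℤ} {{pow-nonZero a}}
        (subst₂ _∣_ (trans (pow-suc a) (ℤ.*-comm P (pow a))) (sym (ℤ.*-identityʳ (pow a))) (∣-trans (pow-∣ {suc a} {b} a<b) d)))

      weaken-periodic : ∀ {s next t₁ t} → t₁ ℕ.≤ t →
        (∀ b → ¬ pow next ∣ pow s * b → ∀ x r → x ~ pow s * b → x + pow t₁ * r ~ pow s * b) →
        (∀ b → ¬ pow next ∣ pow s * b → ∀ x r → x ~ pow s * b → x + pow t * r ~ pow s * b)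
      weaken-periodic {s} {next} {t₁} {t} t₁≤t per b nb x r x~ = let (d , t≡ , _) = complement t₁≤t in
        subst (λ e → x + e ~ pow s * b) (trans (lem (pow t₁) (pow d) r) (cong (_* r) (sym t≡))) (per b nb x (pow d * r) x~)
        where
        lem : ∀ T D r → T * (D * r) ≡ D * T * r
        lem = solve-∀

    CosetIso : ℕ → Set₁
    CosetIso s = ∀ α α′ → Lift s α α′ Anything

    -- The prescribed graph always comes from a cyclotomic section: for the other two kinds of
    -- layers `next` equals `t`, and `saturated-sub` provides the pieces.
    SectionLift : ℕ → Set₁
    SectionLift s = ∀ {s₀ t} → CyclotomicSection s₀ t → s₀ ℕ.< s → s ℕ.≤ t → ∀ {α₀ α₀′ F} →
      PartialIso s₀ t α₀ α₀′ F → Saturated t F → ∀ {β β′} → F β β′ → Lift s β β′ F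

    coset-iso-n : CosetIso n
    coset-iso-n α α′ = (λ y y′ → y ≈ α mod pow n × y′ ≡ α′) , record
        { inside = λ { (mod-by q e , _) → q , trans e (cong (_+_ α) (ℤ.*-comm q (pow n))) }
        ; inside′ = λ { (_ , refl) → Quot.near-refl {n} closed-n α′ }
        ; total = λ a → α′ , mod-by a (cong (_+_ α) (ℤ.*-comm (pow n) a)) , refl
        ; onto = λ nr → α , ≈-refl , sym (exact nr)
        ; iso = λ { {y} {z} (e , refl) (e′ , refl) → Quot.Near⇒Colₜ {n} closed-n (≈⇒∣ (≈-trans e′ (≈-sym e))) (Quot.near-refl {n} closed-n α′) } } , _

    section-lift-n : CosetIso n → SectionLift n
    section-lift-n isos {s₀} {t} C _ n≤t R Rs {β} {β′} h = saturated-sub {n} (subst (λ t → Saturated t _) (ℕ.≤-antisym (CyclotomicSection.t≤n C) n≤t) Rs) h (isos β β′)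

    module Step {s : ℕ} (closed-s : Closedₚ s) (L : Layer s) (isos : CosetIso (Layer.next L)) (lifts : SectionLift (Layer.next L)) where
      open Layer L

      private
        s≤t : s ℕ.≤ t
        s≤t = ℕ.≤-trans (ℕ.<⇒≤ s<next) next≤t

      module _ (α : ℤ) (α′ : Fin m′) where
        private
          finish : ∀ {ρ₁} → PartialIso s t α α′ ρ₁ → (∀ {β β′} → ρ₁ β β′ → Lift next β β′ ρ₁) → Lift s α α′ Anything
          finish R sub = let (ρ , R′ , _) = Glue.glue {s} {next} {t} s<next next≤t closed-s closed-next periodic R sub in ρ , R′ , _

          coarse : ∀ {ρ} → next ≡ t → PartialIso s t α α′ ρ → Lift s α α′ Anything
          coarse {ρ} next≡t R = finish (saturate s≤t closed-s closed-t R) (λ {β} {β′} h →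
            saturated-sub {next} (subst (λ u → Saturated u (Saturation t ρ)) (sym next≡t) (saturated s≤t closed-s closed-t ρ)) h (isos β β′))

          X : Extension A I α α′
          X = extension α α′

          g-data : ∃ λ g′ → Extension.T X α (α + pow s * 1ℤ) α′ g′ × Extension.T X (α + pow s * 1ℤ) α g′ α′
          g-data = Extension.T-forth X (Extension.T-base X) (α + pow s * 1ℤ)

          module FromX (discrete : At.Discrete X s closed-s t) where
            module E = FromExtension X {s} {t} closed-s closed-t discrete (proj₂ (proj₂ g-data))
            ρ : ℤ → Fin m′ → Set
            ρ = Saturation t E.graph
            iso : PartialIso s t α α′ ρ
            iso = saturate s≤t closed-s closed-t E.partialIso
            sat : Saturated t ρ
            sat = saturated s≤t closed-s closed-t E.graph

          module PrimeCase (t≡ : t ≡ suc s) (b : ℤ) (nb : ¬ P ∣ b) (n~ : ¬ pow s * b ~ pow s) where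
            next∤ : ¬ pow next ∣ pow s * 1ℤ
            next∤ h = ∤-pow s<next (subst (pow next ∣_) (ℤ.*-identityʳ (pow s)) h)
            absorb : ∀ r → pow s + pow t * r ~ pow s
            absorb r = subst (λ y → y + pow t * r ~ y) (ℤ.*-identityʳ (pow s)) (periodic 1ℤ next∤ (pow s * 1ℤ) r ~-refl)
            other : ¬ pow s * b ~[ suc s ] pow s
            other (r , h) = n~ (~-trans h (subst (λ u → pow s + pow u * r ~ pow s) t≡ (absorb r)))
            discrete : At.Discrete X s closed-s t
            discrete = subst (λ u → At.Discrete X s closed-s u) (sym t≡)
              (At.prime-discrete X s closed-s (subst (ℕ._≤ n) t≡ t≤n) (subst Closedₚ t≡ closed-t) (b , nb , other))

        coset-iso : Lift s α α′ Anything
        coset-iso = by-kind kind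
          where
          by-kind : (next ≡ t × (∀ b → ¬ pow t ∣ pow s * b → pow s * b ~ pow s))
                    ⊎ (next ≡ t × t ≡ suc s × ∃ λ b → ¬ P ∣ b × ¬ pow s * b ~ pow s)
                    ⊎ CyclotomicSection s t → Lift s α α′ Anything
          by-kind (inj₁ (next≡t , full)) = coarse next≡t (FullSection.fullIso {s} {t} s≤t t≤n closed-s closed-t full α α′)
          by-kind (inj₂ (inj₁ (next≡t , t≡ , b , nb , n~))) = coarse next≡t (FromX.E.partialIso (PrimeCase.discrete t≡ b nb n~))
          by-kind (inj₂ (inj₂ C)) = finish (FromX.iso discrete) (λ h → lifts C s<next next≤t (FromX.iso discrete) (FromX.sat discrete) h)
            where
            discrete : At.Discrete X s closed-s t
            discrete = At.cyclotomic-discrete X s closed-s C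

      module _ {s₀ t₀ : ℕ} (C : CyclotomicSection s₀ t₀) (s₀<s : s₀ ℕ.< s) (s<t₀ : s ℕ.< t₀)
               {α₀ : ℤ} {α₀′ : Fin m′} {F : ℤ → Fin m′ → Set} (R : PartialIso s₀ t₀ α₀ α₀′ F) (Rs : Saturated t₀ F)
               {β : ℤ} {β′ : Fin m′} (h : F β β′) where
        private
          module C = CyclotomicSection C

          s≤t₀ : s ℕ.≤ t₀
          s≤t₀ = ℕ.<⇒≤ s<t₀

          F-s : ℤ → Fin m′ → Set
          F-s y y′ = F y y′ × ∃ λ a → y ≡ β + pow s * a

          Rˢ : PartialIso s t₀ β β′ F-s
          Rˢ = restrict (ℕ.<⇒≤ (ℕ.<-trans s₀<s s<t₀)) C.closed-s C.closed-t R (ℕ.<⇒≤ s₀<s) s≤t₀ closed-s h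

          subcoset : ∀ {γ y a b} → γ ≡ β + pow s * a → y ≡ γ + pow next * b → ∃ λ a → y ≡ β + pow s * a
          subcoset {γ} {y} {a} {b} γ≡ y≡ = place (complement {s} {next} (ℕ.<⇒≤ s<next))
            where
            lem : ∀ β S a D b → β + S * a + D * S * b ≡ β + S * (a + D * b)
            lem = solve-∀
            place : (∃ λ d → pow next ≡ pow d * pow s × d ℕ.+ s ≡ next) → ∃ λ a → y ≡ β + pow s * a
            place (d , next≡ , _) = a + pow d * b , trans y≡ (trans (cong₂ (λ x N → x + N * b) γ≡ next≡) (lem β (pow s) a (pow d) b))

          -- Outside p^next the classes are unions of cosets of p^t, hence of the smaller p^t₀. So
          -- F, known modulo p^t₀, is precise enough to be glued along.
          module Within (t≤t₀ : t ℕ.≤ t₀) where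
            sub : ∀ {γ γ′} → F-s γ γ′ → Lift next γ γ′ F-s
            sub {γ} {γ′} (Fγ , a , γ≡) = enlarge (lifts C (ℕ.<-trans s₀<s s<next) (ℕ.≤-trans next≤t t≤t₀) R Rs Fγ)
              where
              enlarge : Lift next γ γ′ F → Lift next γ γ′ F-s
              enlarge (ρ , G , ρ⊂) = ρ , G , λ hρ → ρ⊂ hρ , subcoset {a = a} γ≡ (proj₂ (PartialIso.inside G hρ))

            forget : Lift s β β′ F-s → Lift s β β′ F
            forget (ρ , G , ρ⊂) = ρ , G , λ hρ → proj₁ (ρ⊂ hρ)

            result : Lift s β β′ F
            result = forget (Glue.glue {s} {next} {t₀} s<next (ℕ.≤-trans next≤t t≤t₀) closed-s closed-next
                              (weaken-periodic {s} {next} t≤t₀ periodic) Rˢ sub)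

          -- The layer needs more precision than F has. It cannot have a single nonzero class,
          -- because the closed subgroup p^t₀ lies strictly between p^s and p^t, and for the same
          -- reason its order is not p. It is cyclotomic, and `Overlap` refines F to precision p^t.
          module Beyond (t₀<t : t₀ ℕ.< t) where
            not-full : ¬ (∀ b → ¬ pow t ∣ pow s * b → pow s * b ~ pow s)
            not-full full = ∤-pow s<t₀ (C.closed-t (place (complement {s} {t₀} s≤t₀)) ∣-refl)
              where
              place : (∃ λ d → pow t₀ ≡ pow d * pow s × d ℕ.+ s ≡ t₀) → pow t₀ ~ pow s
              place (d , t≡ , _) = subst (λ x → x ~ pow s) (sym t≡′) (full (pow d) (λ d → ∤-pow t₀<t (subst (pow t ∣_) (sym t≡′) d)))
                where
                t≡′ : pow t₀ ≡ pow s * pow d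
                t≡′ = trans t≡ (ℤ.*-comm (pow d) (pow s))

            extend-lift : CyclotomicSection s t → (Σ (ℤ → Fin m′ → Set) λ ρ → PartialIso s t β β′ ρ × Saturated t ρ × (∀ {y y′} → ρ y y′ → F y y′)) → Lift s β β′ F
            extend-lift C₁ (ρ₁ , R₁ , Rs₁ , ρ₁⊂) = include (Glue.glue {s} {next} {t} s<next next≤t closed-s closed-next periodic R₁
                                  (λ h₁ → lifts C₁ s<next next≤t R₁ Rs₁ h₁))
              where
              include : Lift s β β′ ρ₁ → Lift s β β′ F
              include (ρ , G , ρ⊂) = ρ , G , λ hρ → ρ₁⊂ (ρ⊂ hρ)

            result : (next ≡ t × (∀ b → ¬ pow t ∣ pow s * b → pow s * b ~ pow s))
                      ⊎ (next ≡ t × t ≡ suc s × ∃ λ b → ¬ P ∣ b × ¬ pow s * b ~ pow s)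
                      ⊎ CyclotomicSection s t → Lift s β β′ F
            result (inj₁ (_ , full)) = ⊥-elim (not-full full)
            result (inj₂ (inj₁ (_ , t≡ , _))) = ⊥-elim (ℕ.<⇒≱ t₀<t (subst (ℕ._≤ t₀) (sym t≡) s<t₀))
            result (inj₂ (inj₂ C₁)) = extend-lift C₁ (Overlap.overlap-lift C C₁ s₀<s s<t₀ t₀<t R Rs h)

        section-lift : Lift s β β′ F
        section-lift = compare (ℕ.≤-<-connex t t₀)
          where
          compare : t ℕ.≤ t₀ ⊎ t₀ ℕ.< t → Lift s β β′ F
          compare (inj₁ le) = Within.result le
          compare (inj₂ gt) = Beyond.result gt kind

    -- The next subgroup is known only from the layer, so the recursion runs on a bound for n - s.
    cosets-lift : ∀ fuel {s} → n ℕ.≤ s ℕ.+ fuel → s ℕ.≤ n → Closedₚ s → CosetIso s × SectionLift s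
    cosets-lift fuel {s} le s≤n closed-s = cases fuel le (ℕ.m≤n⇒m<n∨m≡n s≤n)
      where
      cases : ∀ fuel → n ℕ.≤ s ℕ.+ fuel → s ℕ.< n ⊎ s ≡ n → CosetIso s × SectionLift s
      cases _ _ (inj₂ s≡n) = subst (λ s → CosetIso s × SectionLift s) (sym s≡n) (coset-iso-n , section-lift-n coset-iso-n)
      cases zero le (inj₁ s<n) = ⊥-elim (ℕ.<⇒≱ s<n (subst (n ℕ.≤_) (ℕ.+-identityʳ s) le))
      cases (suc fuel) le (inj₁ s<n) = step (cosets-lift fuel {next} le′ (ℕ.≤-trans next≤t t≤n) closed-next)
        where
        L : Layer s
        L = Radicals.layer s s<n closed-s
        open Layer L
        le′ : n ℕ.≤ next ℕ.+ fuel
        le′ = ℕ.≤-trans le (subst (ℕ._≤ next ℕ.+ fuel) (sym (ℕ.+-suc s fuel)) (ℕ.+-monoˡ-≤ fuel s<next))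
        step : CosetIso next × SectionLift next → CosetIso s × SectionLift s
        step (isos , lifts) = isos-s , lifts-s
          where
          isos-s : CosetIso s
          isos-s = Step.coset-iso closed-s L isos lifts
          lifts-s : SectionLift s
          lifts-s {s₀} {t₀} C s₀<s s≤t₀ {α₀} {α₀′} {F} R Rs {β} {β′} h = compare (ℕ.m≤n⇒m<n∨m≡n s≤t₀)
            where
            compare : s ℕ.< t₀ ⊎ s ≡ t₀ → Lift s β β′ F
            compare (inj₁ s<t₀) = Step.section-lift closed-s L isos lifts C s₀<s s<t₀ R Rs h
            compare (inj₂ s≡t₀) = saturated-sub {s} (subst (λ t → Saturated t F) (sym s≡t₀) Rs) h (isos-s β β′)

-- The S-ring of a circulant scheme and the data given by φ.

module Circulant where
  open import Defs
  open Congruence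
  open SchurRings
  open OnePoint
  open Similarity
  open Images
  open import Data.Nat as ℕ using (ℕ; NonZero)
  open import Data.Integer as ℤ using (ℤ; +_; -_; _+_; _-_; 0ℤ)
  import Data.Integer.Properties as ℤ
  open import Data.Integer.Tactic.RingSolver using (solve-∀)
  open import Data.Fin using (Fin; toℕ; _≟_)
  open import Data.Product using (∃; ∃₂; Σ; _×_; _,_; proj₁; proj₂)
  open import Relation.Binary.PropositionalEquality

  module CirculantScheme (M : ℕ) .{{_ : NonZero M}} {r : ℕ} (c : Coloring M r) (cc : IsCC c)
                         (shift : ∀ a b g → c (residue M (a + g)) (residue M (b + g)) ≡ c (residue M a) (residue M b)) where
    open IsCC cc

    pt : ℤ → Fin M
    pt = residue M

    pt-toℕ : ∀ i → pt (+ toℕ i) ≡ i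
    pt-toℕ = residue-toℕ M

    pt-injective : ∀ {a b} → pt a ≡ pt b → a ≈ b mod + M
    pt-injective {a} {b} e = ≈-trans (≈-sym (residue-≈ M a)) (≈-trans (≈-reflexive (cong (λ i → + toℕ i) e)) (residue-≈ M b))

    χ : ℤ → Fin r
    χ a = c (pt 0ℤ) (pt a)

    colour-difference : ∀ a b → c (pt a) (pt b) ≡ χ (b - a)
    colour-difference a b = subst₂ (λ x y → c (pt x) (pt y) ≡ χ (b - a)) (ℤ.+-identityˡ a) (lem b a) (shift 0ℤ (b - a) a)
      where
      lem : ∀ b a → b - a + a ≡ b
      lem = solve-∀

    private
      χ-toℕ : ∀ {i j} → c (pt 0ℤ) i ≡ c (pt 0ℤ) j → χ (+ toℕ i) ≡ χ (+ toℕ j)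
      χ-toℕ {i} {j} = subst₂ (λ i j → c (pt 0ℤ) i ≡ c (pt 0ℤ) j) (sym (pt-toℕ i)) (sym (pt-toℕ j))

      χ-from : ∀ a i → c i (pt a) ≡ χ (a - + toℕ i)
      χ-from a i = trans (cong (λ i → c i (pt a)) (sym (pt-toℕ i))) (colour-difference (+ toℕ i) a)

      χ-neg : ∀ {a b} → χ a ≡ χ b → χ (- a) ≡ χ (- b)
      χ-neg {a} {b} h = trans (opposite a) (trans (transp _ _ _ _ h) (sym (opposite b)))
        where
        opposite : ∀ a → χ (- a) ≡ c (pt a) (pt 0ℤ)
        opposite a = sym (trans (colour-difference a 0ℤ) (cong χ (ℤ.+-identityˡ (- a))))

    -- Classes are the colours seen from 0. By translation invariance, convolution at a is a sum
    -- over the points of paths from 0 to a, which coherence makes dependent only on the colour of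
    -- (0 , a).
    schurRing : SchurRing M
    schurRing = record
      { _~_ = λ a b → χ a ≡ χ b
      ; _~?_ = λ a b → χ a ≟ χ b
      ; ~-sym = sym
      ; ~-trans = trans
      ; ≈⇒~ = λ h → cong (c (pt 0ℤ)) (residue-cong M h)
      ; ~0⇒≈0 = λ h → ≈-sym (pt-injective (diagUnion _ _ _ (sym h)))
      ; ~-neg = λ {a} {b} → χ-neg {a} {b}
      ; convolve-invariant = λ f g f-inv g-inv {a} {b} h → coherent-sum cc h _ _
          (λ i j p q → cong₂ ℕ._*_ (f-inv (χ-toℕ p)) (g-inv (trans (sym (χ-from a i)) (trans q (χ-from b j))))) }

    module AlgebraicImage {m′ r′ : ℕ} {c′ : Coloring m′ r′} (cc′ : IsCC c′) {φ : Fin r → Fin r′} (φ-closed : IsSesquiclosed c c′ φ) where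
      private
        φ-iso : IsAlgIso c c′ φ
        φ-iso = proj₁ φ-closed

        φ-injective : ∀ {s t} → φ s ≡ φ t → s ≡ t
        φ-injective = proj₁ (proj₁ φ-iso) _ _

        open Similarity.Similarity (similarity cc cc′ φ-iso)

      Colour : ℤ → Fin m′ → Fin m′ → Set
      Colour a x y = c′ x y ≡ φ (χ a)

      match-difference : ∀ {a b x y} → c′ x y ≡ φ (c (pt a) (pt b)) → Colour (b - a) x y
      match-difference {a} {b} h = trans h (cong φ (colour-difference a b))

      private
        total : ∀ x y → ∃ λ a → Colour a x y
        total x y = let (t , e) = proj₂ (proj₁ φ-iso) (c′ x y) ; (u , v , e′) = nonempty t in
          + toℕ v - + toℕ u , match-difference {+ toℕ u} {+ toℕ v} (trans (sym e) (cong φ (trans (sym e′) (cong₂ c (sym (pt-toℕ u)) (sym (pt-toℕ v))))))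

        homogeneous : ∀ x → Colour 0ℤ x x
        homogeneous x = source (proj₂ (total x x))

        add : ∀ {a b x y z} → Colour a x z → Colour b z y → ∃₂ λ a′ b′ → χ a′ ≡ χ a × χ b′ ≡ χ b × Colour (a′ + b′) x y
        add {a} {b} {x} {y} {z} ha hb = place (total x y)
          where
          lem : ∀ a e → e ≡ a + (e - a)
          lem = solve-∀
          place : (∃ λ e → Colour e x y) → ∃₂ λ a′ b′ → χ a′ ≡ χ a × χ b′ ≡ χ b × Colour (a′ + b′) x y
          place (e , he) = let (w , p , q) = back he z in
            + toℕ w , e - + toℕ w ,
            φ-injective (trans (cong (λ i → φ (c (pt 0ℤ) i)) (pt-toℕ w)) (trans (sym p) ha)) ,
            φ-injective (trans (cong φ (sym (χ-from e w))) (trans (sym q) hb)) ,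
            subst (λ e → Colour e x y) (lem (+ toℕ w) e) he

      image : Image schurRing m′
      image = record
        { Col = Colour
        ; Col-~ = λ a~b h → trans h (cong φ a~b)
        ; Col-injective = λ h h′ → φ-injective (trans (sym h) h′)
        ; Col-total = total
        ; Col-refl = homogeneous
        ; Col-0 = diagˡ
        ; Col-neg = λ {a} h → subst (λ b → Colour b _ _) (ℤ.+-identityˡ (- a)) (match-difference {a} {0ℤ} (flip h))
        ; Col-add = λ {a} {b} → add {a} {b}
        ; Col-count = λ x f f-inv f′ e → sums (homogeneous x) (λ i → f (+ toℕ i)) f′
            (λ i j p _ → e (+ toℕ i) j (trans p (cong (λ i → φ (c (pt 0ℤ) i)) (sym (pt-toℕ i))))) }

      module _ (α : ℤ) (α′ : Fin m′) where
        private
          d-data : ∃ λ r₁ → Σ (Coloring M r₁) (IsOnePointExt c (pt α))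
          d-data = Closure.onePoint c cc (pt α)

          d′-data : ∃ λ r₁ → Σ (Coloring m′ r₁) (IsOnePointExt c′ α′)
          d′-data = Closure.onePoint c′ cc′ α′

          module Build {r₁ r₁′ : ℕ} (d : Coloring M r₁) (d′ : Coloring m′ r₁′) (dcc : IsCC d) (d-ref : Refines d c)
                       (single : SingletonBasis d (pt α)) (dcc′ : IsCC d′)
                       (ψ : Fin r₁ → Fin r₁′) (ext : IsExtension c c′ φ (pt α) α′ d d′ ψ) where
            module S = Similarity.Similarity (similarity dcc dcc′ (proj₁ ext))

            Same-d : ℤ → ℤ → ℤ → ℤ → Set
            Same-d a b a′ b′ = d (pt a) (pt b) ≡ d (pt a′) (pt b′)

            Match-d : ℤ → ℤ → Fin m′ → Fin m′ → Set
            Match-d a b x y = d′ x y ≡ ψ (d (pt a) (pt b))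

            step : ∀ {a b a′ b′} → Same-d a b a′ b′ → ∀ z → ∃ λ z′ → Same-d a z a′ z′ × Same-d z b z′ b′
            step {a} {b} {a′} {b′} h z = let (w , p , q) = coherent-∃ dcc h (pt z) in + toℕ w ,
              trans (sym p) (cong (d (pt a′)) (sym (pt-toℕ w))) , trans (sym q) (cong (λ w → d w (pt b′)) (sym (pt-toℕ w)))

            target : ∀ {x u v} → d x (pt α) ≡ d u v → v ≡ pt α
            target h = let (w , _ , q) = coherent-∃ dcc h (pt α) in proj₂ (single _ _ q)

            origin : ∀ {y u v} → d (pt α) y ≡ d u v → u ≡ pt α
            origin h = let (w , p , _) = coherent-∃ dcc h (pt α) in proj₁ (single _ _ p)

            U-left : ∀ {a b a′ b′} → Same-d a b a′ b′ → Same-d a α a′ α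
            U-left {a} {b} {a′} {b′} h = let (w , p , _) = coherent-∃ dcc h (pt α) in
              trans (sym p) (cong (d (pt a′)) (target (sym p)))

            U-right : ∀ {a b a′ b′} → Same-d a b a′ b′ → Same-d α b α b′
            U-right {a} {b} {a′} {b′} h = let (w , _ , q) = coherent-∃ dcc h (pt α) in
              trans (sym q) (cong (λ w → d w (pt b′)) (origin (sym q)))

            result : Extension schurRing image α α′
            result = record
              { U = Same-d
              ; T = Match-d
              ; U-~ = λ {a} {b} {a′} {b′} h → trans (sym (colour-difference a b)) (trans (d-ref _ _ _ _ h) (colour-difference a′ b′))
              ; U-step = λ {a} {b} {a′} {b′} → step {a} {b} {a′} {b′}
              ; U-diag = λ h → pt-injective (IsCC.diagUnion dcc _ _ _ h)
              ; U-left = λ {a} {b} {a′} {b′} → U-left {a} {b} {a′} {b′}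
              ; U-right = λ {a} {b} {a′} {b′} → U-right {a} {b} {a′} {b′}
              ; U-sum = λ {a} {b} {a′} {b′} h H H′ _ _ e → coherent-sum dcc h _ _ (λ i j p q → e (+ toℕ i) (+ toℕ j)
                  (trans (cong (d (pt a)) (pt-toℕ i)) (trans p (cong (d (pt a′)) (sym (pt-toℕ j)))))
                  (trans (cong (λ i → d i (pt b)) (pt-toℕ i)) (trans q (cong (λ j → d j (pt b′)) (sym (pt-toℕ j))))))
              ; T-U = λ h h′ → proj₁ (proj₁ (proj₁ ext)) _ _ (trans (sym h) h′)
              ; T-Col = λ {a} {b} h → match-difference {a} {b} (proj₁ (proj₂ ext) _ _ _ _ h)
              ; T-base = sym (proj₂ (proj₂ ext))
              ; T-forth = λ h z → S.forth h (pt z)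
              ; T-back = λ {a} {b} {x} {y} h z′ → let (w , p , q) = S.back h z′ in + toℕ w ,
                  trans p (cong (λ w → ψ (d (pt a) w)) (sym (pt-toℕ w))) , trans q (cong (λ w → ψ (d w (pt b))) (sym (pt-toℕ w)))
              ; T-flip = S.flip }

        -- All loops have the colour of 0 on both sides, so φ matches the fiber of α with that of α′
        -- and sesquiclosedness applies to every pair.
        extension : Extension schurRing image α α′
        extension = build d-data d′-data
          where
          base : φ (c (pt α) (pt α)) ≡ c′ α′ α′
          base = trans (cong φ (trans (colour-difference α α) (cong χ (ℤ.+-inverseʳ α)))) (sym (homogeneous α′))
          build : (∃ λ r₁ → Σ (Coloring M r₁) (IsOnePointExt c (pt α))) → (∃ λ r₁ → Σ (Coloring m′ r₁) (IsOnePointExt c′ α′)) →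
                  Extension schurRing image α α′
          build (r₁ , d , d-ext@(dcc , d-ref , single , _)) (r₁′ , d′ , d′-ext@(dcc′ , _)) =
            let (ψ , ext) = proj₂ φ-closed (pt α) α′ base r₁ d d-ext r₁′ d′ d′-ext in Build.result d d′ dcc d-ref single dcc′ ψ ext

-- The isomorphism of the whole scheme.

open import Defs
open Congruence
open SchurRings
open Layers
open Images
open CosetIsomorphisms
open Gluing
open Lifting
open Circulant
open import Data.Nat as ℕ using (ℕ; suc; _^_; _≤_; NonZero)
import Data.Nat.Properties as ℕ
open import Data.Nat.Primality using (Prime)
open import Data.Integer as ℤ using (ℤ; +_; _+_; _-_; _*_; 0ℤ)
import Data.Integer.Properties as ℤ
open import Data.Integer.Divisibility.Signed using (divides)
open import Data.Fin using (Fin; toℕ)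
open import Data.Product using (∃; _,_; proj₁; proj₂)
open import Relation.Binary.PropositionalEquality

module CirculantPrimePower (p : ℕ) (pr : Prime p) (n : ℕ) .{{_ : NonZero (p ^ n)}} {r : ℕ} (c : Coloring (p ^ n) r) (cc : IsCC c)
         (shift : ∀ a b g → c (residue (p ^ n) (a + g)) (residue (p ^ n) (b + g)) ≡ c (residue (p ^ n) a) (residue (p ^ n) b))
         {m′ r′ : ℕ} {c′ : Coloring m′ r′} (cc′ : IsCC c′) {φ : Fin r → Fin r′} (φ-closed : IsSesquiclosed c c′ φ) where
  open PrimePower p pr
  open CirculantScheme (p ^ n) c cc shift
  open AlgebraicImage cc′ φ-closed
  open Filtration p pr n schurRing
  open Cosets p pr n schurRing image
  open GluingLemmas p pr n schurRing image
  open LiftingLemmas p pr n schurRing image extension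

  private
    closed-0 : Closedₚ 0
    closed-0 {a} {b} _ _ = divides b (sym (ℤ.*-identityʳ b))

    α′ : Fin m′
    α′ = proj₁ (IsCC.nonempty cc′ (φ (χ 0ℤ)))

    -- The coset of p^0 is the whole group, and precision p^n is equality, so this graph is that of
    -- the required isomorphism.
    whole : Lift 0 0ℤ α′ Anything
    whole = proj₁ (cosets-lift n ℕ.≤-refl ℕ.z≤n closed-0) 0ℤ α′

    ρ : ℤ → Fin m′ → Set
    ρ = proj₁ whole

    module R = PartialIso (proj₁ (proj₂ whole))


    open Image image

    Colour-≈ : ∀ a b {x y} → a ≈ b mod pow n → Colour a x y → Colour b x y
    Colour-≈ a b h = Col-~ {a} {b} (SchurRing.≈⇒~ schurRing {a} {b} h)

    ρ-colour : ∀ {y z y′ z′} → ρ y y′ → ρ z z′ → Colour (z - y) y′ z′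
    ρ-colour {y} {z} {y′} {z′} h h′ = place (R.iso h h′)
      where
      place : ColMod n (z - y) y′ z′ → Colour (z - y) y′ z′
      place (col-mod q col) = Colour-≈ (z - y + pow n * q) (z - y) (mod-by q (cong (_+_ (z - y)) (ℤ.*-comm (pow n) q))) col

    at-pow-0 : ∀ a → 0ℤ + pow 0 * a ≡ a
    at-pow-0 a = trans (ℤ.+-identityˡ (pow 0 * a)) (ℤ.*-identityˡ a)

    f : Fin (p ^ n) → Fin m′
    f x = proj₁ (R.total (+ toℕ x))

    f-ρ : ∀ x → ρ (+ toℕ x) (f x)
    f-ρ x = subst (λ y → ρ y (f x)) (at-pow-0 (+ toℕ x)) (proj₂ (R.total (+ toℕ x)))

    f-colour : ∀ x y → c′ (f x) (f y) ≡ φ (c x y)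
    f-colour x y = trans (ρ-colour (f-ρ x) (f-ρ y)) (cong φ (trans (sym (colour-difference (+ toℕ x) (+ toℕ y))) (cong₂ c (pt-toℕ x) (pt-toℕ y))))

    f-injective : ∀ x y → f x ≡ f y → x ≡ y
    f-injective x y e = IsCC.diagUnion cc x x y (proj₁ (proj₁ (proj₁ φ-closed)) _ _
      (trans (sym (f-colour x x)) (trans (cong (c′ (f x)) e) (f-colour x y))))

    f-surjective : ∀ z → ∃ λ x → f x ≡ z
    f-surjective z = let (a , h) = Col-total α′ z in place (R.onto (near a (subst (λ a → Colour a α′ z) (sym (ℤ.*-identityˡ a)) h)))
      where
      place : (∃ λ y → ρ y z) → ∃ λ x → f x ≡ z
      place (y , hy) = pt y , sym (Col-0 (Colour-≈ (+ toℕ (pt y) - y) 0ℤ (∣⇒≈0 (≈⇒∣ (residue-≈ (p ^ n) y))) (ρ-colour hy (f-ρ (pt y)))))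

  isomorphism : ∃ λ (f : Fin (p ^ n) → Fin m′) → IsIsoOver c c′ φ f
  isomorphism = f , (f-injective , f-surjective) , f-colour

sesquiseparable : ∀ {M p n} .{{_ : NonZero M}} → Prime p → M ≡ p ^ n → ∀ {r} (c : Coloring M r) → IsCC c →
  (∀ a b g → c (residue M (a + g)) (residue M (b + g)) ≡ c (residue M a) (residue M b)) → IsSesquiseparable c
sesquiseparable {p = p} {n} pr refl c cc shift m′ r′ c′ cc′ φ φ-closed =
  CirculantPrimePower.isomorphism p pr n c cc shift cc′ φ-closed

residue-⊕ : ∀ {k} a g → residue (suc k) a ⊕ residue (suc k) g ≡ residue (suc k) (a + g)
residue-⊕ {k} a g = residue-cong (suc k) {+ (toℕ (residue (suc k) a) ℕ.+ toℕ (residue (suc k) g))} {a + g} (≈-+ (residue-≈ (suc k) a) (residue-≈ (suc k) g))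

theorem6p8 : ∀ (p n k : ℕ) → Prime p → 1 ≤ n → suc k ≡ p ^ n →
    ∀ (r : ℕ) (c : Coloring (suc k) r) → IsScheme c → IsCirculant c →
    IsSesquiseparable c
theorem6p8 p n k pr _ size r c (cc , _) circulant = sesquiseparable {suc k} {p} {n} pr size c cc
  (λ a b g → trans (sym (cong₂ c (residue-⊕ a g) (residue-⊕ b g))) (circulant (residue (suc k) a) (residue (suc k) b) (residue (suc k) g)))
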